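{- Under the Impartial Anonymous Culture (IAC), the limiting probability $p_{\mathrm{CW}}$, as the number of voters tends to infinity, that an election with five candidates has a Condorcet winner is exactly $$p_{\mathrm{CW}}=\frac{a}{b},$$ where $$a=760794547958864241496408591531018198021484884229346111658236615929935$$ and $$b=1010827262551214358630401511004028249102084136257935356483840264634368.$$
   Context: For five candidates there are $N=5!=120$ preference rankings (linear orders of the candidates), numbered $1,\dots,120$. A voting profile is a tuple $(x_1,\dots,x_{120})$ of nonnegative integers, where $x_i$ is the number of voters with preference ranking $i$; the number of voters is $k=x_1+\dots+x_{120}$. The Impartial Anonymous Culture (IAC) assumes that, for each fixed $k$, all voting profiles with $k$ voters are equally likely. For a given profile, candidate $A$ beats candidate $B$ in majority, written $A>_M B$, if the number of voters who rank $A$ above $B$ is strictly larger than the number of voters who rank $B$ above $A$. A Condorcet winner is a candidate who beats all other candidates in majority; it is unique if it exists. The probability in question is $$p_{\mathrm{CW}}=\lim_{k\to\infty}\frac{\#\{\text{voting profiles with } k \text{ voters that have a Condorcet winner}\}}{\#\{\text{all voting profiles with } k \text{ voters}\}}.$$ -}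

module Defs where

open import Data.Bool.Base using (if_then_else_)
open import Data.Fin.Base as Fin using (Fin)
import Data.Fin.Properties as Fin
open import Data.Integer.Base as ℤ using ()
open import Data.List.Base as List using (List; []; _∷_; cartesianProductWith; filter; length; upTo)
open import Data.List.Membership.Propositional using (_∈_)
open import Data.List.Membership.Propositional.Properties
  using (∈-cartesianProductWith⁺; ∈-filter⁺; ∈-filter⁻; ∈-upTo⁺; ∈-allFin; ∈-length)
import Data.List.Relation.Unary.All as ListAll
import Data.List.Relation.Unary.AllPairs as ListAllPairs
open import Data.List.Relation.Unary.Any using (here)
import Data.List.Relation.Unary.Unique.Propositional as ListUnique
import Data.List.Relation.Unary.Unique.Propositional.Properties as ListUnique
open import Data.Nat.Base using (ℕ; zero; suc; _+_; _<_; _≤_; _≥_; _!; s≤s; NonZero; >-nonZero)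
open import Data.Nat.Properties using (_≟_; _<?_; m≤m+n; m≤n+m; ≤-trans; +-identityʳ)
open import Data.Product.Base using (_,_; ∃; ∃-syntax; proj₂)
open import Data.Rational.Unnormalised.Base as ℚᵘ using (ℚᵘ; 0ℚᵘ)
open import Data.Vec.Base as Vec using (Vec; []; _∷_; lookup; fromList; zipWith; sum)
open import Data.Vec.Properties using (∷-injective)
open import Data.Vec.Relation.Unary.All as All using (All; []; _∷_)
open import Data.Vec.Relation.Unary.AllPairs using (allPairs?)
open import Data.Vec.Relation.Unary.Unique.Propositional using (Unique)
open import Data.Vec.Relation.Unary.Unique.Propositional.Properties using (tabulate⁺)
open import Function.Base using (id)
open import Relation.Binary.PropositionalEquality using (_≡_; _≢_; refl; cong; trans)
open import Relation.Nullary.Decidable using (Dec; does; ¬?; _→-dec_)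
open import Relation.Unary using (Decidable)

vectorsOver : ∀ {A : Set} → List A → (m : ℕ) → List (Vec A m)
vectorsOver as zero    = [] ∷ []
vectorsOver as (suc m) = cartesianProductWith _∷_ as (vectorsOver as m)

∈-vectorsOver : ∀ {A : Set} {as : List A} {m} {v : Vec A m} →
                All (_∈ as) v → v ∈ vectorsOver as m
∈-vectorsOver []       = here refl
∈-vectorsOver (p ∷ ps) = ∈-cartesianProductWith⁺ _∷_ p (∈-vectorsOver ps)

vectorsOver-unique : ∀ {A : Set} {as : List A} → ListUnique.Unique as →
                     ∀ m → ListUnique.Unique (vectorsOver as m)
vectorsOver-unique u zero    = ListAll.[] ListAllPairs.∷ ListAllPairs.[]
vectorsOver-unique u (suc m) =
  ListUnique.cartesianProductWith⁺ _∷_ ∷-injective u (vectorsOver-unique u m)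

-- A ranking of n candidates is encoded by the vector of the positions of
-- the candidates, position 0 being the best: linear orders of the
-- candidates correspond to injective position vectors.

Above : ∀ {n} → Vec (Fin n) n → Fin n → Fin n → Set
Above r A B = lookup r A Fin.< lookup r B

above? : ∀ {n} (r : Vec (Fin n) n) (A B : Fin n) → Dec (Above r A B)
above? r A B = lookup r A Fin.<? lookup r B

unique? : ∀ {n m} → Decidable (Unique {A = Fin n} {n = m})
unique? = allPairs? λ i j → ¬? (i Fin.≟ j)

rankings : (n : ℕ) → List (Vec (Fin n) n)
rankings n = filter unique? (vectorsOver (List.allFin n) n)

∈-rankings : ∀ {n} {r : Vec (Fin n) n} → Unique r → r ∈ rankings n
∈-rankings {r = r} = ∈-filter⁺ unique? (∈-vectorsOver (All.universal ∈-allFin r))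

rankings-sound : ∀ {n} {r : Vec (Fin n) n} → r ∈ rankings n → Unique r
rankings-sound {n} r∈ = proj₂ (∈-filter⁻ unique? {xs = vectorsOver (List.allFin n) n} r∈)

rankings-unique : ∀ n → ListUnique.Unique (rankings n)
rankings-unique n = ListUnique.filter⁺ unique? (vectorsOver-unique (ListUnique.allFin⁺ n) n)

#rankings-5 : length (rankings 5) ≡ 5 !
#rankings-5 = refl

-- Entry i is the number of voters whose preference is the i-th ranking.
Profile : ℕ → Set
Profile n = Vec ℕ (length (rankings n))

preferring : ∀ {n} → Profile n → Fin n → Fin n → ℕ
preferring {n} x A B =
  sum (zipWith (λ r xᵣ → if does (above? r A B) then xᵣ else 0) (fromList (rankings n)) x)

BeatsInMajority : ∀ {n} → Profile n → Fin n → Fin n → Set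
BeatsInMajority x A B = preferring x B A < preferring x A B

IsCondorcetWinner : ∀ {n} → Profile n → Fin n → Set
IsCondorcetWinner x A = ∀ B → B ≢ A → BeatsInMajority x A B

HasCondorcetWinner : ∀ n → Profile n → Set
HasCondorcetWinner n x = ∃[ A ] IsCondorcetWinner {n} x A

hasCondorcetWinner? : ∀ n → Decidable (HasCondorcetWinner n)
hasCondorcetWinner? n x = Fin.any? λ A → Fin.all? λ B →
  ¬? (B Fin.≟ A) →-dec (preferring x B A <? preferring x A B)

hasSum? : ∀ {m} (k : ℕ) → Decidable (λ (x : Vec ℕ m) → sum x ≡ k)
hasSum? k x = sum x ≟ k

-- Every entry of a profile with k voters is at most k.
profiles : (n k : ℕ) → List (Profile n)
profiles n k = filter (hasSum? k) (vectorsOver (upTo (suc k)) (length (rankings n)))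

entries≤sum : ∀ {m} (x : Vec ℕ m) → All (_≤ sum x) x
entries≤sum []       = []
entries≤sum (a ∷ x) =
  m≤m+n a (sum x) ∷ All.map (λ p → ≤-trans p (m≤n+m (sum x) a)) (entries≤sum x)

∈-profiles : ∀ n {k} {x : Profile n} → sum x ≡ k → x ∈ profiles n k
∈-profiles n {x = x} refl =
  ∈-filter⁺ (hasSum? (sum x))
    (∈-vectorsOver (All.map (λ p → ∈-upTo⁺ (s≤s p)) (entries≤sum x))) refl

profiles-sound : ∀ n k {x : Profile n} → x ∈ profiles n k → sum x ≡ k
profiles-sound n k x∈ =
  proj₂ (∈-filter⁻ (hasSum? k) {xs = vectorsOver (upTo (suc k)) (length (rankings n))} x∈)

profiles-unique : ∀ n k → ListUnique.Unique (profiles n k)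
profiles-unique n k =
  ListUnique.filter⁺ (hasSum? k)
    (vectorsOver-unique (ListUnique.upTo⁺ (suc k)) (length (rankings n)))

private
  vectorWithSum : ∀ {m} → 0 < m → ∀ k → ∃ λ (x : Vec ℕ m) → sum x ≡ k
  vectorWithSum {suc m} _ k = k ∷ Vec.replicate m 0 , trans (cong (k +_) (zeros m)) (+-identityʳ k)
    where
    zeros : ∀ m → sum (Vec.replicate m 0) ≡ 0
    zeros zero    = refl
    zeros (suc m) = zeros m

#profiles : (n k : ℕ) → ℕ
#profiles n k = length (profiles n k)

#profilesWithCondorcetWinner : (n k : ℕ) → ℕ
#profilesWithCondorcetWinner n k = length (filter (hasCondorcetWinner? n) (profiles n k))

#profiles-nonZero : ∀ n k → NonZero (#profiles n k)
#profiles-nonZero n k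
  with x , sum≡k ← vectorWithSum (∈-length (∈-rankings {n} {Vec.allFin n} (tabulate⁺ id))) k
  = >-nonZero (∈-length (∈-profiles n {k} {x} sum≡k))

-- Probability, under the Impartial Anonymous Culture, that an election with
-- n candidates and k voters has a Condorcet winner.
condorcetProbability : (n k : ℕ) → ℚᵘ
condorcetProbability n k =
  (ℤ.+ #profilesWithCondorcetWinner n k) ℚᵘ./ #profiles n k
  where instance _ = #profiles-nonZero n k

_⟶_ : (ℕ → ℚᵘ) → ℚᵘ → Set
s ⟶ L = ∀ (ε : ℚᵘ) → 0ℚᵘ ℚᵘ.< ε →
        ∃[ K ] (∀ k → k ≥ K → ℚᵘ.∣ s k ℚᵘ.- L ∣ ℚᵘ.< ε)

{-# OPTIONS --safe #-}

-- Fix a candidate. Each of the 120 rankings contributes a vector (±1, ±1, ±1, ±1), recording which of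
-- the four rivals it places below the candidate, and the candidate wins exactly for the profiles
-- whose weighted sum of these vectors has positive coordinates. The number of such profiles with at
-- most k voters is asymptotic to a volume times C(k + 120, 120), and since the number with exactly k
-- voters is increasing in k, it is asymptotic to the same volume times C(k + 119, 119).
--
-- Volumes are computed by cutting cones: the cone spanned by a and b is the union of those spanned by
-- a + b and a and by a + b and b (1 − AB = (1 − B) + B (1 − A) for generating functions). Cutting
-- until no two opposite vectors remain in the first three coordinates turns the volume into a sum over
-- lattice paths, of volumes on the line of the fourth coordinate. A vector of degree d and fourth
-- coordinate t on the line behaves like the inverse of the linear form d − t q, so that after clearing
-- denominators the sum becomes a polynomial in q, on which a linear functional is evaluated. The
-- polynomial is found by dynamic programming over the lattice paths at the single large integer
-- q = 2⁸⁶⁴, of which its coefficients are the balanced digits.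

module Submission where

open import Defs
open import Data.Integer.Base using (+_)
open import Data.Rational.Unnormalised.Base using (_/_)
open import Relation.Binary.PropositionalEquality using (_≡_)

-- Binomial coefficients and asymptotics

-- A volume is never a real number here. It is the integer `w` for which a count, scaled by 48 per
-- generator, differs from `w` times a binomial coefficient by a term of lower order. Identities of
-- generating functions then become sums of volumes, because monomial factors only shift degree and
-- offset. A sign condition may be dropped once it can fail only in a slab of bounded width. The
-- obstacle is the number of lattice paths: a cut keeps the number of vectors, so each path ends
-- with 120 of them, and their volume on the line is not a product over them. The variable q repairs
-- this. Partial fraction identities for 1/(d - t q) are identities of volumes on the line, so the
-- volume is a linear functional of a product, and products can be summed in tables. Each factor is
-- cleared by the quartic 4 (1 - q²)(4 - q²), whence the degree 4 · 120 = 480. The absolute values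
-- of the coefficients sum to at most 5 · 144¹²⁰ < 2⁸⁶³, where 144 bounds the growth per step and 5
-- is the number of terms of the inclusion-exclusion.

module Binomials where

  open import Data.Nat.Base as ℕ using (ℕ; zero; suc; _≤_; _<_; z≤n; pred)
  import Data.Nat.Properties as ℕ
  open import Data.Integer.Base as ℤ using (ℤ; +_; ∣_∣)
  import Data.Integer.Properties as ℤ
  import Data.Integer.Tactic.RingSolver as ℤSolver
  open import Relation.Binary.PropositionalEquality

  -- Multiplication of the generating function of `f` by x to the power `d`.
  delay : ℕ → (ℕ → ℕ) → ℕ → ℕ
  delay zero    f k       = f k
  delay (suc d) f zero    = 0
  delay (suc d) f (suc k) = delay d f k

  -- A positive delay reads only earlier values; every recursion on the degree rests on this.
  delay-cong : ∀ d {f g} k → (∀ j → j < k → f j ≡ g j) → delay (suc d) f k ≡ delay (suc d) g k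
  delay-cong zero    zero    h = refl
  delay-cong zero    (suc k) h = h k ℕ.≤-refl
  delay-cong (suc d) zero    h = refl
  delay-cong (suc d) (suc k) h = delay-cong d k λ j j<k → h j (ℕ.m<n⇒m<1+n j<k)

  delay-≤ : ∀ d {f g} k → (∀ j → j < k → f j ≤ g j) → delay (suc d) f k ≤ delay (suc d) g k
  delay-≤ zero    zero    h = z≤n
  delay-≤ zero    (suc k) h = h k ℕ.≤-refl
  delay-≤ (suc d) zero    h = z≤n
  delay-≤ (suc d) (suc k) h = delay-≤ d k λ j j<k → h j (ℕ.m<n⇒m<1+n j<k)

  delay-ext : ∀ d {f g} k → (∀ j → f j ≡ g j) → delay d f k ≡ delay d g k
  delay-ext zero    k       h = h k
  delay-ext (suc d) zero    h = refl
  delay-ext (suc d) (suc k) h = delay-ext d k h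

  delay-+ : ∀ d {f g} k → delay d (λ j → f j ℕ.+ g j) k ≡ delay d f k ℕ.+ delay d g k
  delay-+ zero    k       = refl
  delay-+ (suc d) zero    = refl
  delay-+ (suc d) (suc k) = delay-+ d k

  delay-delay : ∀ d e {f} k → delay d (delay e f) k ≡ delay (d ℕ.+ e) f k
  delay-delay zero    e k       = refl
  delay-delay (suc d) e zero    = refl
  delay-delay (suc d) e (suc k) = delay-delay d e k

  -- B m k is the binomial coefficient C(k+m,m).
  B : ℕ → ℕ → ℕ
  B zero    k       = 1
  B (suc m) zero    = B m zero
  B (suc m) (suc k) = B (suc m) k ℕ.+ B m (suc k)

  B0 : ∀ m → B m 0 ≡ 1
  B0 zero    = refl
  B0 (suc m) = B0 m

  1≤B : ∀ m k → 1 ≤ B m k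
  1≤B zero    k       = ℕ.≤-refl
  1≤B (suc m) zero    = 1≤B m zero
  1≤B (suc m) (suc k) = ℕ.≤-trans (1≤B (suc m) k) (ℕ.m≤m+n _ _)

  B-suc : ∀ m k → B m k ≤ B m (suc k)
  B-suc zero    k = ℕ.≤-refl
  B-suc (suc m) k = ℕ.m≤m+n _ _

  B-step : ∀ m k → B m (suc k) ≤ B m k ℕ.+ B (pred m) (suc k)
  B-step zero    k = ℕ.m≤m+n 1 1
  B-step (suc m) k = ℕ.≤-refl

  infixr 4 _,_
  -- The error is one order below the main term, from `m` = 1 on. Bounding it by a binomial
  -- coefficient for all `k`, and not only eventually, keeps the constants of sums and shifts
  -- explicit.
  record Approx (F : ℕ → ℤ) (w : ℤ) (m : ℕ) : Set where
    constructor _,_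
    field
      constant : ℕ
      bounded  : ∀ k → ∣ F k ℤ.- w ℤ.* + B m k ∣ ≤ constant ℕ.* B (pred m) k

  module _ {m : ℕ} where

    approx-ext : ∀ {F G w} → (∀ k → F k ≡ G k) → Approx F w m → Approx G w m
    approx-ext h (A , p) = A , λ k → subst (λ x → ∣ x ℤ.- _ ∣ ≤ _) (h k) (p k)

    approx-+ : ∀ {F G v w} → Approx F v m → Approx G w m → Approx (λ k → F k ℤ.+ G k) (v ℤ.+ w) m
    approx-+ {F} {G} {v} {w} (A , p) (C , q) = A ℕ.+ C , λ k → begin
        ∣ F k ℤ.+ G k ℤ.- (v ℤ.+ w) ℤ.* + B m k ∣
          ≡⟨ cong ∣_∣ (lem (F k) (G k) v w (+ B m k)) ⟩
        ∣ (F k ℤ.- v ℤ.* + B m k) ℤ.+ (G k ℤ.- w ℤ.* + B m k) ∣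
          ≤⟨ ℤ.∣i+j∣≤∣i∣+∣j∣ (F k ℤ.- v ℤ.* + B m k) _ ⟩
        ∣ F k ℤ.- v ℤ.* + B m k ∣ ℕ.+ ∣ G k ℤ.- w ℤ.* + B m k ∣
          ≤⟨ ℕ.+-mono-≤ (p k) (q k) ⟩
        A ℕ.* B (pred m) k ℕ.+ C ℕ.* B (pred m) k
          ≡⟨ ℕ.*-distribʳ-+ (B (pred m) k) A C ⟨
        (A ℕ.+ C) ℕ.* B (pred m) k ∎
      where
      open ℕ.≤-Reasoning
      lem : ∀ f g v w b → f ℤ.+ g ℤ.- (v ℤ.+ w) ℤ.* b ≡ (f ℤ.- v ℤ.* b) ℤ.+ (g ℤ.- w ℤ.* b)
      lem = ℤSolver.solve-∀

    approx-* : ∀ c {F w} → Approx F w m → Approx (λ k → c ℤ.* F k) (c ℤ.* w) m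
    approx-* c {F} {w} (A , p) = ∣ c ∣ ℕ.* A , λ k → begin
        ∣ c ℤ.* F k ℤ.- c ℤ.* w ℤ.* + B m k ∣     ≡⟨ cong ∣_∣ (lem c (F k) w (+ B m k)) ⟩
        ∣ c ℤ.* (F k ℤ.- w ℤ.* + B m k) ∣         ≡⟨ ℤ.∣i*j∣≡∣i∣*∣j∣ c _ ⟩
        ∣ c ∣ ℕ.* ∣ F k ℤ.- w ℤ.* + B m k ∣       ≤⟨ ℕ.*-monoʳ-≤ ∣ c ∣ (p k) ⟩
        ∣ c ∣ ℕ.* (A ℕ.* B (pred m) k)            ≡⟨ ℕ.*-assoc ∣ c ∣ A _ ⟨
        ∣ c ∣ ℕ.* A ℕ.* B (pred m) k ∎
      where
      open ℕ.≤-Reasoning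
      lem : ∀ c f w b → c ℤ.* f ℤ.- c ℤ.* w ℤ.* b ≡ c ℤ.* (f ℤ.- w ℤ.* b)
      lem = ℤSolver.solve-∀

    approx-perturb : ∀ {F G w} C → (∀ k → ∣ G k ℤ.- F k ∣ ≤ C ℕ.* B (pred m) k) → Approx F w m → Approx G w m
    approx-perturb {F} {G} {w} C h (A , p) = C ℕ.+ A , λ k → begin
        ∣ G k ℤ.- w ℤ.* + B m k ∣                       ≡⟨ cong ∣_∣ (lem (F k) (G k) (w ℤ.* + B m k)) ⟩
        ∣ (G k ℤ.- F k) ℤ.+ (F k ℤ.- w ℤ.* + B m k) ∣    ≤⟨ ℤ.∣i+j∣≤∣i∣+∣j∣ (G k ℤ.- F k) _ ⟩
        ∣ G k ℤ.- F k ∣ ℕ.+ ∣ F k ℤ.- w ℤ.* + B m k ∣    ≤⟨ ℕ.+-mono-≤ (h k) (p k) ⟩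
        C ℕ.* B (pred m) k ℕ.+ A ℕ.* B (pred m) k       ≡⟨ ℕ.*-distribʳ-+ (B (pred m) k) C A ⟨
        (C ℕ.+ A) ℕ.* B (pred m) k ∎
      where
      open ℕ.≤-Reasoning
      lem : ∀ f g x → g ℤ.- x ≡ (g ℤ.- f) ℤ.+ (f ℤ.- x)
      lem = ℤSolver.solve-∀

    -- By Pascal's rule consecutive values of `B m` differ by at most `B (pred m)`, so a delay costs
    -- only `∣ w ∣` in the constant. This is why monomial factors do not affect a volume.
    approx-delay₁ : ∀ {f : ℕ → ℕ} c {w} → Approx (λ k → + (c ℕ.* f k)) w m →
                    Approx (λ k → + (c ℕ.* delay 1 f k)) w m
    approx-delay₁ {f} c {w} (A , p) = A ℕ.+ ∣ w ∣ , λ where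
        zero → begin
          ∣ + (c ℕ.* 0) ℤ.- w ℤ.* + B m 0 ∣  ≡⟨ cong₂ (λ x y → ∣ + x ℤ.- w ℤ.* + y ∣) (ℕ.*-zeroʳ c) (B0 m) ⟩
          ∣ + 0 ℤ.- w ℤ.* + 1 ∣              ≡⟨ cong (λ x → ∣ + 0 ℤ.- x ∣) (ℤ.*-identityʳ w) ⟩
          ∣ + 0 ℤ.- w ∣                      ≡⟨ trans (cong ∣_∣ (ℤ.+-identityˡ (ℤ.- w))) (ℤ.∣-i∣≡∣i∣ w) ⟩
          ∣ w ∣                              ≤⟨ ℕ.m≤n+m ∣ w ∣ A ⟩
          A ℕ.+ ∣ w ∣                        ≡⟨ ℕ.*-identityʳ _ ⟨
          (A ℕ.+ ∣ w ∣) ℕ.* 1                ≡⟨ cong ((A ℕ.+ ∣ w ∣) ℕ.*_) (B0 (pred m)) ⟨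
          (A ℕ.+ ∣ w ∣) ℕ.* B (pred m) 0 ∎
        (suc k) → begin
          ∣ + (c ℕ.* f k) ℤ.- w ℤ.* + B m (suc k) ∣
            ≡⟨ cong ∣_∣ (lem (+ (c ℕ.* f k)) w (+ B m k) (+ B m (suc k))) ⟩
          ∣ (+ (c ℕ.* f k) ℤ.- w ℤ.* + B m k) ℤ.+ w ℤ.* (+ B m k ℤ.- + B m (suc k)) ∣
            ≤⟨ ℤ.∣i+j∣≤∣i∣+∣j∣ (+ (c ℕ.* f k) ℤ.- w ℤ.* + B m k) _ ⟩
          ∣ + (c ℕ.* f k) ℤ.- w ℤ.* + B m k ∣ ℕ.+ ∣ w ℤ.* (+ B m k ℤ.- + B m (suc k)) ∣
            ≤⟨ ℕ.+-mono-≤ (ℕ.≤-trans (p k) (ℕ.*-monoʳ-≤ A (B-suc (pred m) k))) (diff k) ⟩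
          A ℕ.* B (pred m) (suc k) ℕ.+ ∣ w ∣ ℕ.* B (pred m) (suc k)
            ≡⟨ ℕ.*-distribʳ-+ (B (pred m) (suc k)) A ∣ w ∣ ⟨
          (A ℕ.+ ∣ w ∣) ℕ.* B (pred m) (suc k) ∎
      where
      open ℕ.≤-Reasoning
      lem : ∀ f w b b' → f ℤ.- w ℤ.* b' ≡ (f ℤ.- w ℤ.* b) ℤ.+ w ℤ.* (b ℤ.- b')
      lem = ℤSolver.solve-∀
      diff : ∀ k → ∣ w ℤ.* (+ B m k ℤ.- + B m (suc k)) ∣ ≤ ∣ w ∣ ℕ.* B (pred m) (suc k)
      diff k = begin
        ∣ w ℤ.* (+ B m k ℤ.- + B m (suc k)) ∣     ≡⟨ ℤ.∣i*j∣≡∣i∣*∣j∣ w _ ⟩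
        ∣ w ∣ ℕ.* ∣ + B m k ℤ.- + B m (suc k) ∣   ≡⟨ cong (λ x → ∣ w ∣ ℕ.* ∣ x ∣) (ℤ.m-n≡m⊖n (B m k) (B m (suc k))) ⟩
        ∣ w ∣ ℕ.* ∣ B m k ℤ.⊖ B m (suc k) ∣       ≡⟨ cong (∣ w ∣ ℕ.*_) (ℤ.∣⊖∣-≤ (B-suc m k)) ⟩
        ∣ w ∣ ℕ.* (B m (suc k) ℕ.∸ B m k)         ≤⟨ ℕ.*-monoʳ-≤ ∣ w ∣ (ℕ.m≤n+o⇒m∸n≤o _ (B m k) (B-step m k)) ⟩
        ∣ w ∣ ℕ.* B (pred m) (suc k) ∎

    approx-delay : ∀ {f : ℕ → ℕ} c {w} d → Approx (λ k → + (c ℕ.* f k)) w m →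
                   Approx (λ k → + (c ℕ.* delay d f k)) w m
    approx-delay {f} c zero    p = p
    approx-delay {f} c (suc d) p =
      approx-ext (λ k → cong (λ x → + (c ℕ.* x)) (delay-delay 1 d k)) (approx-delay₁ {f = delay d f} c (approx-delay {f} c d p))

-- Counting multisets of generators by degree and offset

module Counting (V : Set) (_⊹_ : V → V → V)
  (exchange : ∀ o a b → (o ⊹ a) ⊹ b ≡ (o ⊹ b) ⊹ a)
  (assoc    : ∀ o a b → (o ⊹ a) ⊹ b ≡ o ⊹ (a ⊹ b)) where

  open import Relation.Binary.PropositionalEquality
  open import Data.Nat.Base as ℕ using (ℕ; zero; suc; _<_; s≤s)
  import Data.Nat.Properties as ℕ
  open import Data.Nat.Induction using (<-rec)
  import Data.Nat.Tactic.RingSolver as ℕSolver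
  open import Data.List.Base using (List; []; _∷_; foldr)
  open import Data.List.Relation.Binary.Permutation.Propositional as ↭ using (_↭_)
  open import Data.List.Relation.Unary.All using ([]; _∷_)
  open Binomials

  infix 4 _≗₂_
  _≗₂_ : (ψ χ : ℕ → V → ℕ) → Set
  ψ ≗₂ χ = ∀ k o → ψ k o ≡ χ k o

  -- A generator of degree suc d and direction v.
  record Gen : Set where
    constructor gen
    field
      d : ℕ
      v : V
  open Gen public

  deg : Gen → ℕ
  deg g = suc (d g)

  infixl 6 _⊕_
  _⊕_ : Gen → Gen → Gen
  gen d v ⊕ gen e w = gen (d ℕ.+ suc e) (v ⊹ w)

  Seq : Set
  Seq = ℕ → V → ℕ

  infixl 6 _+ₛ_
  _+ₛ_ : Seq → Seq → Seq
  (ψ +ₛ χ) k o = ψ k o ℕ.+ χ k o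

  -- Multiplication by the monomial of `g`. In a sequence, `k` is the degree still to be spent and
  -- `o` the point reached so far.
  shift : Gen → Seq → Seq
  shift g ψ k o = delay (deg g) (λ j → ψ j (o ⊹ v g)) k

  module _ (g : Gen) (ψ : Seq) where
    abstract
      private
        -- The first argument is fuel. Degrees are positive, so `suc k` rounds exhaust the degree
        -- `k`.
        iter : ℕ → Seq
        iter zero    k o = 0
        iter (suc f) k o = ψ k o ℕ.+ shift g (iter f) k o

        stable : ∀ f f′ k o → k < f → k < f′ → iter f k o ≡ iter f′ k o
        stable (suc f) (suc f′) k o (s≤s k≤f) (s≤s k≤f′) = cong (ψ k o ℕ.+_)
          (delay-cong (d g) k λ j j<k → stable f f′ j _ (ℕ.<-≤-trans j<k k≤f) (ℕ.<-≤-trans j<k k≤f′))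

      -- The sum of ψ over all multiples of g.
      ray : Seq
      ray k o = iter (suc k) k o

      ray-unfold : ray ≗₂ ψ +ₛ shift g ray
      ray-unfold k o = cong (ψ k o ℕ.+_)
        (delay-cong (d g) k λ j j<k → stable k (suc j) j _ j<k (ℕ.n<1+n j))

    -- Since `g` has positive degree, the equation determines the value at `k` from smaller degrees.
    -- `ray g` thus plays the part of 1/(1 - g), and identities between rays are proved by verifying
    -- this equation.
    ray-unique : ∀ {χ} → χ ≗₂ ψ +ₛ shift g χ → χ ≗₂ ray
    ray-unique {χ} h k = <-rec (λ k → ∀ o → χ k o ≡ ray k o) step k
      where
      step : ∀ k → (∀ {j} → j < k → ∀ o → χ j o ≡ ray j o) → ∀ o → χ k o ≡ ray k o
      step k rec o = trans (h k o) (trans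
        (cong (ψ k o ℕ.+_) (delay-cong (d g) k λ j j<k → rec j<k _)) (sym (ray-unfold k o)))

  shift-cong : ∀ g {ψ χ} → ψ ≗₂ χ → shift g ψ ≗₂ shift g χ
  shift-cong g h k o = delay-ext (deg g) k λ j → h j _

  ray-cong : ∀ g {ψ χ} → ψ ≗₂ χ → ray g ψ ≗₂ ray g χ
  ray-cong g {ψ} {χ} h = ray-unique g χ λ k o →
    trans (ray-unfold g ψ k o) (cong (ℕ._+ shift g (ray g ψ) k o) (h k o))

  shift-+ : ∀ g ψ χ → shift g (ψ +ₛ χ) ≗₂ shift g ψ +ₛ shift g χ
  shift-+ g ψ χ k o = delay-+ (deg g) k

  private
    interchange : ∀ a b c d → (a ℕ.+ b) ℕ.+ (c ℕ.+ d) ≡ (a ℕ.+ c) ℕ.+ (b ℕ.+ d)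
    interchange = ℕSolver.solve-∀

  shift-shift : ∀ a b ψ → shift a (shift b ψ) ≗₂ shift (a ⊕ b) ψ
  shift-shift a b ψ k o = trans
    (delay-ext (deg a) k λ j → delay-ext (deg b) j λ i → cong (ψ i) (assoc o (v a) (v b)))
    (delay-delay (deg a) (deg b) k)

  shift-comm : ∀ a b ψ → shift a (shift b ψ) ≗₂ shift b (shift a ψ)
  shift-comm a b ψ k o = trans (delay-delay (deg a) (deg b) k) (trans
    (cong (λ n → delay n (λ j → ψ j ((o ⊹ v a) ⊹ v b)) k) (ℕ.+-comm (deg a) (deg b))) (trans
    (delay-ext (deg b ℕ.+ deg a) k λ j → cong (ψ j) (exchange o (v a) (v b)))
    (sym (delay-delay (deg b) (deg a) k))))

  ray-+ : ∀ g ψ χ → ray g (ψ +ₛ χ) ≗₂ ray g ψ +ₛ ray g χ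
  ray-+ g ψ χ k o = sym (ray-unique g (ψ +ₛ χ) (λ k o → trans
    (cong₂ ℕ._+_ (ray-unfold g ψ k o) (ray-unfold g χ k o)) (trans
    (interchange (ψ k o) _ (χ k o) _)
    (cong (ψ k o ℕ.+ χ k o ℕ.+_) (sym (shift-+ g (ray g ψ) (ray g χ) k o))))) k o)

  ray-shift : ∀ a b ψ → ray a (shift b ψ) ≗₂ shift b (ray a ψ)
  ray-shift a b ψ k o = sym (ray-unique a (shift b ψ) (λ k o → trans
    (shift-cong b (ray-unfold a ψ) k o) (trans
    (shift-+ b ψ (shift a (ray a ψ)) k o)
    (cong (shift b ψ k o ℕ.+_) (shift-comm b a (ray a ψ) k o)))) k o)

  ray-comm : ∀ a b ψ → ray a (ray b ψ) ≗₂ ray b (ray a ψ)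
  ray-comm a b ψ k o = sym (ray-unique a (ray b ψ) (λ k o → trans
    (ray-cong b (ray-unfold a ψ) k o) (trans
    (ray-+ b ψ (shift a (ray a ψ)) k o)
    (cong (ray b ψ k o ℕ.+_) (ray-shift b a (ray a ψ) k o)))) k o)

  count : Seq → List Gen → Seq
  count = foldr ray

  count-cong : ∀ {ψ χ} M → ψ ≗₂ χ → count ψ M ≗₂ count χ M
  count-cong []      h = h
  count-cong (g ∷ M) h = ray-cong g (count-cong M h)

  count-ray : ∀ g ψ M → count (ray g ψ) M ≗₂ ray g (count ψ M)
  count-ray g ψ []      k o = refl
  count-ray g ψ (h ∷ M) k o = trans (ray-cong h (count-ray g ψ M) k o) (ray-comm h g (count ψ M) k o)

  count-+ : ∀ ψ χ M → count (ψ +ₛ χ) M ≗₂ count ψ M +ₛ count χ M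
  count-+ ψ χ []      k o = refl
  count-+ ψ χ (g ∷ M) k o = trans (ray-cong g (count-+ ψ χ M) k o) (ray-+ g (count ψ M) (count χ M) k o)

  count-↭ : ∀ ψ {M N} → M ↭ N → count ψ M ≗₂ count ψ N
  count-↭ ψ ↭.refl                  k o = refl
  count-↭ ψ (↭.prep g p)            k o = ray-cong g (count-↭ ψ p) k o
  count-↭ ψ {g ∷ h ∷ M} (↭.swap g h p) k o =
    trans (ray-comm g h (count ψ M) k o) (ray-cong h (ray-cong g (count-↭ ψ p)) k o)
  count-↭ ψ (↭.trans p q)           k o = trans (count-↭ ψ p k o) (count-↭ ψ q k o)

  -- 1 − AB = (1 − B) + B (1 − A), divided by (1 − A)(1 − B)(1 − AB), and its fourfold analogue.
  star₂ : ∀ a b ψ → ray a (ray b ψ) ≗₂ ray (a ⊕ b) (ray b ψ) +ₛ shift a (ray (a ⊕ b) (ray a ψ))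
  star₂ a b ψ k o = trans
    (ray-unique w (ray b ψ +ₛ shift a (ray a ψ)) F-eq k o) (trans
    (ray-+ w (ray b ψ) (shift a (ray a ψ)) k o)
    (cong (ray w (ray b ψ) k o ℕ.+_) (ray-shift w a (ray a ψ) k o)))
    where
    w = a ⊕ b
    F = ray a (ray b ψ)
    F-eq : F ≗₂ (ray b ψ +ₛ shift a (ray a ψ)) +ₛ shift w F
    F-eq k o = begin
      F k o                                         ≡⟨ ray-unfold a (ray b ψ) k o ⟩
      ray b ψ k o ℕ.+ shift a F k o                 ≡⟨ cong (ray b ψ k o ℕ.+_) (shift-cong a Fb k o) ⟩
      ray b ψ k o ℕ.+ shift a (ray a ψ +ₛ shift b F) k o
        ≡⟨ cong (ray b ψ k o ℕ.+_) (shift-+ a (ray a ψ) (shift b F) k o) ⟩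
      ray b ψ k o ℕ.+ (shift a (ray a ψ) k o ℕ.+ shift a (shift b F) k o)
        ≡⟨ ℕ.+-assoc (ray b ψ k o) _ _ ⟨
      ray b ψ k o ℕ.+ shift a (ray a ψ) k o ℕ.+ shift a (shift b F) k o
        ≡⟨ cong (ray b ψ k o ℕ.+ shift a (ray a ψ) k o ℕ.+_) (shift-shift a b F k o) ⟩
      ray b ψ k o ℕ.+ shift a (ray a ψ) k o ℕ.+ shift w F k o ∎
      where
      open ≡-Reasoning
      Fb : F ≗₂ ray a ψ +ₛ shift b F
      Fb k o = trans (ray-comm a b ψ k o) (trans (ray-unfold b (ray a ψ) k o)
        (cong (ray a ψ k o ℕ.+_) (shift-cong b (ray-comm b a ψ) k o)))

  star₄ : ∀ a b c e ψ → ray a (ray b (ray c (ray e ψ))) ≗₂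
    ray (a ⊕ b ⊕ c ⊕ e) (ray b (ray c (ray e ψ))) +ₛ
    (shift a (ray (a ⊕ b ⊕ c ⊕ e) (ray a (ray c (ray e ψ)))) +ₛ
    (shift (a ⊕ b) (ray (a ⊕ b ⊕ c ⊕ e) (ray a (ray b (ray e ψ)))) +ₛ
     shift (a ⊕ b ⊕ c) (ray (a ⊕ b ⊕ c ⊕ e) (ray a (ray b (ray c ψ))))))
  star₄ a b c e ψ k o = trans (ray-unique w (X₁ +ₛ (Y₂ +ₛ (Y₃ +ₛ Y₄))) F-eq k o)
    (trans (ray-+ w X₁ (Y₂ +ₛ (Y₃ +ₛ Y₄)) k o) (cong (ray w X₁ k o ℕ.+_)
    (trans (ray-+ w Y₂ (Y₃ +ₛ Y₄) k o) (cong₂ ℕ._+_ (ray-shift w a X₂ k o)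
    (trans (ray-+ w Y₃ Y₄ k o) (cong₂ ℕ._+_ (ray-shift w (a ⊕ b) X₃ k o) (ray-shift w (a ⊕ b ⊕ c) X₄ k o)))))))
    where
    open ≡-Reasoning
    w = a ⊕ b ⊕ c ⊕ e
    X₁ = ray b (ray c (ray e ψ))
    X₂ = ray a (ray c (ray e ψ))
    X₃ = ray a (ray b (ray e ψ))
    X₄ = ray a (ray b (ray c ψ))
    Y₂ = shift a X₂
    Y₃ = shift (a ⊕ b) X₃
    Y₄ = shift (a ⊕ b ⊕ c) X₄
    F = ray a X₁
    F₂ : F ≗₂ ray b X₂
    F₂ = ray-comm a b (ray c (ray e ψ))
    F₃ : F ≗₂ ray c X₃
    F₃ k o = trans (ray-cong a (ray-comm b c (ray e ψ)) k o) (ray-comm a c (ray b (ray e ψ)) k o)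
    F₄ : F ≗₂ ray e X₄
    F₄ k o = trans (ray-cong a (ray-cong b (ray-comm c e ψ)) k o) (trans
      (ray-cong a (ray-comm b e (ray c ψ)) k o) (ray-comm a e (ray b (ray c ψ)) k o))
    -- One step of the telescoping sum 1 - ABCE = (1 - A) + A (1 - B) + AB (1 - C) + ABC (1 - E),
    -- after division by (1 - A)(1 - B)(1 - C)(1 - E).
    unfold : ∀ s g X → F ≗₂ ray g X → shift s F ≗₂ shift s X +ₛ shift (s ⊕ g) F
    unfold s g X h k o = begin
      shift s F k o                       ≡⟨ shift-cong s h k o ⟩
      shift s (ray g X) k o               ≡⟨ shift-cong s (ray-unfold g X) k o ⟩
      shift s (X +ₛ shift g (ray g X)) k o ≡⟨ shift-+ s X (shift g (ray g X)) k o ⟩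
      shift s X k o ℕ.+ shift s (shift g (ray g X)) k o
        ≡⟨ cong (shift s X k o ℕ.+_) (shift-cong s (shift-cong g λ k o → sym (h k o)) k o) ⟩
      shift s X k o ℕ.+ shift s (shift g F) k o ≡⟨ cong (shift s X k o ℕ.+_) (shift-shift s g F k o) ⟩
      shift s X k o ℕ.+ shift (s ⊕ g) F k o ∎
    re : ∀ p q r s t → p ℕ.+ (q ℕ.+ (r ℕ.+ (s ℕ.+ t))) ≡ p ℕ.+ (q ℕ.+ (r ℕ.+ s)) ℕ.+ t
    re = ℕSolver.solve-∀
    F-eq : F ≗₂ (X₁ +ₛ (Y₂ +ₛ (Y₃ +ₛ Y₄))) +ₛ shift w F
    F-eq k o = begin
      F k o ≡⟨ ray-unfold a X₁ k o ⟩
      X₁ k o ℕ.+ shift a F k o ≡⟨ cong (X₁ k o ℕ.+_) (unfold a b X₂ F₂ k o) ⟩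
      X₁ k o ℕ.+ (Y₂ k o ℕ.+ shift (a ⊕ b) F k o)
        ≡⟨ cong (λ x → X₁ k o ℕ.+ (Y₂ k o ℕ.+ x)) (unfold (a ⊕ b) c X₃ F₃ k o) ⟩
      X₁ k o ℕ.+ (Y₂ k o ℕ.+ (Y₃ k o ℕ.+ shift (a ⊕ b ⊕ c) F k o))
        ≡⟨ cong (λ x → X₁ k o ℕ.+ (Y₂ k o ℕ.+ (Y₃ k o ℕ.+ x))) (unfold (a ⊕ b ⊕ c) e X₄ F₄ k o) ⟩
      X₁ k o ℕ.+ (Y₂ k o ℕ.+ (Y₃ k o ℕ.+ (Y₄ k o ℕ.+ shift w F k o)))
        ≡⟨ re (X₁ k o) (Y₂ k o) (Y₃ k o) (Y₄ k o) _ ⟩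
      X₁ k o ℕ.+ (Y₂ k o ℕ.+ (Y₃ k o ℕ.+ Y₄ k o)) ℕ.+ shift w F k o ∎

  -- Halving: the multiples of g are the even multiples and g plus the even multiples.
  double : ∀ g ψ → ray g ψ ≗₂ ray (g ⊕ g) ψ +ₛ shift g (ray (g ⊕ g) ψ)
  double g ψ k o = sym (ray-unique g ψ (λ k o → begin
      F k o ℕ.+ shift g F k o                ≡⟨ cong (ℕ._+ shift g F k o) (ray-unfold (g ⊕ g) ψ k o) ⟩
      ψ k o ℕ.+ shift (g ⊕ g) F k o ℕ.+ shift g F k o
        ≡⟨ cong (λ x → ψ k o ℕ.+ x ℕ.+ shift g F k o) (shift-shift g g F k o) ⟨
      ψ k o ℕ.+ shift g (shift g F) k o ℕ.+ shift g F k o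
        ≡⟨ re (ψ k o) (shift g (shift g F) k o) (shift g F k o) ⟩
      ψ k o ℕ.+ (shift g F k o ℕ.+ shift g (shift g F) k o)
        ≡⟨ cong (ψ k o ℕ.+_) (shift-+ g F (shift g F) k o) ⟨
      ψ k o ℕ.+ shift g (F +ₛ shift g F) k o ∎) k o)
    where
    open ≡-Reasoning
    F = ray (g ⊕ g) ψ
    re : ∀ p q r → p ℕ.+ q ℕ.+ r ≡ p ℕ.+ (r ℕ.+ q)
    re = ℕSolver.solve-∀

-- Volumes

module Volumes (V : Set) (_⊹_ : V → V → V)
  (exchange : ∀ o a b → (o ⊹ a) ⊹ b ≡ (o ⊹ b) ⊹ a)
  (assoc    : ∀ o a b → (o ⊹ a) ⊹ b ≡ o ⊹ (a ⊹ b)) where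

  open import Relation.Binary.PropositionalEquality
  open import Data.Bool.Base using (if_then_else_; true; false; T)
  open import Data.Nat.Base as ℕ using (ℕ; zero; suc; _≤_; _<_; z≤n; s≤s; pred)
  import Data.Nat.Properties as ℕ
  open import Data.Nat.Induction using (<-rec)
  open import Data.Integer.Base as ℤ using (ℤ; +_; ∣_∣)
  import Data.Integer.Properties as ℤ
  import Data.Nat.Tactic.RingSolver as ℕSolver
  import Data.Integer.Tactic.RingSolver as ℤSolver
  open import Data.List.Base using (List; []; _∷_; length)
  open import Data.List.Relation.Binary.Permutation.Propositional using (_↭_)
  open import Data.List.Relation.Binary.Permutation.Propositional.Properties using (↭-length)
  open import Data.List.Relation.Unary.All using (All; []; _∷_)
  open import Data.Product.Base using (∃-syntax) renaming (_,_ to _,,_)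
  open import Data.Unit.Base using (tt)
  open import Relation.Nullary using (contradiction)
  open import Data.Sum.Base using (inj₁; inj₂)
  open Binomials
  open Counting V _⊹_ exchange assoc public

  constant : (V → ℕ) → Seq
  constant φ k o = φ o

  -- `constant φ` ignores the unspent degree, so total degree at most `k` is counted, not exactly
  -- `k`.
  cnt : (V → ℕ) → List Gen → Seq
  cnt φ M = count (constant φ) M

  abstract
    -- The degrees by which volumes get divided are 2, 4, 8, 12 and 16, all divisors of 48, so one
    -- factor 48 per generator keeps volumes integral.
    scale : ℕ → ℕ
    scale n = 48 ℕ.^ n

    scale-0 : scale 0 ≡ 1
    scale-0 = refl

    scale-suc : ∀ n → scale (suc n) ≡ 48 ℕ.* scale n
    scale-suc n = refl

  -- The same `w` is demanded at every offset, because the shifted terms of a cut start elsewhere.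
  record HasVol (φ : V → ℕ) (M : List Gen) (w : ℤ) : Set where
    constructor vol
    field at : ∀ o → Approx (λ k → + (scale (length M) ℕ.* cnt φ M k o)) w (length M)
  open HasVol public

  module _ {φ : V → ℕ} where

    vol-↭ : ∀ {M N w} → M ↭ N → HasVol φ M w → HasVol φ N w
    vol-↭ {M} {N} {w} p h .at o = subst (Approx _ w) (↭-length p)
      (approx-ext (λ k → cong₂ (λ n x → + (scale n ℕ.* x)) (↭-length p) (count-↭ (constant φ) p k o)) (at h o))

    private
      split : ∀ c x y → + (c ℕ.* (x ℕ.+ y)) ≡ + (c ℕ.* x) ℤ.+ + (c ℕ.* y)
      split c x y = trans (cong +_ (ℕ.*-distribˡ-+ c x y)) (ℤ.pos-+ (c ℕ.* x) (c ℕ.* y))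

      split₄ : ∀ c x y z t → + (c ℕ.* (x ℕ.+ (y ℕ.+ (z ℕ.+ t)))) ≡
               + (c ℕ.* x) ℤ.+ (+ (c ℕ.* y) ℤ.+ (+ (c ℕ.* z) ℤ.+ + (c ℕ.* t)))
      split₄ c x y z t = trans (split c x _) (cong (λ u → + (c ℕ.* x) ℤ.+ u)
        (trans (split c y _) (cong (λ u → + (c ℕ.* y) ℤ.+ u) (split c z t))))

      shifted : ∀ g {M w} → HasVol φ M w → ∀ o →
                Approx (λ k → + (scale (length M) ℕ.* shift g (cnt φ M) k o)) w (length M)
      shifted g {M} h o = approx-delay {f = λ j → cnt φ M j (o ⊹ v g)} (scale (length M)) (deg g) (at h (o ⊹ v g))

    -- The shift by `a` in the second summand of `star₂` delays the degree and moves the offset;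
    -- neither changes the leading term.
    vol-star₂ : ∀ {a b M x y} → HasVol φ (a ⊕ b ∷ b ∷ M) x → HasVol φ (a ⊕ b ∷ a ∷ M) y →
                HasVol φ (a ∷ b ∷ M) (x ℤ.+ y)
    vol-star₂ {a} {b} {M} p q .at o = approx-ext
      (λ k → sym (trans (cong (λ x → + (scale (suc (suc (length M))) ℕ.* x)) (star₂ a b (cnt φ M) k o))
        (split (scale (suc (suc (length M)))) _ _)))
      (approx-+ (at p o) (shifted a {a ⊕ b ∷ a ∷ M} q o))

    vol-star₄ : ∀ {a b c e M x y z t} (let w = a ⊕ b ⊕ c ⊕ e) →
      HasVol φ (w ∷ b ∷ c ∷ e ∷ M) x → HasVol φ (w ∷ a ∷ c ∷ e ∷ M) y →
      HasVol φ (w ∷ a ∷ b ∷ e ∷ M) z → HasVol φ (w ∷ a ∷ b ∷ c ∷ M) t →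
      HasVol φ (a ∷ b ∷ c ∷ e ∷ M) (x ℤ.+ (y ℤ.+ (z ℤ.+ t)))
    vol-star₄ {a} {b} {c} {e} {M} p q r s .at o = approx-ext
      (λ k → sym (trans (cong (λ x → + (C ℕ.* x)) (star₄ a b c e (cnt φ M) k o)) (split₄ C _ _ _ _)))
      (approx-+ (at p o) (approx-+ (shifted a {w ∷ a ∷ c ∷ e ∷ M} q o)
        (approx-+ (shifted (a ⊕ b) {w ∷ a ∷ b ∷ e ∷ M} r o) (shifted (a ⊕ b ⊕ c) {w ∷ a ∷ b ∷ c ∷ M} s o))))
      where
      w = a ⊕ b ⊕ c ⊕ e
      C = scale (4 ℕ.+ length M)

    vol-double : ∀ {g M x} → HasVol φ (g ⊕ g ∷ M) x → HasVol φ (g ∷ M) (x ℤ.+ x)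
    vol-double {g} {M} p .at o = approx-ext
      (λ k → sym (trans (cong (λ x → + (scale (suc (length M)) ℕ.* x)) (double g (cnt φ M) k o))
        (split (scale (suc (length M))) _ _)))
      (approx-+ (at p o) (shifted g {g ⊕ g ∷ M} p o))

    vol-subst : ∀ {M x y} → x ≡ y → HasVol φ M x → HasVol φ M y
    vol-subst refl h = h

  module _ {φ χ : V → ℕ} {M : List Gen} where
    private
      n = scale (length M)
      cnt-+ : ∀ k o → cnt (λ y → φ y ℕ.+ χ y) M k o ≡ cnt φ M k o ℕ.+ cnt χ M k o
      cnt-+ = count-+ (constant φ) (constant χ) M
      split : ∀ k o → + (n ℕ.* cnt (λ y → φ y ℕ.+ χ y) M k o) ≡ + (n ℕ.* cnt φ M k o) ℤ.+ + (n ℕ.* cnt χ M k o)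
      split k o = trans (cong +_ (trans (cong (n ℕ.*_) (cnt-+ k o)) (ℕ.*-distribˡ-+ n (cnt φ M k o) (cnt χ M k o))))
                        (ℤ.pos-+ (n ℕ.* cnt φ M k o) _)

    vol-+ : ∀ {x y} → HasVol φ M x → HasVol χ M y → HasVol (λ y → φ y ℕ.+ χ y) M (x ℤ.+ y)
    vol-+ p q .at o = approx-ext (λ k → sym (split k o)) (approx-+ (at p o) (at q o))

    -- Counts are natural numbers, so a difference of events enters through the sum that it
    -- satisfies.
    vol-- : ∀ {x y} → HasVol (λ y → φ y ℕ.+ χ y) M x → HasVol χ M y → HasVol φ M (x ℤ.+ ℤ.-1ℤ ℤ.* y)
    vol-- p q .at o = approx-ext
      (λ k → trans (cong (ℤ._+ ℤ.-1ℤ ℤ.* + (n ℕ.* cnt χ M k o)) (split k o)) (lem _ (+ (n ℕ.* cnt χ M k o))))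
      (approx-+ (at p o) (approx-* ℤ.-1ℤ (at q o)))
      where
      lem : ∀ x y → x ℤ.+ y ℤ.+ ℤ.-1ℤ ℤ.* y ≡ x
      lem = ℤSolver.solve-∀

  -- The absorption identities of binomial coefficients; by Pascal's rule each induction step uses
  -- both of them.
  B-step-k : ∀ m k → suc k ℕ.* B m (suc k) ≡ (suc k ℕ.+ m) ℕ.* B m k
  B-step-m : ∀ m k → suc m ℕ.* B (suc m) k ≡ (k ℕ.+ suc m) ℕ.* B m k
  B-step-k zero    k = cong (ℕ._* 1) (sym (ℕ.+-identityʳ (suc k)))
  B-step-k (suc m) k = begin
    suc k ℕ.* (B (suc m) k ℕ.+ B m (suc k))                  ≡⟨ ℕ.*-distribˡ-+ (suc k) (B (suc m) k) _ ⟩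
    suc k ℕ.* B (suc m) k ℕ.+ suc k ℕ.* B m (suc k)          ≡⟨ cong (suc k ℕ.* B (suc m) k ℕ.+_) (B-step-k m k) ⟩
    suc k ℕ.* B (suc m) k ℕ.+ (suc k ℕ.+ m) ℕ.* B m k
      ≡⟨ cong (λ x → suc k ℕ.* B (suc m) k ℕ.+ x ℕ.* B m k) (sym (ℕ.+-suc k m)) ⟩
    suc k ℕ.* B (suc m) k ℕ.+ (k ℕ.+ suc m) ℕ.* B m k        ≡⟨ cong (suc k ℕ.* B (suc m) k ℕ.+_) (B-step-m m k) ⟨
    suc k ℕ.* B (suc m) k ℕ.+ suc m ℕ.* B (suc m) k          ≡⟨ ℕ.*-distribʳ-+ (B (suc m) k) (suc k) (suc m) ⟨
    (suc k ℕ.+ suc m) ℕ.* B (suc m) k ∎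
    where open ≡-Reasoning
  B-step-m m zero    = cong (suc m ℕ.*_) refl
  B-step-m m (suc k) = begin
    suc m ℕ.* (B (suc m) k ℕ.+ B m (suc k))               ≡⟨ ℕ.*-distribˡ-+ (suc m) (B (suc m) k) _ ⟩
    suc m ℕ.* B (suc m) k ℕ.+ suc m ℕ.* B m (suc k)       ≡⟨ cong (ℕ._+ suc m ℕ.* B m (suc k)) (B-step-m m k) ⟩
    (k ℕ.+ suc m) ℕ.* B m k ℕ.+ suc m ℕ.* B m (suc k)
      ≡⟨ cong (λ x → x ℕ.* B m k ℕ.+ suc m ℕ.* B m (suc k)) (ℕ.+-suc k m) ⟩
    (suc k ℕ.+ m) ℕ.* B m k ℕ.+ suc m ℕ.* B m (suc k)     ≡⟨ cong (ℕ._+ suc m ℕ.* B m (suc k)) (B-step-k m k) ⟨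
    suc k ℕ.* B m (suc k) ℕ.+ suc m ℕ.* B m (suc k)       ≡⟨ ℕ.*-distribʳ-+ (B m (suc k)) (suc k) (suc m) ⟨
    (suc k ℕ.+ suc m) ℕ.* B m (suc k) ∎
    where open ≡-Reasoning

  B-grows : ∀ m e k → e ℕ.* suc m ≤ k → e ℕ.* B m k < B (suc m) k
  B-grows m e k le = ℕ.*-cancelˡ-< (suc m) _ _ (begin-strict
    suc m ℕ.* (e ℕ.* B m k)     ≡⟨ lem (suc m) e (B m k) ⟩
    e ℕ.* suc m ℕ.* B m k       ≤⟨ ℕ.*-monoˡ-≤ (B m k) le ⟩
    k ℕ.* B m k                 <⟨ ℕ.*-monoˡ-< (B m k) ⦃ ℕ.>-nonZero (1≤B m k) ⦄ (ℕ.m<m+n k (s≤s z≤n)) ⟩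
    (k ℕ.+ suc m) ℕ.* B m k     ≡⟨ B-step-m m k ⟨
    suc m ℕ.* B (suc m) k ∎)
    where
    open ℕ.≤-Reasoning
    lem : ∀ a b c → a ℕ.* (b ℕ.* c) ≡ b ℕ.* a ℕ.* c
    lem = ℕSolver.solve-∀

  -- If the two integers differed, `B (suc m)` would be bounded by a multiple of `B m`, against
  -- `B-grows`.
  approx-unique : ∀ {F m v w} → Approx F v (suc m) → Approx F w (suc m) → v ≡ w
  approx-unique {F} {m} {v} {w} (A , p) (C , q) with ∣ v ℤ.- w ∣ in eq
  ... | zero  = ℤ.i-j≡0⇒i≡j v w (ℤ.∣i∣≡0⇒i≡0 eq)
  ... | suc n = contradiction (B-grows m (A ℕ.+ C) k ℕ.≤-refl) (ℕ.≤⇒≯ (begin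
    B (suc m) k                                         ≤⟨ ℕ.m≤n*m (B (suc m) k) (suc n) ⟩
    suc n ℕ.* B (suc m) k                               ≡⟨ cong (ℕ._* B (suc m) k) eq ⟨
    ∣ v ℤ.- w ∣ ℕ.* B (suc m) k                         ≡⟨ ℤ.∣i*j∣≡∣i∣*∣j∣ (v ℤ.- w) (+ B (suc m) k) ⟨
    ∣ (v ℤ.- w) ℤ.* + B (suc m) k ∣                     ≡⟨ cong ∣_∣ (lem (F k) v w (+ B (suc m) k)) ⟩
    ∣ (F k ℤ.- w ℤ.* + B (suc m) k) ℤ.- (F k ℤ.- v ℤ.* + B (suc m) k) ∣
      ≤⟨ ℤ.∣i-j∣≤∣i∣+∣j∣ (F k ℤ.- w ℤ.* + B (suc m) k) _ ⟩
    ∣ F k ℤ.- w ℤ.* + B (suc m) k ∣ ℕ.+ ∣ F k ℤ.- v ℤ.* + B (suc m) k ∣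
      ≤⟨ ℕ.+-mono-≤ (q k) (p k) ⟩
    C ℕ.* B m k ℕ.+ A ℕ.* B m k                         ≡⟨ ℕ.+-comm (C ℕ.* B m k) _ ⟩
    A ℕ.* B m k ℕ.+ C ℕ.* B m k                         ≡⟨ ℕ.*-distribʳ-+ (B m k) A C ⟨
    (A ℕ.+ C) ℕ.* B m k ∎))
    where
    open ℕ.≤-Reasoning
    k = (A ℕ.+ C) ℕ.* suc m
    lem : ∀ f v w b → (v ℤ.- w) ℤ.* b ≡ (f ℤ.- w ℤ.* b) ℤ.- (f ℤ.- v ℤ.* b)
    lem = ℤSolver.solve-∀

  -- Linear relations between volumes are obtained from this by cutting the same generators in two
  -- ways. The argument in `V` is the offset at which the two are compared.
  vol-unique : V → ∀ {φ g M v w} → HasVol φ (g ∷ M) v → HasVol φ (g ∷ M) w → v ≡ w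
  vol-unique o p q = approx-unique (at p o) (at q o)

  delay-bound : ∀ d {f x} k → (∀ j → j < k → f j ≤ x) → delay (suc d) f k ≤ x
  delay-bound zero    zero    h = z≤n
  delay-bound zero    (suc k) h = h k ℕ.≤-refl
  delay-bound (suc d) zero    h = z≤n
  delay-bound (suc d) (suc k) h = delay-bound d k λ j j<k → h j (ℕ.m<n⇒m<1+n j<k)

  B-mono : ∀ m {j k} → j ≤ k → B m j ≤ B m k
  B-mono m {k = zero}  z≤n = ℕ.≤-refl
  B-mono m {j} {suc k} le with ℕ.m≤n⇒m<n∨m≡n le
  ... | inj₁ (s≤s j≤k) = ℕ.≤-trans (B-mono m j≤k) (B-suc m k)
  ... | inj₂ refl      = ℕ.≤-refl

  -- Each step of a ray spends degree at least 1, so summing along it raises the order of growth by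
  -- at most one.
  ray-B : ∀ g ψ c m → (∀ k o → ψ k o ≤ c ℕ.* B m k) → ∀ k o → ray g ψ k o ≤ c ℕ.* B (suc m) k
  ray-B g ψ c m h k = <-rec (λ k → ∀ o → ray g ψ k o ≤ c ℕ.* B (suc m) k) step k
    where
    open ℕ.≤-Reasoning
    step : ∀ k → (∀ {j} → j < k → ∀ o → ray g ψ j o ≤ c ℕ.* B (suc m) j) → ∀ o → ray g ψ k o ≤ c ℕ.* B (suc m) k
    step zero    rec o = begin
      ray g ψ 0 o             ≡⟨ ray-unfold g ψ 0 o ⟩
      ψ 0 o ℕ.+ 0             ≡⟨ ℕ.+-identityʳ _ ⟩
      ψ 0 o                   ≤⟨ h 0 o ⟩
      c ℕ.* B m 0 ∎
    step (suc k) rec o = begin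
      ray g ψ (suc k) o                                 ≡⟨ ray-unfold g ψ (suc k) o ⟩
      ψ (suc k) o ℕ.+ shift g (ray g ψ) (suc k) o       ≤⟨ ℕ.+-mono-≤ (h (suc k) o) (delay-bound (d g) (suc k)
          λ j j<k → ℕ.≤-trans (rec j<k _) (ℕ.*-monoʳ-≤ c (B-mono (suc m) (ℕ.≤-pred j<k)))) ⟩
      c ℕ.* B m (suc k) ℕ.+ c ℕ.* B (suc m) k           ≡⟨ ℕ.+-comm (c ℕ.* B m (suc k)) _ ⟩
      c ℕ.* B (suc m) k ℕ.+ c ℕ.* B m (suc k)           ≡⟨ ℕ.*-distribˡ-+ c (B (suc m) k) _ ⟨
      c ℕ.* B (suc m) (suc k) ∎

  count-B : ∀ ψ c M → (∀ k o → ψ k o ≤ c) → ∀ k o → count ψ M k o ≤ c ℕ.* B (length M) k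
  count-B ψ c []      h k o = ℕ.≤-trans (h k o) (ℕ.≤-reflexive (sym (ℕ.*-identityʳ c)))
  count-B ψ c (g ∷ M) h = ray-B g (count ψ M) c (length M) (count-B ψ c M h)

  -- `P` is an invariant of the walk, so only reachable points have to be compared.
  ray-mono : ∀ (P : V → Set) g {ψ χ} → (∀ {y} → P y → P (y ⊹ v g)) →
             (∀ k y → P y → ψ k y ≤ χ k y) → ∀ k y → P y → ray g ψ k y ≤ ray g χ k y
  ray-mono P g {ψ} {χ} cl h k = <-rec (λ k → ∀ y → P y → ray g ψ k y ≤ ray g χ k y) step k
    where
    step : ∀ k → (∀ {j} → j < k → ∀ y → P y → ray g ψ j y ≤ ray g χ j y) → ∀ y → P y → ray g ψ k y ≤ ray g χ k y
    step k rec y py = subst₂ _≤_ (sym (ray-unfold g ψ k y)) (sym (ray-unfold g χ k y))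
      (ℕ.+-mono-≤ (h k y py) (delay-≤ (d g) k λ j j<k → rec j<k _ (cl py)))

  count-mono : ∀ (P : V → Set) M {ψ χ} → All (λ g → ∀ {y} → P y → P (y ⊹ v g)) M →
               (∀ k y → P y → ψ k y ≤ χ k y) → ∀ k y → P y → count ψ M k y ≤ count χ M k y
  count-mono P []      []         h = h
  count-mono P (g ∷ M) (cl ∷ cls) h = ray-mono P g cl (count-mono P M cls h)

  -- ω is negligible: its count is of lower order.
  Small : (V → ℕ) → List Gen → V → Set
  Small ω M o = ∃[ C ] ∀ k → cnt ω M k o ≤ C ℕ.* B (pred (length M)) k

  small-+ : ∀ {ω ω′ M o} → Small ω M o → Small ω′ M o → Small (λ y → ω y ℕ.+ ω′ y) M o
  small-+ {ω} {ω′} {M} {o} (A ,, p) (C ,, q) = A ℕ.+ C ,, λ k → subst₂ _≤_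
    (sym (count-+ (constant ω) (constant ω′) M k o)) (sym (ℕ.*-distribʳ-+ (B (pred (length M)) k) A C))
    (ℕ.+-mono-≤ (p k) (q k))

  -- The slab around a bounding hyperplane inside which events may be altered freely.
  window : ℕ → (V → ℤ) → V → ℕ
  window C λ′ y = if ∣ λ′ y ∣ ℕ.≤ᵇ C then 1 else 0

  window-≤1 : ∀ C λ′ y → window C λ′ y ≤ 1
  window-≤1 C λ′ y with ∣ λ′ y ∣ ℕ.≤ᵇ C
  ... | true  = ℕ.≤-refl
  ... | false = z≤n

  window-out : ∀ C λ′ y → C < ∣ λ′ y ∣ → window C λ′ y ≡ 0
  window-out C λ′ y lt with ∣ λ′ y ∣ ℕ.≤ᵇ C in eq
  ... | false = refl
  ... | true  = contradiction (ℕ.≤ᵇ⇒≤ ∣ λ′ y ∣ C (subst T (sym eq) tt)) (ℕ.<⇒≱ lt)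

  window-in : ∀ C λ′ y → ∣ λ′ y ∣ ≤ C → window C λ′ y ≡ 1
  window-in C λ′ y le with ∣ λ′ y ∣ ℕ.≤ᵇ C in eq
  ... | true  = refl
  ... | false = contradiction (subst T eq (ℕ.≤⇒≤ᵇ le)) (λ ())

-- Negligible windows, and generators that do not move

module FlatVolumes (V : Set) (_⊹_ : V → V → V)
  (exchange : ∀ o a b → (o ⊹ a) ⊹ b ≡ (o ⊹ b) ⊹ a)
  (assoc    : ∀ o a b → (o ⊹ a) ⊹ b ≡ o ⊹ (a ⊹ b)) where

  open import Relation.Binary.PropositionalEquality
  open import Data.Nat.Base as ℕ using (ℕ; zero; suc; _≤_; _<_; s≤s; pred)
  import Data.Nat.Properties as ℕ
  open import Data.Nat.Induction using (<-rec)
  open import Data.Integer.Base as ℤ using (ℤ; +_; ∣_∣)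
  import Data.Integer.Properties as ℤ
  import Data.Nat.Tactic.RingSolver as ℕSolver
  import Data.Integer.Tactic.RingSolver as ℤSolver
  open import Data.List.Base using (List; []; _∷_; length)
  open import Data.List.Relation.Unary.All using (All; []; _∷_)
  open import Data.List.Relation.Unary.Any using (Any; here; there)
  open import Data.Product.Base using (∃-syntax; _×_; proj₁; proj₂) renaming (_,_ to _,,_)
  open import Data.Sum.Base using (_⊎_; inj₁; inj₂)
  open import Relation.Nullary using (yes; no; contradiction)
  open import Relation.Binary.Definitions using (tri<; tri≈; tri>)
  open Binomials
  open Volumes V _⊹_ exchange assoc public

  private module Window (λ′ : V → ℤ) (λ-+ : ∀ a b → λ′ (a ⊹ b) ≡ λ′ a ℤ.+ λ′ b) (C : ℕ) where
    ω : V → ℕ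
    ω = window C λ′

    module Up (g : Gen) (pos : + 1 ℤ.≤ λ′ (v g)) where
      next : ∀ y → λ′ y ℤ.+ + 1 ℤ.≤ λ′ (y ⊹ v g)
      next y = subst (λ′ y ℤ.+ + 1 ℤ.≤_) (sym (λ-+ y (v g))) (ℤ.+-monoʳ-≤ (λ′ y) pos)

      -- Each step along `g` raises `λ′` by at least 1, so after `n` steps the walk has left the
      -- window upwards for good.
      above : ∀ k y n → + C ℤ.< λ′ y ℤ.+ + n → ray g (constant ω) k y ≤ n
      above k = <-rec (λ k → ∀ y n → + C ℤ.< λ′ y ℤ.+ + n → ray g (constant ω) k y ≤ n) step k
        where
        step : ∀ k → (∀ {j} → j < k → ∀ y n → + C ℤ.< λ′ y ℤ.+ + n → ray g (constant ω) j y ≤ n) →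
               ∀ y n → + C ℤ.< λ′ y ℤ.+ + n → ray g (constant ω) k y ≤ n
        step k rec y zero    h = subst (_≤ 0) (sym (ray-unfold g (constant ω) k y)) (ℕ.+-mono-≤
          (ℕ.≤-reflexive (window-out C λ′ y (abs h′)))
          (delay-bound (d g) k λ j j<k → rec j<k _ 0 (subst (+ C ℤ.<_) (sym (ℤ.+-identityʳ _))
            (ℤ.<-≤-trans h′ (ℤ.≤-trans (ℤ.i≤i+j (λ′ y) (+ 1)) (next y))))))
          where
          h′ : + C ℤ.< λ′ y
          h′ = subst (+ C ℤ.<_) (ℤ.+-identityʳ _) h
          abs : ∀ {z} → + C ℤ.< z → C < ∣ z ∣
          abs (ℤ.+<+ lt) = lt
        step k rec y (suc n) h = subst (_≤ suc n) (sym (ray-unfold g (constant ω) k y)) (ℕ.+-mono-≤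
          (window-≤1 C λ′ y)
          (delay-bound (d g) k λ j j<k → rec j<k _ n (ℤ.<-≤-trans h
            (subst (ℤ._≤ λ′ (y ⊹ v g) ℤ.+ + n) (ℤ.+-assoc (λ′ y) (+ 1) (+ n)) (ℤ.+-monoˡ-≤ (+ n) (next y))))))

      bound : ∀ k y → ray g (constant ω) k y ≤ suc (C ℕ.+ C)
      bound k = <-rec (λ k → ∀ y → ray g (constant ω) k y ≤ suc (C ℕ.+ C)) step k
        where
        step : ∀ k → (∀ {j} → j < k → ∀ y → ray g (constant ω) j y ≤ suc (C ℕ.+ C)) →
               ∀ y → ray g (constant ω) k y ≤ suc (C ℕ.+ C)
        -- Below the window nothing is counted and the walk goes on. From -C upwards there are only
        -- 2C + 1 levels to pass.
        step k rec y with λ′ y ℤ.+ + C ℤ.<? + 0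
        ... | yes low = subst (_≤ suc (C ℕ.+ C)) (sym (ray-unfold g (constant ω) k y)) (ℕ.+-mono-≤
          (ℕ.≤-reflexive (window-out C λ′ y (out (λ′ y) low))) (delay-bound (d g) k λ j j<k → rec j<k _))
          where
          out : ∀ z → z ℤ.+ + C ℤ.< + 0 → C < ∣ z ∣
          out z lt = subst (C <_) (ℤ.∣-i∣≡∣i∣ z) (abs (ℤ.- z)
            (subst₂ ℤ._<_ (lem z (+ C)) (ℤ.+-identityˡ (ℤ.- z)) (ℤ.+-monoˡ-< (ℤ.- z) lt)))
            where
            lem : ∀ z c → z ℤ.+ c ℤ.- z ≡ c
            lem = ℤSolver.solve-∀
            abs : ∀ z → + C ℤ.< z → C < ∣ z ∣
            abs _ (ℤ.+<+ lt) = lt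
        ... | no ¬low = above k y (suc (C ℕ.+ C)) (ℤ.<-≤-trans (ℤ.+<+ (ℕ.n<1+n C))
            (subst (+ suc C ℤ.≤_) (lem (λ′ y) (+ C)) (ℤ.+-monoˡ-≤ (+ suc C) (ℤ.≮⇒≥ ¬low))))
          where
          lem : ∀ z c → z ℤ.+ c ℤ.+ (+ 1 ℤ.+ c) ≡ z ℤ.+ (+ 1 ℤ.+ (c ℤ.+ c))
          lem = ℤSolver.solve-∀

  window-neg : ∀ C λ′ y → window C (λ y → ℤ.- λ′ y) y ≡ window C λ′ y
  window-neg C λ′ y rewrite ℤ.∣-i∣≡∣i∣ (λ′ y) = refl

  window-ray : ∀ λ′ (λ-+ : ∀ a b → λ′ (a ⊹ b) ≡ λ′ a ℤ.+ λ′ b) C g → λ′ (v g) ≢ + 0 →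
               ∀ k y → ray g (constant (window C λ′)) k y ≤ suc (C ℕ.+ C)
  window-ray λ′ λ-+ C g ≢0 k y with ℤ.<-cmp (+ 0) (λ′ (v g))
  ... | tri< 0< _ _ = Window.Up.bound λ′ λ-+ C g (ℤ.i<j⇒suc[i]≤j 0<) k y
  ... | tri≈ _ 0≡ _ = contradiction (sym 0≡) ≢0
  ... | tri> _ _ <0 = subst (_≤ _) (ray-cong g (λ _ → window-neg C λ′) k y)
    (Window.Up.bound (λ y → ℤ.- λ′ y) (λ a b → trans (cong ℤ.-_ (λ-+ a b)) (ℤ.neg-distrib-+ (λ′ a) (λ′ b))) C g
      (ℤ.i<j⇒suc[i]≤j (ℤ.neg-mono-< <0)) k y)

  -- One generator transversal to the window suffices: its ray meets the window a bounded number of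
  -- times, and each other generator adds one order of growth.
  small-window : ∀ λ′ (λ-+ : ∀ a b → λ′ (a ⊹ b) ≡ λ′ a ℤ.+ λ′ b) C {M} →
                 Any (λ g → λ′ (v g) ≢ + 0) M → ∀ o → Small (window C λ′) M o
  small-window λ′ λ-+ C p o = suc (C ℕ.+ C) ,, λ k → go p k o
    where
    ω = window C λ′
    go : ∀ {M} → Any (λ g → λ′ (v g) ≢ + 0) M → ∀ k o → cnt ω M k o ≤ suc (C ℕ.+ C) ℕ.* B (pred (length M)) k
    go {g ∷ M} (here ≢0) k o = subst (_≤ suc (C ℕ.+ C) ℕ.* B (length M) k) (count-ray g (constant ω) M k o)
      (count-B (ray g (constant ω)) (suc (C ℕ.+ C)) M (window-ray λ′ λ-+ C g ≢0) k o)
    go {g ∷ g′ ∷ M} (there p) k o = ray-B g (cnt ω (g′ ∷ M)) (suc (C ℕ.+ C)) (length M) (go p) k o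

  Close : (φ χ : V → ℕ) → List Gen → Set
  Close φ χ M = ∀ o → ∃[ C ] ∀ k →
    cnt φ M k o ≤ cnt χ M k o ℕ.+ C ℕ.* B (pred (length M)) k ×
    cnt χ M k o ≤ cnt φ M k o ℕ.+ C ℕ.* B (pred (length M)) k

  ∣+-+∣≤ : ∀ {a b c} → a ≤ b ℕ.+ c → b ≤ a ℕ.+ c → ∣ + a ℤ.- + b ∣ ≤ c
  ∣+-+∣≤ {a} {b} {c} p q with ℕ.≤-total a b
  ... | inj₁ a≤b = subst (_≤ c) (sym (trans (cong ∣_∣ (ℤ.m-n≡m⊖n a b)) (ℤ.∣⊖∣-≤ a≤b))) (ℕ.m≤n+o⇒m∸n≤o b a q)
  ... | inj₂ b≤a = subst (_≤ c) (sym (trans (cong ∣_∣ (ℤ.m-n≡m⊖n a b)) (trans (ℤ.∣m⊖n∣≡∣n⊖m∣ a b) (ℤ.∣⊖∣-≤ b≤a))))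
    (ℕ.m≤n+o⇒m∸n≤o a b p)

  vol-close : ∀ {φ χ M w} → Close φ χ M → HasVol χ M w → HasVol φ M w
  vol-close {φ} {χ} {M} {w} cl h .at o = approx-perturb (n ℕ.* C) bound (at h o)
    where
    n = scale (length M)
    C = proj₁ (cl o)
    scaled : ∀ {x y} z → x ≤ y ℕ.+ C ℕ.* z → n ℕ.* x ≤ n ℕ.* y ℕ.+ n ℕ.* C ℕ.* z
    scaled {x} {y} z le = subst (n ℕ.* x ≤_) (lem n y C z) (ℕ.*-monoʳ-≤ n le)
      where
      lem : ∀ n y c z → n ℕ.* (y ℕ.+ c ℕ.* z) ≡ n ℕ.* y ℕ.+ n ℕ.* c ℕ.* z
      lem = ℕSolver.solve-∀
    bound : ∀ k → ∣ + (n ℕ.* cnt φ M k o) ℤ.- + (n ℕ.* cnt χ M k o) ∣ ≤ n ℕ.* C ℕ.* B (pred (length M)) k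
    bound k = ∣+-+∣≤ (scaled (B (pred (length M)) k) (proj₁ (proj₂ (cl o) k)))
                     (scaled (B (pred (length M)) k) (proj₂ (proj₂ (cl o) k)))

  -- A walk from `o` stays in `P o`; there `φ` and `χ` differ by at most the negligible `ω`.
  close : ∀ {φ χ M} (P : V → V → Set) → (∀ {o} → P o o) →
          (∀ {o} → All (λ g → ∀ {y} → P o y → P o (y ⊹ v g)) M) →
          (∀ o → ∃[ ω ] Small ω M o × (∀ y → P o y → φ y ≤ χ y ℕ.+ ω y × χ y ≤ φ y ℕ.+ ω y)) →
          Close φ χ M
  close {φ} {χ} {M} P Poo cl h o with h o
  ... | ω ,, (C ,, small) ,, le = C ,, λ k → bound φ χ (λ y p → proj₁ (le y p)) k , bound χ φ (λ y p → proj₂ (le y p)) k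
    where
    open import Data.Product.Base using (_,_)
    bound : ∀ α β → (∀ y → P o y → α y ≤ β y ℕ.+ ω y) → ∀ k →
            cnt α M k o ≤ cnt β M k o ℕ.+ C ℕ.* B (pred (length M)) k
    bound α β le k = ℕ.≤-trans (count-mono (P o) M cl (λ _ → le) k o Poo)
      (subst (_≤ _) (sym (count-+ (constant β) (constant ω) M k o)) (ℕ.+-monoʳ-≤ (cnt β M k o) (small k)))

  Σ≤ : (ℕ → ℕ) → ℕ → ℕ
  Σ≤ f zero    = f 0
  Σ≤ f (suc k) = Σ≤ f k ℕ.+ f (suc k)

  B-Σ : ∀ m k → B (suc m) k ≡ Σ≤ (B m) k
  B-Σ m zero    = refl
  B-Σ m (suc k) = cong (ℕ._+ B m (suc k)) (B-Σ m k)

  delay-< : ∀ d {f : ℕ → ℕ} k → k < d → delay d f k ≡ 0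
  delay-< (suc d) zero    lt       = refl
  delay-< (suc d) (suc k) (s≤s lt) = delay-< d k lt

  delay-+ʳ : ∀ d {f : ℕ → ℕ} k → delay d f (d ℕ.+ k) ≡ f k
  delay-+ʳ zero    k = refl
  delay-+ʳ (suc d) k = delay-+ʳ d k

  module _ {f : ℕ → ℕ} (mono : ∀ {j k} → j ≤ k → f j ≤ f k) where

    Σ≤-upper : ∀ k → Σ≤ f k ≤ suc k ℕ.* f k
    Σ≤-upper zero    = ℕ.m≤m+n (f 0) 0
    Σ≤-upper (suc k) = subst (Σ≤ f (suc k) ≤_) (ℕ.+-comm (suc k ℕ.* f (suc k)) (f (suc k)))
      (ℕ.+-monoˡ-≤ (f (suc k)) (ℕ.≤-trans (Σ≤-upper k) (ℕ.*-monoʳ-≤ (suc k) (mono (ℕ.n≤1+n k)))))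

    Σ≤-block-upper : ∀ d k → Σ≤ f (d ℕ.+ k) ≤ Σ≤ f k ℕ.+ d ℕ.* f (d ℕ.+ k)
    Σ≤-block-upper zero    k = ℕ.m≤m+n _ 0
    Σ≤-block-upper (suc d) k = begin
      Σ≤ f (d ℕ.+ k) ℕ.+ f (suc d ℕ.+ k)
        ≤⟨ ℕ.+-monoˡ-≤ _ (ℕ.≤-trans (Σ≤-block-upper d k)
             (ℕ.+-monoʳ-≤ (Σ≤ f k) (ℕ.*-monoʳ-≤ d (mono (ℕ.n≤1+n (d ℕ.+ k)))))) ⟩
      Σ≤ f k ℕ.+ d ℕ.* f (suc d ℕ.+ k) ℕ.+ f (suc d ℕ.+ k)
        ≡⟨ lem (Σ≤ f k) d (f (suc d ℕ.+ k)) ⟩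
      Σ≤ f k ℕ.+ suc d ℕ.* f (suc d ℕ.+ k) ∎
      where
      open ℕ.≤-Reasoning
      lem : ∀ s d x → s ℕ.+ d ℕ.* x ℕ.+ x ≡ s ℕ.+ (x ℕ.+ d ℕ.* x)
      lem = ℕSolver.solve-∀

    Σ≤-block-lower : ∀ d k → Σ≤ f k ℕ.+ d ℕ.* f k ≤ Σ≤ f (d ℕ.+ k)
    Σ≤-block-lower zero    k = ℕ.≤-reflexive (ℕ.+-identityʳ _)
    Σ≤-block-lower (suc d) k = begin
      Σ≤ f k ℕ.+ (f k ℕ.+ d ℕ.* f k)  ≡⟨ lem (Σ≤ f k) (f k) (d ℕ.* f k) ⟩
      Σ≤ f k ℕ.+ d ℕ.* f k ℕ.+ f k    ≤⟨ ℕ.+-mono-≤ (Σ≤-block-lower d k) (mono (ℕ.m≤n+m k (suc d))) ⟩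
      Σ≤ f (d ℕ.+ k) ℕ.+ f (suc d ℕ.+ k) ∎
      where
      open ℕ.≤-Reasoning
      lem : ∀ s x y → s ℕ.+ (x ℕ.+ y) ≡ s ℕ.+ y ℕ.+ x
      lem = ℕSolver.solve-∀

    module _ d {F : ℕ → ℕ} (comb : ∀ k → F k ≡ f k ℕ.+ delay (suc d) F k) where

      -- `F` sums `f` over one residue class modulo `suc d`. As `f` is monotone, each term
      -- represents a block of `suc d` consecutive terms, up to one block at the end.
      comb-lower : ∀ k → Σ≤ f k ≤ suc d ℕ.* F k
      comb-upper : ∀ k → suc d ℕ.* F k ≤ Σ≤ f k ℕ.+ suc d ℕ.* f k
      private
        cases : ∀ k → k < suc d ⊎ ∃[ j ] k ≡ suc d ℕ.+ j
        cases k with k ℕ.<? suc d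
        ... | yes p = inj₁ p
        ... | no ¬p = inj₂ (k ℕ.∸ suc d ,, sym (ℕ.m+[n∸m]≡n (ℕ.≮⇒≥ ¬p)))
        F-< : ∀ {k} → k < suc d → F k ≡ f k
        F-< {k} lt = trans (comb k) (trans (cong (f k ℕ.+_) (delay-< (suc d) k lt)) (ℕ.+-identityʳ _))
        F-+ : ∀ j → F (suc d ℕ.+ j) ≡ f (suc d ℕ.+ j) ℕ.+ F j
        F-+ j = trans (comb (suc d ℕ.+ j)) (cong (f (suc d ℕ.+ j) ℕ.+_) (delay-+ʳ (suc d) j))
      comb-lower = <-rec (λ k → Σ≤ f k ≤ suc d ℕ.* F k) step
        where
        step : ∀ k → (∀ {j} → j < k → Σ≤ f j ≤ suc d ℕ.* F j) → Σ≤ f k ≤ suc d ℕ.* F k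
        step k rec with cases k
        ... | inj₁ lt = ℕ.≤-trans (Σ≤-upper k) (subst (λ x → suc k ℕ.* f k ≤ suc d ℕ.* x) (sym (F-< lt))
                          (ℕ.*-monoˡ-≤ (f k) lt))
        ... | inj₂ (j ,, refl) = begin
          Σ≤ f (suc d ℕ.+ j)                                ≤⟨ Σ≤-block-upper (suc d) j ⟩
          Σ≤ f j ℕ.+ suc d ℕ.* f (suc d ℕ.+ j)              ≤⟨ ℕ.+-monoˡ-≤ _ (rec (s≤s (ℕ.m≤n+m j d))) ⟩
          suc d ℕ.* F j ℕ.+ suc d ℕ.* f (suc d ℕ.+ j)       ≡⟨ ℕ.+-comm (suc d ℕ.* F j) _ ⟩
          suc d ℕ.* f (suc d ℕ.+ j) ℕ.+ suc d ℕ.* F j       ≡⟨ ℕ.*-distribˡ-+ (suc d) (f (suc d ℕ.+ j)) (F j) ⟨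
          suc d ℕ.* (f (suc d ℕ.+ j) ℕ.+ F j)               ≡⟨ cong (suc d ℕ.*_) (F-+ j) ⟨
          suc d ℕ.* F (suc d ℕ.+ j) ∎
          where open ℕ.≤-Reasoning
      comb-upper = <-rec (λ k → suc d ℕ.* F k ≤ Σ≤ f k ℕ.+ suc d ℕ.* f k) step
        where
        step : ∀ k → (∀ {j} → j < k → suc d ℕ.* F j ≤ Σ≤ f j ℕ.+ suc d ℕ.* f j) →
               suc d ℕ.* F k ≤ Σ≤ f k ℕ.+ suc d ℕ.* f k
        step k rec with cases k
        ... | inj₁ lt = subst (λ x → suc d ℕ.* x ≤ Σ≤ f k ℕ.+ suc d ℕ.* f k) (sym (F-< lt)) (ℕ.m≤n+m _ (Σ≤ f k))
        ... | inj₂ (j ,, refl) = begin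
          suc d ℕ.* F (suc d ℕ.+ j)                         ≡⟨ cong (suc d ℕ.*_) (F-+ j) ⟩
          suc d ℕ.* (f (suc d ℕ.+ j) ℕ.+ F j)               ≡⟨ ℕ.*-distribˡ-+ (suc d) (f (suc d ℕ.+ j)) (F j) ⟩
          suc d ℕ.* f (suc d ℕ.+ j) ℕ.+ suc d ℕ.* F j       ≤⟨ ℕ.+-monoʳ-≤ (suc d ℕ.* f (suc d ℕ.+ j)) (ℕ.≤-trans (rec (s≤s (ℕ.m≤n+m j d)))
                                                                (Σ≤-block-lower (suc d) j)) ⟩
          suc d ℕ.* f (suc d ℕ.+ j) ℕ.+ Σ≤ f (suc d ℕ.+ j)  ≡⟨ ℕ.+-comm (suc d ℕ.* f (suc d ℕ.+ j)) _ ⟩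
          Σ≤ f (suc d ℕ.+ j) ℕ.+ suc d ℕ.* f (suc d ℕ.+ j) ∎
          where open ℕ.≤-Reasoning

      comb-close : ∀ c w k → ∣ + c ℤ.* w ℤ.* + (suc d ℕ.* F k) ℤ.- + c ℤ.* w ℤ.* + Σ≤ f k ∣ ≤ c ℕ.* ∣ w ∣ ℕ.* suc d ℕ.* f k
      comb-close c w k = begin
        ∣ + c ℤ.* w ℤ.* + (suc d ℕ.* F k) ℤ.- + c ℤ.* w ℤ.* + Σ≤ f k ∣
          ≡⟨ cong ∣_∣ (lem (+ c) w (+ (suc d ℕ.* F k)) (+ Σ≤ f k)) ⟩
        ∣ + c ℤ.* w ℤ.* (+ (suc d ℕ.* F k) ℤ.- + Σ≤ f k) ∣
          ≡⟨ trans (ℤ.∣i*j∣≡∣i∣*∣j∣ (+ c ℤ.* w) _) (cong (ℕ._* _) (ℤ.∣i*j∣≡∣i∣*∣j∣ (+ c) w)) ⟩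
        c ℕ.* ∣ w ∣ ℕ.* ∣ + (suc d ℕ.* F k) ℤ.- + Σ≤ f k ∣
          ≤⟨ ℕ.*-monoʳ-≤ (c ℕ.* ∣ w ∣) (∣+-+∣≤ (comb-upper k)
               (ℕ.≤-trans (comb-lower k) (ℕ.m≤m+n _ _))) ⟩
        c ℕ.* ∣ w ∣ ℕ.* (suc d ℕ.* f k)   ≡⟨ ℕ.*-assoc (c ℕ.* ∣ w ∣) (suc d) (f k) ⟨
        c ℕ.* ∣ w ∣ ℕ.* suc d ℕ.* f k ∎
        where
        open ℕ.≤-Reasoning
        lem : ∀ c w x y → c ℤ.* w ℤ.* x ℤ.- c ℤ.* w ℤ.* y ≡ c ℤ.* w ℤ.* (x ℤ.- y)
        lem = ℤSolver.solve-∀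

  open import Data.Unit.Base using (⊤; tt)
  private
    module Top = Volumes ⊤ (λ _ _ → tt) (λ _ _ _ → refl) (λ _ _ _ → refl)

  -- A ray over a one-point space of offsets is the sum of `f` at `k`, k - (d + 1), k - 2 (d + 1),
  -- and so on.
  progression : ℕ → (ℕ → ℕ) → ℕ → ℕ
  progression d f k = Top.ray (Top.gen d tt) (λ j _ → f j) k tt

  progression-unfold : ∀ d f k → progression d f k ≡ f k ℕ.+ delay (suc d) (progression d f) k
  progression-unfold d f k = Top.ray-unfold (Top.gen d tt) (λ j _ → f j) k tt

  progression-≤ : ∀ d m c k → progression d (λ j → c ℕ.* B m j) k ≤ c ℕ.* B (suc m) k
  progression-≤ d m c k = Top.ray-B (Top.gen d tt) (λ j _ → c ℕ.* B m j) c m (λ _ _ → ℕ.≤-refl) k tt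

  module _ (g : Gen) {ψ : Seq} (flat : ∀ k o → ψ k (o ⊹ v g) ≡ ψ k o) where

    ray-flat : ∀ k o → ray g ψ k (o ⊹ v g) ≡ ray g ψ k o
    ray-flat k o = ray-unique g ψ (λ k o → trans (ray-unfold g ψ k (o ⊹ v g))
      (cong (ℕ._+ shift g (ray g ψ) k (o ⊹ v g)) (flat k o))) k o

    ray-comb : ∀ o k → ray g ψ k o ≡ ψ k o ℕ.+ delay (deg g) (λ j → ray g ψ j o) k
    ray-comb o k = trans (ray-unfold g ψ k o) (cong (ψ k o ℕ.+_) (delay-ext (deg g) k λ j → ray-flat j o))

  -- A generator that leaves the count unchanged only spends degree, so the count is summed along a
  -- progression with difference `deg g`. This is asymptotically the full sum divided by `deg g`,
  -- and the full sum of `B m` is `B (suc m)`. Together with the additional scale 48 the factor is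
  -- 48 / `deg g`.
  vol-flat : ∀ {φ g h M w} c → c ℕ.* deg g ≡ 48 → (∀ k o → cnt φ (h ∷ M) k (o ⊹ v g) ≡ cnt φ (h ∷ M) k o) →
             HasVol φ (h ∷ M) w → HasVol φ (g ∷ h ∷ M) (+ c ℤ.* w)
  vol-flat {φ} {g} {h} {M} {w} c c*d flat p .at o = 48 ℕ.* A ℕ.+ c ℕ.* ∣ w ∣ ℕ.* deg g , λ k → begin
      ∣ + (scale (suc m) ℕ.* F k) ℤ.- + c ℤ.* w ℤ.* + B (suc m) k ∣
        ≡⟨ cong ∣_∣ (trans (cong₂ (λ x y → + x ℤ.- + c ℤ.* w ℤ.* + y)
              (trans (cong (ℕ._* F k) (scale-suc m)) (ℕ.*-assoc 48 (scale m) (F k))) (B-Σ m k))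
            (trans (cong (ℤ._- + c ℤ.* w ℤ.* + Σ≤ (B m) k) (ℤ.pos-* 48 (scale m ℕ.* F k)))
            (trans (lem (+ 48) (+ (scale m ℕ.* F k)) w (+ P k) (+ c ℤ.* w ℤ.* + Σ≤ (B m) k))
            (cong (λ x → + 48 ℤ.* (+ (scale m ℕ.* F k) ℤ.- w ℤ.* + P k) ℤ.+ (x ℤ.- + c ℤ.* w ℤ.* + Σ≤ (B m) k)) (main k))))) ⟩
      ∣ + 48 ℤ.* (+ (scale m ℕ.* F k) ℤ.- w ℤ.* + P k) ℤ.+
        (+ c ℤ.* w ℤ.* + (deg g ℕ.* P k) ℤ.- + c ℤ.* w ℤ.* + Σ≤ (B m) k) ∣
        ≤⟨ ℤ.∣i+j∣≤∣i∣+∣j∣ (+ 48 ℤ.* (+ (scale m ℕ.* F k) ℤ.- w ℤ.* + P k)) _ ⟩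
      ∣ + 48 ℤ.* (+ (scale m ℕ.* F k) ℤ.- w ℤ.* + P k) ∣ ℕ.+
        ∣ + c ℤ.* w ℤ.* + (deg g ℕ.* P k) ℤ.- + c ℤ.* w ℤ.* + Σ≤ (B m) k ∣
        ≤⟨ ℕ.+-mono-≤ (subst (_≤ 48 ℕ.* (A ℕ.* B m k)) (sym (ℤ.∣i*j∣≡∣i∣*∣j∣ (+ 48) (+ (scale m ℕ.* F k) ℤ.- w ℤ.* + P k)))
             (ℕ.*-monoʳ-≤ 48 (error k)))
           (comb-close (λ {j} {k} → B-mono m {j} {k}) (d g) (progression-unfold (d g) (B m)) c w k) ⟩
      48 ℕ.* (A ℕ.* B m k) ℕ.+ c ℕ.* ∣ w ∣ ℕ.* deg g ℕ.* B m k
        ≡⟨ cong (ℕ._+ c ℕ.* ∣ w ∣ ℕ.* deg g ℕ.* B m k) (sym (ℕ.*-assoc 48 A (B m k))) ⟩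
      48 ℕ.* A ℕ.* B m k ℕ.+ c ℕ.* ∣ w ∣ ℕ.* deg g ℕ.* B m k
        ≡⟨ ℕ.*-distribʳ-+ (B m k) (48 ℕ.* A) (c ℕ.* ∣ w ∣ ℕ.* deg g) ⟨
      (48 ℕ.* A ℕ.+ c ℕ.* ∣ w ∣ ℕ.* deg g) ℕ.* B m k ∎
    where
    open ℕ.≤-Reasoning
    m = length (h ∷ M)
    A = Approx.constant (at p o)
    F P : ℕ → ℕ
    F k = cnt φ (g ∷ h ∷ M) k o
    P = progression (d g) (B m)
    lem : ∀ s x w p y → s ℤ.* x ℤ.- y ≡ s ℤ.* (x ℤ.- w ℤ.* p) ℤ.+ (s ℤ.* w ℤ.* p ℤ.- y)
    lem = ℤSolver.solve-∀
    main : ∀ k → + 48 ℤ.* w ℤ.* + P k ≡ + c ℤ.* w ℤ.* + (deg g ℕ.* P k)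
    main k = trans (cong (λ x → + x ℤ.* w ℤ.* + P k) (sym c*d)) (trans
      (cong (λ x → x ℤ.* w ℤ.* + P k) (ℤ.pos-* c (deg g))) (trans
      (re (+ c) (+ deg g) w (+ P k)) (cong (+ c ℤ.* w ℤ.*_) (sym (ℤ.pos-* (deg g) (P k))))))
      where
      re : ∀ c d w p → c ℤ.* d ℤ.* w ℤ.* p ≡ c ℤ.* w ℤ.* (d ℤ.* p)
      re = ℤSolver.solve-∀
    Pε : ℕ → ℕ
    Pε = progression (d g) (λ j → A ℕ.* B (length M) j)
    -- Replacing the count by `w` times the binomial coefficient inside the progression costs the
    -- progression of the individual errors.
    error′ : ∀ k → ∣ + (scale m ℕ.* F k) ℤ.- w ℤ.* + P k ∣ ≤ Pε k
    error′ = <-rec (λ k → ∣ + (scale m ℕ.* F k) ℤ.- w ℤ.* + P k ∣ ≤ Pε k) step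
      where
      f : ℕ → ℕ
      f k = cnt φ (h ∷ M) k o
      delayed : ∀ d k → (∀ j → j < k → ∣ + (scale m ℕ.* F j) ℤ.- w ℤ.* + P j ∣ ≤ Pε j) →
                ∣ + (scale m ℕ.* delay (suc d) F k) ℤ.- w ℤ.* + delay (suc d) P k ∣ ≤ delay (suc d) Pε k
      delayed zero    zero    h = ℕ.≤-reflexive (cong₂ (λ x y → ∣ + x ℤ.- y ∣) (ℕ.*-zeroʳ (scale m)) (ℤ.*-zeroʳ w))
      delayed zero    (suc k) h = h k ℕ.≤-refl
      delayed (suc d) zero    h = ℕ.≤-reflexive (cong₂ (λ x y → ∣ + x ℤ.- y ∣) (ℕ.*-zeroʳ (scale m)) (ℤ.*-zeroʳ w))
      delayed (suc d) (suc k) h = delayed d k λ j j<k → h j (ℕ.m<n⇒m<1+n j<k)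
      step : ∀ k → (∀ {j} → j < k → ∣ + (scale m ℕ.* F j) ℤ.- w ℤ.* + P j ∣ ≤ Pε j) →
             ∣ + (scale m ℕ.* F k) ℤ.- w ℤ.* + P k ∣ ≤ Pε k
      step k rec = begin
        ∣ + (scale m ℕ.* F k) ℤ.- w ℤ.* + P k ∣
          ≡⟨ cong₂ (λ x y → ∣ + (scale m ℕ.* x) ℤ.- w ℤ.* + y ∣) (ray-comb g flat o k) (progression-unfold (d g) (B m) k) ⟩
        ∣ + (scale m ℕ.* (f k ℕ.+ DF)) ℤ.- w ℤ.* + (B m k ℕ.+ DP) ∣
          ≡⟨ cong ∣_∣ (trans (cong₂ (λ x y → x ℤ.- w ℤ.* y)
               (trans (cong +_ (ℕ.*-distribˡ-+ (scale m) (f k) DF)) (ℤ.pos-+ (scale m ℕ.* f k) (scale m ℕ.* DF)))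
               (ℤ.pos-+ (B m k) DP)) (re (+ (scale m ℕ.* f k)) (+ (scale m ℕ.* DF)) w (+ B m k) (+ DP))) ⟩
        ∣ (+ (scale m ℕ.* f k) ℤ.- w ℤ.* + B m k) ℤ.+ (+ (scale m ℕ.* DF) ℤ.- w ℤ.* + DP) ∣
          ≤⟨ ℤ.∣i+j∣≤∣i∣+∣j∣ (+ (scale m ℕ.* f k) ℤ.- w ℤ.* + B m k) _ ⟩
        ∣ + (scale m ℕ.* f k) ℤ.- w ℤ.* + B m k ∣ ℕ.+ ∣ + (scale m ℕ.* DF) ℤ.- w ℤ.* + DP ∣
          ≤⟨ ℕ.+-mono-≤ (Approx.bounded (at p o) k) (delayed (d g) k λ j → rec) ⟩
        A ℕ.* B (length M) k ℕ.+ delay (deg g) Pε k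
          ≡⟨ progression-unfold (d g) (λ j → A ℕ.* B (length M) j) k ⟨
        Pε k ∎
        where
        DF = delay (deg g) F k
        DP = delay (deg g) P k
        re : ∀ x y w b q → x ℤ.+ y ℤ.- w ℤ.* (b ℤ.+ q) ≡ (x ℤ.- w ℤ.* b) ℤ.+ (y ℤ.- w ℤ.* q)
        re = ℤSolver.solve-∀
    error : ∀ k → ∣ + (scale m ℕ.* F k) ℤ.- w ℤ.* + P k ∣ ≤ A ℕ.* B m k
    error k = ℕ.≤-trans (error′ k) (progression-≤ (d g) (length M) A k)

  -- The index is the product of the quotients 48 / `deg g`, the scaled volume when no event
  -- restricts the multisets.
  data Leaf : List Gen → ℕ → Set where
    []  : Leaf [] 1
    _∷_ : ∀ {g M c w} → c ℕ.* deg g ≡ 48 → Leaf M w → Leaf (g ∷ M) (c ℕ.* w)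

  cnt-1-flat : ∀ M x k o → cnt (λ _ → 1) M k (o ⊹ x) ≡ cnt (λ _ → 1) M k o
  cnt-1-flat []      x k o = refl
  cnt-1-flat (g ∷ M) x k o = ray-unique g (cnt (λ _ → 1) M) (λ k o → trans
    (ray-unfold g (cnt (λ _ → 1) M) k (o ⊹ x))
    (cong₂ ℕ._+_ (cnt-1-flat M x k o)
      (delay-ext (deg g) k λ j → cong (cnt (λ _ → 1) (g ∷ M) j) (exchange o x (v g))))) k o

  vol-1 : ∀ {g M w} → Leaf (g ∷ M) w → HasVol (λ _ → 1) (g ∷ M) (+ w)
  vol-1 {g} {[]} (_∷_ {c = c} c*d []) .at o = c ℕ.* 1 ℕ.* deg g , λ k → begin
      ∣ + (scale 1 ℕ.* F k) ℤ.- + (c ℕ.* 1) ℤ.* + B 1 k ∣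
        ≡⟨ cong₂ (λ x y → ∣ x ℤ.- y ∣)
             (trans (cong (λ x → + (x ℕ.* F k)) (trans (scale-suc 0) (cong (48 ℕ.*_) scale-0)))
             (trans (cong (λ x → + (x ℕ.* 1 ℕ.* F k)) (sym c*d)) (trans (cong +_ (re c (deg g) (F k)))
             (trans (ℤ.pos-* (c ℕ.* 1) (deg g ℕ.* F k)) (cong (ℤ._* + (deg g ℕ.* F k)) (ℤ.pos-* c 1))))))
             (cong₂ (λ x y → x ℤ.* + y) (ℤ.pos-* c 1) (B-Σ 0 k)) ⟩
      ∣ + c ℤ.* + 1 ℤ.* + (deg g ℕ.* F k) ℤ.- + c ℤ.* + 1 ℤ.* + Σ≤ (B 0) k ∣
        ≤⟨ comb-close (λ _ → ℕ.≤-refl) (d g) (ray-comb g (λ _ _ → refl) o) c (+ 1) k ⟩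
      c ℕ.* 1 ℕ.* deg g ℕ.* 1 ∎
    where
    open ℕ.≤-Reasoning
    F : ℕ → ℕ
    F k = cnt (λ _ → 1) (g ∷ []) k o
    re : ∀ c d x → c ℕ.* d ℕ.* 1 ℕ.* x ≡ c ℕ.* 1 ℕ.* (d ℕ.* x)
    re = ℕSolver.solve-∀
  vol-1 {g} {h ∷ M} (_∷_ {c = c} {w} c*d l) = vol-subst {φ = λ _ → 1} (sym (ℤ.pos-* c w))
    (vol-flat {λ _ → 1} {g} {h} {M} c c*d (λ k o → cnt-1-flat (h ∷ M) (v g) k o) (vol-1 l))

-- Positivity of additive functionals

module Events (V : Set) (_⊹_ : V → V → V)
  (exchange : ∀ o a b → (o ⊹ a) ⊹ b ≡ (o ⊹ b) ⊹ a)
  (assoc    : ∀ o a b → (o ⊹ a) ⊹ b ≡ o ⊹ (a ⊹ b)) where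

  open import Relation.Binary.PropositionalEquality
  open import Data.Nat.Base as ℕ using (ℕ; zero; suc; _≤_; _<_; z≤n; s≤s)
  import Data.Nat.Properties as ℕ
  open import Data.Integer.Base as ℤ using (ℤ; +_; ∣_∣; -[1+_])
  import Data.Integer.Properties as ℤ
  import Data.Integer.Tactic.RingSolver as ℤSolver
  open import Data.List.Base using (List; []; _∷_; length)
  open import Data.List.Relation.Unary.All as All using (All; []; _∷_)
  open import Data.List.Relation.Unary.Any using (Any)
  open import Data.Product.Base using (_×_; _,_)
  open import Data.Sum.Base using (_⊎_; inj₁; inj₂)
  open Binomials using (B)
  open FlatVolumes V _⊹_ exchange assoc public

  record Functional : Set where
    constructor functional
    field
      fun : V → ℤ
      add : ∀ a b → fun (a ⊹ b) ≡ fun a ℤ.+ fun b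
  open Functional public

  infix 8 _⟦_⟧
  _⟦_⟧ : Functional → Gen → ℤ
  λ′ ⟦ g ⟧ = fun λ′ (v g)

  _+ᶠ_ : Functional → Functional → Functional
  fun (λ′ +ᶠ μ) y = fun λ′ y ℤ.+ fun μ y
  add (λ′ +ᶠ μ) a b = trans (cong₂ ℤ._+_ (add λ′ a b) (add μ a b)) (lem (fun λ′ a) (fun λ′ b) (fun μ a) (fun μ b))
    where
    lem : ∀ a b c d → (a ℤ.+ b) ℤ.+ (c ℤ.+ d) ≡ (a ℤ.+ c) ℤ.+ (b ℤ.+ d)
    lem = ℤSolver.solve-∀

  _-ᶠ_ : Functional → Functional → Functional
  fun (λ′ -ᶠ μ) y = fun λ′ y ℤ.- fun μ y
  add (λ′ -ᶠ μ) a b = trans (cong₂ ℤ._-_ (add λ′ a b) (add μ a b)) (lem (fun λ′ a) (fun λ′ b) (fun μ a) (fun μ b))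
    where
    lem : ∀ a b c d → (a ℤ.+ b) ℤ.- (c ℤ.+ d) ≡ (a ℤ.- c) ℤ.+ (b ℤ.- d)
    lem = ℤSolver.solve-∀

  pos : ℤ → ℕ
  pos (+ zero)  = 0
  pos (+ suc _) = 1
  pos -[1+ _ ]  = 0

  pos-cases : ∀ z → (pos z ≡ 1 × + 0 ℤ.< z) ⊎ (pos z ≡ 0 × z ℤ.≤ + 0)
  pos-cases (+ zero)  = inj₂ (refl , ℤ.+≤+ z≤n)
  pos-cases (+ suc _) = inj₁ (refl , ℤ.+<+ (s≤s z≤n))
  pos-cases -[1+ _ ]  = inj₂ (refl , ℤ.-≤+)

  pos-≤1 : ∀ z → pos z ≤ 1
  pos-≤1 z with pos-cases z
  ... | inj₁ (eq , _) = ℕ.≤-reflexive eq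
  ... | inj₂ (eq , _) = subst (_≤ 1) (sym eq) z≤n

  event : List Functional → V → ℕ
  event []       y = 1
  event (λ′ ∷ Λ) y = pos (fun λ′ y) ℕ.* event Λ y

  event-≤1 : ∀ Λ y → event Λ y ≤ 1
  event-≤1 []       y = ℕ.≤-refl
  event-≤1 (λ′ ∷ Λ) y = ℕ.*-mono-≤ (pos-≤1 (fun λ′ y)) (event-≤1 Λ y)

  vol-≗ : ∀ {φ χ M w} → (∀ y → φ y ≡ χ y) → HasVol φ M w → HasVol χ M w
  vol-≗ {φ} {χ} {M} eq h .at o = Binomials.approx-ext
    (λ k → cong (λ x → + (scale (length M) ℕ.* x)) (count-cong M (λ _ → eq) k o)) (at h o)

  vol-0 : ∀ M → HasVol (λ _ → 0) M (+ 0)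
  vol-0 M .at o = 0 Binomials., λ k → ℕ.≤-reflexive (cong ∣_∣ (trans
    (cong (λ x → + x ℤ.- + 0 ℤ.* + B (length M) k) (trans (cong (scale (length M) ℕ.*_) (zeros M k o)) (ℕ.*-zeroʳ (scale (length M)))))
    refl))
    where
    zeros : ∀ M k o → cnt (λ _ → 0) M k o ≡ 0
    zeros []      k o = refl
    zeros (g ∷ M) k o = sym (ray-unique g _ {λ _ _ → 0} (λ k o → sym (cong₂ ℕ._+_ (zeros M k o) (z (deg g) k))) k o)
      where
      z : ∀ d k → Binomials.delay d (λ _ → 0) k ≡ 0
      z zero    k       = refl
      z (suc d) zero    = refl
      z (suc d) (suc k) = z d k

  -- Up to the window |y| ≤ C the sign of a quantity bounded below by −C (above by C) is known.
  private
    low : ∀ o z → o ℤ.≤ z → z ℤ.≤ + 0 → ∣ z ∣ ≤ ∣ o ∣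
    low o         (+ zero)  p q = z≤n
    low o         (+ suc n) p (ℤ.+≤+ ())
    low -[1+ m ]  -[1+ n ]  (ℤ.-≤- n≤m) q = s≤s n≤m
    high : ∀ o z → z ℤ.≤ o → + 0 ℤ.< z → ∣ z ∣ ≤ ∣ o ∣
    high (+ m) (+ n) (ℤ.+≤+ p) q = p

  Increasing : Functional → List Gen → Set
  Increasing λ′ M = All (λ g → + 0 ℤ.≤ λ′ ⟦ g ⟧) M

  Nontrivial : Functional → List Gen → Set
  Nontrivial λ′ M = Any (λ g → λ′ ⟦ g ⟧ ≢ + 0) M

  module _ (λ′ : Functional) where
    Ahead : V → V → Set
    Ahead o y = fun λ′ o ℤ.≤ fun λ′ y

    ahead : ∀ {M o} → Increasing λ′ M → All (λ g → ∀ {y} → Ahead o y → Ahead o (y ⊹ v g)) M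
    ahead {o = o} inc = All.map (λ {g} 0≤ {y} le → subst (fun λ′ o ℤ.≤_) (sym (add λ′ y (v g)))
      (ℤ.≤-trans le (subst (ℤ._≤ fun λ′ y ℤ.+ λ′ ⟦ g ⟧) (ℤ.+-identityʳ _) (ℤ.+-monoʳ-≤ (fun λ′ y) 0≤)))) inc

    Behind : V → V → Set
    Behind o y = fun λ′ y ℤ.≤ fun λ′ o

    behind : ∀ {M o} → All (λ g → λ′ ⟦ g ⟧ ℤ.≤ + 0) M → All (λ g → ∀ {y} → Behind o y → Behind o (y ⊹ v g)) M
    behind {o = o} dec = All.map (λ {g} ≤0 {y} le → subst (ℤ._≤ fun λ′ o) (sym (add λ′ y (v g)))
      (ℤ.≤-trans (subst (fun λ′ y ℤ.+ λ′ ⟦ g ⟧ ℤ.≤_) (ℤ.+-identityʳ _) (ℤ.+-monoʳ-≤ (fun λ′ y) ≤0)) le)) dec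

  win : Functional → V → V → ℕ
  win λ′ o = window (∣ fun λ′ o ∣) (fun λ′)

  small-win : ∀ λ′ {M} → Nontrivial λ′ M → ∀ o o′ → Small (window (∣ fun λ′ o′ ∣) (fun λ′)) M o
  small-win λ′ nt o o′ = small-window (fun λ′) (add λ′) (∣ fun λ′ o′ ∣) nt o

  -- As `λ′` never increases, it can be positive only between 0 and its value at the offset, which
  -- is a window.
  vol-fail : ∀ λ′ {φ M} → (∀ y → φ y ≤ pos (fun λ′ y)) → All (λ g → λ′ ⟦ g ⟧ ℤ.≤ + 0) M → Nontrivial λ′ M →
             HasVol φ M (+ 0)
  vol-fail λ′ {φ} {M} φ≤ dec nt = vol-close
    (close (Behind λ′) ℤ.≤-refl (λ {o} → behind λ′ {o = o} dec)
      λ o → win λ′ o , small-win λ′ nt o o , λ y le → bound o y le , z≤n)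
    (vol-0 M)
    where
    bound : ∀ o y → Behind λ′ o y → φ y ≤ win λ′ o y
    bound o y le with pos-cases (fun λ′ y)
    ... | inj₁ (_ , 0<) = ℕ.≤-trans (φ≤ y) (ℕ.≤-trans (pos-≤1 (fun λ′ y))
            (ℕ.≤-reflexive (sym (window-in (∣ fun λ′ o ∣) (fun λ′) y (high (fun λ′ o) (fun λ′ y) le 0<)))))
    ... | inj₂ (eq , _) = ℕ.≤-trans (subst (φ y ≤_) eq (φ≤ y)) z≤n

  -- As `λ′` never decreases, it can be nonpositive only between its value at the offset and 0,
  -- which is a window.
  vol-drop : ∀ λ′ Λ {M w} → Increasing λ′ M → Nontrivial λ′ M →
             HasVol (event Λ) M w → HasVol (event (λ′ ∷ Λ)) M w
  vol-drop λ′ Λ {M} inc nt = vol-close (close (Ahead λ′) ℤ.≤-refl (λ {o} → ahead λ′ {o = o} inc)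
    λ o → win λ′ o , small-win λ′ nt o o , bound o)
    where
    bound : ∀ o y → Ahead λ′ o y →
            event (λ′ ∷ Λ) y ≤ event Λ y ℕ.+ win λ′ o y ×
            event Λ y ≤ event (λ′ ∷ Λ) y ℕ.+ win λ′ o y
    bound o y le with pos-cases (fun λ′ y)
    ... | inj₁ (eq , _) rewrite eq | ℕ.+-identityʳ (event Λ y) = ℕ.m≤m+n _ _ , ℕ.m≤m+n _ _
    ... | inj₂ (eq , ≤0) rewrite eq = z≤n , ℕ.≤-trans (event-≤1 Λ y)
            (ℕ.≤-reflexive (sym (window-in (∣ fun λ′ o ∣) (fun λ′) y (low (fun λ′ o) (fun λ′ y) le ≤0))))

  -- If μ − λ is increasing then λ > 0 implies μ > 0 up to a window of λ.
  vol-dominate : ∀ λ′ μ Λ {M w} → Increasing (μ -ᶠ λ′) M → Nontrivial λ′ M →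
                 HasVol (event (λ′ ∷ Λ)) M w → HasVol (event (λ′ ∷ μ ∷ Λ)) M w
  vol-dominate λ′ μ Λ {M} inc nt = vol-close (close (Ahead (μ -ᶠ λ′)) ℤ.≤-refl (λ {o} → ahead (μ -ᶠ λ′) {o = o} inc)
    λ o → window (∣ fun (μ -ᶠ λ′) o ∣) (fun λ′) , small-window (fun λ′) (add λ′) (∣ fun (μ -ᶠ λ′) o ∣) nt o , bound o)
    where
    bound : ∀ o y → Ahead (μ -ᶠ λ′) o y →
            event (λ′ ∷ μ ∷ Λ) y ≤ event (λ′ ∷ Λ) y ℕ.+ window (∣ fun (μ -ᶠ λ′) o ∣) (fun λ′) y ×
            event (λ′ ∷ Λ) y ≤ event (λ′ ∷ μ ∷ Λ) y ℕ.+ window (∣ fun (μ -ᶠ λ′) o ∣) (fun λ′) y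
    bound o y le with pos-cases (fun μ y)
    ... | inj₁ (eq , _) rewrite eq | ℕ.+-identityʳ (event Λ y) = ℕ.m≤m+n _ _ , ℕ.m≤m+n _ _
    ... | inj₂ (eq , μ≤0) rewrite eq | ℕ.*-zeroʳ (pos (fun λ′ y)) with pos-cases (fun λ′ y)
    ...   | inj₂ (eq′ , _)  rewrite eq′ = z≤n , z≤n
    ...   | inj₁ (eq′ , 0<λ) = z≤n , ℕ.≤-trans (event-≤1 (λ′ ∷ Λ) y) (ℕ.≤-reflexive (sym
              (window-in (∣ o′ ∣) (fun λ′) y (subst₂ _≤_ (ℤ.∣-i∣≡∣i∣ (fun λ′ y)) refl
                (low o′ (ℤ.- fun λ′ y) (ℤ.≤-trans le (subst (ℤ._≤ ℤ.- fun λ′ y) refl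
                  (subst (fun μ y ℤ.- fun λ′ y ℤ.≤_) (ℤ.+-identityˡ _) (ℤ.+-monoˡ-≤ (ℤ.- fun λ′ y) μ≤0))))
                  (ℤ.neg-mono-≤ (ℤ.<⇒≤ 0<λ)))))))
      where o′ = fun (μ -ᶠ λ′) o

  -- If at most one of x, y, z can be nonpositive, then [x>0][y>0][z>0] = [x>0] + [y>0] + [z>0] − 2.
  vol-inclusion–exclusion : ∀ x y z Λ {M a b c w} →
    Increasing (x +ᶠ y) M → Increasing (x +ᶠ z) M → Increasing (y +ᶠ z) M →
    Nontrivial (x +ᶠ y) M → Nontrivial (x +ᶠ z) M → Nontrivial (y +ᶠ z) M →
    HasVol (event (x ∷ Λ)) M a → HasVol (event (y ∷ Λ)) M b → HasVol (event (z ∷ Λ)) M c → HasVol (event Λ) M w →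
    HasVol (event (x ∷ y ∷ z ∷ Λ)) M (a ℤ.+ (b ℤ.+ c) ℤ.+ ℤ.-1ℤ ℤ.* (w ℤ.+ w))
  vol-inclusion–exclusion x y z Λ {M} ixy ixz iyz nxy nxz nyz ha hb hc hw =
    vol-- {event (x ∷ y ∷ z ∷ Λ)} {λ p → event Λ p ℕ.+ event Λ p}
      (vol-close {α} {β} (close P (ℤ.≤-refl , ℤ.≤-refl , ℤ.≤-refl)
        (λ {o} → closed o)
        λ o → ω o , small o , bound o)
        (vol-+ ha (vol-+ hb hc)))
      (vol-+ hw hw)
    where
    α β : V → ℕ
    α p = event (x ∷ y ∷ z ∷ Λ) p ℕ.+ (event Λ p ℕ.+ event Λ p)
    β p = event (x ∷ Λ) p ℕ.+ (event (y ∷ Λ) p ℕ.+ event (z ∷ Λ) p)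
    P : V → V → Set
    P o p = Ahead (x +ᶠ y) o p × Ahead (x +ᶠ z) o p × Ahead (y +ᶠ z) o p
    closed : ∀ o → All (λ g → ∀ {p} → P o p → P o (p ⊹ v g)) M
    closed o = All.zipWith (λ { (f , g , h) {p} (a , b , c) → f {p} a , g {p} b , h {p} c })
      (ahead (x +ᶠ y) {o = o} ixy , All.zipWith (λ { (f , g) → f , g }) (ahead (x +ᶠ z) {o = o} ixz , ahead (y +ᶠ z) {o = o} iyz))
    ω : V → V → ℕ
    ω o p = win (x +ᶠ y) o p ℕ.+ (win (x +ᶠ z) o p ℕ.+ win (y +ᶠ z) o p)
    small : ∀ o → Small (ω o) M o
    small o = small-+ {win (x +ᶠ y) o} {λ p → win (x +ᶠ z) o p ℕ.+ win (y +ᶠ z) o p} {M} {o} (small-win (x +ᶠ y) nxy o o)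
      (small-+ {win (x +ᶠ z) o} {win (y +ᶠ z) o} {M} {o} (small-win (x +ᶠ z) nxz o o) (small-win (y +ᶠ z) nyz o o))
    -- The identity fails only where two of the values are nonpositive. Their sum is then
    -- nonpositive as well, but not below its value at the offset.
    inside : ∀ λ′ μ o p → Ahead (λ′ +ᶠ μ) o p → fun λ′ p ℤ.≤ + 0 → fun μ p ℤ.≤ + 0 → win (λ′ +ᶠ μ) o p ≡ 1
    inside λ′ μ o p ah l m = window-in (∣ fun (λ′ +ᶠ μ) o ∣) (fun (λ′ +ᶠ μ)) p
      (low (fun (λ′ +ᶠ μ) o) (fun (λ′ +ᶠ μ) p) ah (ℤ.+-mono-≤ l m))
    bound : ∀ o p → P o p → α p ≤ β p ℕ.+ ω o p × β p ≤ α p ℕ.+ ω o p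
    bound o p (axy , axz , ayz) with event Λ p | event-≤1 Λ p
    ... | zero | _ rewrite ℕ.*-zeroʳ (pos (fun z p)) | ℕ.*-zeroʳ (pos (fun y p)) | ℕ.*-zeroʳ (pos (fun x p)) = z≤n , z≤n
    ... | suc zero | _ with pos-cases (fun x p) | pos-cases (fun y p) | pos-cases (fun z p)
    ... | inj₁ (e , _) | inj₁ (f , _) | inj₁ (g , _) rewrite e | f | g = ℕ.m≤m+n 3 _ , ℕ.m≤m+n 3 _
    ... | inj₁ (e , _) | inj₁ (f , _) | inj₂ (g , _) rewrite e | f | g = ℕ.m≤m+n 2 _ , ℕ.m≤m+n 2 _
    ... | inj₁ (e , _) | inj₂ (f , _) | inj₁ (g , _) rewrite e | f | g = ℕ.m≤m+n 2 _ , ℕ.m≤m+n 2 _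
    ... | inj₂ (e , _) | inj₁ (f , _) | inj₁ (g , _) rewrite e | f | g = ℕ.m≤m+n 2 _ , ℕ.m≤m+n 2 _
    ... | inj₁ (e , _) | inj₂ (f , fy) | inj₂ (g , gz) rewrite e | f | g | inside y z o p ayz fy gz =
            s≤s (ℕ.≤-trans (ℕ.m≤n+m 1 (win (x +ᶠ z) o p)) (ℕ.m≤n+m _ (win (x +ᶠ y) o p))) , s≤s z≤n
    ... | inj₂ (e , ex) | inj₁ (f , _) | inj₂ (g , gz) rewrite e | f | g | inside x z o p axz ex gz =
            s≤s (ℕ.≤-trans (ℕ.m≤m+n 1 (win (y +ᶠ z) o p)) (ℕ.m≤n+m _ (win (x +ᶠ y) o p))) , s≤s z≤n
    ... | inj₂ (e , ex) | inj₂ (f , fy) | inj₁ (g , _) rewrite e | f | g | inside x y o p axy ex fy =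
            s≤s (ℕ.m≤m+n 1 _) , s≤s z≤n
    ... | inj₂ (e , ex) | inj₂ (f , fy) | inj₂ (g , gz) rewrite e | f | g | inside x y o p axy ex fy
            | inside x z o p axz ex gz = s≤s (s≤s z≤n) , z≤n
    bound o p _ | suc (suc _) | s≤s ()

-- Sums over lattice paths

module Labels where

  open import Data.Nat.Base using (ℕ; suc)
  open import Data.List.Base using (List; []; _∷_)

  -- The sign of the fourth coordinate. It is ignored by the cuts in the first three coordinates and
  -- matters only on the line.
  data Tilt : Set where
    up dn : Tilt

  -- The sums of one, two or four of the original vectors.
  data Label : Set where
    one  : Tilt → Label
    two  : Tilt → Tilt → Label
    four : Tilt → Tilt → Tilt → Tilt → Label

  -- The linear forms 1 − q, 2 − q, 1 + q and 2 + q.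
  data Form : Set where
    r₁ r₂ l₁ l₂ : Form

  -- Π = 4 (1 − q²)(4 − q²) divided by the form d − t q of a label of degree d and tilt t is
  -- c times the three forms other than τ, or e times all four forms.
  data Kind : Set where
    form : (c : ℕ) (τ : Form) → Kind
    flat : (e : ℕ) → Kind

  ups : Tilt → ℕ → ℕ
  ups up n = suc n
  ups dn n = n

  kind : Label → Kind
  kind (one up)       = form 4 r₁
  kind (one dn)       = form 4 l₁
  kind (two a b)      = pair (ups a (ups b 0))
    where
    pair : ℕ → Kind
    pair 0 = form 2 l₁
    pair 1 = flat 2
    pair _ = form 2 r₁
  kind (four a b c e) = quadruple (ups a (ups b (ups c (ups e 0))))
    where
    quadruple : ℕ → Kind
    quadruple 0 = form 1 l₁
    quadruple 1 = form 2 l₂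
    quadruple 2 = flat 1
    quadruple 3 = form 2 r₂
    quadruple _ = form 1 r₁

  -- The sum over all lattice paths which start at (A , B) and remove an entry of one of the lists
  -- in each step, until one of the lists is empty.
  module Race {X C : Set} (_⊕_ : C → C → C) (emit : X → X → C → C) where
    race : List X → List X → (List X → C) → (List X → C) → C
    race []      B       k l = l B
    race (a ∷ A) []      k l = k (a ∷ A)
    race (a ∷ A) (b ∷ B) k l = emit a b (race A (b ∷ B) k l ⊕ race (a ∷ A) B k l)

  -- For four directions whose sum vanishes in the first three coordinates; the continuations are
  -- named after the exhausted list.
  module Quad {X C : Set} (emit : X → X → X → X → C → C → C → C → C) where
    quad : List X → List X → List X → List X → (kD kA kB kC : List X → List X → List X → C) → C
    quad []      A       B       C       kD kA kB kC = kD A B C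
    quad (d ∷ D) []      B       C       kD kA kB kC = kA (d ∷ D) B C
    quad (d ∷ D) (a ∷ A) []      C       kD kA kB kC = kB (d ∷ D) (a ∷ A) C
    quad (d ∷ D) (a ∷ A) (b ∷ B) []      kD kA kB kC = kC (d ∷ D) (a ∷ A) (b ∷ B)
    quad (d ∷ D) (a ∷ A) (b ∷ B) (c ∷ C) kD kA kB kC = emit d a b c
      (quad D (a ∷ A) (b ∷ B) (c ∷ C) kD kA kB kC)
      (quad (d ∷ D) A (b ∷ B) (c ∷ C) kD kA kB kC)
      (quad (d ∷ D) (a ∷ A) B (c ∷ C) kD kA kB kC)
      (quad (d ∷ D) (a ∷ A) (b ∷ B) C kD kA kB kC)

-- The scheme of cuts

module Recursion where

  open import Data.List.Base using (List; []; _∷_; _++_; replicate)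
  open Labels

  -- The scheme is written once and interpreted twice: with volumes in `𝔽`, and with integers for
  -- the computation. The two are compared along their common structure.
  record Algebra : Set₁ where
    infixl 6 _⊕_
    field
      Value : Set
      _⊕_   : Value → Value → Value
      emit  : Label → Value → Value
      unit  : Value
      zro   : Value
      neg   : Value → Value

  module Evaluate (𝔸 : Algebra) where
    open Algebra 𝔸
    open Race _⊕_ (λ a b → emit (two a b)) public

    leaf : List Tilt → Value
    leaf []      = unit
    leaf (a ∷ A) = emit (one a) (leaf A)

    none : List Tilt → Value
    none _ = zro

    -- The event that a coordinate equal to 1 on `P` and to -1 on `N` is positive: it holds on the
    -- paths on which `P` survives. `beaten` is the same with the lists exchanged.
    beats : List Tilt → List Tilt → Value
    beats P N = race P N leaf none

    beaten : List Tilt → List Tilt → Value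
    beaten N P = race N P none leaf

    open Quad (λ d a b c x y z r → emit (four d a b c) (x ⊕ (y ⊕ (z ⊕ r)))) public

    -- The suffixes + and − refer to the signs of the three lines transversal to D.
    case₊₊₊ case₊₊₋ case₊₋₋ case₋₋₋ : (D A B C : List Tilt) → Value
    -- `D`, `A`, `B`, `C` point along (1,1,1), (-1,1,1), (1,-1,1), (1,1,-1). Sums of two coordinates
    -- never decrease, so up to a window at most one coordinate is nonpositive, and
    -- inclusion-exclusion applies.
    case₊₊₊ D A B C = beaten A (C ++ (B ++ D)) ⊕ (beaten B (C ++ (A ++ D)) ⊕ beaten C (B ++ (A ++ D))) ⊕
                      neg (leaf (C ++ (B ++ (A ++ D))) ⊕ leaf (C ++ (B ++ (A ++ D))))
    -- Now `C` is (-1,-1,1) and the third coordinate only grows. In the other two `A` and `B` are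
    -- opposite; after they are cut against each other, one coordinate dominates the other.
    case₊₊₋ D A B C = race A B (λ A′ → beats D (A′ ++ C)) (λ B′ → beats D (B′ ++ C))
    case₊₋₋ D A B C = beats D (A ++ (B ++ C))
    -- The four directions sum to zero. When one of `A`, `B`, `C` is exhausted, one coordinate
    -- bounds the two others from below; when `D` is, the sum of two coordinates never increases.
    case₋₋₋ D A B C = quad D A B C (λ _ _ _ → zro) (λ D B C → beats D (B ++ C)) (λ D A C → beats D (A ++ C)) (λ D A B → beats D (A ++ B))

    case⁻ : (D A B C : List Tilt) → Value
    -- `D` lies on (-1,-1,-1) here, so the event survives only if `D` is exhausted first.
    case⁻ D A B C = quad D A B C (λ A B C → case₊₊₊ [] A B C) (λ _ _ _ → zro) (λ _ _ _ → zro) (λ _ _ _ → zro)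

    module _ (A⁺ A⁻ : List Tilt) where
      ahead⁺ ahead⁻ : List Tilt → Value
      -- Each of the eight outcomes is one of the four cases after a permutation of the coordinates,
      -- hence the permuted arguments.
      ahead⁺ D = race A⁺ A⁻
        (λ A → race A⁺ A⁻
          (λ B → race A⁺ A⁻ (λ C → case₊₊₊ D A B C) (λ C → case₊₊₋ D A B C))
          (λ B → race A⁺ A⁻ (λ C → case₊₊₋ D A C B) (λ C → case₊₋₋ D A B C)))
        (λ A → race A⁺ A⁻
          (λ B → race A⁺ A⁻ (λ C → case₊₊₋ D B C A) (λ C → case₊₋₋ D B A C))
          (λ B → race A⁺ A⁻ (λ C → case₊₋₋ D C A B) (λ C → case₋₋₋ D A B C)))
      ahead⁻ D = race A⁺ A⁻ (λ A → race A⁺ A⁻ (λ B → race A⁺ A⁻ (λ C → case⁻ D A B C) none) none) none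

      total : (D⁺ D⁻ : List Tilt) → Value
      total D⁺ D⁻ = race D⁺ D⁻ ahead⁺ ahead⁻

  -- The candidate is above three given rivals in 30 rankings, in 24 of them also above the fourth.
  -- A given one of the three is above and the two others are below in 10 rankings, the fourth being
  -- below in 3! = 6 and above in 2! · 2! = 4. Reversed rankings give the opposite directions.
  D⁺ D⁻ A⁺ A⁻ : List Tilt
  D⁺ = replicate 24 up ++ replicate 6 dn
  D⁻ = replicate 24 dn ++ replicate 6 up
  A⁺ = replicate 6 up ++ replicate 4 dn
  A⁻ = replicate 6 dn ++ replicate 4 up

-- Volumes on a line

module Line where

  open import Data.Nat.Base as ℕ using (ℕ; zero; suc; _≤_; z≤n)
  import Data.Nat.Properties as ℕ
  open import Data.Integer.Base as ℤ using (ℤ; +_)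
  import Data.Integer.Properties as ℤ
  import Data.Integer.Tactic.RingSolver as ℤSolver
  open import Data.List.Base using (List; []; _∷_; map; _++_; replicate; [_])
  open import Data.List.Relation.Binary.Permutation.Propositional using (_↭_; ↭-refl; ↭-sym; ↭-trans; prep; swap)
  open import Data.List.Relation.Binary.Permutation.Propositional.Properties using (++⁺ˡ) renaming (shift to shift-↭)
  open import Data.List.Relation.Unary.All using (All; []; _∷_)
  open import Data.List.Relation.Unary.Any using (here)
  open import Relation.Binary.PropositionalEquality hiding ([_])
  open Labels

  -- Abstract, because the modules below carry this proof as a parameter.
  abstract
    exchangeℤ : ∀ o a b → (o ℤ.+ a) ℤ.+ b ≡ (o ℤ.+ b) ℤ.+ a
    exchangeℤ = ℤSolver.solve-∀

  open Events ℤ ℤ._+_ exchangeℤ ℤ.+-assoc public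

  height : Functional
  height = functional (λ y → y) (λ _ _ → refl)

  positive : ℤ → ℕ
  positive = event [ height ]

  data Size : Set where
    s₁ s₂ : Size

  -- Doubling brings each moving label to height 4 or -4 with degree 4 or 8. A right and a left
  -- generator then always sum to one that stays in place.
  right left : Size → Gen
  right s₁ = gen 3 (+ 4)
  right s₂ = gen 7 (+ 4)
  left  s₁ = gen 3 (ℤ.- + 4)
  left  s₂ = gen 7 (ℤ.- + 4)

  -- 12 divided by the size, and by the sum of two sizes.
  share : Size → ℕ
  share s₁ = 12
  share s₂ = 6

  share₂ : Size → Size → ℕ
  share₂ s₁ s₁ = 6
  share₂ s₁ s₂ = 4
  share₂ s₂ s₁ = 4
  share₂ s₂ s₂ = 3

  shares : List Size → ℕ
  shares []      = 1
  shares (a ∷ A) = share a ℕ.* shares A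

  open Race {Size} {ℤ} ℤ._+_ (λ a b x → + share₂ a b ℤ.* x) public

  w : List Size → List Size → ℤ
  w R L = race R L (λ A → + shares A) (λ _ → + 0)

  gens : List Size → List Size → List Gen
  gens R L = map right R ++ map left L

  private
    leaf : ∀ R → Leaf (map right R ++ []) (shares R)
    leaf []       = []
    leaf (s₁ ∷ R) = _∷_ {c = 12} refl (leaf R)
    leaf (s₂ ∷ R) = _∷_ {c = 6} refl (leaf R)

    right≥0 : ∀ R → Increasing height (map right R ++ [])
    right≥0 []       = []
    right≥0 (s₁ ∷ R) = ℤ.+≤+ z≤n ∷ right≥0 R
    right≥0 (s₂ ∷ R) = ℤ.+≤+ z≤n ∷ right≥0 R

    right≢0 : ∀ a → height ⟦ right a ⟧ ≢ + 0
    right≢0 s₁ ()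
    right≢0 s₂ ()

    left≤0 : ∀ L → All (λ g → height ⟦ g ⟧ ℤ.≤ + 0) (map left L)
    left≤0 []       = []
    left≤0 (s₁ ∷ L) = ℤ.-≤+ ∷ left≤0 L
    left≤0 (s₂ ∷ L) = ℤ.-≤+ ∷ left≤0 L

    left≢0 : ∀ a → height ⟦ left a ⟧ ≢ + 0
    left≢0 s₁ ()
    left≢0 s₂ ()

    ≤pos : ∀ y → positive y ≤ pos y
    ≤pos y = ℕ.≤-reflexive (ℕ.*-identityʳ (pos y))

  vol-still : ∀ {e h M x} c → c ℕ.* suc e ≡ 48 → HasVol positive (h ∷ M) x → HasVol positive (gen e (+ 0) ∷ h ∷ M) (+ c ℤ.* x)
  vol-still {e} {h} {M} c eq = vol-flat {g = gen e (+ 0)} c eq (λ k o → cong (cnt positive (h ∷ M) k) (ℤ.+-identityʳ o))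

  -- The cut produces a generator of height 0, whose factor 48 / degree is `share₂ a b`.
  vol-opposite : ∀ a b {M x y} → HasVol positive (left b ∷ M) x → HasVol positive (right a ∷ M) y →
                 HasVol positive (right a ∷ left b ∷ M) (+ share₂ a b ℤ.* (x ℤ.+ y))
  vol-opposite s₁ s₁ {x = x} {y} p q = vol-subst (sym (ℤ.*-distribˡ-+ (+ 6) x y)) (vol-star₂ (vol-still 6 refl p) (vol-still 6 refl q))
  vol-opposite s₁ s₂ {x = x} {y} p q = vol-subst (sym (ℤ.*-distribˡ-+ (+ 4) x y)) (vol-star₂ (vol-still 4 refl p) (vol-still 4 refl q))
  vol-opposite s₂ s₁ {x = x} {y} p q = vol-subst (sym (ℤ.*-distribˡ-+ (+ 4) x y)) (vol-star₂ (vol-still 4 refl p) (vol-still 4 refl q))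
  vol-opposite s₂ s₂ {x = x} {y} p q = vol-subst (sym (ℤ.*-distribˡ-+ (+ 3) x y)) (vol-star₂ (vol-still 3 refl p) (vol-still 3 refl q))

  -- With no generator at all the event is decided by the offset.
  data Nonempty : List Size → List Size → Set where
    hasRight : ∀ {a A L} → Nonempty (a ∷ A) L
    hasLeft  : ∀ {b B R} → Nonempty R (b ∷ B)

  vol-w : ∀ R L → Nonempty R L → HasVol positive (gens R L) (w R L)
  vol-w []      (b ∷ B) _ = vol-fail height ≤pos (left≤0 (b ∷ B)) (here (left≢0 b))
  vol-w (a ∷ A) []      _ = vol-drop height [] (right≥0 (a ∷ A)) (here (right≢0 a)) (vol-1 (leaf (a ∷ A)))
  vol-w (a ∷ A) (b ∷ B) _ = vol-↭ (prep (right a) (↭-sym (shift-↭ (left b) (map right A) (map left B))))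
    (vol-opposite a b (vol-↭ (shift-↭ (left b) (map right A) (map left B)) (vol-w A (b ∷ B) hasLeft)) (vol-w (a ∷ A) B hasRight))

  -- Partial fraction relations between the volumes on the line

  record Counts : Set where
    constructor counts
    field #r₁ #r₂ #l₁ #l₂ : ℕ

  inc : Form → Counts → Counts
  inc r₁ (counts a h b k) = counts (suc a) h b k
  inc r₂ (counts a h b k) = counts a (suc h) b k
  inc l₁ (counts a h b k) = counts a h (suc b) k
  inc l₂ (counts a h b k) = counts a h b (suc k)

  inc-comm : ∀ τ σ n → inc τ (inc σ n) ≡ inc σ (inc τ n)
  inc-comm r₁ r₁ n = refl
  inc-comm r₁ r₂ n = refl
  inc-comm r₁ l₁ n = refl
  inc-comm r₁ l₂ n = refl
  inc-comm r₂ r₁ n = refl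
  inc-comm r₂ r₂ n = refl
  inc-comm r₂ l₁ n = refl
  inc-comm r₂ l₂ n = refl
  inc-comm l₁ r₁ n = refl
  inc-comm l₁ r₂ n = refl
  inc-comm l₁ l₁ n = refl
  inc-comm l₁ l₂ n = refl
  inc-comm l₂ r₁ n = refl
  inc-comm l₂ r₂ n = refl
  inc-comm l₂ l₁ n = refl
  inc-comm l₂ l₂ n = refl

  sizes sizesᵣ : ℕ → ℕ → List Size
  sizes  a h = replicate a s₁ ++ replicate h s₂
  sizesᵣ b k = replicate k s₂ ++ replicate b s₁

  abstract
    -- Up to normalisation, the volume attached to the product of the inverse forms, which depends
    -- only on their multiplicities.
    W : Counts → ℤ
    W (counts a h b k) = w (sizes a h) (sizesᵣ b k)

    W-≡ : ∀ a h b k → W (counts a h b k) ≡ w (sizes a h) (sizesᵣ b k)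
    W-≡ a h b k = refl

  genOf : Form → Gen
  genOf r₁ = right s₁
  genOf r₂ = right s₂
  genOf l₁ = left s₁
  genOf l₂ = left s₂

  gensOf : Counts → List Gen
  gensOf (counts a h b k) = gens (sizes a h) (sizesᵣ b k)

  gensOf-inc : ∀ τ n → gensOf (inc τ n) ↭ genOf τ ∷ gensOf n
  gensOf-inc r₁ n = ↭-refl
  gensOf-inc r₂ (counts zero    h b k) = ↭-refl
  gensOf-inc r₂ (counts (suc a) h b k) = ↭-trans (prep _ (gensOf-inc r₂ (counts a h b k))) (swap _ _ ↭-refl)
  gensOf-inc l₁ (counts a h b k) = ↭-trans (++⁺ˡ (map right (sizes a h)) (go k)) (shift-↭ (left s₁) (map right (sizes a h)) _)
    where
    go : ∀ k → map left (sizesᵣ (suc b) k) ↭ left s₁ ∷ map left (sizesᵣ b k)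
    go zero    = ↭-refl
    go (suc k) = ↭-trans (prep _ (go k)) (swap _ _ ↭-refl)
  gensOf-inc l₂ (counts a h b k) = shift-↭ (left s₂) (map right (sizes a h)) (map left (sizesᵣ b k))

  abstract
    vol-W : ∀ τ n → HasVol positive (gensOf (inc τ n)) (W (inc τ n))
    vol-W r₁ (counts a h b k) = vol-w (sizes (suc a) h) (sizesᵣ b k) hasRight
    vol-W r₂ (counts zero h b k) = vol-w (sizes zero (suc h)) (sizesᵣ b k) hasRight
    vol-W r₂ (counts (suc a) h b k) = vol-w (sizes (suc a) (suc h)) (sizesᵣ b k) hasRight
    vol-W l₁ (counts a h b zero) = vol-w (sizes a h) (sizesᵣ (suc b) zero) hasLeft
    vol-W l₁ (counts a h b (suc k)) = vol-w (sizes a h) (sizesᵣ (suc b) (suc k)) hasLeft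
    vol-W l₂ (counts a h b k) = vol-w (sizes a h) (sizesᵣ b (suc k)) hasLeft

  vol-W₁ : ∀ τ n → HasVol positive (genOf τ ∷ gensOf n) (W (inc τ n))
  vol-W₁ τ n = vol-↭ (gensOf-inc τ n) (vol-W τ n)

  vol-W₂ : ∀ τ σ n → HasVol positive (genOf τ ∷ genOf σ ∷ gensOf n) (W (inc τ (inc σ n)))
  vol-W₂ τ σ n = vol-↭ (↭-trans (gensOf-inc τ (inc σ n)) (prep _ (gensOf-inc σ n))) (vol-W τ (inc σ n))

  -- f_τ = d_τ − s_τ q.
  sgn size : Form → ℤ
  sgn r₁ = + 1
  sgn r₂ = + 1
  sgn l₁ = ℤ.- + 1
  sgn l₂ = ℤ.- + 1
  size r₁ = + 1
  size r₂ = + 2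
  size l₁ = + 1
  size l₂ = + 2

  sgn² : ∀ τ → sgn τ ℤ.* sgn τ ≡ + 1
  sgn² r₁ = refl
  sgn² r₂ = refl
  sgn² l₁ = refl
  sgn² l₂ = refl

  private
    -- Partial fractions 1/(f g) = (1/f + 1/g)/(f + g), where f + g is free of q for opposite sides.
    -- For volumes it holds because a cut computes the same volume.
    opposite : ∀ {a b τ σ} → genOf τ ≡ right a → genOf σ ≡ left b → ∀ n →
               W (inc τ (inc σ n)) ≡ + share₂ a b ℤ.* (W (inc σ n) ℤ.+ W (inc τ n))
    opposite {a} {b} {τ} {σ} eτ eσ n = vol-unique (+ 0)
      (subst₂ (λ g h → HasVol positive (g ∷ h ∷ gensOf n) (W (inc τ (inc σ n)))) eτ eσ (vol-W₂ τ σ n))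
      (vol-opposite a b
        (subst (λ g → HasVol positive (g ∷ gensOf n) (W (inc σ n))) eσ (vol-W₁ σ n))
        (subst (λ g → HasVol positive (g ∷ gensOf n) (W (inc τ n))) eτ (vol-W₁ τ n)))

    -- Height 0 and degree 4: adding it turns size 1 into size 2 on the same side, just as 2 - q =
    -- (1 - q) + 1.
    Z : Gen
    Z = gen 3 (+ 0)

    insert-Z : ∀ τ n → HasVol positive (genOf τ ∷ Z ∷ gensOf n) (+ 12 ℤ.* W (inc τ n))
    insert-Z τ n = vol-↭ (swap Z (genOf τ) ↭-refl) (vol-still 12 refl (vol-W₁ τ n))

    -- With f_σ = f_τ + 1 one has 1/f_τ = 1/f_σ + 1/(f_τ f_σ). The volume of `τ`, `Z` and `n` is
    -- computed with and without a cut of `τ` against `Z`.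
    same : ∀ {τ σ} → genOf τ ⊕ Z ≡ genOf σ → ∀ n →
           + 12 ℤ.* W (inc τ n) ≡ + 12 ℤ.* W (inc σ n) ℤ.+ W (inc σ (inc τ n))
    same {τ} {σ} eq n = vol-unique (+ 0) (insert-Z τ n)
      (vol-star₂ (subst (λ g → HasVol positive (g ∷ Z ∷ gensOf n) (+ 12 ℤ.* W (inc σ n))) (sym eq) (insert-Z σ n))
                 (subst (λ g → HasVol positive (g ∷ genOf τ ∷ gensOf n) (W (inc σ (inc τ n)))) (sym eq) (vol-W₂ σ τ n)))

  -- The value "q W(n + τ)" computed with the form τ.
  times-q : Form → ℤ → ℤ → ℤ
  times-q τ x y = sgn τ ℤ.* (size τ ℤ.* x ℤ.- + 12 ℤ.* y)

  private
    Rel : Form → Form → Set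
    Rel τ σ = ∀ n → times-q τ (W (inc τ (inc σ n))) (W (inc σ n)) ≡ times-q σ (W (inc σ (inc τ n))) (W (inc τ n))

    arith-opposite : ∀ {s s′ d e c x y N} → s ≡ + 1 → s′ ≡ ℤ.- + 1 → (d ℤ.+ e) ℤ.* c ≡ + 12 → N ≡ c ℤ.* (x ℤ.+ y) →
                     s ℤ.* (d ℤ.* N ℤ.- + 12 ℤ.* x) ≡ s′ ℤ.* (e ℤ.* N ℤ.- + 12 ℤ.* y)
    arith-opposite {d = d} {e} {c} {x} {y} refl refl eq refl = trans
      (cong (λ t → + 1 ℤ.* (d ℤ.* (c ℤ.* (x ℤ.+ y)) ℤ.- t ℤ.* x)) (sym eq)) (trans (lem d e c x y)
      (cong (λ t → ℤ.- + 1 ℤ.* (e ℤ.* (c ℤ.* (x ℤ.+ y)) ℤ.- t ℤ.* y)) eq))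
      where
      lem : ∀ d e c x y → + 1 ℤ.* (d ℤ.* (c ℤ.* (x ℤ.+ y)) ℤ.- (d ℤ.+ e) ℤ.* c ℤ.* x) ≡
            ℤ.- + 1 ℤ.* (e ℤ.* (c ℤ.* (x ℤ.+ y)) ℤ.- (d ℤ.+ e) ℤ.* c ℤ.* y)
      lem = ℤSolver.solve-∀

    arith-same : ∀ {s s′ d e x y N} → s ≡ s′ → d ≡ + 1 → e ≡ + 2 → x ≡ y ℤ.+ N →
                 s ℤ.* (d ℤ.* N ℤ.- y) ≡ s′ ℤ.* (e ℤ.* N ℤ.- x)
    arith-same {s} {y = y} {N} refl refl refl refl = lem s y N
      where
      lem : ∀ s y N → s ℤ.* (+ 1 ℤ.* N ℤ.- y) ≡ s ℤ.* (+ 2 ℤ.* N ℤ.- (y ℤ.+ N))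
      lem = ℤSolver.solve-∀

    rel-opposite : ∀ {a b τ σ} → genOf τ ≡ right a → genOf σ ≡ left b → sgn τ ≡ + 1 → sgn σ ≡ ℤ.- + 1 →
                   (size τ ℤ.+ size σ) ℤ.* + share₂ a b ≡ + 12 → Rel τ σ
    rel-opposite {a} {b} {τ} {σ} eτ eσ s s′ e n = trans
      (arith-opposite {sgn τ} {sgn σ} {size τ} {size σ} {+ share₂ a b} {W (inc σ n)} {W (inc τ n)} s s′ e (opposite {a} {b} {τ} {σ} eτ eσ n))
      (cong (λ N → times-q σ (W N) (W (inc τ n))) (inc-comm τ σ n))

    rel-same : ∀ {τ σ} → genOf τ ⊕ Z ≡ genOf σ → sgn τ ≡ sgn σ → size τ ≡ + 1 → size σ ≡ + 2 → Rel τ σ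
    rel-same {τ} {σ} e s d d′ n = trans (cong (λ N → times-q τ (W N) (W (inc σ n))) (inc-comm τ σ n))
      (arith-same {sgn τ} {sgn σ} {size τ} {size σ} {+ 12 ℤ.* W (inc τ n)} {+ 12 ℤ.* W (inc σ n)} s d d′ (same {τ} {σ} e n))

  -- This agreement lets q act on volumes: the product of q and a volume may be computed by
  -- cancelling any form that is present.
  rel : ∀ τ σ n → times-q τ (W (inc τ (inc σ n))) (W (inc σ n)) ≡ times-q σ (W (inc σ (inc τ n))) (W (inc τ n))
  rel r₁ r₁ n = refl
  rel r₁ r₂ n = rel-same {r₁} {r₂} refl refl refl refl n
  rel r₁ l₁ n = rel-opposite {s₁} {s₁} {r₁} {l₁} refl refl refl refl refl n
  rel r₁ l₂ n = rel-opposite {s₁} {s₂} {r₁} {l₂} refl refl refl refl refl n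
  rel r₂ r₁ n = sym (rel-same {r₁} {r₂} refl refl refl refl n)
  rel r₂ r₂ n = refl
  rel r₂ l₁ n = rel-opposite {s₂} {s₁} {r₂} {l₁} refl refl refl refl refl n
  rel r₂ l₂ n = rel-opposite {s₂} {s₂} {r₂} {l₂} refl refl refl refl refl n
  rel l₁ r₁ n = sym (rel-opposite {s₁} {s₁} {r₁} {l₁} refl refl refl refl refl n)
  rel l₁ r₂ n = sym (rel-opposite {s₂} {s₁} {r₂} {l₁} refl refl refl refl refl n)
  rel l₁ l₁ n = refl
  rel l₁ l₂ n = rel-same {l₁} {l₂} refl refl refl refl n
  rel l₂ r₁ n = sym (rel-opposite {s₁} {s₂} {r₁} {l₂} refl refl refl refl refl n)
  rel l₂ r₂ n = sym (rel-opposite {s₂} {s₂} {r₂} {l₂} refl refl refl refl refl n)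
  rel l₂ l₁ n = sym (rel-same {l₁} {l₂} refl refl refl refl n)
  rel l₂ l₂ n = refl

-- Polynomials as functionals on the volumes of the line

module Functionals where

  open import Data.Nat.Base as ℕ using (ℕ; zero; suc)
  import Data.Nat.Properties as ℕ
  open import Data.Integer.Base as ℤ using (ℤ; +_)
  import Data.Integer.Properties as ℤ
  import Data.Integer.Tactic.RingSolver as ℤSolver
  open import Data.List.Base using (List; []; _∷_; map; _++_)
  open import Data.List.Relation.Binary.Permutation.Propositional using (↭-sym; ↭-trans; prep)
  open import Data.List.Relation.Binary.Permutation.Propositional.Properties using (++⁺ˡ) renaming (shift to shift-↭)
  open import Relation.Binary.PropositionalEquality hiding ([_])
  open Labels
  open Recursion using (Algebra)
  open Line

  Poly : Set
  Poly = List ℤ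

  -- functional n P is the value of P(q) W(n).
  functional-q : Counts → Poly → (Counts → ℤ) → ℤ
  functional-q (counts a h b (suc k))          P L = times-q l₂ (L (counts a h b (suc k))) (L (counts a h b k))
  functional-q (counts a h (suc b) zero)       P L = times-q l₁ (L (counts a h (suc b) zero)) (L (counts a h b zero))
  functional-q (counts (suc a) h zero zero)    P L = times-q r₁ (L (counts (suc a) h zero zero)) (L (counts a h zero zero))
  functional-q (counts zero (suc h) zero zero) P L = times-q r₂ (L (counts zero (suc h) zero zero)) (L (counts zero h zero zero))
  -- A default value: without a form to cancel, multiplication by q is not defined.
  functional-q (counts zero zero zero zero)    P L = + 0

  ⟪_⟫ : Poly → Counts → ℤ
  ⟪ []    ⟫ n = + 0
  ⟪ m ∷ P ⟫ n = m ℤ.* W n ℤ.+ functional-q n P ⟪ P ⟫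

  -- The relation `rel` with P(q) W in the place of W.
  Consistent : Poly → Set
  Consistent P = ∀ τ σ n → times-q τ (⟪ P ⟫ (inc τ (inc σ n))) (⟪ P ⟫ (inc σ n)) ≡
                           times-q σ (⟪ P ⟫ (inc σ (inc τ n))) (⟪ P ⟫ (inc τ n))

  -- Consistency replaces the form that `functional-q` prefers by any other form present.
  choice : ∀ P → Consistent P → ∀ τ n → functional-q (inc τ n) P ⟪ P ⟫ ≡ times-q τ (⟪ P ⟫ (inc τ n)) (⟪ P ⟫ n)
  choice P c l₂ n                                  = refl
  choice P c l₁ (counts a h b zero)                = refl
  choice P c l₁ (counts a h b (suc k))             = c l₂ l₁ (counts a h b k)
  choice P c r₁ (counts a h zero zero)             = refl
  choice P c r₁ (counts a h (suc b) zero)          = c l₁ r₁ (counts a h b zero)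
  choice P c r₁ (counts a h b (suc k))             = c l₂ r₁ (counts a h b k)
  choice P c r₂ (counts zero h zero zero)          = refl
  choice P c r₂ (counts (suc a) h zero zero)       = c r₁ r₂ (counts a h zero zero)
  choice P c r₂ (counts a h (suc b) zero)          = c l₁ r₂ (counts a h b zero)
  choice P c r₂ (counts a h b (suc k))             = c l₂ r₂ (counts a h b k)

  private
    arith : ∀ m s d s′ d′ wN wσ wτ N σ τ o →
            s ℤ.* (d ℤ.* wN ℤ.- + 12 ℤ.* wσ) ≡ s′ ℤ.* (d′ ℤ.* wN ℤ.- + 12 ℤ.* wτ) →
            s ℤ.* (d ℤ.* (m ℤ.* wN ℤ.+ s′ ℤ.* (d′ ℤ.* N ℤ.- + 12 ℤ.* τ)) ℤ.- + 12 ℤ.* (m ℤ.* wσ ℤ.+ s′ ℤ.* (d′ ℤ.* σ ℤ.- + 12 ℤ.* o))) ≡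
            s′ ℤ.* (d′ ℤ.* (m ℤ.* wN ℤ.+ s ℤ.* (d ℤ.* N ℤ.- + 12 ℤ.* σ)) ℤ.- + 12 ℤ.* (m ℤ.* wτ ℤ.+ s ℤ.* (d ℤ.* τ ℤ.- + 12 ℤ.* o)))
    arith m s d s′ d′ wN wσ wτ N σ τ o eq = trans (lem₁ m s d s′ d′ wN wσ N σ τ o)
      (trans (cong (λ x → m ℤ.* x ℤ.+ s ℤ.* s′ ℤ.* (d ℤ.* d′ ℤ.* N ℤ.- + 12 ℤ.* d ℤ.* τ ℤ.- + 12 ℤ.* d′ ℤ.* σ ℤ.+ + 144 ℤ.* o)) eq)
      (sym (lem₂ m s d s′ d′ wN wτ N σ τ o)))
      where
      lem₁ : ∀ m s d s′ d′ wN wσ N σ τ o →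
        s ℤ.* (d ℤ.* (m ℤ.* wN ℤ.+ s′ ℤ.* (d′ ℤ.* N ℤ.- + 12 ℤ.* τ)) ℤ.- + 12 ℤ.* (m ℤ.* wσ ℤ.+ s′ ℤ.* (d′ ℤ.* σ ℤ.- + 12 ℤ.* o))) ≡
        m ℤ.* (s ℤ.* (d ℤ.* wN ℤ.- + 12 ℤ.* wσ)) ℤ.+ s ℤ.* s′ ℤ.* (d ℤ.* d′ ℤ.* N ℤ.- + 12 ℤ.* d ℤ.* τ ℤ.- + 12 ℤ.* d′ ℤ.* σ ℤ.+ + 144 ℤ.* o)
      lem₁ = ℤSolver.solve-∀
      lem₂ : ∀ m s d s′ d′ wN wτ N σ τ o →
        s′ ℤ.* (d′ ℤ.* (m ℤ.* wN ℤ.+ s ℤ.* (d ℤ.* N ℤ.- + 12 ℤ.* σ)) ℤ.- + 12 ℤ.* (m ℤ.* wτ ℤ.+ s ℤ.* (d ℤ.* τ ℤ.- + 12 ℤ.* o))) ≡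
        m ℤ.* (s′ ℤ.* (d′ ℤ.* wN ℤ.- + 12 ℤ.* wτ)) ℤ.+ s ℤ.* s′ ℤ.* (d ℤ.* d′ ℤ.* N ℤ.- + 12 ℤ.* d ℤ.* τ ℤ.- + 12 ℤ.* d′ ℤ.* σ ℤ.+ + 144 ℤ.* o)
      lem₂ = ℤSolver.solve-∀

  -- Induction along Horner's rule: the constant coefficient obeys `rel`, and for the remainder
  -- multiplications by q through `τ` and through `σ` commute.
  consistent : ∀ P → Consistent P
  consistent []      τ σ n = trans (zeros τ) (sym (zeros σ))
    where
    zeros : ∀ τ → times-q τ (+ 0) (+ 0) ≡ + 0
    zeros r₁ = refl
    zeros r₂ = refl
    zeros l₁ = refl
    zeros l₂ = refl
  consistent (m ∷ P) τ σ n = begin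
    times-q τ (⟪ m ∷ P ⟫ (inc τ (inc σ n))) (⟪ m ∷ P ⟫ (inc σ n))
      ≡⟨ cong₂ (times-q τ) (trans (cong ⟪ m ∷ P ⟫ (inc-comm τ σ n)) (expand σ (inc τ n))) (expand σ n) ⟩
    times-q τ (m ℤ.* W στ ℤ.+ times-q σ (⟪ P ⟫ στ) (⟪ P ⟫ (inc τ n))) (m ℤ.* W (inc σ n) ℤ.+ times-q σ (⟪ P ⟫ (inc σ n)) (⟪ P ⟫ n))
      ≡⟨ arith m (sgn τ) (size τ) (sgn σ) (size σ) (W στ) (W (inc σ n)) (W (inc τ n)) (⟪ P ⟫ στ) (⟪ P ⟫ (inc σ n)) (⟪ P ⟫ (inc τ n)) (⟪ P ⟫ n)
           (trans (cong (λ N → times-q τ (W N) (W (inc σ n))) (inc-comm σ τ n)) (rel τ σ n)) ⟩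
    times-q σ (m ℤ.* W στ ℤ.+ times-q τ (⟪ P ⟫ στ) (⟪ P ⟫ (inc σ n))) (m ℤ.* W (inc τ n) ℤ.+ times-q τ (⟪ P ⟫ (inc τ n)) (⟪ P ⟫ n))
      ≡⟨ cong₂ (times-q σ) (trans (cong ⟪ m ∷ P ⟫ (inc-comm σ τ n)) (trans (expand τ (inc σ n))
           (cong (λ N → m ℤ.* W N ℤ.+ times-q τ (⟪ P ⟫ N) (⟪ P ⟫ (inc σ n))) (inc-comm τ σ n)))) (expand τ n) ⟨
    times-q σ (⟪ m ∷ P ⟫ (inc σ (inc τ n))) (⟪ m ∷ P ⟫ (inc τ n)) ∎
    where
    open ≡-Reasoning
    στ = inc σ (inc τ n)
    expand : ∀ τ n → ⟪ m ∷ P ⟫ (inc τ n) ≡ m ℤ.* W (inc τ n) ℤ.+ times-q τ (⟪ P ⟫ (inc τ n)) (⟪ P ⟫ n)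
    expand τ n = cong (λ x → m ℤ.* W (inc τ n) ℤ.+ x) (choice P (consistent P) τ n)

  infixl 6 _+ₚ_
  _+ₚ_ : Poly → Poly → Poly
  []      +ₚ R       = R
  (m ∷ P) +ₚ []      = m ∷ P
  (m ∷ P) +ₚ (n ∷ R) = (m ℤ.+ n) ∷ (P +ₚ R)

  infixr 7 _·ₚ_
  _·ₚ_ : ℤ → Poly → Poly
  c ·ₚ P = map (c ℤ.*_) P

  _*ₚ_ : Form → Poly → Poly
  τ *ₚ P = size τ ·ₚ P +ₚ (+ 0 ∷ (ℤ.- sgn τ) ·ₚ P)

  module _ where
    private
      times-+ : ∀ s d x y x′ y′ → s ℤ.* (d ℤ.* (x ℤ.+ x′) ℤ.- + 12 ℤ.* (y ℤ.+ y′)) ≡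
                s ℤ.* (d ℤ.* x ℤ.- + 12 ℤ.* y) ℤ.+ s ℤ.* (d ℤ.* x′ ℤ.- + 12 ℤ.* y′)
      times-+ = ℤSolver.solve-∀
      times-· : ∀ c s d x y → s ℤ.* (d ℤ.* (c ℤ.* x) ℤ.- + 12 ℤ.* (c ℤ.* y)) ≡ c ℤ.* (s ℤ.* (d ℤ.* x ℤ.- + 12 ℤ.* y))
      times-· = ℤSolver.solve-∀
      times-q-+ : ∀ τ {x x₁ x₂ y y₁ y₂} → x ≡ x₁ ℤ.+ x₂ → y ≡ y₁ ℤ.+ y₂ → times-q τ x y ≡ times-q τ x₁ y₁ ℤ.+ times-q τ x₂ y₂
      times-q-+ τ {x₁ = x₁} {x₂} {y₁ = y₁} {y₂} refl refl = times-+ (sgn τ) (size τ) x₁ y₁ x₂ y₂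
      times-q-· : ∀ τ c {x x₁ y y₁} → x ≡ c ℤ.* x₁ → y ≡ c ℤ.* y₁ → times-q τ x y ≡ c ℤ.* times-q τ x₁ y₁
      times-q-· τ c {x₁ = x₁} {y₁ = y₁} refl refl = times-· c (sgn τ) (size τ) x₁ y₁

      q-+ : ∀ n P R {L L₁ L₂} → (∀ n → L n ≡ L₁ n ℤ.+ L₂ n) → functional-q n (P +ₚ R) L ≡ functional-q n P L₁ ℤ.+ functional-q n R L₂
      q-+ n P R {L} {L₁} {L₂} e = go n
        where
        sum : ∀ τ m k → times-q τ (L m) (L k) ≡ times-q τ (L₁ m) (L₁ k) ℤ.+ times-q τ (L₂ m) (L₂ k)
        sum τ m k = times-q-+ τ {L m} {L₁ m} {L₂ m} {L k} {L₁ k} {L₂ k} (e m) (e k)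
        go : ∀ n → functional-q n (P +ₚ R) L ≡ functional-q n P L₁ ℤ.+ functional-q n R L₂
        go (counts a h b (suc k))          = sum l₂ (counts a h b (suc k)) (counts a h b k)
        go (counts a h (suc b) zero)       = sum l₁ (counts a h (suc b) zero) (counts a h b zero)
        go (counts (suc a) h zero zero)    = sum r₁ (counts (suc a) h zero zero) (counts a h zero zero)
        go (counts zero (suc h) zero zero) = sum r₂ (counts zero (suc h) zero zero) (counts zero h zero zero)
        go (counts zero zero zero zero)    = refl

      q-· : ∀ n P c {L L₁} → (∀ n → L n ≡ c ℤ.* L₁ n) → functional-q n (c ·ₚ P) L ≡ c ℤ.* functional-q n P L₁
      q-· n P c {L} {L₁} e = go n
        where
        sum : ∀ τ m k → times-q τ (L m) (L k) ≡ c ℤ.* times-q τ (L₁ m) (L₁ k)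
        sum τ m k = times-q-· τ c {L m} {L₁ m} {L k} {L₁ k} (e m) (e k)
        go : ∀ n → functional-q n (c ·ₚ P) L ≡ c ℤ.* functional-q n P L₁
        go (counts a h b (suc k))          = sum l₂ (counts a h b (suc k)) (counts a h b k)
        go (counts a h (suc b) zero)       = sum l₁ (counts a h (suc b) zero) (counts a h b zero)
        go (counts (suc a) h zero zero)    = sum r₁ (counts (suc a) h zero zero) (counts a h zero zero)
        go (counts zero (suc h) zero zero) = sum r₂ (counts zero (suc h) zero zero) (counts zero h zero zero)
        go (counts zero zero zero zero)    = sym (ℤ.*-zeroʳ c)

      lem-+ : ∀ m n w x y → (m ℤ.+ n) ℤ.* w ℤ.+ (x ℤ.+ y) ≡ (m ℤ.* w ℤ.+ x) ℤ.+ (n ℤ.* w ℤ.+ y)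
      lem-+ = ℤSolver.solve-∀
      lem-· : ∀ c m w x → c ℤ.* m ℤ.* w ℤ.+ c ℤ.* x ≡ c ℤ.* (m ℤ.* w ℤ.+ x)
      lem-· = ℤSolver.solve-∀

    ⟪⟫-+ : ∀ P R n → ⟪ P +ₚ R ⟫ n ≡ ⟪ P ⟫ n ℤ.+ ⟪ R ⟫ n
    ⟪⟫-+ []      R       n = sym (ℤ.+-identityˡ _)
    ⟪⟫-+ (m ∷ P) []      n = sym (ℤ.+-identityʳ _)
    ⟪⟫-+ (m ∷ P) (k ∷ R) n = trans (cong (λ x → (m ℤ.+ k) ℤ.* W n ℤ.+ x) (q-+ n P R (⟪⟫-+ P R)))
      (lem-+ m k (W n) (functional-q n P ⟪ P ⟫) (functional-q n R ⟪ R ⟫))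

    ⟪⟫-· : ∀ c P n → ⟪ c ·ₚ P ⟫ n ≡ c ℤ.* ⟪ P ⟫ n
    ⟪⟫-· c []      n = sym (ℤ.*-zeroʳ c)
    ⟪⟫-· c (m ∷ P) n = trans (cong (λ x → c ℤ.* m ℤ.* W n ℤ.+ x) (q-· n P c (⟪⟫-· c P)))
      (lem-· c m (W n) (functional-q n P ⟪ P ⟫))

    -- Multiplication by the form τ cancels τ.
    ⟪⟫-form : ∀ τ P n → ⟪ τ *ₚ P ⟫ (inc τ n) ≡ + 12 ℤ.* ⟪ P ⟫ n
    ⟪⟫-form τ P n = begin
      ⟪ τ *ₚ P ⟫ (inc τ n)
        ≡⟨ ⟪⟫-+ (size τ ·ₚ P) (+ 0 ∷ (ℤ.- sgn τ) ·ₚ P) (inc τ n) ⟩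
      ⟪ size τ ·ₚ P ⟫ (inc τ n) ℤ.+ (+ 0 ℤ.* W (inc τ n) ℤ.+ functional-q (inc τ n) S ⟪ S ⟫)
        ≡⟨ cong₂ ℤ._+_ (⟪⟫-· (size τ) P (inc τ n)) (trans (ℤ.+-identityˡ _) (trans (choice S (consistent S) τ n)
             (times-q-· τ (ℤ.- sgn τ) {⟪ S ⟫ (inc τ n)} {⟪ P ⟫ (inc τ n)} {⟪ S ⟫ n} {⟪ P ⟫ n} (⟪⟫-· (ℤ.- sgn τ) P (inc τ n)) (⟪⟫-· (ℤ.- sgn τ) P n)))) ⟩
      size τ ℤ.* ⟪ P ⟫ (inc τ n) ℤ.+ (ℤ.- sgn τ) ℤ.* times-q τ (⟪ P ⟫ (inc τ n)) (⟪ P ⟫ n)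
        ≡⟨ lem (sgn τ) (size τ) (⟪ P ⟫ (inc τ n)) (⟪ P ⟫ n) ⟩
      size τ ℤ.* ⟪ P ⟫ (inc τ n) ℤ.- sgn τ ℤ.* sgn τ ℤ.* (size τ ℤ.* ⟪ P ⟫ (inc τ n) ℤ.- + 12 ℤ.* ⟪ P ⟫ n)
        ≡⟨ cong (λ s → size τ ℤ.* ⟪ P ⟫ (inc τ n) ℤ.- s ℤ.* (size τ ℤ.* ⟪ P ⟫ (inc τ n) ℤ.- + 12 ℤ.* ⟪ P ⟫ n)) (sgn² τ) ⟩
      size τ ℤ.* ⟪ P ⟫ (inc τ n) ℤ.- + 1 ℤ.* (size τ ℤ.* ⟪ P ⟫ (inc τ n) ℤ.- + 12 ℤ.* ⟪ P ⟫ n)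
        ≡⟨ lem′ (size τ) (⟪ P ⟫ (inc τ n)) (⟪ P ⟫ n) ⟩
      + 12 ℤ.* ⟪ P ⟫ n ∎
      where
      open ≡-Reasoning
      S = (ℤ.- sgn τ) ·ₚ P
      lem : ∀ s d x y → d ℤ.* x ℤ.+ (ℤ.- s) ℤ.* (s ℤ.* (d ℤ.* x ℤ.- + 12 ℤ.* y)) ≡ d ℤ.* x ℤ.- s ℤ.* s ℤ.* (d ℤ.* x ℤ.- + 12 ℤ.* y)
      lem = ℤSolver.solve-∀
      lem′ : ∀ d x y → d ℤ.* x ℤ.- + 1 ℤ.* (d ℤ.* x ℤ.- + 12 ℤ.* y) ≡ + 12 ℤ.* y
      lem′ = ℤSolver.solve-∀

  all-forms : Poly → Poly
  all-forms P = r₁ *ₚ (r₂ *ₚ (l₁ *ₚ (l₂ *ₚ P)))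

  other-forms : Form → Poly → Poly
  other-forms r₁ P = r₂ *ₚ (l₁ *ₚ (l₂ *ₚ P))
  other-forms r₂ P = r₁ *ₚ (l₁ *ₚ (l₂ *ₚ P))
  other-forms l₁ P = r₁ *ₚ (r₂ *ₚ (l₂ *ₚ P))
  other-forms l₂ P = r₁ *ₚ (r₂ *ₚ (l₁ *ₚ P))

  -- The numerator that is left when the denominator of one label is cleared by the quartic Π.
  num : Kind → Poly → Poly
  num (form c τ) P = + c ·ₚ other-forms τ P
  num (flat e)   P = + e ·ₚ all-forms P

  inc-all : Counts → Counts
  inc-all n = inc r₁ (inc r₂ (inc l₁ (inc l₂ n)))

  abstract
    -- Abstract, so that long chains of multiplications by 12 stay symbolic.
    dozen : ℤ → ℤ
    dozen x = + 12 ℤ.* x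

    dozen-≡ : ∀ x → dozen x ≡ + 12 ℤ.* x
    dozen-≡ x = refl

  twelves : ℕ → ℤ → ℤ
  twelves zero    x = x
  twelves (suc k) x = dozen (twelves k x)

  -- What a label leaves on the line. A label that stays in place leaves nothing and acts only
  -- through `factor`.
  residual : Kind → Counts → Counts
  residual (form c τ) n = inc τ n
  residual (flat e)   n = n

  factor : Kind → ℤ
  factor (form c τ) = + c
  factor (flat e)   = + e ℤ.* + 12

  private
    cancel : ∀ τ P n {x} → ⟪ P ⟫ n ≡ x → ⟪ τ *ₚ P ⟫ (inc τ n) ≡ dozen x
    cancel τ P n eq = trans (⟪⟫-form τ P n) (trans (sym (dozen-≡ _)) (cong dozen eq))

    cancel-others : ∀ τ P n → ⟪ other-forms τ P ⟫ (inc-all n) ≡ twelves 3 (⟪ P ⟫ (inc τ n))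
    cancel-others r₁ P n = cancel r₂ (l₁ *ₚ (l₂ *ₚ P)) (inc r₁ (inc l₁ (inc l₂ n))) (cancel l₁ (l₂ *ₚ P) (inc r₁ (inc l₂ n)) (cancel l₂ P (inc r₁ n) refl))
    cancel-others r₂ P n = cancel r₁ (l₁ *ₚ (l₂ *ₚ P)) (inc r₂ (inc l₁ (inc l₂ n))) (cancel l₁ (l₂ *ₚ P) (inc r₂ (inc l₂ n)) (cancel l₂ P (inc r₂ n) refl))
    cancel-others l₁ P n = cancel r₁ (r₂ *ₚ (l₂ *ₚ P)) (inc r₂ (inc l₁ (inc l₂ n))) (cancel r₂ (l₂ *ₚ P) (inc l₁ (inc l₂ n)) (cancel l₂ P (inc l₁ n) refl))
    cancel-others l₂ P n = cancel r₁ (r₂ *ₚ (l₁ *ₚ P)) (inc r₂ (inc l₁ (inc l₂ n))) (cancel r₂ (l₁ *ₚ P) (inc l₁ (inc l₂ n)) (cancel l₁ P (inc l₂ n) refl))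

  -- Of the four added forms three cancel, and the remaining one is the form of the label. For a
  -- flat label all four cancel, and the fourth 12 is part of its factor 48 / degree = 12 e.
  ⟪⟫-num : ∀ κ P n → ⟪ num κ P ⟫ (inc-all n) ≡ factor κ ℤ.* twelves 3 (⟪ P ⟫ (residual κ n))
  ⟪⟫-num (form c τ) P n = trans (⟪⟫-· (+ c) (other-forms τ P) (inc-all n)) (cong (+ c ℤ.*_) (cancel-others τ P n))
  ⟪⟫-num (flat e)   P n = trans (⟪⟫-· (+ e) (all-forms P) (inc-all n)) (trans
    (cong (+ e ℤ.*_) (cancel r₁ (r₂ *ₚ (l₁ *ₚ (l₂ *ₚ P))) (inc r₂ (inc l₁ (inc l₂ n))) (cancel r₂ (l₁ *ₚ (l₂ *ₚ P)) (inc l₁ (inc l₂ n)) (cancel l₁ (l₂ *ₚ P) (inc l₂ n) (cancel l₂ P n refl)))))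
    (trans (cong (+ e ℤ.*_) (dozen-≡ _)) (sym (ℤ.*-assoc (+ e) (+ 12) _))))

  -- The volume of the generators counted by `n` together with those of the labels in `T`.
  W⁺ : List Label → Counts → ℤ
  W⁺ []      n = W n
  W⁺ (g ∷ T) n = factor (kind g) ℤ.* W⁺ T (residual (kind g) n)

  inc-alls : ℕ → Counts → Counts
  inc-alls zero    n = n
  inc-alls (suc k) n = inc-all (inc-alls k n)

  inc-inc-alls : ∀ κ k n → residual κ (inc-alls k n) ≡ inc-alls k (residual κ n)
  inc-inc-alls (flat e)   k       n = refl
  inc-inc-alls (form c τ) zero    n = refl
  inc-inc-alls (form c τ) (suc k) n = trans (commute τ (inc-alls k n)) (cong inc-all (inc-inc-alls (form c τ) k n))
    where
    commute : ∀ τ n → inc τ (inc-all n) ≡ inc-all (inc τ n)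
    commute r₁ n = refl
    commute r₂ n = refl
    commute l₁ n = refl
    commute l₂ n = refl

  -- A value is a function of the labels emitted so far and includes their volume.
  𝔽 : Algebra
  𝔽 = record
    { Value = List Label → ℤ
    ; _⊕_  = λ Φ Ψ T → Φ T ℤ.+ Ψ T
    ; emit = λ g Φ T → Φ (g ∷ T)
    ; unit = λ T → W⁺ T (counts 0 0 0 0)
    ; zro  = λ _ → + 0
    ; neg  = λ Φ T → ℤ.-1ℤ ℤ.* Φ T
    }
  tilt : Tilt → ℤ
  tilt up = + 1
  tilt dn = ℤ.- + 1

  degree : Label → ℕ
  degree (one a)        = 0
  degree (two a b)      = 1
  degree (four a b c e) = 3

  slope : Label → ℤ
  slope (one a)        = tilt a
  slope (two a b)      = tilt a ℤ.+ tilt b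
  slope (four a b c e) = tilt a ℤ.+ tilt b ℤ.+ tilt c ℤ.+ tilt e

  labelGen : Label → Gen
  labelGen g = gen (degree g) (slope g)

  -- Each doubling of a generator doubles the volume, hence the constants 4, 2 and 1 of the kinds.
  data Reduces : ℕ → ℤ → Kind → Set where
    quarter : ∀ {τ x} → gen 0 x ⊕ gen 0 x ⊕ (gen 0 x ⊕ gen 0 x) ≡ genOf τ → Reduces 0 x (form 4 τ)
    half    : ∀ {d x τ} → gen d x ⊕ gen d x ≡ genOf τ → Reduces d x (form 2 τ)
    exact   : ∀ {d x τ} → gen d x ≡ genOf τ → Reduces d x (form 1 τ)
    still   : ∀ {d e} → e ℕ.* 12 ℕ.* suc d ≡ 48 → Reduces d (+ 0) (flat e)

  reduces : ∀ g → Reduces (degree g) (slope g) (kind g)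
  reduces (one up) = quarter refl
  reduces (one dn) = quarter refl
  reduces (two up up) = half refl
  reduces (two up dn) = still {e = 2} refl
  reduces (two dn up) = still {e = 2} refl
  reduces (two dn dn) = half refl
  reduces (four up up up up) = exact refl
  reduces (four up up up dn) = half refl
  reduces (four up up dn up) = half refl
  reduces (four up dn up up) = half refl
  reduces (four dn up up up) = half refl
  reduces (four up up dn dn) = still {e = 1} refl
  reduces (four up dn up dn) = still {e = 1} refl
  reduces (four dn up up dn) = still {e = 1} refl
  reduces (four up dn dn up) = still {e = 1} refl
  reduces (four dn up dn up) = still {e = 1} refl
  reduces (four dn dn up up) = still {e = 1} refl
  reduces (four up dn dn dn) = half refl
  reduces (four dn up dn dn) = half refl
  reduces (four dn dn up dn) = half refl
  reduces (four dn dn dn up) = half refl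
  reduces (four dn dn dn dn) = exact refl

  -- Some generator has to move in the end; otherwise the height keeps the sign of the offset.
  data Live : List Label → Counts → Set where
    now   : ∀ {τ n} → Live [] (inc τ n)
    later : ∀ {g T n} → Live T (residual (kind g) n) → Live (g ∷ T) n

  vol-reduced : ∀ {d x κ} T n → Reduces d x κ → Live T (residual κ n) →
                HasVol positive (map labelGen T ++ gensOf (residual κ n)) (W⁺ T (residual κ n)) →
                HasVol positive (gen d x ∷ map labelGen T ++ gensOf n) (factor κ ℤ.* W⁺ T (residual κ n))
  vol-reduced {d} {x} {κ} T n r live ih = go r live ih
    where
    moved : ∀ {τ g w} → g ≡ genOf τ → HasVol positive (map labelGen T ++ gensOf (inc τ n)) w →
            HasVol positive (g ∷ map labelGen T ++ gensOf n) w
    moved {τ} refl = vol-↭ (↭-trans (++⁺ˡ (map labelGen T) (gensOf-inc τ n)) (shift-↭ (genOf τ) (map labelGen T) (gensOf n)))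
    four-times : ∀ x → x ℤ.+ x ℤ.+ (x ℤ.+ x) ≡ + 4 ℤ.* x
    four-times = ℤSolver.solve-∀
    twice : ∀ x → x ℤ.+ x ≡ + 2 ℤ.* x
    twice = ℤSolver.solve-∀
    insert : ∀ {e d} T n → e ℕ.* 12 ℕ.* suc d ≡ 48 → Live T n → ∀ {w} → HasVol positive (map labelGen T ++ gensOf n) w →
             HasVol positive (gen d (+ 0) ∷ map labelGen T ++ gensOf n) (+ (e ℕ.* 12) ℤ.* w)
    insert {e} []      _ eq (now {τ} {n}) ih = vol-↭ (prep _ (↭-sym (gensOf-inc τ n))) (vol-still (e ℕ.* 12) eq (vol-↭ (gensOf-inc τ n) ih))
    insert {e} (_ ∷ T) n eq _             ih = vol-still (e ℕ.* 12) eq ih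
    go : ∀ {d x κ} → Reduces d x κ → Live T (residual κ n) → ∀ {w} →
         HasVol positive (map labelGen T ++ gensOf (residual κ n)) w →
         HasVol positive (gen d x ∷ map labelGen T ++ gensOf n) (factor κ ℤ.* w)
    go (quarter {τ = τ} eq) live {w} ih = vol-subst (four-times w) (vol-double (vol-double (moved {τ} eq ih)))
    go (half {τ = τ} eq) live {w} ih = vol-subst (twice w) (vol-double (moved {τ} eq ih))
    go (exact {τ = τ} eq) live {w} ih = vol-subst (sym (ℤ.*-identityˡ w)) (moved {τ} eq ih)
    go (still {e = e} eq) live {w} ih = vol-subst (cong (ℤ._* w) (ℤ.pos-* e 12)) (insert {e} T n eq live ih)

  vol-W⁺ : ∀ T n → Live T n → HasVol positive (map labelGen T ++ gensOf n) (W⁺ T n)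
  vol-W⁺ []      _ (now {τ} {n}) = vol-W τ n
  vol-W⁺ (g ∷ T) n (later live)  = vol-reduced T n (reduces g) live (vol-W⁺ T (residual (kind g) n) live)

-- Volumes in four dimensions

module Space where

  open import Data.Nat.Base as ℕ using (ℕ; zero; suc; _≤_; z≤n)
  import Data.Nat.Properties as ℕ
  open import Data.Integer.Base as ℤ using (ℤ; +_; -[1+_])
  import Data.Integer.Properties as ℤ
  open import Data.List.Base using (List; []; _∷_; length; map; _++_)
  import Data.List.Properties as List
  open import Data.List.Relation.Binary.Permutation.Propositional using (_↭_; ↭-refl; ↭-sym; ↭-trans; prep)
  open import Data.List.Relation.Binary.Permutation.Propositional.Properties using (++-commutativeMonoid; ++⁺ˡ; ++⁺ʳ) renaming (shift to shift-↭)
  open import Data.List.Relation.Unary.All as All using (All; []; _∷_)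
  import Data.List.Relation.Unary.All.Properties as All
  open import Data.List.Relation.Unary.Any using (Any; here)
  import Data.List.Relation.Unary.Any.Properties as Any
  open import Data.Product.Base using (_×_; proj₁; proj₂; _,_)
  open import Relation.Binary.PropositionalEquality hiding ([_])
  open Labels
  open Recursion
  open Functionals using (𝔽; W⁺; tilt; slope; degree; labelGen; Live; now; later; residual)

  record Point : Set where
    constructor point
    field x₁ x₂ x₃ x₄ : ℤ
  open Point

  infixl 6 _⊹_
  _⊹_ : Point → Point → Point
  point a b c d ⊹ point a′ b′ c′ d′ = point (a ℤ.+ a′) (b ℤ.+ b′) (c ℤ.+ c′) (d ℤ.+ d′)

  private
    point-≡ : ∀ {a a′ b b′ c c′ d d′} → a ≡ a′ → b ≡ b′ → c ≡ c′ → d ≡ d′ → point a b c d ≡ point a′ b′ c′ d′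
    point-≡ refl refl refl refl = refl

  abstract
    exchange : ∀ o a b → (o ⊹ a) ⊹ b ≡ (o ⊹ b) ⊹ a
    exchange o a b = point-≡ (Line.exchangeℤ (x₁ o) (x₁ a) (x₁ b)) (Line.exchangeℤ (x₂ o) (x₂ a) (x₂ b))
                             (Line.exchangeℤ (x₃ o) (x₃ a) (x₃ b)) (Line.exchangeℤ (x₄ o) (x₄ a) (x₄ b))

    assoc : ∀ o a b → (o ⊹ a) ⊹ b ≡ o ⊹ (a ⊹ b)
    assoc o a b = point-≡ (ℤ.+-assoc (x₁ o) (x₁ a) (x₁ b)) (ℤ.+-assoc (x₂ o) (x₂ a) (x₂ b))
                          (ℤ.+-assoc (x₃ o) (x₃ a) (x₃ b)) (ℤ.+-assoc (x₄ o) (x₄ a) (x₄ b))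

  open Events Point _⊹_ exchange assoc public

  c₁ c₂ c₃ c₄ : Functional
  c₁ = functional x₁ (λ _ _ → refl)
  c₂ = functional x₂ (λ _ _ → refl)
  c₃ = functional x₃ (λ _ _ → refl)
  c₄ = functional x₄ (λ _ _ → refl)

  project : Gen → Line.Gen
  project (gen d v) = Line.gen d (x₄ v)

  scale-≡ : ∀ n → scale n ≡ Line.scale n
  scale-≡ zero    = trans scale-0 (sym Line.scale-0)
  scale-≡ (suc n) = trans (scale-suc n) (trans (cong (48 ℕ.*_) (scale-≡ n)) (sym (Line.scale-suc n)))

  cnt-project : ∀ M k o → cnt (event (c₄ ∷ [])) M k o ≡ Line.cnt Line.positive (map project M) k (x₄ o)
  cnt-project []      k o = cong (ℕ._* 1) (pos-≡ (x₄ o))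
    where
    pos-≡ : ∀ z → pos z ≡ Line.pos z
    pos-≡ (+ zero)  = refl
    pos-≡ (+ suc _) = refl
    pos-≡ -[1+ _ ]  = refl
  cnt-project (g ∷ M) k o = sym (ray-unique g (cnt (event (c₄ ∷ [])) M)
    {λ k o → Line.cnt Line.positive (map project (g ∷ M)) k (x₄ o)}
    (λ k o → trans (Line.ray-unfold (project g) (Line.cnt Line.positive (map project M)) k (x₄ o))
      (cong (λ n → n ℕ.+ Line.shift (project g) (Line.cnt Line.positive (map project (g ∷ M))) k (x₄ o)) (sym (cnt-project M k o)))) k o)

  -- The last event sees only degrees and fourth coordinates, so the first three coordinates can be
  -- forgotten.
  vol-project : ∀ {M w} → Line.HasVol Line.positive (map project M) w → HasVol (event (c₄ ∷ [])) M w
  vol-project {M} {w} h .at o = subst (Binomials.Approx _ w) len (Binomials.approx-ext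
    (λ k → cong₂ (λ s x → + (s ℕ.* x)) (trans (cong Line.scale len) (sym (scale-≡ (length M)))) (sym (cnt-project M k o)))
    (Line.HasVol.at h (x₄ o)))
    where
    len : length (map project M) ≡ length M
    len = List.length-map project M

  open Evaluate 𝔽

  -- Original vectors on one ray of the first three coordinates, given by `K`; the tilts are all
  -- that the scheme remembers of them.
  data Tilted (K : Point → Set) : List Gen → List Tilt → Set where
    []  : Tilted K [] []
    _∷_ : ∀ {u a G A} → K u × x₄ u ≡ tilt a → Tilted K G A → Tilted K (gen 0 u ∷ G) (a ∷ A)

  infixr 5 _++ᵗ_
  _++ᵗ_ : ∀ {K G A H B} → Tilted K G A → Tilted K H B → Tilted K (G ++ H) (A ++ B)
  []      ++ᵗ q = q
  (p ∷ t) ++ᵗ q = p ∷ (t ++ᵗ q)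

  tilted-map : ∀ {K L G A} → (∀ {u} → K u → L u) → Tilted K G A → Tilted L G A
  tilted-map f []            = []
  tilted-map f ((k , e) ∷ p) = (f k , e) ∷ tilted-map f p

  tilted-all : ∀ {K G A} → Tilted K G A → All (λ g → K (v g)) G
  tilted-all []            = []
  tilted-all ((k , _) ∷ p) = k ∷ tilted-all p

  tilted-any : ∀ {K : Point → Set} {P : Gen → Set} {G a A} → (∀ {g} → K (v g) → P g) → Tilted K G (a ∷ A) → Any P G
  tilted-any f ((k , _) ∷ p) = here (f k)

  -- The sums produced by cuts so far. `Z` says that the coordinates concerned have cancelled.
  data Emitted (Z : Point → Set) : List Gen → List Label → Set where
    []  : Emitted Z [] []
    _∷_ : ∀ {u g T′ T} → Z u × x₄ u ≡ slope g → Emitted Z T′ T → Emitted Z (gen (degree g) u ∷ T′) (g ∷ T)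

  emitted-map : ∀ {K L G A} → (∀ {u} → K u → L u) → Emitted K G A → Emitted L G A
  emitted-map f []            = []
  emitted-map f ((k , e) ∷ p) = (f k , e) ∷ emitted-map f p

  emitted-all : ∀ {K G A} → Emitted K G A → All (λ g → K (v g)) G
  emitted-all []            = []
  emitted-all ((k , _) ∷ p) = k ∷ emitted-all p

  data Some : List Tilt → List Tilt → Set where
    left  : ∀ {a A B} → Some (a ∷ A) B
    right : ∀ {b A B} → Some A (b ∷ B)

  module _ {K N Z : Point → Set} (φ : Point → ℕ) (closed : ∀ {u w} → K u → N w → Z (u ⊹ w)) (S : List Gen)
    {k l : List Tilt → List Label → ℤ}
    (hk : ∀ {a A G T′ T} → Tilted K G (a ∷ A) → Emitted Z T′ T → HasVol φ (T′ ++ (G ++ S)) (k (a ∷ A) T))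
    (hl : ∀ {b B H T′ T} → Tilted N H (b ∷ B) → Emitted Z T′ T → HasVol φ (T′ ++ (H ++ S)) (l (b ∷ B) T))
    where

    -- A cut of the two heads keeps one of them and adds their sum to the emitted generators. The
    -- rest is bringing the heads to the front.
    vol-race : ∀ {A B G H T′ T} → Some A B → Tilted K G A → Tilted N H B → Emitted Z T′ T →
               HasVol φ (T′ ++ (G ++ (H ++ S))) (race A B k l T)
    vol-race {[]}    {b ∷ B} _ [] q e = hl q e
    vol-race {a ∷ A} {[]}    _ p [] e = hk p e
    vol-race {a ∷ A} {b ∷ B} {g ∷ G} {h ∷ H} {T′} {T} _ (p@(pk , pe) ∷ ps) (q@(qk , qe) ∷ qs) e =
      vol-↭ (↭-sym (↭-trans (shift-↭ g T′ (G ++ (h ∷ H ++ S))) (prep g front-h)))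
        (vol-star₂
          (vol-↭ (prep (g ⊕ h) front-h) (vol-race right ps (q ∷ qs) e′))
          (vol-↭ (prep (g ⊕ h) (shift-↭ g T′ (G ++ (H ++ S)))) (vol-race left (p ∷ ps) qs e′)))
      where
      front-h : T′ ++ (G ++ (h ∷ H ++ S)) ↭ h ∷ (T′ ++ (G ++ (H ++ S)))
      front-h = ↭-trans (++⁺ˡ T′ (shift-↭ h G (H ++ S))) (shift-↭ h T′ (G ++ (H ++ S)))
      e′ : Emitted Z (g ⊕ h ∷ T′) (two a b ∷ T)
      e′ = (closed pk qk , cong₂ ℤ._+_ pe qe) ∷ e

  module _ {K₀ K₁ K₂ K₃ Z : Point → Set} (φ : Point → ℕ)
    (closed : ∀ {a b c e} → K₀ a → K₁ b → K₂ c → K₃ e → Z (a ⊹ b ⊹ c ⊹ e))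
    {k₀ k₁ k₂ k₃ : List Tilt → List Tilt → List Tilt → List Label → ℤ}
    (h₀ : ∀ {a A b B c C G₁ G₂ G₃ T′ T} → Tilted K₁ G₁ (a ∷ A) → Tilted K₂ G₂ (b ∷ B) → Tilted K₃ G₃ (c ∷ C) → Emitted Z T′ T →
          HasVol φ (T′ ++ (G₁ ++ (G₂ ++ G₃))) (k₀ (a ∷ A) (b ∷ B) (c ∷ C) T))
    (h₁ : ∀ {a A b B c C G₁ G₂ G₃ T′ T} → Tilted K₀ G₁ (a ∷ A) → Tilted K₂ G₂ (b ∷ B) → Tilted K₃ G₃ (c ∷ C) → Emitted Z T′ T →
          HasVol φ (T′ ++ (G₁ ++ (G₂ ++ G₃))) (k₁ (a ∷ A) (b ∷ B) (c ∷ C) T))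
    (h₂ : ∀ {a A b B c C G₁ G₂ G₃ T′ T} → Tilted K₀ G₁ (a ∷ A) → Tilted K₁ G₂ (b ∷ B) → Tilted K₃ G₃ (c ∷ C) → Emitted Z T′ T →
          HasVol φ (T′ ++ (G₁ ++ (G₂ ++ G₃))) (k₂ (a ∷ A) (b ∷ B) (c ∷ C) T))
    (h₃ : ∀ {a A b B c C G₁ G₂ G₃ T′ T} → Tilted K₀ G₁ (a ∷ A) → Tilted K₁ G₂ (b ∷ B) → Tilted K₂ G₃ (c ∷ C) → Emitted Z T′ T →
          HasVol φ (T′ ++ (G₁ ++ (G₂ ++ G₃))) (k₃ (a ∷ A) (b ∷ B) (c ∷ C) T))
    where
    private
      -- A step shortens a single list, so starting from nonempty lists no two become empty
      -- together.
      data AtMostOneEmpty : (D A B C : List Tilt) → Set where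
        full : ∀ {d D a A b B c C} → AtMostOneEmpty (d ∷ D) (a ∷ A) (b ∷ B) (c ∷ C)
        no₀  : ∀ {a A b B c C} → AtMostOneEmpty [] (a ∷ A) (b ∷ B) (c ∷ C)
        no₁  : ∀ {d D b B c C} → AtMostOneEmpty (d ∷ D) [] (b ∷ B) (c ∷ C)
        no₂  : ∀ {d D a A c C} → AtMostOneEmpty (d ∷ D) (a ∷ A) [] (c ∷ C)
        no₃  : ∀ {d D a A b B} → AtMostOneEmpty (d ∷ D) (a ∷ A) (b ∷ B) []

      less₀ : ∀ D {a A b B c C} → AtMostOneEmpty D (a ∷ A) (b ∷ B) (c ∷ C)
      less₀ []      = no₀
      less₀ (_ ∷ _) = full
      less₁ : ∀ A {d D b B c C} → AtMostOneEmpty (d ∷ D) A (b ∷ B) (c ∷ C)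
      less₁ []      = no₁
      less₁ (_ ∷ _) = full
      less₂ : ∀ B {d D a A c C} → AtMostOneEmpty (d ∷ D) (a ∷ A) B (c ∷ C)
      less₂ []      = no₂
      less₂ (_ ∷ _) = full
      less₃ : ∀ C {d D a A b B} → AtMostOneEmpty (d ∷ D) (a ∷ A) (b ∷ B) C
      less₃ []      = no₃
      less₃ (_ ∷ _) = full

      go : ∀ {D A B C G₀ G₁ G₂ G₃ T′ T} → AtMostOneEmpty D A B C →
           Tilted K₀ G₀ D → Tilted K₁ G₁ A → Tilted K₂ G₂ B → Tilted K₃ G₃ C → Emitted Z T′ T →
           HasVol φ (T′ ++ (G₀ ++ (G₁ ++ (G₂ ++ G₃)))) (quad D A B C k₀ k₁ k₂ k₃ T)
      go no₀ [] p q r e = h₀ p q r e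
      go no₁ p [] q r e = h₁ p q r e
      go no₂ p q [] r e = h₂ p q r e
      go {G₀ = G₀} {G₁} {G₂} {T′ = T′} no₃ p q r [] e =
        subst (λ X → HasVol φ (T′ ++ (G₀ ++ (G₁ ++ X))) _) (sym (List.++-identityʳ G₂)) (h₃ p q r e)
      go {a ∷ D} {b ∷ A} {f′ ∷ B} {f ∷ C} {g₀ ∷ G₀} {g₁ ∷ G₁} {g₂ ∷ G₂} {g₃ ∷ G₃} {T′} {T} full
         (p@(pk , pe) ∷ ps) (q@(qk , qe) ∷ qs) (r@(rk , re) ∷ rs) (s@(sk , se) ∷ ss) e =
        vol-↭ (↭-sym (↭-trans (front₀ _) (prep g₀ (↭-trans (front₁ _) (prep g₁ (↭-trans (front₂ _) (prep g₂ (front₃ _))))))))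
          (vol-star₄
            (vol-↭ (prep w (↭-trans (front₁ _) (prep g₁ (↭-trans (front₂ _) (prep g₂ (front₃ _))))))
              (go (less₀ D) ps (q ∷ qs) (r ∷ rs) (s ∷ ss) e′))
            (vol-↭ (prep w (↭-trans (front₀ _) (prep g₀ (↭-trans (front₂ _) (prep g₂ (front₃ _))))))
              (go (less₁ A) (p ∷ ps) qs (r ∷ rs) (s ∷ ss) e′))
            (vol-↭ (prep w (↭-trans (front₀ _) (prep g₀ (↭-trans (front₁ _) (prep g₁ (front₃ _))))))
              (go (less₂ B) (p ∷ ps) (q ∷ qs) rs (s ∷ ss) e′))
            (vol-↭ (prep w (↭-trans (front₀ _) (prep g₀ (↭-trans (front₁ _) (prep g₁ (front₂ _))))))
              (go (less₃ C) (p ∷ ps) (q ∷ qs) (r ∷ rs) ss e′)))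
        where
        w = g₀ ⊕ g₁ ⊕ g₂ ⊕ g₃
        front₀ : ∀ R → T′ ++ (g₀ ∷ R) ↭ g₀ ∷ T′ ++ R
        front₀ R = shift-↭ g₀ T′ R
        front₁ : ∀ R → T′ ++ (G₀ ++ (g₁ ∷ R)) ↭ g₁ ∷ T′ ++ (G₀ ++ R)
        front₁ R = ↭-trans (++⁺ˡ T′ (shift-↭ g₁ G₀ R)) (shift-↭ g₁ T′ _)
        front₂ : ∀ R → T′ ++ (G₀ ++ (G₁ ++ (g₂ ∷ R))) ↭ g₂ ∷ T′ ++ (G₀ ++ (G₁ ++ R))
        front₂ R = ↭-trans (++⁺ˡ T′ (↭-trans (++⁺ˡ G₀ (shift-↭ g₂ G₁ R)) (shift-↭ g₂ G₀ _))) (shift-↭ g₂ T′ _)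
        front₃ : ∀ R → T′ ++ (G₀ ++ (G₁ ++ (G₂ ++ (g₃ ∷ R)))) ↭ g₃ ∷ T′ ++ (G₀ ++ (G₁ ++ (G₂ ++ R)))
        front₃ R = ↭-trans (++⁺ˡ T′ (↭-trans (++⁺ˡ G₀ (↭-trans (++⁺ˡ G₁ (shift-↭ g₃ G₂ R)) (shift-↭ g₃ G₁ _))) (shift-↭ g₃ G₀ _))) (shift-↭ g₃ T′ _)
        e′ : Emitted Z (w ∷ T′) (four a b f′ f ∷ T)
        e′ = (closed pk qk rk sk , cong₂ ℤ._+_ (cong₂ ℤ._+_ (cong₂ ℤ._+_ pe qe) re) se) ∷ e

    vol-quad : ∀ {d D a A b B c C G₀ G₁ G₂ G₃ T′ T} →
               Tilted K₀ G₀ (d ∷ D) → Tilted K₁ G₁ (a ∷ A) → Tilted K₂ G₂ (b ∷ B) → Tilted K₃ G₃ (c ∷ C) → Emitted Z T′ T →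
               HasVol φ (T′ ++ (G₀ ++ (G₁ ++ (G₂ ++ G₃)))) (quad (d ∷ D) (a ∷ A) (b ∷ B) (c ∷ C) k₀ k₁ k₂ k₃ T)
    vol-quad = go full

  open import Data.Unit.Base using (⊤; tt)

  live-inc : ∀ T τ n → Live T (Line.inc τ n)
  live-inc []      τ n = now
  live-inc (g ∷ T) τ n with kind g in eq
  ... | form c σ = later (subst (λ κ → Live T (residual κ (Line.inc τ n))) (sym eq) (live-inc T σ (Line.inc τ n)))
  ... | flat e   = later (subst (λ κ → Live T (residual κ (Line.inc τ n))) (sym eq) (live-inc T τ n))

  live-one : ∀ a T n → Live (one a ∷ T) n
  live-one up T n = later (live-inc T r₁ n)
  live-one dn T n = later (live-inc T l₁ n)

  -- Only the fourth condition is left, so the surviving vectors become labels themselves; any one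
  -- of them makes the list live.
  vol-leaf : ∀ {K Z a A G T′ T} → Tilted K G (a ∷ A) → Emitted Z T′ T →
             HasVol (event (c₄ ∷ [])) (T′ ++ G) (leaf (a ∷ A) T)
  vol-leaf {a = a} {A} {g ∷ G} {T′} {T} ((_ , e) ∷ p) es = vol-↭ (↭-sym (shift-↭ g T′ G))
    (go p ((tt , e) ∷ emitted-map (λ _ → tt) es) (live-one a T _))
    where
    any : Point → Set
    any _ = ⊤
    projected : ∀ {T′ T} → Emitted any T′ T → map project T′ ≡ map labelGen T
    projected []             = refl
    projected (_∷_ {g = g} (_ , e) es) = cong₂ (λ x M → Line.gen (degree g) x ∷ M) e (projected es)
    go : ∀ {K G A T′ T} → Tilted K G A → Emitted any T′ T → Live T (Line.counts 0 0 0 0) →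
         HasVol (event (c₄ ∷ [])) (T′ ++ G) (leaf A T)
    go {T′ = T′} {T} [] es live = vol-project (subst (λ M → Line.HasVol Line.positive M (W⁺ T (Line.counts 0 0 0 0)))
      (trans (cong (_++ []) (sym (projected es))) (sym (List.map-++ project T′ []))) (Functionals.vol-W⁺ T _ live))
    go {G = g ∷ G} {A = a ∷ A} {T′} {T} ((_ , e) ∷ p) es live = vol-↭ (↭-sym (shift-↭ g T′ G))
      (go p ((tt , e) ∷ es) (live-one a T _))

  private
    zero≤ : ∀ {a} n → a ≡ + n → + 0 ℤ.≤ a
    zero≤ n refl = ℤ.+≤+ z≤n

    ≤zero : ∀ {a} n → a ≡ ℤ.- + n → a ℤ.≤ + 0
    ≤zero zero    refl = ℤ.+≤+ z≤n
    ≤zero (suc n) refl = ℤ.-≤+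

    ≢zero : ∀ {a} b → a ≡ b → b ≢ + 0 → a ≢ + 0
    ≢zero b refl b≢0 = b≢0

  event-≤pos : ∀ x Λ y → event (x ∷ Λ) y ≤ pos (fun x y)
  event-≤pos x Λ y = subst (event (x ∷ Λ) y ≤_) (ℕ.*-identityʳ _) (ℕ.*-monoʳ-≤ (pos (fun x y)) (event-≤1 Λ y))

  Value : Functional → ℤ → Point → Set
  Value x i v = fun x v ≡ i

  module _ (x : Functional) where
    private
      sum-zero : ∀ {u w} → Value x (+ 1) u → Value x (ℤ.- + 1) w → Value x (+ 0) (u ⊹ w)
      sum-zero {u} {w} p q = trans (add x u w) (cong₂ ℤ._+_ p q)
      sum-zero′ : ∀ {u w} → Value x (ℤ.- + 1) u → Value x (+ 1) w → Value x (+ 0) (u ⊹ w)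
      sum-zero′ {u} {w} p q = trans (add x u w) (cong₂ ℤ._+_ p q)

      won : ∀ {a A G T′ T} → Tilted (Value x (+ 1)) G (a ∷ A) → Emitted (Value x (+ 0)) T′ T →
            HasVol (event (x ∷ c₄ ∷ [])) (T′ ++ (G ++ [])) (leaf (a ∷ A) T)
      won {a} {A} {G} {T′} {T} p e = subst (λ G → HasVol (event (x ∷ c₄ ∷ [])) (T′ ++ G) (leaf (a ∷ A) T)) (sym (List.++-identityʳ G))
        (vol-drop x (c₄ ∷ []) (All.++⁺ (All.map (zero≤ 0) (emitted-all e)) (All.map (zero≤ 1) (tilted-all p)))
          (Any.++⁺ʳ T′ (tilted-any (λ q → ≢zero (+ 1) q (λ ())) p)) (vol-leaf p e))

      lost : ∀ {b B H T′ T} → Tilted (Value x (ℤ.- + 1)) H (b ∷ B) → Emitted (Value x (+ 0)) T′ T →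
             HasVol (event (x ∷ c₄ ∷ [])) (T′ ++ (H ++ [])) (+ 0)
      lost {H = H} {T′} p e = subst (λ G → HasVol (event (x ∷ c₄ ∷ [])) (T′ ++ G) (+ 0)) (sym (List.++-identityʳ H))
        (vol-fail x (event-≤pos x (c₄ ∷ [])) (All.++⁺ (All.map (≤zero 0) (emitted-all e)) (All.map (≤zero 1) (tilted-all p)))
          (Any.++⁺ʳ T′ (tilted-any (λ q → ≢zero (ℤ.- + 1) q (λ ())) p)))

    -- If `P` survives, the coordinate never decreases and its condition is dropped; if `N`
    -- survives, the event fails.
    vol-beats : ∀ {P N G H T′ T} → Some P N → Tilted (Value x (+ 1)) G P → Tilted (Value x (ℤ.- + 1)) H N →
                Emitted (Value x (+ 0)) T′ T → HasVol (event (x ∷ c₄ ∷ [])) (T′ ++ (G ++ (H ++ []))) (beats P N T)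
    vol-beats = vol-race (event (x ∷ c₄ ∷ [])) sum-zero [] won lost

    vol-beaten : ∀ {P N G H T′ T} → Some N P → Tilted (Value x (ℤ.- + 1)) H N → Tilted (Value x (+ 1)) G P →
                 Emitted (Value x (+ 0)) T′ T → HasVol (event (x ∷ c₄ ∷ [])) (T′ ++ (H ++ (G ++ []))) (beaten N P T)
    vol-beaten = vol-race (event (x ∷ c₄ ∷ [])) sum-zero′ [] lost won

  event-swap : ∀ x y Λ u → event (x ∷ y ∷ Λ) u ≡ event (y ∷ x ∷ Λ) u
  event-swap x y Λ u = trans (sym (ℕ.*-assoc (pos (fun x u)) (pos (fun y u)) (event Λ u)))
    (trans (cong (ℕ._* event Λ u) (ℕ.*-comm (pos (fun x u)) (pos (fun y u)))) (ℕ.*-assoc (pos (fun y u)) (pos (fun x u)) (event Λ u)))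

  event-front : ∀ x y z Λ u → event (x ∷ y ∷ z ∷ Λ) u ≡ event (z ∷ x ∷ y ∷ Λ) u
  event-front x y z Λ u = trans (cong (pos (fun x u) ℕ.*_) (event-swap y z Λ u)) (event-swap x z (y ∷ Λ) u)

  Values : (x y z : Functional) (i j k : ℤ) → Point → Set
  Values x y z i j k v = fun x v ≡ i × fun y v ≡ j × fun z v ≡ k

  open import Algebra.Solver.CommutativeMonoid (++-commutativeMonoid {A = Gen}) using (solve; _⊜_)
    renaming (_⊕_ to _∙_; id to ε)

  private
    pattern 0± = + 0
    pattern 1⁺ = + 1
    pattern 1⁻ = -[1+ 0 ]

    difference : ∀ {a b} i j → a ≡ i → b ≡ j → + 0 ℤ.≤ i ℤ.- j → + 0 ℤ.≤ a ℤ.- b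
    difference i j refl refl le = le

    sum≥0 : ∀ {a b} i j → a ≡ i → b ≡ j → + 0 ℤ.≤ i ℤ.+ j → + 0 ℤ.≤ a ℤ.+ b
    sum≥0 i j refl refl le = le

    sum≤0 : ∀ {a b} i j → a ≡ i → b ≡ j → i ℤ.+ j ℤ.≤ + 0 → a ℤ.+ b ℤ.≤ + 0
    sum≤0 i j refl refl le = le

    0≤ : ∀ {n} → + 0 ℤ.≤ + n
    0≤ = ℤ.+≤+ z≤n

    ≤0 : ∀ {n} → -[1+ n ] ℤ.≤ + 0
    ≤0 = ℤ.-≤+

  -- The directions (p , q , r) = (1 , ∗ , ∗) race against (−1 , ∗ , ∗), where q − p and r − p never decrease.
  vol-single : ∀ p q r {P N G H T′ T} → Some P N →
    Tilted (Values p q r 1⁺ 1⁺ 1⁺) G P →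
    Tilted (λ v → fun p v ≡ 1⁻ × + 0 ℤ.≤ fun q v ℤ.- fun p v × + 0 ℤ.≤ fun r v ℤ.- fun p v) H N →
    Emitted (Values p q r 0± 0± 0±) T′ T →
    HasVol (event (p ∷ q ∷ r ∷ c₄ ∷ [])) (T′ ++ (G ++ (H ++ []))) (beats P N T)
  vol-single p q r {G = G} {H} {T′} ne tp tn te =
    vol-dominate p q (r ∷ c₄ ∷ []) (inc q (λ { (e , f , _) → difference 0± 0± f e 0≤ }) (λ { (e , f , _) → difference 1⁺ 1⁺ f e 0≤ }) (λ { (_ , i , _) → i })) nt
    (vol-dominate p r (c₄ ∷ []) (inc r (λ { (e , _ , f) → difference 0± 0± f e 0≤ }) (λ { (e , _ , f) → difference 1⁺ 1⁺ f e 0≤ }) (λ { (_ , _ , i) → i })) nt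
    (vol-beats p ne (tilted-map proj₁ tp) (tilted-map proj₁ tn) (emitted-map proj₁ te)))
    where
    inc : ∀ s → (∀ {v} → Values p q r 0± 0± 0± v → + 0 ℤ.≤ fun s v ℤ.- fun p v) →
          (∀ {v} → Values p q r 1⁺ 1⁺ 1⁺ v → + 0 ℤ.≤ fun s v ℤ.- fun p v) →
          (∀ {v} → fun p v ≡ 1⁻ × + 0 ℤ.≤ fun q v ℤ.- fun p v × + 0 ℤ.≤ fun r v ℤ.- fun p v → + 0 ℤ.≤ fun s v ℤ.- fun p v) →
          Increasing (s -ᶠ p) (T′ ++ (G ++ (H ++ [])))
    inc s f g h = All.++⁺ (All.map f (emitted-all te)) (All.++⁺ (All.map g (tilted-all tp)) (All.++⁺ (All.map h (tilted-all tn)) []))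
    nontrivial : ∀ {P N G H} → Some P N → Tilted (Values p q r 1⁺ 1⁺ 1⁺) G P →
      Tilted (λ v → fun p v ≡ 1⁻ × + 0 ℤ.≤ fun q v ℤ.- fun p v × + 0 ℤ.≤ fun r v ℤ.- fun p v) H N → Nontrivial p (G ++ (H ++ []))
    nontrivial left          tp tn = Any.++⁺ˡ (tilted-any (λ { (e , _) → ≢zero 1⁺ e (λ ()) }) tp)
    nontrivial {G = G} right tp tn = Any.++⁺ʳ G (Any.++⁺ˡ (tilted-any (λ { (e , _) → ≢zero 1⁻ e (λ ()) }) tn))
    nt : Nontrivial p (T′ ++ (G ++ (H ++ [])))
    nt = Any.++⁺ʳ T′ (nontrivial ne tp tn)

  -- Two positive values have a positive sum, so it suffices that the sum never increases.
  vol-fail₂ : ∀ p q {Λ M} → (∀ u → event Λ u ≤ pos (fun p u) ℕ.* pos (fun q u)) →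
    All (λ g → fun p (v g) ℤ.+ fun q (v g) ℤ.≤ + 0) M → Any (λ g → fun p (v g) ℤ.+ fun q (v g) ≢ + 0) M →
    HasVol (event Λ) M (+ 0)
  vol-fail₂ p q le = vol-fail (p +ᶠ q) λ u → ℕ.≤-trans (le u) (both (fun p u) (fun q u))
    where
    both : ∀ a b → pos a ℕ.* pos b ≤ pos (a ℤ.+ b)
    both (+ zero)  b          = z≤n
    both (+ suc m) (+ zero)   = z≤n
    both (+ suc m) (+ suc n)  = ℕ.≤-refl
    both (+ suc m) -[1+ n ]   = z≤n
    both -[1+ m ]  b          = z≤n

  module Cases (x y z : Functional) where
    private
      Λ : List Functional
      Λ = x ∷ y ∷ z ∷ c₄ ∷ []
      K : (i j k : ℤ) → Point → Set
      K = Values x y z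

    module _ where
      xy≤ : ∀ u → event Λ u ≤ pos (fun x u) ℕ.* pos (fun y u)
      xy≤ u = subst (event Λ u ≤_) (cong (pos (fun x u) ℕ.*_) (ℕ.*-identityʳ _))
        (ℕ.*-monoʳ-≤ (pos (fun x u)) (ℕ.*-monoʳ-≤ (pos (fun y u)) (event-≤1 (z ∷ c₄ ∷ []) u)))
      xz≤ : ∀ u → event Λ u ≤ pos (fun x u) ℕ.* pos (fun z u)
      xz≤ u = subst (_≤ pos (fun x u) ℕ.* pos (fun z u)) (cong (pos (fun x u) ℕ.*_) (event-swap z y (c₄ ∷ []) u))
        (subst (event (x ∷ z ∷ y ∷ c₄ ∷ []) u ≤_) (cong (pos (fun x u) ℕ.*_) (ℕ.*-identityʳ _))
          (ℕ.*-monoʳ-≤ (pos (fun x u)) (ℕ.*-monoʳ-≤ (pos (fun z u)) (event-≤1 (y ∷ c₄ ∷ []) u))))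
      yz≤ : ∀ u → event Λ u ≤ pos (fun y u) ℕ.* pos (fun z u)
      yz≤ u = ℕ.≤-trans (ℕ.*-monoˡ-≤ (event (y ∷ z ∷ c₄ ∷ []) u) (pos-≤1 (fun x u))) (subst (_≤ pos (fun y u) ℕ.* pos (fun z u))
        (sym (ℕ.*-identityˡ _)) (subst (event (y ∷ z ∷ c₄ ∷ []) u ≤_) (cong (pos (fun y u) ℕ.*_) (ℕ.*-identityʳ _))
          (ℕ.*-monoʳ-≤ (pos (fun y u)) (ℕ.*-monoʳ-≤ (pos (fun z u)) (event-≤1 (c₄ ∷ []) u)))))

    private
      values-+ : ∀ {i j k i′ j′ k′ u w} → K i j k u → K i′ j′ k′ w → K (i ℤ.+ i′) (j ℤ.+ j′) (k ℤ.+ k′) (u ⊹ w)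
      values-+ {u = u} {w} (a , b , c) (a′ , b′ , c′) =
        trans (add x u w) (cong₂ ℤ._+_ a a′) , trans (add y u w) (cong₂ ℤ._+_ b b′) , trans (add z u w) (cong₂ ℤ._+_ c c′)

    -- No direction has another coordinate smaller than its first one, so positivity of `x` implies
    -- the rest up to a window.
    vol₊₋₋ : ∀ {d D a A b B c C G₀ G₁ G₂ G₃ T′ T} →
      Tilted (K 1⁺ 1⁺ 1⁺) G₀ (d ∷ D) → Tilted (K 1⁻ 1⁺ 1⁺) G₁ (a ∷ A) → Tilted (K 1⁻ 1⁺ 1⁻) G₂ (b ∷ B) → Tilted (K 1⁻ 1⁻ 1⁺) G₃ (c ∷ C) →
      Emitted (K 0± 0± 0±) T′ T →
      HasVol (event Λ) (T′ ++ (G₀ ++ (G₁ ++ (G₂ ++ G₃)))) (case₊₋₋ (d ∷ D) (a ∷ A) (b ∷ B) (c ∷ C) T)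
    vol₊₋₋ {G₀ = G₀} {G₁} {G₂} {G₃} {T′} p₀ p₁ p₂ p₃ e =
      vol-↭ (solve 5 (λ t g h i j → (t ∙ (g ∙ ((h ∙ (i ∙ j)) ∙ ε))) ⊜ (t ∙ (g ∙ (h ∙ (i ∙ j))))) ↭-refl T′ G₀ G₁ G₂ G₃)
        (vol-single x y z left p₀
          (tilted-map (λ { (f , g , h) → f , difference 1⁺ 1⁻ g f 0≤ , difference 1⁺ 1⁻ h f 0≤ }) p₁ ++ᵗ
           (tilted-map (λ { (f , g , h) → f , difference 1⁺ 1⁻ g f 0≤ , difference 1⁻ 1⁻ h f 0≤ }) p₂ ++ᵗ
            tilted-map (λ { (f , g , h) → f , difference 1⁻ 1⁻ g f 0≤ , difference 1⁺ 1⁻ h f 0≤ }) p₃)) e)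

    vol₊₊₋ : ∀ {d D a A b B c C G₀ G₁ G₂ G₃ T′ T} →
      Tilted (K 1⁺ 1⁺ 1⁺) G₀ (d ∷ D) → Tilted (K 1⁻ 1⁺ 1⁺) G₁ (a ∷ A) → Tilted (K 1⁺ 1⁻ 1⁺) G₂ (b ∷ B) → Tilted (K 1⁻ 1⁻ 1⁺) G₃ (c ∷ C) →
      Emitted (K 0± 0± 0±) T′ T →
      HasVol (event Λ) (T′ ++ (G₁ ++ (G₂ ++ (G₀ ++ G₃)))) (case₊₊₋ (d ∷ D) (a ∷ A) (b ∷ B) (c ∷ C) T)
    vol₊₊₋ {d} {D} {c = c} {C} {G₀} {G₁} {G₂} {G₃} {T′} p₀ p₁ p₂ p₃ e =
      vol-≗ (λ u → sym (event-front x y z (c₄ ∷ []) u))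
        (vol-drop z (x ∷ y ∷ c₄ ∷ [])
          (All.++⁺ (All.map (λ { (_ , _ , f) → zero≤ 0 f }) (emitted-all e)) (All.++⁺ (All.map (λ { (_ , _ , f) → zero≤ 1 f }) (tilted-all p₁))
            (All.++⁺ (All.map (λ { (_ , _ , f) → zero≤ 1 f }) (tilted-all p₂)) (All.++⁺ (All.map (λ { (_ , _ , f) → zero≤ 1 f }) (tilted-all p₀))
              (All.map (λ { (_ , _ , f) → zero≤ 1 f }) (tilted-all p₃))))))
          (Any.++⁺ʳ T′ (Any.++⁺ˡ (tilted-any (λ { (_ , _ , f) → ≢zero 1⁺ f (λ ()) }) p₁)))
          (vol-race {Z = Z} (event (x ∷ y ∷ c₄ ∷ [])) (λ p q → let (f , g , _) = values-+ p q in f , g) (G₀ ++ G₃)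
            after-B after-A left p₁ p₂ (emitted-map (λ { (f , g , _) → f , g }) e)))
      where
      Z : Point → Set
      Z v = fun x v ≡ 0± × fun y v ≡ 0±
      after-B : ∀ {a A G T′ T} → Tilted (K 1⁻ 1⁺ 1⁺) G (a ∷ A) → Emitted Z T′ T →
        HasVol (event (x ∷ y ∷ c₄ ∷ [])) (T′ ++ (G ++ (G₀ ++ G₃))) (beats (d ∷ D) (a ∷ A ++ (c ∷ C)) T)
      after-B {G = G} {T′} p e = vol-dominate x y (c₄ ∷ [])
        (All.++⁺ (All.map (λ { (f , g) → difference 0± 0± g f 0≤ }) (emitted-all e)) (All.++⁺ (All.map (λ { (f , g , _) → difference 1⁺ 1⁻ g f 0≤ }) (tilted-all p))
          (All.++⁺ (All.map (λ { (f , g , _) → difference 1⁺ 1⁺ g f 0≤ }) (tilted-all p₀)) (All.map (λ { (f , g , _) → difference 1⁻ 1⁻ g f 0≤ }) (tilted-all p₃)))))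
        (Any.++⁺ʳ T′ (Any.++⁺ˡ (tilted-any (λ { (f , _) → ≢zero 1⁻ f (λ ()) }) p)))
        (vol-↭ (solve 4 (λ t g h i → (t ∙ (g ∙ ((h ∙ i) ∙ ε))) ⊜ (t ∙ (h ∙ (g ∙ i)))) ↭-refl T′ G₀ G G₃)
          (vol-beats x left (tilted-map proj₁ p₀) (tilted-map proj₁ p ++ᵗ tilted-map proj₁ p₃) (emitted-map proj₁ e)))
      after-A : ∀ {b B G T′ T} → Tilted (K 1⁺ 1⁻ 1⁺) G (b ∷ B) → Emitted Z T′ T →
        HasVol (event (x ∷ y ∷ c₄ ∷ [])) (T′ ++ (G ++ (G₀ ++ G₃))) (beats (d ∷ D) (b ∷ B ++ (c ∷ C)) T)
      after-A {G = G} {T′} p e = vol-≗ (event-swap y x (c₄ ∷ [])) (vol-dominate y x (c₄ ∷ [])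
        (All.++⁺ (All.map (λ { (f , g) → difference 0± 0± f g 0≤ }) (emitted-all e)) (All.++⁺ (All.map (λ { (f , g , _) → difference 1⁺ 1⁻ f g 0≤ }) (tilted-all p))
          (All.++⁺ (All.map (λ { (f , g , _) → difference 1⁺ 1⁺ f g 0≤ }) (tilted-all p₀)) (All.map (λ { (f , g , _) → difference 1⁻ 1⁻ f g 0≤ }) (tilted-all p₃)))))
        (Any.++⁺ʳ T′ (Any.++⁺ˡ (tilted-any (λ { (_ , g , _) → ≢zero 1⁻ g (λ ()) }) p)))
        (vol-↭ (solve 4 (λ t g h i → (t ∙ (g ∙ ((h ∙ i) ∙ ε))) ⊜ (t ∙ (h ∙ (g ∙ i)))) ↭-refl T′ G₀ G G₃)
          (vol-beats y left (tilted-map (λ q → proj₁ (proj₂ q)) p₀)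
            (tilted-map (λ q → proj₁ (proj₂ q)) p ++ᵗ tilted-map (λ q → proj₁ (proj₂ q)) p₃) (emitted-map proj₂ e))))

    vol₊₊₊ : ∀ {D a A b B c C G₀ G₁ G₂ G₃ T′ T} →
      Tilted (K 1⁺ 1⁺ 1⁺) G₀ D → Tilted (K 1⁻ 1⁺ 1⁺) G₁ (a ∷ A) → Tilted (K 1⁺ 1⁻ 1⁺) G₂ (b ∷ B) → Tilted (K 1⁺ 1⁺ 1⁻) G₃ (c ∷ C) →
      Emitted (K 0± 0± 0±) T′ T →
      HasVol (event Λ) (T′ ++ (G₃ ++ (G₂ ++ (G₁ ++ G₀)))) (case₊₊₊ D (a ∷ A) (b ∷ B) (c ∷ C) T)
    vol₊₊₊ {G₀ = G₀} {G₁} {G₂} {G₃} {T′} p₀ p₁ p₂ p₃ e = vol-inclusion–exclusion x y z (c₄ ∷ [])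
        (inc x y (λ { (f , g , h) → sum≥0 0± 0± f g 0≤ }) (λ { (f , g , h) → sum≥0 1⁺ 1⁺ f g 0≤ }) (λ { (f , g , h) → sum≥0 1⁻ 1⁺ f g 0≤ })
                 (λ { (f , g , h) → sum≥0 1⁺ 1⁻ f g 0≤ }) (λ { (f , g , h) → sum≥0 1⁺ 1⁺ f g 0≤ }))
        (inc x z (λ { (f , g , h) → sum≥0 0± 0± f h 0≤ }) (λ { (f , g , h) → sum≥0 1⁺ 1⁺ f h 0≤ }) (λ { (f , g , h) → sum≥0 1⁻ 1⁺ f h 0≤ })
                 (λ { (f , g , h) → sum≥0 1⁺ 1⁺ f h 0≤ }) (λ { (f , g , h) → sum≥0 1⁺ 1⁻ f h 0≤ }))
        (inc y z (λ { (f , g , h) → sum≥0 0± 0± g h 0≤ }) (λ { (f , g , h) → sum≥0 1⁺ 1⁺ g h 0≤ }) (λ { (f , g , h) → sum≥0 1⁺ 1⁺ g h 0≤ })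
                 (λ { (f , g , h) → sum≥0 1⁻ 1⁺ g h 0≤ }) (λ { (f , g , h) → sum≥0 1⁺ 1⁻ g h 0≤ }))
        (Any.++⁺ʳ T′ (Any.++⁺ˡ (tilted-any (λ { (f , g , h) → ≢zero (+ 2) (cong₂ ℤ._+_ f g) (λ ()) }) p₃)))
        (Any.++⁺ʳ T′ (Any.++⁺ʳ G₃ (Any.++⁺ˡ (tilted-any (λ { (f , g , h) → ≢zero (+ 2) (cong₂ ℤ._+_ f h) (λ ()) }) p₂))))
        (Any.++⁺ʳ T′ (Any.++⁺ʳ G₃ (Any.++⁺ʳ G₂ (Any.++⁺ˡ (tilted-any (λ { (f , g , h) → ≢zero (+ 2) (cong₂ ℤ._+_ g h) (λ ()) }) p₁)))))
        (vol-↭ (solve 5 (λ t g h i j → (t ∙ (h ∙ ((j ∙ (i ∙ g)) ∙ ε))) ⊜ (t ∙ (j ∙ (i ∙ (h ∙ g))))) ↭-refl T′ G₀ G₁ G₂ G₃)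
          (vol-beaten x left (tilted-map X p₁) (tilted-map X p₃ ++ᵗ (tilted-map X p₂ ++ᵗ tilted-map X p₀)) (emitted-map X e)))
        (vol-↭ (solve 5 (λ t g h i j → (t ∙ (i ∙ ((j ∙ (h ∙ g)) ∙ ε))) ⊜ (t ∙ (j ∙ (i ∙ (h ∙ g))))) ↭-refl T′ G₀ G₁ G₂ G₃)
          (vol-beaten y left (tilted-map Y p₂) (tilted-map Y p₃ ++ᵗ (tilted-map Y p₁ ++ᵗ tilted-map Y p₀)) (emitted-map Y e)))
        (vol-↭ (solve 5 (λ t g h i j → (t ∙ (j ∙ ((i ∙ (h ∙ g)) ∙ ε))) ⊜ (t ∙ (j ∙ (i ∙ (h ∙ g))))) ↭-refl T′ G₀ G₁ G₂ G₃)
          (vol-beaten z left (tilted-map Z p₃) (tilted-map Z p₂ ++ᵗ (tilted-map Z p₁ ++ᵗ tilted-map Z p₀)) (emitted-map Z e)))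
        (vol-leaf {K = λ _ → ⊤} (tilted-map (λ _ → tt) p₃ ++ᵗ (tilted-map (λ _ → tt) p₂ ++ᵗ (tilted-map (λ _ → tt) p₁ ++ᵗ tilted-map (λ _ → tt) p₀))) e)
      where
      X : ∀ {i j k v} → K i j k v → fun x v ≡ i
      X = proj₁
      Y : ∀ {i j k v} → K i j k v → fun y v ≡ j
      Y q = proj₁ (proj₂ q)
      Z : ∀ {i j k v} → K i j k v → fun z v ≡ k
      Z q = proj₂ (proj₂ q)
      inc : ∀ s t → let P : Point → Set ; P v = + 0 ℤ.≤ fun s v ℤ.+ fun t v in
            (∀ {v} → K 0± 0± 0± v → P v) → (∀ {v} → K 1⁺ 1⁺ 1⁺ v → P v) → (∀ {v} → K 1⁻ 1⁺ 1⁺ v → P v) →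
            (∀ {v} → K 1⁺ 1⁻ 1⁺ v → P v) → (∀ {v} → K 1⁺ 1⁺ 1⁻ v → P v) → Increasing (s +ᶠ t) (T′ ++ (G₃ ++ (G₂ ++ (G₁ ++ G₀))))
      inc s t f f₀ f₁ f₂ f₃ = All.++⁺ (All.map f (emitted-all e)) (All.++⁺ (All.map f₃ (tilted-all p₃)) (All.++⁺ (All.map f₂ (tilted-all p₂))
        (All.++⁺ (All.map f₁ (tilted-all p₁)) (All.map f₀ (tilted-all p₀)))))

    vol₋₋₋ : ∀ {d D a A b B c C G₀ G₁ G₂ G₃ T′ T} →
      Tilted (K 1⁺ 1⁺ 1⁺) G₀ (d ∷ D) → Tilted (K 1⁺ 1⁻ 1⁻) G₁ (a ∷ A) → Tilted (K 1⁻ 1⁺ 1⁻) G₂ (b ∷ B) → Tilted (K 1⁻ 1⁻ 1⁺) G₃ (c ∷ C) →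
      Emitted (K 0± 0± 0±) T′ T →
      HasVol (event Λ) (T′ ++ (G₀ ++ (G₁ ++ (G₂ ++ G₃)))) (case₋₋₋ (d ∷ D) (a ∷ A) (b ∷ B) (c ∷ C) T)
    vol₋₋₋ = vol-quad (event Λ) (λ p q r s → values-+ (values-+ (values-+ p q) r) s)
      (λ {_} {_} {_} {_} {_} {_} {G₁} {G₂} {G₃} {T′} p q r e → vol-fail₂ x y {Λ} xy≤
        (All.++⁺ (All.map (λ { (f , g , h) → sum≤0 0± 0± f g 0≤ }) (emitted-all e)) (All.++⁺ (All.map (λ { (f , g , h) → sum≤0 1⁺ 1⁻ f g 0≤ }) (tilted-all p))
          (All.++⁺ (All.map (λ { (f , g , h) → sum≤0 1⁻ 1⁺ f g 0≤ }) (tilted-all q)) (All.map (λ { (f , g , h) → sum≤0 1⁻ 1⁻ f g ≤0 }) (tilted-all r)))))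
        (Any.++⁺ʳ T′ (Any.++⁺ʳ G₁ (Any.++⁺ʳ G₂ (tilted-any (λ { (f , g , h) → ≢zero (ℤ.- + 2) (cong₂ ℤ._+_ f g) (λ ()) }) r)))))
      (λ {_} {_} {_} {_} {_} {_} {G₁} {G₂} {G₃} {T′} p q r e → flatten T′ G₁ G₂ G₃ (vol-single x y z left p
        (tilted-map (λ { (f , g , h) → f , difference 1⁺ 1⁻ g f 0≤ , difference 1⁻ 1⁻ h f 0≤ }) q ++ᵗ
         tilted-map (λ { (f , g , h) → f , difference 1⁻ 1⁻ g f 0≤ , difference 1⁺ 1⁻ h f 0≤ }) r) e))
      (λ {_} {_} {_} {_} {_} {_} {G₁} {G₂} {G₃} {T′} p q r e → vol-≗ (event-swap y x (z ∷ c₄ ∷ [])) (flatten T′ G₁ G₂ G₃ (vol-single y x z left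
        (tilted-map (λ { (f , g , h) → g , f , h }) p)
        (tilted-map (λ { (f , g , h) → g , difference 1⁺ 1⁻ f g 0≤ , difference 1⁻ 1⁻ h g 0≤ }) q ++ᵗ
         tilted-map (λ { (f , g , h) → g , difference 1⁻ 1⁻ f g 0≤ , difference 1⁺ 1⁻ h g 0≤ }) r)
        (emitted-map (λ { (f , g , h) → g , f , h }) e))))
      (λ {_} {_} {_} {_} {_} {_} {G₁} {G₂} {G₃} {T′} p q r e → vol-≗ (λ u → sym (event-front x y z (c₄ ∷ []) u)) (flatten T′ G₁ G₂ G₃ (vol-single z x y left
        (tilted-map (λ { (f , g , h) → h , f , g }) p)
        (tilted-map (λ { (f , g , h) → h , difference 1⁺ 1⁻ f h 0≤ , difference 1⁻ 1⁻ g h 0≤ }) q ++ᵗ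
         tilted-map (λ { (f , g , h) → h , difference 1⁻ 1⁻ f h 0≤ , difference 1⁺ 1⁻ g h 0≤ }) r)
        (emitted-map (λ { (f , g , h) → h , f , g }) e))))
      where
      flatten : ∀ {φ w} T′ G₁ G₂ G₃ → HasVol φ (T′ ++ (G₁ ++ ((G₂ ++ G₃) ++ []))) w → HasVol φ (T′ ++ (G₁ ++ (G₂ ++ G₃))) w
      flatten T′ G₁ G₂ G₃ = vol-↭ (solve 4 (λ t g h i → (t ∙ (g ∙ ((h ∙ i) ∙ ε))) ⊜ (t ∙ (g ∙ (h ∙ i)))) ↭-refl T′ G₁ G₂ G₃)

    vol⁻ : ∀ {d D a A b B c C G₀ G₁ G₂ G₃ T′ T} →
      Tilted (K 1⁻ 1⁻ 1⁻) G₀ (d ∷ D) → Tilted (K 1⁻ 1⁺ 1⁺) G₁ (a ∷ A) → Tilted (K 1⁺ 1⁻ 1⁺) G₂ (b ∷ B) → Tilted (K 1⁺ 1⁺ 1⁻) G₃ (c ∷ C) →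
      Emitted (K 0± 0± 0±) T′ T →
      HasVol (event Λ) (T′ ++ (G₀ ++ (G₁ ++ (G₂ ++ G₃)))) (case⁻ (d ∷ D) (a ∷ A) (b ∷ B) (c ∷ C) T)
    vol⁻ = vol-quad (event Λ) (λ p q r s → values-+ (values-+ (values-+ p q) r) s)
      (λ {_} {_} {_} {_} {_} {_} {G₁} {G₂} {G₃} {T′} p q r e →
        vol-↭ (solve 4 (λ t g h i → (t ∙ (i ∙ (h ∙ (g ∙ ε)))) ⊜ (t ∙ (g ∙ (h ∙ i)))) ↭-refl T′ G₁ G₂ G₃) (vol₊₊₊ [] p q r e))
      (λ p q r e → fail y z yz≤ p q r e (λ { (_ , f , g) → f , g }) (λ { (_ , f , g) → f , g }) (λ { (_ , f , g) → f , g }) (λ { (_ , f , g) → f , g }))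
      (λ p q r e → fail x z xz≤ p q r e (λ { (f , _ , g) → f , g }) (λ { (f , _ , g) → f , g }) (λ { (f , _ , g) → f , g }) (λ { (f , _ , g) → f , g }))
      (λ p q r e → fail x y xy≤ p q r e (λ { (f , g , _) → f , g }) (λ { (f , g , _) → f , g }) (λ { (f , g , _) → f , g }) (λ { (f , g , _) → f , g }))
      where
      fail : ∀ s t {P Q R Z : Point → Set} (le : ∀ u → event Λ u ≤ pos (fun s u) ℕ.* pos (fun t u)) {a A B C G₁ G₂ G₃ T′ T} →
        Tilted P G₁ (a ∷ A) → Tilted Q G₂ B → Tilted R G₃ C → Emitted Z T′ T →
        (∀ {v} → Z v → fun s v ≡ 0± × fun t v ≡ 0±) → (∀ {v} → P v → fun s v ≡ 1⁻ × fun t v ≡ 1⁻) →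
        (∀ {v} → Q v → fun s v ≡ 1⁻ × fun t v ≡ 1⁺) → (∀ {v} → R v → fun s v ≡ 1⁺ × fun t v ≡ 1⁻) →
        HasVol (event Λ) (T′ ++ (G₁ ++ (G₂ ++ G₃))) (+ 0)
      fail s t le {T′ = T′} p q r e fz fp fq fr = vol-fail₂ s t {Λ} le
        (All.++⁺ (All.map (λ h → let (f , g) = fz h in sum≤0 0± 0± f g 0≤) (emitted-all e))
          (All.++⁺ (All.map (λ h → let (f , g) = fp h in sum≤0 1⁻ 1⁻ f g ≤0) (tilted-all p))
          (All.++⁺ (All.map (λ h → let (f , g) = fq h in sum≤0 1⁻ 1⁺ f g 0≤) (tilted-all q))
                   (All.map (λ h → let (f , g) = fr h in sum≤0 1⁺ 1⁻ f g 0≤) (tilted-all r)))))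
        (Any.++⁺ʳ T′ (Any.++⁺ˡ (tilted-any (λ h → let (f , g) = fp h in ≢zero (ℤ.- + 2) (cong₂ ℤ._+_ f g) (λ ())) p)))

  module Total (x y z : Functional) {a₀ b₀ d₀ e₀ : Tilt} {A B D E : List Tilt} where
    private
      A⁺′ A⁻′ D⁺′ D⁻′ : List Tilt
      A⁺′ = a₀ ∷ A
      A⁻′ = b₀ ∷ B
      D⁺′ = d₀ ∷ D
      D⁻′ = e₀ ∷ E
      Λ : List Functional
      Λ = x ∷ y ∷ z ∷ c₄ ∷ []
      K : (i j k : ℤ) → Point → Set
      K = Values x y z
      values-+ : ∀ {i j k i′ j′ k′ u w} → K i j k u → K i′ j′ k′ w → K (i ℤ.+ i′) (j ℤ.+ j′) (k ℤ.+ k′) (u ⊹ w)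
      values-+ {u = u} {w} (a , b , c) (a′ , b′ , c′) =
        trans (add x u w) (cong₂ ℤ._+_ a a′) , trans (add y u w) (cong₂ ℤ._+_ b b′) , trans (add z u w) (cong₂ ℤ._+_ c c′)
      xzy : ∀ {i j k v} → Values x y z i j k v → Values x z y i k j v
      xzy (f , g , h) = f , h , g
      yzx : ∀ {i j k v} → Values x y z i j k v → Values y z x j k i v
      yzx (f , g , h) = g , h , f
      yxz : ∀ {i j k v} → Values x y z i j k v → Values y x z j i k v
      yxz (f , g , h) = g , f , h
      zxy : ∀ {i j k v} → Values x y z i j k v → Values z x y k i j v
      zxy (f , g , h) = h , f , g

      as-xzy : ∀ {M w} → HasVol (event (x ∷ z ∷ y ∷ c₄ ∷ [])) M w → HasVol (event Λ) M w
      as-xzy = vol-≗ λ u → cong (pos (fun x u) ℕ.*_) (event-swap z y (c₄ ∷ []) u)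
      as-yxz : ∀ {M w} → HasVol (event (y ∷ x ∷ z ∷ c₄ ∷ [])) M w → HasVol (event Λ) M w
      as-yxz = vol-≗ λ u → event-swap y x (z ∷ c₄ ∷ []) u
      as-yzx : ∀ {M w} → HasVol (event (y ∷ z ∷ x ∷ c₄ ∷ [])) M w → HasVol (event Λ) M w
      as-yzx = vol-≗ λ u → event-front y z x (c₄ ∷ []) u
      as-zxy : ∀ {M w} → HasVol (event (z ∷ x ∷ y ∷ c₄ ∷ [])) M w → HasVol (event Λ) M w
      as-zxy = vol-≗ λ u → sym (event-front x y z (c₄ ∷ []) u)

    module _ {P₀ M₀ P₁ M₁ P₂ M₂ P₃ M₃ : List Gen}
      (p₀ : Tilted (K 1⁺ 1⁺ 1⁺) P₀ D⁺′) (m₀ : Tilted (K 1⁻ 1⁻ 1⁻) M₀ D⁻′)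
      (p₁ : Tilted (K 1⁻ 1⁺ 1⁺) P₁ A⁺′) (m₁ : Tilted (K 1⁺ 1⁻ 1⁻) M₁ A⁻′)
      (p₂ : Tilted (K 1⁺ 1⁻ 1⁺) P₂ A⁺′) (m₂ : Tilted (K 1⁻ 1⁺ 1⁻) M₂ A⁻′)
      (p₃ : Tilted (K 1⁺ 1⁺ 1⁻) P₃ A⁺′) (m₃ : Tilted (K 1⁻ 1⁻ 1⁺) M₃ A⁻′) where

      private
        R₃ R₂ R₁ : List Gen
        R₃ = P₃ ++ M₃
        R₂ = P₂ ++ (M₂ ++ R₃)
        R₁ = P₁ ++ (M₁ ++ R₂)

        -- Brings a pair of opposite lists to the front of what is left.
        front : ∀ {φ w} T′ X P M R → HasVol φ (T′ ++ (P ++ (M ++ (X ++ R)))) w → HasVol φ (T′ ++ (X ++ (P ++ (M ++ R)))) w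
        front T′ X P M R = vol-↭ (solve 5 (λ t x p m r → (t ∙ (p ∙ (m ∙ (x ∙ r)))) ⊜ (t ∙ (x ∙ (p ∙ (m ∙ r))))) ↭-refl T′ X P M R)

        front₂ : ∀ {φ w} T′ X Y P M R → HasVol φ (T′ ++ (P ++ (M ++ (Y ++ (X ++ R))))) w → HasVol φ (T′ ++ (Y ++ (X ++ (P ++ (M ++ R))))) w
        front₂ T′ X Y P M R = vol-↭ (solve 6 (λ t x y p m r → (t ∙ (p ∙ (m ∙ (y ∙ (x ∙ r))))) ⊜ (t ∙ (y ∙ (x ∙ (p ∙ (m ∙ r)))))) ↭-refl T′ X Y P M R)

        front₃ : ∀ {φ w} T′ X Y Z P M → HasVol φ (T′ ++ (P ++ (M ++ (Z ++ (Y ++ X))))) w → HasVol φ (T′ ++ (Z ++ (Y ++ (X ++ (P ++ M))))) w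
        front₃ T′ X Y Z P M = vol-↭ (solve 6 (λ t x y z p m → (t ∙ (p ∙ (m ∙ (z ∙ (y ∙ x))))) ⊜ (t ∙ (z ∙ (y ∙ (x ∙ (p ∙ m)))))) ↭-refl T′ X Y Z P M)

        -- From the orders used in the cases to the order in which the lines are resolved.
        order₁ : ∀ {φ w} T′ D A B C → HasVol φ (T′ ++ (A ++ (B ++ (D ++ C)))) w → HasVol φ (T′ ++ (C ++ (B ++ (A ++ D)))) w
        order₁ T′ D A B C = vol-↭ (solve 5 (λ t d a b c → (t ∙ (a ∙ (b ∙ (d ∙ c)))) ⊜ (t ∙ (c ∙ (b ∙ (a ∙ d))))) ↭-refl T′ D A B C)
        order₂ : ∀ {φ w} T′ D A B C → HasVol φ (T′ ++ (A ++ (C ++ (D ++ B)))) w → HasVol φ (T′ ++ (C ++ (B ++ (A ++ D)))) w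
        order₂ T′ D A B C = vol-↭ (solve 5 (λ t d a b c → (t ∙ (a ∙ (c ∙ (d ∙ b)))) ⊜ (t ∙ (c ∙ (b ∙ (a ∙ d))))) ↭-refl T′ D A B C)
        order₃ : ∀ {φ w} T′ D A B C → HasVol φ (T′ ++ (B ++ (C ++ (D ++ A)))) w → HasVol φ (T′ ++ (C ++ (B ++ (A ++ D)))) w
        order₃ T′ D A B C = vol-↭ (solve 5 (λ t d a b c → (t ∙ (b ∙ (c ∙ (d ∙ a)))) ⊜ (t ∙ (c ∙ (b ∙ (a ∙ d))))) ↭-refl T′ D A B C)
        order₄ : ∀ {φ w} T′ D A B C → HasVol φ (T′ ++ (D ++ (A ++ (B ++ C)))) w → HasVol φ (T′ ++ (C ++ (B ++ (A ++ D)))) w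
        order₄ T′ D A B C = vol-↭ (solve 5 (λ t d a b c → (t ∙ (d ∙ (a ∙ (b ∙ c)))) ⊜ (t ∙ (c ∙ (b ∙ (a ∙ d))))) ↭-refl T′ D A B C)
        order₅ : ∀ {φ w} T′ D A B C → HasVol φ (T′ ++ (D ++ (B ++ (A ++ C)))) w → HasVol φ (T′ ++ (C ++ (B ++ (A ++ D)))) w
        order₅ T′ D A B C = vol-↭ (solve 5 (λ t d a b c → (t ∙ (d ∙ (b ∙ (a ∙ c)))) ⊜ (t ∙ (c ∙ (b ∙ (a ∙ d))))) ↭-refl T′ D A B C)
        order₆ : ∀ {φ w} T′ D A B C → HasVol φ (T′ ++ (D ++ (C ++ (A ++ B)))) w → HasVol φ (T′ ++ (C ++ (B ++ (A ++ D)))) w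
        order₆ T′ D A B C = vol-↭ (solve 5 (λ t d a b c → (t ∙ (d ∙ (c ∙ (a ∙ b)))) ⊜ (t ∙ (c ∙ (b ∙ (a ∙ d))))) ↭-refl T′ D A B C)

        module _ {d D′ G₀} (g₀ : Tilted (K 1⁺ 1⁺ 1⁺) G₀ (d ∷ D′)) where
          module XYZ = Cases x y z

          -- The three other lines are resolved one after the other, each with the lists not yet
          -- resolved as spectators.
          vol-ahead⁺ : ∀ {T′ T} → Emitted (K 0± 0± 0±) T′ T → HasVol (event Λ) (T′ ++ (G₀ ++ R₁)) (ahead⁺ A⁺′ A⁻′ (d ∷ D′) T)
          vol-ahead⁺ {T′} e = front T′ G₀ P₁ M₁ R₂ (vol-race (event Λ) values-+ (G₀ ++ R₂)
            (λ {_} {_} {G₁} {T′} g₁ e → front₂ T′ G₀ G₁ P₂ M₂ R₃ (vol-race (event Λ) values-+ (G₁ ++ (G₀ ++ R₃))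
              (λ {_} {_} {G₂} {T′} g₂ e → front₃ T′ G₀ G₁ G₂ P₃ M₃ (vol-race (event Λ) values-+ (G₂ ++ (G₁ ++ G₀))
                (λ g₃ e → XYZ.vol₊₊₊ g₀ g₁ g₂ g₃ e)
                (λ {_} {_} {G₃} {T′} g₃ e → order₁ T′ G₀ G₁ G₂ G₃ (XYZ.vol₊₊₋ g₀ g₁ g₂ g₃ e)) left p₃ m₃ e))
              (λ {_} {_} {G₂} {T′} g₂ e → front₃ T′ G₀ G₁ G₂ P₃ M₃ (vol-race (event Λ) values-+ (G₂ ++ (G₁ ++ G₀))
                (λ {_} {_} {G₃} {T′} g₃ e → order₂ T′ G₀ G₁ G₂ G₃ (as-xzy (Cases.vol₊₊₋ x z y (tilted-map xzy g₀) (tilted-map xzy g₁) (tilted-map xzy g₃) (tilted-map xzy g₂) (emitted-map xzy e))))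
                (λ {_} {_} {G₃} {T′} g₃ e → order₄ T′ G₀ G₁ G₂ G₃ (XYZ.vol₊₋₋ g₀ g₁ g₂ g₃ e)) left p₃ m₃ e)) left p₂ m₂ e))
            (λ {_} {_} {G₁} {T′} g₁ e → front₂ T′ G₀ G₁ P₂ M₂ R₃ (vol-race (event Λ) values-+ (G₁ ++ (G₀ ++ R₃))
              (λ {_} {_} {G₂} {T′} g₂ e → front₃ T′ G₀ G₁ G₂ P₃ M₃ (vol-race (event Λ) values-+ (G₂ ++ (G₁ ++ G₀))
                (λ {_} {_} {G₃} {T′} g₃ e → order₃ T′ G₀ G₁ G₂ G₃ (as-yzx (Cases.vol₊₊₋ y z x (tilted-map yzx g₀) (tilted-map yzx g₂) (tilted-map yzx g₃) (tilted-map yzx g₁) (emitted-map yzx e))))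
                (λ {_} {_} {G₃} {T′} g₃ e → order₅ T′ G₀ G₁ G₂ G₃ (as-yxz (Cases.vol₊₋₋ y x z (tilted-map yxz g₀) (tilted-map yxz g₂) (tilted-map yxz g₁) (tilted-map yxz g₃) (emitted-map yxz e)))) left p₃ m₃ e))
              (λ {_} {_} {G₂} {T′} g₂ e → front₃ T′ G₀ G₁ G₂ P₃ M₃ (vol-race (event Λ) values-+ (G₂ ++ (G₁ ++ G₀))
                (λ {_} {_} {G₃} {T′} g₃ e → order₆ T′ G₀ G₁ G₂ G₃ (as-zxy (Cases.vol₊₋₋ z x y (tilted-map zxy g₀) (tilted-map zxy g₃) (tilted-map zxy g₁) (tilted-map zxy g₂) (emitted-map zxy e))))
                (λ {_} {_} {G₃} {T′} g₃ e → order₄ T′ G₀ G₁ G₂ G₃ (XYZ.vol₋₋₋ g₀ g₁ g₂ g₃ e)) left p₃ m₃ e)) left p₂ m₂ e)) left p₁ m₁ e)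

        module _ {d D′ G₀} (g₀ : Tilted (K 1⁻ 1⁻ 1⁻) G₀ (d ∷ D′)) where

          open Cases x y z using (xy≤; xz≤; yz≤; vol⁻)

          -- If a minus side survives on some line, then on it and on (-1,-1,-1) the same two
          -- coordinates have sum -2. On the other lines that sum is never positive, so the event
          -- fails even before they are all cut.
          vol-ahead⁻ : ∀ {T′ T} → Emitted (K 0± 0± 0±) T′ T → HasVol (event Λ) (T′ ++ (G₀ ++ R₁)) (ahead⁻ A⁺′ A⁻′ (d ∷ D′) T)
          vol-ahead⁻ {T′} e = front T′ G₀ P₁ M₁ R₂ (vol-race (event Λ) values-+ (G₀ ++ R₂)
            (λ {_} {_} {G₁} {T′} g₁ e → front₂ T′ G₀ G₁ P₂ M₂ R₃ (vol-race (event Λ) values-+ (G₁ ++ (G₀ ++ R₃))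
              (λ {_} {_} {G₂} {T′} g₂ e → front₃ T′ G₀ G₁ G₂ P₃ M₃ (vol-race (event Λ) values-+ (G₂ ++ (G₁ ++ G₀))
                (λ {_} {_} {G₃} {T′} g₃ e → order₄ T′ G₀ G₁ G₂ G₃ (vol⁻ g₀ g₁ g₂ g₃ e))
                (λ {_} {_} {G₃} {T′} g₃ e → vol-fail₂ x y {Λ} xy≤
                  (All.++⁺ (All.map (λ { (f , g , h) → sum≤0 0± 0± f g 0≤ }) (emitted-all e))
                  (All.++⁺ (All.map (λ { (f , g , h) → sum≤0 1⁻ 1⁻ f g ≤0 }) (tilted-all g₃))
                  (All.++⁺ (All.map (λ { (f , g , h) → sum≤0 1⁺ 1⁻ f g 0≤ }) (tilted-all g₂))
                  (All.++⁺ (All.map (λ { (f , g , h) → sum≤0 1⁻ 1⁺ f g 0≤ }) (tilted-all g₁))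
                           (All.map (λ { (f , g , h) → sum≤0 1⁻ 1⁻ f g ≤0 }) (tilted-all g₀))))))
                  (Any.++⁺ʳ T′ (Any.++⁺ˡ (tilted-any (λ { (f , g , h) → ≢zero (ℤ.- + 2) (cong₂ ℤ._+_ f g) (λ ()) }) g₃)))) left p₃ m₃ e))
              (λ {_} {_} {G₂} {T′} g₂ e → vol-fail₂ x z {Λ} xz≤
                  (All.++⁺ (All.map (λ { (f , g , h) → sum≤0 0± 0± f h 0≤ }) (emitted-all e))
                  (All.++⁺ (All.map (λ { (f , g , h) → sum≤0 1⁻ 1⁻ f h ≤0 }) (tilted-all g₂))
                  (All.++⁺ (All.map (λ { (f , g , h) → sum≤0 1⁻ 1⁺ f h 0≤ }) (tilted-all g₁))
                  (All.++⁺ (All.map (λ { (f , g , h) → sum≤0 1⁻ 1⁻ f h ≤0 }) (tilted-all g₀))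
                  (All.++⁺ (All.map (λ { (f , g , h) → sum≤0 1⁺ 1⁻ f h 0≤ }) (tilted-all p₃))
                           (All.map (λ { (f , g , h) → sum≤0 1⁻ 1⁺ f h 0≤ }) (tilted-all m₃)))))))
                  (Any.++⁺ʳ T′ (Any.++⁺ˡ (tilted-any (λ { (f , g , h) → ≢zero (ℤ.- + 2) (cong₂ ℤ._+_ f h) (λ ()) }) g₂)))) left p₂ m₂ e))
            (λ {_} {_} {G₁} {T′} g₁ e → vol-fail₂ y z {Λ} yz≤
                  (All.++⁺ (All.map (λ { (f , g , h) → sum≤0 0± 0± g h 0≤ }) (emitted-all e))
                  (All.++⁺ (All.map (λ { (f , g , h) → sum≤0 1⁻ 1⁻ g h ≤0 }) (tilted-all g₁))
                  (All.++⁺ (All.map (λ { (f , g , h) → sum≤0 1⁻ 1⁻ g h ≤0 }) (tilted-all g₀))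
                  (All.++⁺ (All.map (λ { (f , g , h) → sum≤0 1⁻ 1⁺ g h 0≤ }) (tilted-all p₂))
                  (All.++⁺ (All.map (λ { (f , g , h) → sum≤0 1⁺ 1⁻ g h 0≤ }) (tilted-all m₂))
                  (All.++⁺ (All.map (λ { (f , g , h) → sum≤0 1⁺ 1⁻ g h 0≤ }) (tilted-all p₃))
                           (All.map (λ { (f , g , h) → sum≤0 1⁻ 1⁺ g h 0≤ }) (tilted-all m₃))))))))
                  (Any.++⁺ʳ T′ (Any.++⁺ˡ (tilted-any (λ { (f , g , h) → ≢zero (ℤ.- + 2) (cong₂ ℤ._+_ g h) (λ ()) }) g₁)))) left p₁ m₁ e)

      vol-total : HasVol (event Λ) (P₀ ++ (M₀ ++ R₁)) (total A⁺′ A⁻′ D⁺′ D⁻′ [])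
      vol-total = vol-race (event Λ) values-+ R₁ (λ g e → vol-ahead⁺ g e) (λ g e → vol-ahead⁻ g e) left p₀ m₀ []

-- Dynamic programming

module Tables where

  open import Data.Integer.Base as ℤ using (ℤ; +_; -[1+_])
  import Data.Integer.Properties as ℤ
  import Data.Integer.Tactic.RingSolver as ℤSolver
  open import Data.List.Base using (List; []; _∷_; _++_; map; zipWith)
  import Data.List.Properties as List
  open import Relation.Binary.PropositionalEquality
  open Labels
  open Recursion using (Algebra; module Evaluate)

  -- The values at all suffixes, the empty one included: exactly the arguments that a recursion on
  -- tails can reach.
  tab : ∀ {X Y : Set} → (List X → Y) → List X → List Y
  tab f []       = f [] ∷ []
  tab f (x ∷ xs) = f (x ∷ xs) ∷ tab f xs

  module _ {X : Set} where
    tab-cong : ∀ {Y : Set} {f g : List X → Y} → (∀ L → f L ≡ g L) → ∀ L → tab f L ≡ tab g L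
    tab-cong h []      = cong (_∷ []) (h [])
    tab-cong h (x ∷ L) = cong₂ _∷_ (h (x ∷ L)) (tab-cong h L)

    map-tab : ∀ {Y Z : Set} (h : Y → Z) (f : List X → Y) L → map h (tab f L) ≡ tab (λ M → h (f M)) L
    map-tab h f []      = refl
    map-tab h f (x ∷ L) = cong (h (f (x ∷ L)) ∷_) (map-tab h f L)

    zipWith-tab : ∀ {Y Z T : Set} (h : Y → Z → T) (f : List X → Y) (g : List X → Z) L →
                  zipWith h (tab f L) (tab g L) ≡ tab (λ M → h (f M) (g M)) L
    zipWith-tab h f g []      = refl
    zipWith-tab h f g (x ∷ L) = cong (h (f (x ∷ L)) (g (x ∷ L)) ∷_) (zipWith-tab h f g L)

  transpose : ∀ {Y : Set} → List (List Y) → List (List Y)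
  transpose []               = []
  transpose (xs ∷ [])        = map (_∷ []) xs
  transpose (xs ∷ ys ∷ yss)  = zipWith _∷_ xs (transpose (ys ∷ yss))

  transpose-tab : ∀ {X Y Z : Set} (f : List X → List Y → Z) L M →
                  transpose (tab (λ A → tab (f A) M) L) ≡ tab (λ B → tab (λ A → f A B) L) M
  transpose-tab f []          M = map-tab (_∷ []) (f []) M
  transpose-tab f (x ∷ [])    M = trans (cong (zipWith _∷_ (tab (f (x ∷ [])) M)) (transpose-tab f [] M))
                                        (zipWith-tab _∷_ (f (x ∷ [])) (λ B → f [] B ∷ []) M)
  transpose-tab f (x ∷ y ∷ L) M = trans (cong (zipWith _∷_ (tab (f (x ∷ y ∷ L)) M)) (transpose-tab f (y ∷ L) M))
                                        (zipWith-tab _∷_ (f (x ∷ y ∷ L)) (λ B → tab (λ A → f A B) (y ∷ L)) M)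

  push : ∀ {Y : Set} → (Y → Y) → List Y → List Y
  push h []       = []
  push h (y ∷ ys) = h y ∷ y ∷ ys

  push-tab : ∀ {X Y : Set} (h : Y → Y) (f : List X → Y) L → push h (tab f L) ≡ h (f L) ∷ tab f L
  push-tab h f []      = refl
  push-tab h f (x ∷ L) = refl

  module Table {X C : Set} (_⊕_ : C → C → C) (emit : X → X → C → C) where
    open Race _⊕_ emit

    -- The entry at `a ∷ A` and `b ∷ B` combines `p`, from the previous row, with `r`, its neighbour
    -- in the same row.
    row : X → C → List X → List C → List C
    row a k []      ps       = k ∷ []
    row a k (b ∷ B) []       = []
    row a k (b ∷ B) (p ∷ ps) = push (λ r → emit a b (p ⊕ r)) (row a k B ps)

    table : List X → List X → List C → List C → List (List C)
    table []      B ks       ls = ls ∷ []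
    table (a ∷ A) B []       ls = []
    table (a ∷ A) B (k ∷ ks) ls = push (row a k B) (table A B ks ls)

    row-≡ : ∀ k l a A B → row a (k (a ∷ A)) B (tab (λ B → race A B k l) B) ≡ tab (λ B → race (a ∷ A) B k l) B
    row-≡ k l a A []      = refl
    row-≡ k l a A (b ∷ B) = trans (cong (push _) (row-≡ k l a A B)) (push-tab _ (λ B → race (a ∷ A) B k l) B)

    table-≡ : ∀ k l A B → table A B (tab k A) (tab l B) ≡ tab (λ A → tab (λ B → race A B k l) B) A
    table-≡ k l []      B = cong (_∷ []) (tab-cong (λ _ → refl) B)
    table-≡ k l (a ∷ A) B = trans (cong (push (row a (k (a ∷ A)) B)) (table-≡ k l A B))
      (trans (push-tab _ (λ A → tab (λ B → race A B k l) B) A) (cong (_∷ _) (row-≡ k l a A B)))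

  module Hypertable {X C : Set} (emit : X → X → X → X → C → C → C → C → C) where

    open Quad emit

    line : X → X → X → C → List X → List C → List C → List C → List C
    line d a b k (c ∷ C) (x ∷ xs) (y ∷ ys) (z ∷ zs) = push (emit d a b c x y z) (line d a b k C xs ys zs)
    line d a b k C       _        _        _        = k ∷ []

    plane : X → X → List C → List C → List X → List X → List (List C) → List (List C) → List (List C)
    plane d a (k ∷ ks) kB (b ∷ B) C (xs ∷ xss) (ys ∷ yss) = push (line d a b k C xs ys) (plane d a ks kB B C xss yss)
    plane d a _        kB _       C _          _          = kB ∷ []

    cube : X → List (List C) → List (List C) → List (List C) → List X → List X → List X → List (List (List C)) → List (List (List C))
    cube d (ks ∷ kss) (kB ∷ kBs) kA (a ∷ A) B C (xss ∷ xsss) = push (plane d a ks kB B C xss) (cube d kss kBs kA A B C xsss)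
    cube d _          _          kA _       B C _            = kA ∷ []

    hypertable : List X → List X → List X → List X → List (List (List C)) → List (List (List C)) → List (List (List C)) → List (List (List C)) → List (List (List (List C)))
    hypertable (d ∷ D) A B C kD (kA ∷ kAs) (kB ∷ kBs) (kC ∷ kCs) = push (cube d kC kB kA A B C) (hypertable D A B C kD kAs kBs kCs)
    hypertable _       A B C kD _          _          _          = kD ∷ []

    module _ (kD kA kB kC : List X → List X → List X → C) where
      private
        q : List X → List X → List X → List X → C
        q D A B C = quad D A B C kD kA kB kC

      line-≡ : ∀ d D a A b B C →
        line d a b (kC (d ∷ D) (a ∷ A) (b ∷ B)) C (tab (q D (a ∷ A) (b ∷ B)) C) (tab (q (d ∷ D) A (b ∷ B)) C) (tab (q (d ∷ D) (a ∷ A) B) C) ≡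
        tab (q (d ∷ D) (a ∷ A) (b ∷ B)) C
      line-≡ d D a A b B []      = refl
      line-≡ d D a A b B (c ∷ C) = trans (cong (push _) (line-≡ d D a A b B C)) (push-tab _ (q (d ∷ D) (a ∷ A) (b ∷ B)) C)

      plane-≡ : ∀ d D a A B C →
        plane d a (tab (kC (d ∷ D) (a ∷ A)) B) (tab (kB (d ∷ D) (a ∷ A)) C) B C
          (tab (λ B → tab (q D (a ∷ A) B) C) B) (tab (λ B → tab (q (d ∷ D) A B) C) B) ≡
        tab (λ B → tab (q (d ∷ D) (a ∷ A) B) C) B
      plane-≡ d D a A []      C = cong (_∷ []) (tab-cong (λ _ → refl) C)
      plane-≡ d D a A (b ∷ B) C = trans (cong (push _) (plane-≡ d D a A B C))
        (trans (push-tab _ (λ B → tab (q (d ∷ D) (a ∷ A) B) C) B) (cong (_∷ _) (line-≡ d D a A b B C)))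

      cube-≡ : ∀ d D A B C →
        cube d (tab (λ A → tab (kC (d ∷ D) A) B) A) (tab (λ A → tab (kB (d ∷ D) A) C) A) (tab (λ B → tab (kA (d ∷ D) B) C) B) A B C
          (tab (λ A → tab (λ B → tab (q D A B) C) B) A) ≡
        tab (λ A → tab (λ B → tab (q (d ∷ D) A B) C) B) A
      cube-≡ d D []      B C = cong (_∷ []) (tab-cong (λ B → tab-cong (λ _ → refl) C) B)
      cube-≡ d D (a ∷ A) B C = trans (cong (push _) (cube-≡ d D A B C))
        (trans (push-tab _ (λ A → tab (λ B → tab (q (d ∷ D) A B) C) B) A) (cong (_∷ _) (plane-≡ d D a A B C)))

      hypertable-≡ : ∀ D A B C →
        hypertable D A B C (tab (λ A → tab (λ B → tab (kD A B) C) B) A) (tab (λ D → tab (λ B → tab (kA D B) C) B) D)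
          (tab (λ D → tab (λ A → tab (kB D A) C) A) D) (tab (λ D → tab (λ A → tab (kC D A) B) A) D) ≡
        tab (λ D → tab (λ A → tab (λ B → tab (q D A B) C) B) A) D
      hypertable-≡ []      A B C = cong (_∷ []) (tab-cong (λ _ → refl) A)
      hypertable-≡ (d ∷ D) A B C = trans (cong (push _) (hypertable-≡ D A B C))
        (trans (push-tab _ (λ D → tab (λ A → tab (λ B → tab (q D A B) C) B) A) D) (cong (_∷ _) (cube-≡ d D A B C)))

  head₀ : List ℤ → ℤ
  head₀ []      = + 0
  head₀ (x ∷ _) = x

  corner : List (List ℤ) → ℤ
  corner []       = + 0
  corner (xs ∷ _) = head₀ xs

  head₀-tab : ∀ {X : Set} (f : List X → ℤ) L → head₀ (tab f L) ≡ f L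
  head₀-tab f []      = refl
  head₀-tab f (_ ∷ _) = refl

  corner-tab : ∀ {X Y : Set} (f : List X → List Y → ℤ) L M → corner (tab (λ A → tab (f A) M) L) ≡ f L M
  corner-tab f []      M = head₀-tab (f []) M
  corner-tab f (a ∷ L) M = head₀-tab (f (a ∷ L)) M

  module Integers (num : Label → ℤ) where

    ℤAlgebra : Algebra
    ℤAlgebra = record
      { Value = ℤ
      ; _⊕_   = ℤ._+_
      ; emit  = λ g x → num g ℤ.* x
      ; unit  = + 1
      ; zro   = + 0
      ; neg   = λ x → ℤ.-1ℤ ℤ.* x
      }
    open Evaluate ℤAlgebra public

    private
      two-sums : ∀ c a b x y → c ℤ.* ((a ℤ.+ b) ℤ.+ (x ℤ.+ y)) ≡ c ℤ.* (a ℤ.+ x) ℤ.+ c ℤ.* (b ℤ.+ y)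
      two-sums = ℤSolver.solve-∀
      two-scales : ∀ c d x y → c ℤ.* (d ℤ.* x ℤ.+ d ℤ.* y) ≡ d ℤ.* (c ℤ.* (x ℤ.+ y))
      two-scales = ℤSolver.solve-∀

    race-cong : ∀ {k l k′ l′ : List Tilt → ℤ} → (∀ A → k A ≡ k′ A) → (∀ B → l B ≡ l′ B) → ∀ A B → race A B k l ≡ race A B k′ l′
    race-cong f g []      B       = g B
    race-cong f g (a ∷ A) []      = f (a ∷ A)
    race-cong f g (a ∷ A) (b ∷ B) = cong (num (two a b) ℤ.*_) (cong₂ ℤ._+_ (race-cong f g A (b ∷ B)) (race-cong f g (a ∷ A) B))

    race-+ : ∀ (k l k′ l′ : List Tilt → ℤ) A B → race A B (λ A → k A ℤ.+ k′ A) (λ B → l B ℤ.+ l′ B) ≡ race A B k l ℤ.+ race A B k′ l′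
    race-+ k l k′ l′ []      B       = refl
    race-+ k l k′ l′ (a ∷ A) []      = refl
    race-+ k l k′ l′ (a ∷ A) (b ∷ B) = trans
      (cong (num (two a b) ℤ.*_) (cong₂ ℤ._+_ (race-+ k l k′ l′ A (b ∷ B)) (race-+ k l k′ l′ (a ∷ A) B)))
      (two-sums (num (two a b)) (race A (b ∷ B) k l) (race A (b ∷ B) k′ l′) (race (a ∷ A) B k l) (race (a ∷ A) B k′ l′))

    race-* : ∀ c (k l : List Tilt → ℤ) A B → race A B (λ A → c ℤ.* k A) (λ B → c ℤ.* l B) ≡ c ℤ.* race A B k l
    race-* c k l []      B       = refl
    race-* c k l (a ∷ A) []      = refl
    race-* c k l (a ∷ A) (b ∷ B) = trans
      (cong (num (two a b) ℤ.*_) (cong₂ ℤ._+_ (race-* c k l A (b ∷ B)) (race-* c k l (a ∷ A) B)))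
      (two-scales (num (two a b)) c (race A (b ∷ B) k l) (race (a ∷ A) B k l))

    -- Both sides sum over pairs of independent lattice paths, so the order of summation is free.
    race-swap : ∀ (kk kl lk ll : List Tilt → List Tilt → ℤ) A B D E →
      race A B (λ A → race D E (kk A) (kl A)) (λ B → race D E (lk B) (ll B)) ≡
      race D E (λ D → race A B (λ A → kk A D) (λ B → lk B D)) (λ E → race A B (λ A → kl A E) (λ B → ll B E))
    race-swap kk kl lk ll []      B       D E = refl
    race-swap kk kl lk ll (a ∷ A) []      D E = refl
    race-swap kk kl lk ll (a ∷ A) (b ∷ B) D E = trans
      (cong (num (two a b) ℤ.*_) (trans (cong₂ ℤ._+_ (race-swap kk kl lk ll A (b ∷ B) D E) (race-swap kk kl lk ll (a ∷ A) B D E))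
        (sym (race-+ _ _ _ _ D E))))
      (sym (race-* (num (two a b)) _ _ D E))

    race-0 : ∀ A B → race A B none none ≡ + 0
    race-0 []      B       = refl
    race-0 (a ∷ A) []      = refl
    race-0 (a ∷ A) (b ∷ B) rewrite race-0 A (b ∷ B) | race-0 (a ∷ A) B = ℤ.*-zeroʳ (num (two a b))

    leaf-++ : ∀ A B → leaf (A ++ B) ≡ leaf A ℤ.* leaf B
    leaf-++ []      B = sym (ℤ.*-identityˡ _)
    leaf-++ (a ∷ A) B = trans (cong (num (one a) ℤ.*_) (leaf-++ A B)) (sym (ℤ.*-assoc (num (one a)) (leaf A) (leaf B)))

    -- A path against `X ++ Y` crosses `X` first and meets `Y` only if part of `D` is left. Races
    -- against concatenations thus become iterated tables.
    beats-++ : ∀ D X Y → beats D (X ++ Y) ≡ race D X (λ D → beats D Y) none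
    beats-++ []      X       Y = refl
    beats-++ (d ∷ D) []      Y = refl
    beats-++ (d ∷ D) (x ∷ X) Y = cong (num (two d x) ℤ.*_) (cong₂ ℤ._+_ (beats-++ D (x ∷ X) Y) (beats-++ (d ∷ D) X Y))

    beaten-++ : ∀ N X Y → beaten N (X ++ Y) ≡ race N X (λ N → beaten N Y) (λ X → leaf X ℤ.* leaf Y)
    beaten-++ []      X       Y = leaf-++ X Y
    beaten-++ (n ∷ N) []      Y = refl
    beaten-++ (n ∷ N) (x ∷ X) Y = cong (num (two n x) ℤ.*_) (cong₂ ℤ._+_ (beaten-++ N (x ∷ X) Y) (beaten-++ (n ∷ N) X Y))

    open Table {Tilt} {ℤ} ℤ._+_ (λ a b x → num (two a b) ℤ.* x)

    -- Vectors as values handle all suffixes of a further list at once.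
    module VectorRace = Race {Tilt} {List ℤ} (zipWith ℤ._+_) (λ a b → map (num (two a b) ℤ.*_))
    module Vectors = Table {Tilt} {List ℤ} (zipWith ℤ._+_) (λ a b → map (num (two a b) ℤ.*_))

    race-tab : ∀ (k l : List Tilt → List Tilt → ℤ) Y A B →
      VectorRace.race A B (λ A → tab (k A) Y) (λ B → tab (l B) Y) ≡ tab (λ Z → race A B (λ A → k A Z) (λ B → l B Z)) Y
    race-tab k l Y []      B       = refl
    race-tab k l Y (a ∷ A) []      = refl
    race-tab k l Y (a ∷ A) (b ∷ B) = begin
      map (num (two a b) ℤ.*_) (zipWith ℤ._+_ (VectorRace.race A (b ∷ B) (λ A → tab (k A) Y) (λ B → tab (l B) Y)) (VectorRace.race (a ∷ A) B (λ A → tab (k A) Y) (λ B → tab (l B) Y)))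
        ≡⟨ cong₂ (λ x y → map (num (two a b) ℤ.*_) (zipWith ℤ._+_ x y)) (race-tab k l Y A (b ∷ B)) (race-tab k l Y (a ∷ A) B) ⟩
      map (num (two a b) ℤ.*_) (zipWith ℤ._+_ (tab f Y) (tab g Y))
        ≡⟨ cong (map (num (two a b) ℤ.*_)) (zipWith-tab ℤ._+_ f g Y) ⟩
      map (num (two a b) ℤ.*_) (tab (λ Z → f Z ℤ.+ g Z) Y)
        ≡⟨ map-tab (num (two a b) ℤ.*_) (λ Z → f Z ℤ.+ g Z) Y ⟩
      tab (λ Z → num (two a b) ℤ.* (f Z ℤ.+ g Z)) Y ∎
      where
      open ≡-Reasoning
      f g : List Tilt → ℤ
      f Z = race A (b ∷ B) (λ A → k A Z) (λ B → l B Z)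
      g Z = race (a ∷ A) B (λ A → k A Z) (λ B → l B Z)

    leaves : List Tilt → List ℤ
    leaves []      = + 1 ∷ []
    leaves (a ∷ A) = push (num (one a) ℤ.*_) (leaves A)

    leaves-≡ : ∀ A → leaves A ≡ tab leaf A
    leaves-≡ []      = refl
    leaves-≡ (a ∷ A) = trans (cong (push _) (leaves-≡ A)) (push-tab _ leaf A)

    zeros : List Tilt → List ℤ
    zeros = tab none

    module Lines (A⁺ A⁻ : List Tilt) where

      ℙ 𝕄 : (List Tilt → ℤ) → ℤ
      ℙ k = race A⁺ A⁻ k none
      𝕄 l = race A⁺ A⁻ none l

      P M : List ℤ → ℤ
      P ks = corner (table A⁺ A⁻ ks (zeros A⁻))
      M ls = corner (table A⁺ A⁻ (zeros A⁺) ls)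

      P-≡ : ∀ k → P (tab k A⁺) ≡ ℙ k
      P-≡ k = trans (cong corner (table-≡ k none A⁺ A⁻)) (corner-tab (λ A B → race A B k none) A⁺ A⁻)

      M-≡ : ∀ l → M (tab l A⁻) ≡ 𝕄 l
      M-≡ l = trans (cong corner (table-≡ none l A⁺ A⁻)) (corner-tab (λ A B → race A B none l) A⁺ A⁻)

      split : ∀ k l → race A⁺ A⁻ k l ≡ ℙ k ℤ.+ 𝕄 l
      split k l = trans (race-cong (λ A → sym (ℤ.+-identityʳ (k A))) (λ B → sym (ℤ.+-identityˡ (l B))) A⁺ A⁻) (race-+ k none none l A⁺ A⁻)

      ℙ-cong : ∀ {k k′} → (∀ A → k A ≡ k′ A) → ℙ k ≡ ℙ k′
      ℙ-cong f = race-cong f (λ _ → refl) A⁺ A⁻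
      𝕄-cong : ∀ {k k′} → (∀ A → k A ≡ k′ A) → 𝕄 k ≡ 𝕄 k′
      𝕄-cong f = race-cong (λ _ → refl) f A⁺ A⁻

      ℙ-+ : ∀ k k′ → ℙ (λ A → k A ℤ.+ k′ A) ≡ ℙ k ℤ.+ ℙ k′
      ℙ-+ k k′ = race-+ k none k′ none A⁺ A⁻
      𝕄-+ : ∀ k k′ → 𝕄 (λ A → k A ℤ.+ k′ A) ≡ 𝕄 k ℤ.+ 𝕄 k′
      𝕄-+ k k′ = race-+ none k none k′ A⁺ A⁻

      ℙ-* : ∀ c k → ℙ (λ A → c ℤ.* k A) ≡ c ℤ.* ℙ k
      ℙ-* c k = trans (race-cong (λ _ → refl) (λ _ → sym (ℤ.*-zeroʳ c)) A⁺ A⁻) (race-* c k none A⁺ A⁻)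

      ℙ-race : ∀ (k l : List Tilt → List Tilt → ℤ) D E →
               ℙ (λ A → race D E (k A) (l A)) ≡ race D E (λ D → ℙ (λ A → k A D)) (λ E → ℙ (λ A → l A E))
      ℙ-race k l D E = trans (race-cong (λ _ → refl) (λ _ → sym (race-0 D E)) A⁺ A⁻) (race-swap k l (λ _ → none) (λ _ → none) A⁺ A⁻ D E)

      𝕄-race : ∀ (k l : List Tilt → List Tilt → ℤ) D E →
               𝕄 (λ A → race D E (k A) (l A)) ≡ race D E (λ D → 𝕄 (λ A → k A D)) (λ E → 𝕄 (λ A → l A E))
      𝕄-race k l D E = trans (race-cong (λ _ → sym (race-0 D E)) (λ _ → refl) A⁺ A⁻) (race-swap (λ _ → none) (λ _ → none) k l A⁺ A⁻ D E)

      ℙ-0 : ℙ none ≡ + 0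
      ℙ-0 = race-0 A⁺ A⁻
      𝕄-0 : 𝕄 none ≡ + 0
      𝕄-0 = race-0 A⁺ A⁻

      ℙ-ℙ : ∀ f → ℙ (λ A → ℙ (f A)) ≡ ℙ (λ B → ℙ (λ A → f A B))
      ℙ-ℙ f = trans (ℙ-race f (λ _ → none) A⁺ A⁻) (race-cong (λ _ → refl) (λ _ → ℙ-0) A⁺ A⁻)
      𝕄-ℙ : ∀ f → 𝕄 (λ A → ℙ (f A)) ≡ ℙ (λ B → 𝕄 (λ A → f A B))
      𝕄-ℙ f = trans (𝕄-race f (λ _ → none) A⁺ A⁻) (race-cong (λ _ → refl) (λ _ → 𝕄-0) A⁺ A⁻)
      -- `E₁`, `E₂` and `E₃` collect the outcomes with one, two and three surviving plus sides, `E₄`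
      -- those with none.
      E₁ E₂ E₃ E₄ : List Tilt → ℤ
      E₁ D = ℙ λ A → 𝕄 λ B → 𝕄 λ C → case₊₋₋ D A B C
      E₂ D = ℙ λ A → ℙ λ B → 𝕄 λ C → case₊₊₋ D A B C
      E₃ D = ℙ λ A → ℙ λ B → ℙ λ C → case₊₊₊ D A B C
      E₄ D = 𝕄 λ A → 𝕄 λ B → 𝕄 λ C → case₋₋₋ D A B C

      -- The three lines carry the same tilts and sums may be exchanged, so only the number of plus
      -- sides matters: 8 = 1 + 3 + 3 + 1.
      ahead⁺-≡ : ∀ D → ahead⁺ A⁺ A⁻ D ≡ E₃ D ℤ.+ + 3 ℤ.* E₂ D ℤ.+ + 3 ℤ.* E₁ D ℤ.+ E₄ D
      ahead⁺-≡ D = begin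
        ahead⁺ A⁺ A⁻ D
          ≡⟨ split _ _ ⟩
        ℙ (λ A → race A⁺ A⁻ (λ B → race A⁺ A⁻ (λ C → case₊₊₊ D A B C) (λ C → case₊₊₋ D A B C))
                            (λ B → race A⁺ A⁻ (λ C → case₊₊₋ D A C B) (λ C → case₊₋₋ D A B C))) ℤ.+
        𝕄 (λ A → race A⁺ A⁻ (λ B → race A⁺ A⁻ (λ C → case₊₊₋ D B C A) (λ C → case₊₋₋ D B A C))
                            (λ B → race A⁺ A⁻ (λ C → case₊₋₋ D C A B) (λ C → case₋₋₋ D A B C)))
          ≡⟨ cong₂ ℤ._+_ (trans (ℙ-cong (λ A → four-way (case₊₊₊ D A) (case₊₊₋ D A) (λ B C → case₊₊₋ D A C B) (case₊₋₋ D A))) (ℙ-+⁴ _ _ _ _))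
                         (trans (𝕄-cong (λ A → four-way (λ B C → case₊₊₋ D B C A) (λ B C → case₊₋₋ D B A C) (λ B C → case₊₋₋ D C A B) (case₋₋₋ D A))) (𝕄-+⁴ _ _ _ _)) ⟩
        (E₃ D ℤ.+ E₂ D ℤ.+ (X₁ ℤ.+ E₁ D)) ℤ.+ (X₂ ℤ.+ X₃ ℤ.+ (X₄ ℤ.+ E₄ D))
          ≡⟨ cong₂ (λ a b → (E₃ D ℤ.+ E₂ D ℤ.+ (a ℤ.+ E₁ D)) ℤ.+ (b ℤ.+ X₃ ℤ.+ (X₄ ℤ.+ E₄ D)))
               (ℙ-cong λ A → 𝕄-ℙ λ B C → case₊₊₋ D A C B)
               (trans (𝕄-ℙ (λ A B → ℙ λ C → case₊₊₋ D B C A)) (ℙ-cong λ B → 𝕄-ℙ λ A C → case₊₊₋ D B C A)) ⟩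
        (E₃ D ℤ.+ E₂ D ℤ.+ (E₂ D ℤ.+ E₁ D)) ℤ.+ (E₂ D ℤ.+ X₃ ℤ.+ (X₄ ℤ.+ E₄ D))
          ≡⟨ cong₂ (λ a b → (E₃ D ℤ.+ E₂ D ℤ.+ (E₂ D ℤ.+ E₁ D)) ℤ.+ (E₂ D ℤ.+ a ℤ.+ (b ℤ.+ E₄ D)))
               (𝕄-ℙ λ A B → 𝕄 λ C → case₊₋₋ D B A C)
               (trans (𝕄-cong λ A → 𝕄-ℙ λ B C → case₊₋₋ D C A B) (𝕄-ℙ λ A C → 𝕄 λ B → case₊₋₋ D C A B)) ⟩
        (E₃ D ℤ.+ E₂ D ℤ.+ (E₂ D ℤ.+ E₁ D)) ℤ.+ (E₂ D ℤ.+ E₁ D ℤ.+ (E₁ D ℤ.+ E₄ D))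
          ≡⟨ collect (E₃ D) (E₂ D) (E₁ D) (E₄ D) ⟩
        E₃ D ℤ.+ + 3 ℤ.* E₂ D ℤ.+ + 3 ℤ.* E₁ D ℤ.+ E₄ D ∎
        where
        open ≡-Reasoning
        X₁ = ℙ λ A → 𝕄 λ B → ℙ λ C → case₊₊₋ D A C B
        X₂ = 𝕄 λ A → ℙ λ B → ℙ λ C → case₊₊₋ D B C A
        X₃ = 𝕄 λ A → ℙ λ B → 𝕄 λ C → case₊₋₋ D B A C
        X₄ = 𝕄 λ A → 𝕄 λ B → ℙ λ C → case₊₋₋ D C A B
        collect : ∀ a b c d → (a ℤ.+ b ℤ.+ (b ℤ.+ c)) ℤ.+ (b ℤ.+ c ℤ.+ (c ℤ.+ d)) ≡ a ℤ.+ + 3 ℤ.* b ℤ.+ + 3 ℤ.* c ℤ.+ d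
        collect = ℤSolver.solve-∀
        four-way : ∀ (f g h i : List Tilt → List Tilt → ℤ) →
          race A⁺ A⁻ (λ B → race A⁺ A⁻ (f B) (g B)) (λ B → race A⁺ A⁻ (h B) (i B)) ≡
          ℙ (λ B → ℙ (f B)) ℤ.+ ℙ (λ B → 𝕄 (g B)) ℤ.+ (𝕄 (λ B → ℙ (h B)) ℤ.+ 𝕄 (λ B → 𝕄 (i B)))
        four-way f g h i = trans (split _ _) (cong₂ ℤ._+_
          (trans (ℙ-cong λ B → split (f B) (g B)) (ℙ-+ _ _)) (trans (𝕄-cong λ B → split (h B) (i B)) (𝕄-+ _ _)))
        ℙ-+⁴ : ∀ (f g h i : List Tilt → ℤ) → ℙ (λ A → f A ℤ.+ g A ℤ.+ (h A ℤ.+ i A)) ≡ ℙ f ℤ.+ ℙ g ℤ.+ (ℙ h ℤ.+ ℙ i)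
        ℙ-+⁴ f g h i = trans (ℙ-+ _ _) (cong₂ ℤ._+_ (ℙ-+ f g) (ℙ-+ h i))
        𝕄-+⁴ : ∀ (f g h i : List Tilt → ℤ) → 𝕄 (λ A → f A ℤ.+ g A ℤ.+ (h A ℤ.+ i A)) ≡ 𝕄 f ℤ.+ 𝕄 g ℤ.+ (𝕄 h ℤ.+ 𝕄 i)
        𝕄-+⁴ f g h i = trans (𝕄-+ _ _) (cong₂ ℤ._+_ (𝕄-+ f g) (𝕄-+ h i))

      tab₂ : ∀ {X : Set} → (List Tilt → List Tilt → X) → List Tilt → List Tilt → List (List X)
      tab₂ f L M = tab (λ A → tab (f A) M) L

      tab₂-cong : ∀ {X : Set} {f g : List Tilt → List Tilt → X} → (∀ A B → f A B ≡ g A B) → ∀ L M → tab₂ f L M ≡ tab₂ g L M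
      tab₂-cong h L M = tab-cong (λ A → tab-cong (h A) M) L

      tab₃ : ∀ {X : Set} → (List Tilt → List Tilt → List Tilt → X) → List Tilt → List Tilt → List Tilt → List (List (List X))
      tab₃ f L M N = tab (λ A → tab₂ (f A) M N) L

      tab₃-cong : ∀ {X : Set} {f g : List Tilt → List Tilt → List Tilt → X} → (∀ A B C → f A B C ≡ g A B C) → ∀ L M N → tab₃ f L M N ≡ tab₃ g L M N
      tab₃-cong h L M N = tab-cong (λ A → tab₂-cong (h A) M N) L

      map-P : ∀ (f : List Tilt → List Tilt → ℤ) L → map P (tab₂ f L A⁺) ≡ tab (λ D → ℙ (f D)) L
      map-P f L = trans (map-tab P (λ D → tab (f D) A⁺) L) (tab-cong (λ D → P-≡ (f D)) L)

      map-M : ∀ (f : List Tilt → List Tilt → ℤ) L → map M (tab₂ f L A⁻) ≡ tab (λ D → 𝕄 (f D)) L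
      map-M f L = trans (map-tab M (λ D → tab (f D) A⁻) L) (tab-cong (λ D → M-≡ (f D)) L)

      PPP MMM : List (List (List ℤ)) → ℤ
      PPP xsss = P (map (λ xss → P (map P xss)) xsss)
      MMM xsss = M (map (λ xss → M (map M xss)) xsss)

      PPP-≡ : ∀ f → PPP (tab₃ f A⁺ A⁺ A⁺) ≡ ℙ (λ A → ℙ (λ B → ℙ (f A B)))
      PPP-≡ f = trans (cong P (trans (map-tab (λ xss → P (map P xss)) (λ A → tab₂ (f A) A⁺ A⁺) A⁺)
                  (tab-cong (λ A → trans (cong P (map-P (f A) A⁺)) (P-≡ (λ B → ℙ (f A B)))) A⁺)))
                  (P-≡ (λ A → ℙ (λ B → ℙ (f A B))))

      MMM-≡ : ∀ f → MMM (tab₃ f A⁻ A⁻ A⁻) ≡ 𝕄 (λ A → 𝕄 (λ B → 𝕄 (f A B)))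
      MMM-≡ f = trans (cong M (trans (map-tab (λ xss → M (map M xss)) (λ A → tab₂ (f A) A⁻ A⁻) A⁻)
                  (tab-cong (λ A → trans (cong M (map-M (f A) A⁻)) (M-≡ (λ B → 𝕄 (f A B)))) A⁻)))
                  (M-≡ (λ A → 𝕄 (λ B → 𝕄 (f A B))))

      module _ (D⁺ : List Tilt) where

        -- Sums over one and two minus lines that `D` has yet to survive. They depend on the suffix
        -- `D` alone and serve as boundary values of later tables.
        h₁ h₂ : List Tilt → ℤ
        h₁ D = 𝕄 λ C → beats D C
        h₂ D = 𝕄 λ B → 𝕄 λ C → beats D (B ++ C)

        h₁s h₂s : List ℤ → List ℤ
        h₁s lf  = map M (table D⁺ A⁻ lf (zeros A⁻))
        h₂s hs = map M (table D⁺ A⁻ hs (zeros A⁻))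

        𝕄-beats : ∀ D B → 𝕄 (λ C → beats D (B ++ C)) ≡ race D B h₁ none
        𝕄-beats D B = begin
          𝕄 (λ C → beats D (B ++ C))                          ≡⟨ 𝕄-cong (beats-++ D B) ⟩
          𝕄 (λ C → race D B (λ D → beats D C) none)           ≡⟨ 𝕄-race (λ C D → beats D C) (λ _ → none) D B ⟩
          race D B h₁ (λ _ → 𝕄 none)                          ≡⟨ race-cong (λ _ → refl) (λ _ → 𝕄-0) D B ⟩
          race D B h₁ none                                     ∎
          where open ≡-Reasoning

        𝕄𝕄-beats : ∀ D A → 𝕄 (λ B → 𝕄 λ C → beats D (A ++ (B ++ C))) ≡ race D A h₂ none
        𝕄𝕄-beats D A = begin
          𝕄 (λ B → 𝕄 λ C → beats D (A ++ (B ++ C)))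
            ≡⟨ 𝕄-cong (λ B → trans (𝕄-cong λ C → beats-++ D A (B ++ C)) (trans (𝕄-race (λ C D → beats D (B ++ C)) (λ _ → none) D A)
                 (race-cong (λ _ → refl) (λ _ → 𝕄-0) D A))) ⟩
          𝕄 (λ B → race D A (λ D → 𝕄 λ C → beats D (B ++ C)) none)
            ≡⟨ 𝕄-race (λ B D → 𝕄 λ C → beats D (B ++ C)) (λ _ → none) D A ⟩
          race D A h₂ (λ _ → 𝕄 none)
            ≡⟨ race-cong (λ _ → refl) (λ _ → 𝕄-0) D A ⟩
          race D A h₂ none ∎
          where open ≡-Reasoning

        h₁s-≡ : h₁s (tab leaf D⁺) ≡ tab h₁ D⁺
        h₁s-≡ = trans (cong (map M) (table-≡ leaf none D⁺ A⁻)) (map-M (λ D C → beats D C) D⁺)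

        h₂s-≡ : h₂s (tab h₁ D⁺) ≡ tab h₂ D⁺
        h₂s-≡ = trans (cong (map M) (table-≡ h₁ none D⁺ A⁻)) (trans (map-M (λ D B → race D B h₁ none) D⁺)
                  (tab-cong (λ D → 𝕄-cong (λ B → sym (𝕄-beats D B))) D⁺))

        E₁s : List ℤ → List ℤ
        E₁s hs = map P (table D⁺ A⁺ hs (zeros A⁺))

        E₁-≡ : E₁s (tab h₂ D⁺) ≡ tab E₁ D⁺
        E₁-≡ = trans (cong (map P) (table-≡ h₂ none D⁺ A⁺)) (trans (map-P (λ D A → race D A h₂ none) D⁺)
                 (tab-cong (λ D → ℙ-cong (λ A → sym (𝕄𝕄-beats D A))) D⁺))

        E₂s : List ℤ → List ℤ
        E₂s hs = map (λ gs → P (map P (table A⁺ A⁺ gs gs))) (table D⁺ A⁺ hs (zeros A⁺))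

        E₂-≡ : E₂s (tab h₁ D⁺) ≡ tab E₂ D⁺
        E₂-≡ = trans (cong (map (λ gs → P (map P (table A⁺ A⁺ gs gs)))) (table-≡ h₁ none D⁺ A⁺))
          (trans (map-tab (λ gs → P (map P (table A⁺ A⁺ gs gs))) (λ D → tab (g D) A⁺) D⁺) (tab-cong each D⁺))
          where
          g : List Tilt → List Tilt → ℤ
          g D X = race D X h₁ none
          each : ∀ D → P (map P (table A⁺ A⁺ (tab (g D) A⁺) (tab (g D) A⁺))) ≡ E₂ D
          each D = begin
            P (map P (table A⁺ A⁺ (tab (g D) A⁺) (tab (g D) A⁺)))   ≡⟨ cong (λ t → P (map P t)) (table-≡ (g D) (g D) A⁺ A⁺) ⟩
            P (map P (tab₂ (λ A B → race A B (g D) (g D)) A⁺ A⁺))    ≡⟨ cong P (map-P (λ A B → race A B (g D) (g D)) A⁺) ⟩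
            P (tab (λ A → ℙ λ B → race A B (g D) (g D)) A⁺)          ≡⟨ P-≡ (λ A → ℙ λ B → race A B (g D) (g D)) ⟩
            ℙ (λ A → ℙ λ B → race A B (g D) (g D))
              ≡⟨ ℙ-cong (λ A → ℙ-cong λ B → sym (trans (𝕄-race (λ C A → beats D (A ++ C)) (λ C B → beats D (B ++ C)) A B)
                   (race-cong (𝕄-beats D) (𝕄-beats D) A B))) ⟩
            E₂ D ∎
            where open ≡-Reasoning

        σ : ℤ
        σ = ℙ leaf

        -- Each of the three signed sums in E₃ is the same by symmetry.
        T : List Tilt → ℤ
        T D = ℙ λ A → ℙ λ B → ℙ λ C → beaten A (C ++ (B ++ D))

        Ts : List ℤ → List ℤ → ℤ → ℤ → ℤ
        Ts ks lf c s = go (map P (table A⁺ A⁺ ks (map (ℤ._* c) lf)))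
          where
          go : List ℤ → ℤ
          go k₁s = P (map P (table A⁺ A⁺ k₁s (map (ℤ._* (s ℤ.* c)) lf)))

        T-≡ : ∀ D → Ts (tab (λ N → beaten N D) A⁺) (tab leaf A⁺) (leaf D) σ ≡ T D
        T-≡ D = begin
          P (map P (table A⁺ A⁺ (map P (table A⁺ A⁺ (tab (λ N → beaten N D) A⁺) (map (ℤ._* leaf D) (tab leaf A⁺)))) (map (ℤ._* (σ ℤ.* leaf D)) (tab leaf A⁺))))
            ≡⟨ cong₂ (λ x y → P (map P (table A⁺ A⁺ x y))) inner (map-tab (ℤ._* (σ ℤ.* leaf D)) leaf A⁺) ⟩
          P (map P (table A⁺ A⁺ (tab k₁ A⁺) (tab (λ C → leaf C ℤ.* (σ ℤ.* leaf D)) A⁺)))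
            ≡⟨ cong (λ x → P (map P x)) (table-≡ k₁ (λ C → leaf C ℤ.* (σ ℤ.* leaf D)) A⁺ A⁺) ⟩
          P (map P (tab₂ (λ A C → race A C k₁ (λ C → leaf C ℤ.* (σ ℤ.* leaf D))) A⁺ A⁺))
            ≡⟨ cong P (map-P (λ A C → race A C k₁ (λ C → leaf C ℤ.* (σ ℤ.* leaf D))) A⁺) ⟩
          P (tab (λ A → ℙ λ C → race A C k₁ (λ C → leaf C ℤ.* (σ ℤ.* leaf D))) A⁺)
            ≡⟨ P-≡ (λ A → ℙ λ C → race A C k₁ (λ C → leaf C ℤ.* (σ ℤ.* leaf D))) ⟩
          ℙ (λ A → ℙ λ C → race A C k₁ (λ C → leaf C ℤ.* (σ ℤ.* leaf D)))
            ≡⟨ ℙ-cong (λ A → trans (ℙ-cong λ C → sym (outer A C)) (ℙ-ℙ λ C B → beaten A (C ++ (B ++ D)))) ⟩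
          T D ∎
          where
          open ≡-Reasoning
          k₁ : List Tilt → ℤ
          k₁ A = ℙ λ B → beaten A (B ++ D)
          inner : map P (table A⁺ A⁺ (tab (λ N → beaten N D) A⁺) (map (ℤ._* leaf D) (tab leaf A⁺))) ≡ tab k₁ A⁺
          inner = trans (cong (λ x → map P (table A⁺ A⁺ (tab (λ N → beaten N D) A⁺) x)) (map-tab (ℤ._* leaf D) leaf A⁺))
            (trans (cong (map P) (table-≡ (λ N → beaten N D) (λ B → leaf B ℤ.* leaf D) A⁺ A⁺))
            (trans (map-P (λ A B → race A B (λ N → beaten N D) (λ B → leaf B ℤ.* leaf D)) A⁺)
                   (tab-cong (λ A → ℙ-cong λ B → sym (beaten-++ A B D)) A⁺)))
          leaves-++ : ∀ C → ℙ (λ B → leaf C ℤ.* leaf (B ++ D)) ≡ leaf C ℤ.* (σ ℤ.* leaf D)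
          leaves-++ C = trans (ℙ-* (leaf C) (λ B → leaf (B ++ D))) (cong (leaf C ℤ.*_) (trans
            (ℙ-cong λ B → trans (leaf-++ B D) (ℤ.*-comm (leaf B) (leaf D))) (trans (ℙ-* (leaf D) leaf) (ℤ.*-comm (leaf D) σ))))
          outer : ∀ A C → ℙ (λ B → beaten A (C ++ (B ++ D))) ≡ race A C k₁ (λ C → leaf C ℤ.* (σ ℤ.* leaf D))
          outer A C = trans (ℙ-cong λ B → beaten-++ A C (B ++ D))
            (trans (ℙ-race (λ B A → beaten A (B ++ D)) (λ B C → leaf C ℤ.* leaf (B ++ D)) A C) (race-cong (λ _ → refl) leaves-++ A C))

        -- The three `beaten` terms agree by symmetry, and `leaf` is multiplicative on
        -- concatenations, so the correction factors into powers of `σ`.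
        E₃-≡ : ∀ D → E₃ D ≡ + 3 ℤ.* T D ℤ.+ -[1+ 1 ] ℤ.* (σ ℤ.* (σ ℤ.* (σ ℤ.* leaf D)))
        E₃-≡ D = begin
          E₃ D ≡⟨ ℙ-cong (λ A → ℙ-cong λ B → split₃ (λ C → beaten A (C ++ (B ++ D))) (λ C → beaten B (C ++ (A ++ D))) (λ C → beaten C (B ++ (A ++ D))) (λ C → leaf (C ++ (B ++ (A ++ D))))) ⟩
          ℙ (λ A → ℙ λ B → t₁ A B ℤ.+ (t₂ A B ℤ.+ t₃ A B) ℤ.+ -[1+ 1 ] ℤ.* t₄ A B)
            ≡⟨ ℙ-cong (λ A → split₄ (t₁ A) (t₂ A) (t₃ A) (t₄ A)) ⟩
          ℙ (λ A → ℙ (t₁ A) ℤ.+ (ℙ (t₂ A) ℤ.+ ℙ (t₃ A)) ℤ.+ -[1+ 1 ] ℤ.* ℙ (t₄ A))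
            ≡⟨ split₄ (λ A → ℙ (t₁ A)) (λ A → ℙ (t₂ A)) (λ A → ℙ (t₃ A)) (λ A → ℙ (t₄ A)) ⟩
          T D ℤ.+ (ℙ (λ A → ℙ (t₂ A)) ℤ.+ ℙ (λ A → ℙ (t₃ A))) ℤ.+ -[1+ 1 ] ℤ.* ℙ (λ A → ℙ (t₄ A))
            ≡⟨ cong₂ (λ x y → T D ℤ.+ (x ℤ.+ y) ℤ.+ -[1+ 1 ] ℤ.* ℙ (λ A → ℙ (t₄ A)))
                 (ℙ-ℙ t₂)
                 (trans (ℙ-cong λ A → ℙ-ℙ λ B C → beaten C (B ++ (A ++ D))) (ℙ-ℙ λ A C → ℙ λ B → beaten C (B ++ (A ++ D)))) ⟩
          T D ℤ.+ (T D ℤ.+ T D) ℤ.+ -[1+ 1 ] ℤ.* ℙ (λ A → ℙ (t₄ A))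
            ≡⟨ cong (λ x → T D ℤ.+ (T D ℤ.+ T D) ℤ.+ -[1+ 1 ] ℤ.* x) product ⟩
          T D ℤ.+ (T D ℤ.+ T D) ℤ.+ -[1+ 1 ] ℤ.* (σ ℤ.* (σ ℤ.* (σ ℤ.* leaf D)))
            ≡⟨ three (T D) (-[1+ 1 ] ℤ.* (σ ℤ.* (σ ℤ.* (σ ℤ.* leaf D)))) ⟩
          + 3 ℤ.* T D ℤ.+ -[1+ 1 ] ℤ.* (σ ℤ.* (σ ℤ.* (σ ℤ.* leaf D))) ∎
          where
          open ≡-Reasoning
          t₁ t₂ t₃ t₄ : List Tilt → List Tilt → ℤ
          t₁ A B = ℙ λ C → beaten A (C ++ (B ++ D))
          t₂ A B = ℙ λ C → beaten B (C ++ (A ++ D))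
          t₃ A B = ℙ λ C → beaten C (B ++ (A ++ D))
          t₄ A B = ℙ λ C → leaf (C ++ (B ++ (A ++ D)))
          three : ∀ x y → x ℤ.+ (x ℤ.+ x) ℤ.+ y ≡ + 3 ℤ.* x ℤ.+ y
          three = ℤSolver.solve-∀
          twice : ∀ x → ℤ.-1ℤ ℤ.* (x ℤ.+ x) ≡ -[1+ 1 ] ℤ.* x
          twice = ℤSolver.solve-∀
          split₄ : ∀ (f g h i : List Tilt → ℤ) → ℙ (λ C → f C ℤ.+ (g C ℤ.+ h C) ℤ.+ -[1+ 1 ] ℤ.* i C) ≡ ℙ f ℤ.+ (ℙ g ℤ.+ ℙ h) ℤ.+ -[1+ 1 ] ℤ.* ℙ i
          split₄ f g h i = trans (ℙ-+ (λ C → f C ℤ.+ (g C ℤ.+ h C)) (λ C → -[1+ 1 ] ℤ.* i C))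
            (cong₂ ℤ._+_ (trans (ℙ-+ f (λ C → g C ℤ.+ h C)) (cong (λ x → ℙ f ℤ.+ x) (ℙ-+ g h))) (ℙ-* -[1+ 1 ] i))
          split₃ : ∀ (f g h i : List Tilt → ℤ) → ℙ (λ C → f C ℤ.+ (g C ℤ.+ h C) ℤ.+ ℤ.-1ℤ ℤ.* (i C ℤ.+ i C)) ≡ ℙ f ℤ.+ (ℙ g ℤ.+ ℙ h) ℤ.+ -[1+ 1 ] ℤ.* ℙ i
          split₃ f g h i = trans (ℙ-cong λ C → cong (λ x → f C ℤ.+ (g C ℤ.+ h C) ℤ.+ x) (twice (i C))) (split₄ f g h i)
          factorˡ : ∀ c → ℙ (λ C → leaf C ℤ.* c) ≡ σ ℤ.* c
          factorˡ c = trans (ℙ-cong λ C → ℤ.*-comm (leaf C) c) (trans (ℙ-* c leaf) (ℤ.*-comm c σ))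
          pull : ∀ x → ℙ (λ B → σ ℤ.* (leaf B ℤ.* x)) ≡ σ ℤ.* (σ ℤ.* x)
          pull x = trans (ℙ-* σ (λ B → leaf B ℤ.* x)) (cong (σ ℤ.*_) (factorˡ x))
          product : ℙ (λ A → ℙ (t₄ A)) ≡ σ ℤ.* (σ ℤ.* (σ ℤ.* leaf D))
          product = trans (ℙ-cong λ A → trans (ℙ-cong λ B → trans (ℙ-cong λ C → leaf-++ C (B ++ (A ++ D))) (trans (factorˡ (leaf (B ++ (A ++ D))))
              (cong (σ ℤ.*_) (leaf-++ B (A ++ D))))) (trans (pull (leaf (A ++ D))) (cong (λ x → σ ℤ.* (σ ℤ.* x)) (leaf-++ A D))))
            (trans (ℙ-* σ (λ A → σ ℤ.* (leaf A ℤ.* leaf D))) (cong (σ ℤ.*_) (pull (leaf D))))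

        open Hypertable {Tilt} {ℤ} (λ d a b c x y z r → num (four d a b c) ℤ.* (x ℤ.+ (y ℤ.+ (z ℤ.+ r))))

        -- Three indices are kept because the fourfold race may stop at any suffixes of `D` and of
        -- two further lists.
        us : List ℤ → List (List (List ℤ))
        us lf = Vectors.table D⁺ A⁻ (table D⁺ A⁻ lf (zeros A⁻)) (tab (λ _ → zeros A⁻) A⁻)

        u : List Tilt → List Tilt → List Tilt → ℤ
        u D X Y = beats D (X ++ Y)

        us-≡ : us (tab leaf D⁺) ≡ tab₃ u D⁺ A⁻ A⁻
        us-≡ = begin
          Vectors.table D⁺ A⁻ (table D⁺ A⁻ (tab leaf D⁺) (zeros A⁻)) (tab (λ _ → zeros A⁻) A⁻)
            ≡⟨ cong (λ t → Vectors.table D⁺ A⁻ t (tab (λ _ → zeros A⁻) A⁻)) (table-≡ leaf none D⁺ A⁻) ⟩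
          Vectors.table D⁺ A⁻ (tab (λ D → tab (λ Y → beats D Y) A⁻) D⁺) (tab (λ _ → zeros A⁻) A⁻)
            ≡⟨ Vectors.table-≡ (λ D → tab (λ Y → beats D Y) A⁻) (λ _ → zeros A⁻) D⁺ A⁻ ⟩
          tab₂ (λ D X → VectorRace.race D X (λ D → tab (λ Y → beats D Y) A⁻) (λ _ → zeros A⁻)) D⁺ A⁻
            ≡⟨ tab₂-cong (λ D X → trans (race-tab (λ D Y → beats D Y) (λ _ → none) A⁻ D X) (tab-cong (λ Y → sym (beats-++ D X Y)) A⁻)) D⁺ A⁻ ⟩
          tab₃ u D⁺ A⁻ A⁻ ∎
          where open ≡-Reasoning

        E₄s : List (List (List ℤ)) → List ℤ
        E₄s us = map MMM (hypertable D⁺ A⁻ A⁻ A⁻ (tab₃ (λ _ _ _ → + 0) A⁻ A⁻ A⁻) us us us)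

        E₄-≡ : E₄s (tab₃ u D⁺ A⁻ A⁻) ≡ tab E₄ D⁺
        E₄-≡ = trans (cong (map MMM) (hypertable-≡ (λ _ _ _ → + 0) u u u D⁺ A⁻ A⁻ A⁻))
          (trans (map-tab MMM (λ D → tab₃ (case₋₋₋ D) A⁻ A⁻ A⁻) D⁺) (tab-cong (λ D → MMM-≡ (case₋₋₋ D)) D⁺))

        zip₃ : (ℤ → ℤ → ℤ) → List (List (List ℤ)) → List (List (List ℤ)) → List (List (List ℤ))
        zip₃ f = zipWith (zipWith (zipWith f))

        zip₃-tab : ∀ f (g h : List Tilt → List Tilt → List Tilt → ℤ) L M N → zip₃ f (tab₃ g L M N) (tab₃ h L M N) ≡ tab₃ (λ A B C → f (g A B C) (h A B C)) L M N
        zip₃-tab f g h L M N = trans (zipWith-tab (zipWith (zipWith f)) (λ A → tab₂ (g A) M N) (λ A → tab₂ (h A) M N) L)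
          (tab-cong (λ A → trans (zipWith-tab (zipWith f) (λ B → tab (g A B) N) (λ B → tab (h A B) N) M)
            (tab-cong (λ B → zipWith-tab f (g A B) (h A B) N) M)) L)

        lastTwo : List (List (List ℤ)) → List (List (List ℤ))
        lastTwo = map transpose

        lastTwo-≡ : ∀ (f : List Tilt → List Tilt → List Tilt → ℤ) L M N → lastTwo (tab₃ f L M N) ≡ tab₃ (λ A C B → f A B C) L N M
        lastTwo-≡ f L M N = trans (map-tab transpose (λ A → tab₂ (f A) M N) L) (tab-cong (λ A → transpose-tab (f A) M N) L)

        firstTwo-≡ : ∀ (f : List Tilt → List Tilt → List Tilt → ℤ) L M N → transpose (tab₃ f L M N) ≡ tab₃ (λ B A C → f A B C) M L N
        firstTwo-≡ f L M N = transpose-tab (λ A B → tab (f A B) N) L M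

        bs : List ℤ → List (List (List ℤ))
        bs lf = Vectors.table A⁺ A⁺ (table A⁺ A⁺ (zeros A⁺) lf) (map (λ x → map (x ℤ.*_) lf) lf)

        b s p : List Tilt → List Tilt → List Tilt → ℤ
        b N X Y = beaten N (X ++ (Y ++ []))
        s A B C = b A C B
        p A B C = leaf A ℤ.* (leaf B ℤ.* leaf C)

        bs-≡ : bs (tab leaf A⁺) ≡ tab₃ b A⁺ A⁺ A⁺
        bs-≡ = begin
          Vectors.table A⁺ A⁺ (table A⁺ A⁺ (zeros A⁺) (tab leaf A⁺)) (map (λ x → map (x ℤ.*_) (tab leaf A⁺)) (tab leaf A⁺))
            ≡⟨ cong₂ (Vectors.table A⁺ A⁺) (table-≡ none leaf A⁺ A⁺)
                 (trans (map-tab (λ x → map (x ℤ.*_) (tab leaf A⁺)) leaf A⁺) (tab-cong (λ X → map-tab (leaf X ℤ.*_) leaf A⁺) A⁺)) ⟩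
          Vectors.table A⁺ A⁺ (tab (λ N → tab (λ Y → beaten N Y) A⁺) A⁺) (tab (λ X → tab (λ Y → leaf X ℤ.* leaf Y) A⁺) A⁺)
            ≡⟨ Vectors.table-≡ (λ N → tab (λ Y → beaten N Y) A⁺) (λ X → tab (λ Y → leaf X ℤ.* leaf Y) A⁺) A⁺ A⁺ ⟩
          tab₂ (λ N X → VectorRace.race N X (λ N → tab (λ Y → beaten N Y) A⁺) (λ X → tab (λ Y → leaf X ℤ.* leaf Y) A⁺)) A⁺ A⁺
            ≡⟨ tab₂-cong (λ N X → trans (race-tab (λ N Y → beaten N Y) (λ X Y → leaf X ℤ.* leaf Y) A⁺ N X) (tab-cong (λ Y →
                 trans (sym (beaten-++ N X Y)) (cong (λ Y → beaten N (X ++ Y)) (sym (List.++-identityʳ Y)))) A⁺)) A⁺ A⁺ ⟩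
          tab₃ b A⁺ A⁺ A⁺ ∎
          where open ≡-Reasoning

        ps : List ℤ → List (List (List ℤ))
        ps lf = map (λ x → map (λ y → map (λ z → x ℤ.* (y ℤ.* z)) lf) lf) lf

        ps-≡ : ps (tab leaf A⁺) ≡ tab₃ p A⁺ A⁺ A⁺
        ps-≡ = trans (map-tab (λ x → map (λ y → map (λ z → x ℤ.* (y ℤ.* z)) (tab leaf A⁺)) (tab leaf A⁺)) leaf A⁺) (tab-cong (λ A →
               trans (map-tab (λ y → map (λ z → leaf A ℤ.* (y ℤ.* z)) (tab leaf A⁺)) leaf A⁺) (tab-cong (λ B →
               map-tab (λ z → leaf A ℤ.* (leaf B ℤ.* z)) leaf A⁺) A⁺)) A⁺)

        -- The three `beaten` terms are one array read with its axes permuted.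
        case₊₊₊s : List (List (List ℤ)) → List (List (List ℤ)) → List (List (List ℤ))
        case₊₊₊s ss ps = go (transpose ss)
          where
          go : List (List (List ℤ)) → List (List (List ℤ))
          go ts = zip₃ (λ x y → x ℤ.+ ℤ.-1ℤ ℤ.* (y ℤ.+ y)) (zip₃ ℤ._+_ ss (zip₃ ℤ._+_ ts (lastTwo ts))) ps

        case₊₊₊-≡ : case₊₊₊s (lastTwo (tab₃ b A⁺ A⁺ A⁺)) (tab₃ p A⁺ A⁺ A⁺) ≡ tab₃ (case₊₊₊ []) A⁺ A⁺ A⁺
        case₊₊₊-≡ = begin
          case₊₊₊s (lastTwo (tab₃ b A⁺ A⁺ A⁺)) (tab₃ p A⁺ A⁺ A⁺)
            ≡⟨ cong (λ t → case₊₊₊s t (tab₃ p A⁺ A⁺ A⁺)) (lastTwo-≡ b A⁺ A⁺ A⁺) ⟩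
          case₊₊₊s (tab₃ s A⁺ A⁺ A⁺) (tab₃ p A⁺ A⁺ A⁺)
            ≡⟨ cong (λ t → zip₃ f (zip₃ ℤ._+_ (tab₃ s A⁺ A⁺ A⁺) (zip₃ ℤ._+_ t (lastTwo t))) (tab₃ p A⁺ A⁺ A⁺)) (firstTwo-≡ s A⁺ A⁺ A⁺) ⟩
          zip₃ f (zip₃ ℤ._+_ (tab₃ s A⁺ A⁺ A⁺) (zip₃ ℤ._+_ (tab₃ (λ A B C → s B A C) A⁺ A⁺ A⁺) (lastTwo (tab₃ (λ A B C → s B A C) A⁺ A⁺ A⁺)))) (tab₃ p A⁺ A⁺ A⁺)
            ≡⟨ cong (λ t → zip₃ f (zip₃ ℤ._+_ (tab₃ s A⁺ A⁺ A⁺) t) (tab₃ p A⁺ A⁺ A⁺))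
                 (trans (cong (zip₃ ℤ._+_ (tab₃ (λ A B C → s B A C) A⁺ A⁺ A⁺)) (lastTwo-≡ (λ A B C → s B A C) A⁺ A⁺ A⁺))
                        (zip₃-tab ℤ._+_ (λ A B C → s B A C) (λ A B C → s C A B) A⁺ A⁺ A⁺)) ⟩
          zip₃ f (zip₃ ℤ._+_ (tab₃ s A⁺ A⁺ A⁺) (tab₃ (λ A B C → s B A C ℤ.+ s C A B) A⁺ A⁺ A⁺)) (tab₃ p A⁺ A⁺ A⁺)
            ≡⟨ cong (λ t → zip₃ f t (tab₃ p A⁺ A⁺ A⁺)) (zip₃-tab ℤ._+_ s (λ A B C → s B A C ℤ.+ s C A B) A⁺ A⁺ A⁺) ⟩
          zip₃ f (tab₃ (λ A B C → s A B C ℤ.+ (s B A C ℤ.+ s C A B)) A⁺ A⁺ A⁺) (tab₃ p A⁺ A⁺ A⁺)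
            ≡⟨ zip₃-tab f (λ A B C → s A B C ℤ.+ (s B A C ℤ.+ s C A B)) p A⁺ A⁺ A⁺ ⟩
          tab₃ (λ A B C → f (s A B C ℤ.+ (s B A C ℤ.+ s C A B)) (p A B C)) A⁺ A⁺ A⁺
            ≡⟨ tab₃-cong (λ A B C → cong (f (s A B C ℤ.+ (s B A C ℤ.+ s C A B))) (sym (product A B C))) A⁺ A⁺ A⁺ ⟩
          tab₃ (case₊₊₊ []) A⁺ A⁺ A⁺ ∎
          where
          open ≡-Reasoning
          f : ℤ → ℤ → ℤ
          f x y = x ℤ.+ ℤ.-1ℤ ℤ.* (y ℤ.+ y)
          reverse₃ : ∀ x y z → x ℤ.* (y ℤ.* z) ≡ z ℤ.* (y ℤ.* x)
          reverse₃ = ℤSolver.solve-∀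
          product : ∀ A B C → leaf (C ++ (B ++ (A ++ []))) ≡ p A B C
          product A B C = trans (leaf-++ C (B ++ (A ++ []))) (trans (cong (leaf C ℤ.*_) (trans (leaf-++ B (A ++ []))
            (cong (λ A → leaf B ℤ.* leaf A) (List.++-identityʳ A)))) (reverse₃ (leaf C) (leaf B) (leaf A)))

      module _ (D⁺ D⁻ : List Tilt) where
        open Hypertable {Tilt} {ℤ} (λ d a b c x y z r → num (four d a b c) ℤ.* (x ℤ.+ (y ℤ.+ (z ℤ.+ r))))

        E₅s : List (List (List ℤ)) → List ℤ
        E₅s c = map PPP (hypertable D⁻ A⁺ A⁺ A⁺ c zs zs zs)
          where
          zs : List (List (List ℤ))
          zs = tab₃ (λ _ _ _ → + 0) D⁻ A⁺ A⁺

        E₅-≡ : E₅s (tab₃ (case₊₊₊ []) A⁺ A⁺ A⁺) ≡ tab (ahead⁻ A⁺ A⁻) D⁻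
        E₅-≡ = trans (cong (map PPP) (hypertable-≡ (case₊₊₊ []) (λ _ _ _ → + 0) (λ _ _ _ → + 0) (λ _ _ _ → + 0) D⁻ A⁺ A⁺ A⁺))
          (trans (map-tab PPP (λ D → tab₃ (case⁻ D) A⁺ A⁺ A⁺) D⁻) (tab-cong (λ D → PPP-≡ (case⁻ D)) D⁻))

        E₃s : List (List ℤ) → List ℤ → List ℤ → ℤ → List ℤ
        E₃s []         _        lf s = []
        E₃s (ks ∷ kss) []       lf s = []
        E₃s (ks ∷ kss) (c ∷ cs) lf s = + 3 ℤ.* Ts D⁺ ks lf c s ℤ.+ -[1+ 1 ] ℤ.* (s ℤ.* (s ℤ.* (s ℤ.* c))) ∷ E₃s kss cs lf s

        E₃s-≡ : ∀ D → E₃s (tab₂ (λ D N → beaten N D) D A⁺) (tab leaf D) (tab leaf A⁺) (σ D⁺) ≡ tab E₃ D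
        E₃s-≡ []      = cong (_∷ []) (trans (cong (λ x → + 3 ℤ.* x ℤ.+ -[1+ 1 ] ℤ.* (σ D⁺ ℤ.* (σ D⁺ ℤ.* (σ D⁺ ℤ.* leaf [])))) (T-≡ D⁺ [])) (sym (E₃-≡ D⁺ [])))
        E₃s-≡ (d ∷ D) = cong₂ _∷_ (trans (cong (λ x → + 3 ℤ.* x ℤ.+ -[1+ 1 ] ℤ.* (σ D⁺ ℤ.* (σ D⁺ ℤ.* (σ D⁺ ℤ.* leaf (d ∷ D))))) (T-≡ D⁺ (d ∷ D))) (sym (E₃-≡ D⁺ (d ∷ D))))
                                  (E₃s-≡ D)

        E⁺s : List ℤ → List ℤ → List ℤ → List ℤ → List ℤ
        E⁺s e₁ e₂ e₃ e₄ = zipWith (λ x e₄ → x ℤ.+ e₄) (zipWith (λ x e₁ → x ℤ.+ + 3 ℤ.* e₁) (zipWith (λ e₃ e₂ → e₃ ℤ.+ + 3 ℤ.* e₂) e₃ e₂) e₁) e₄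

        E⁺-≡ : E⁺s (tab E₁ D⁺) (tab E₂ D⁺) (tab E₃ D⁺) (tab E₄ D⁺) ≡ tab (ahead⁺ A⁺ A⁻) D⁺
        E⁺-≡ = begin
          E⁺s (tab E₁ D⁺) (tab E₂ D⁺) (tab E₃ D⁺) (tab E₄ D⁺)
            ≡⟨ cong (λ t → zipWith f₄ (zipWith f₃ t (tab E₁ D⁺)) (tab E₄ D⁺)) (zipWith-tab f₃ E₃ E₂ D⁺) ⟩
          zipWith f₄ (zipWith f₃ (tab (λ D → f₃ (E₃ D) (E₂ D)) D⁺) (tab E₁ D⁺)) (tab E₄ D⁺)
            ≡⟨ cong (λ t → zipWith f₄ t (tab E₄ D⁺)) (zipWith-tab f₃ (λ D → f₃ (E₃ D) (E₂ D)) E₁ D⁺) ⟩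
          zipWith f₄ (tab (λ D → f₃ (f₃ (E₃ D) (E₂ D)) (E₁ D)) D⁺) (tab E₄ D⁺)
            ≡⟨ zipWith-tab f₄ (λ D → f₃ (f₃ (E₃ D) (E₂ D)) (E₁ D)) E₄ D⁺ ⟩
          tab (λ D → f₄ (f₃ (f₃ (E₃ D) (E₂ D)) (E₁ D)) (E₄ D)) D⁺
            ≡⟨ tab-cong (λ D → sym (ahead⁺-≡ D)) D⁺ ⟩
          tab (ahead⁺ A⁺ A⁻) D⁺ ∎
          where
          open ≡-Reasoning
          f₃ f₄ : ℤ → ℤ → ℤ
          f₃ x y = x ℤ.+ + 3 ℤ.* y
          f₄ x y = x ℤ.+ y

        -- Results which are used several times are passed as arguments, so that they are evaluated once.
        finish : List ℤ → List ℤ → ℤ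
        finish e⁺ e⁻ = corner (table D⁺ D⁻ e⁺ e⁻)

        plus : List ℤ → List ℤ → List ℤ → List (List (List ℤ)) → List ℤ
        plus lfD lfA h₁s us = E⁺s (E₁s D⁺ (h₂s D⁺ h₁s)) (E₂s D⁺ h₁s) (E₃s (transpose (table A⁺ D⁺ (zeros A⁺) lfD)) lfD lfA (P lfA)) (E₄s D⁺ us)

        start : List ℤ → List ℤ → ℤ
        start lfD lfA = finish (plus lfD lfA (h₁s D⁺ lfD) (us D⁺ lfD)) (E₅s (case₊₊₊s D⁺ (lastTwo D⁺ (bs D⁺ lfA)) (ps D⁺ lfA)))

        efficient : ℤ
        efficient = start (leaves D⁺) (leaves A⁺)

        finish-≡ : finish (tab (ahead⁺ A⁺ A⁻) D⁺) (tab (ahead⁻ A⁺ A⁻) D⁻) ≡ total A⁺ A⁻ D⁺ D⁻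
        finish-≡ = trans (cong corner (table-≡ (ahead⁺ A⁺ A⁻) (ahead⁻ A⁺ A⁻) D⁺ D⁻)) (corner-tab (λ D N → race D N (ahead⁺ A⁺ A⁻) (ahead⁻ A⁺ A⁻)) D⁺ D⁻)

        plus-≡ : plus (tab leaf D⁺) (tab leaf A⁺) (tab (h₁ D⁺) D⁺) (tab₃ (u D⁺) D⁺ A⁻ A⁻) ≡ tab (ahead⁺ A⁺ A⁻) D⁺
        plus-≡ = trans
          (cong₂ (λ f e₄ → f e₄) (cong₂ (λ f e₃ → f e₃) (cong₂ E⁺s (trans (cong (E₁s D⁺) (h₂s-≡ D⁺)) (E₁-≡ D⁺)) (E₂-≡ D⁺))
            (trans (cong₂ (λ kss s → E₃s kss (tab leaf D⁺) (tab leaf A⁺) s)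
              (trans (cong transpose (table-≡ none leaf A⁺ D⁺)) (transpose-tab (λ N D → beaten N D) A⁺ D⁺)) (P-≡ leaf)) (E₃s-≡ D⁺)))
            (E₄-≡ D⁺))
          E⁺-≡

        start-≡ : start (tab leaf D⁺) (tab leaf A⁺) ≡ total A⁺ A⁻ D⁺ D⁻
        start-≡ = trans (cong₂ finish
          (trans (cong₂ (plus (tab leaf D⁺) (tab leaf A⁺)) (h₁s-≡ D⁺) (us-≡ D⁺)) plus-≡)
          (trans (cong E₅s (trans (cong₂ (λ b p → case₊₊₊s D⁺ (lastTwo D⁺ b) p) (bs-≡ D⁺) (ps-≡ D⁺)) (case₊₊₊-≡ D⁺))) E₅-≡))
          finish-≡

        efficient-≡ : efficient ≡ total A⁺ A⁻ D⁺ D⁻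
        efficient-≡ = trans (cong₂ start (leaves-≡ D⁺) (leaves-≡ A⁺)) start-≡

-- Evaluation at a large integer

module Polynomials where

  open import Data.Nat.Base as ℕ using (ℕ; zero; suc; _≤_; z≤n; s≤s)
  import Data.Nat.Properties as ℕ
  import Data.Nat.Tactic.RingSolver as ℕSolver
  open import Data.Integer.Base as ℤ using (ℤ; +_; ∣_∣)
  import Data.Integer.Properties as ℤ
  import Data.Integer.Tactic.RingSolver as ℤSolver
  import Data.Integer.DivMod as ℤ
  open import Data.List.Base using (List; []; _∷_; length)
  import Data.List.Properties as List
  open import Relation.Binary.PropositionalEquality
  open Labels
  open Recursion
  open Line using (Counts; counts; inc-comm; sgn; size; W)
  open Functionals

  eval : ℤ → Poly → ℤ
  eval q []      = + 0
  eval q (m ∷ P) = m ℤ.+ q ℤ.* eval q P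

  -- The sum of the absolute values of the coefficients. It bounds every digit and is easily
  -- followed through sums and products with forms.
  norm : Poly → ℕ
  norm []      = 0
  norm (m ∷ P) = ∣ m ∣ ℕ.+ norm P

  private
    interchange : ∀ a b c d → a ℕ.+ b ℕ.+ (c ℕ.+ d) ≡ (a ℕ.+ c) ℕ.+ (b ℕ.+ d)
    interchange = ℕSolver.solve-∀

  norm-+ : ∀ P R → norm (P +ₚ R) ≤ norm P ℕ.+ norm R
  norm-+ []      R       = ℕ.≤-refl
  norm-+ (m ∷ P) []      = ℕ.m≤m+n (norm (m ∷ P)) 0
  norm-+ (m ∷ P) (n ∷ R) = ℕ.≤-trans (ℕ.+-mono-≤ (ℤ.∣i+j∣≤∣i∣+∣j∣ m n) (norm-+ P R))
    (ℕ.≤-reflexive (interchange (∣ m ∣) (∣ n ∣) (norm P) (norm R)))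

  norm-· : ∀ c P → norm (c ·ₚ P) ≡ ∣ c ∣ ℕ.* norm P
  norm-· c []      = sym (ℕ.*-zeroʳ (∣ c ∣))
  norm-· c (m ∷ P) = trans (cong₂ ℕ._+_ (ℤ.abs-* c m) (norm-· c P)) (sym (ℕ.*-distribˡ-+ (∣ c ∣) (∣ m ∣) (norm P)))

  formNorm : Form → ℕ
  formNorm r₁ = 2
  formNorm r₂ = 3
  formNorm l₁ = 2
  formNorm l₂ = 3

  norm-form : ∀ τ P → norm (τ *ₚ P) ≤ formNorm τ ℕ.* norm P
  norm-form τ P = ℕ.≤-trans (norm-+ (size τ ·ₚ P) (+ 0 ∷ (ℤ.- sgn τ) ·ₚ P))
    (ℕ.≤-reflexive (trans (cong₂ ℕ._+_ (norm-· (size τ) P) (norm-· (ℤ.- sgn τ) P)) (add τ)))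
    where
    add : ∀ τ → ∣ size τ ∣ ℕ.* norm P ℕ.+ ∣ ℤ.- sgn τ ∣ ℕ.* norm P ≡ formNorm τ ℕ.* norm P
    add r₁ = sym (ℕ.*-distribʳ-+ (norm P) 1 1)
    add r₂ = sym (ℕ.*-distribʳ-+ (norm P) 2 1)
    add l₁ = sym (ℕ.*-distribʳ-+ (norm P) 1 1)
    add l₂ = sym (ℕ.*-distribʳ-+ (norm P) 2 1)

  eval-+ : ∀ q P R → eval q (P +ₚ R) ≡ eval q P ℤ.+ eval q R
  eval-+ q []      R       = sym (ℤ.+-identityˡ _)
  eval-+ q (m ∷ P) []      = sym (ℤ.+-identityʳ _)
  eval-+ q (m ∷ P) (n ∷ R) = trans (cong (λ x → m ℤ.+ n ℤ.+ q ℤ.* x) (eval-+ q P R)) (lem q m n (eval q P) (eval q R))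
    where
    lem : ∀ q m n x y → m ℤ.+ n ℤ.+ q ℤ.* (x ℤ.+ y) ≡ (m ℤ.+ q ℤ.* x) ℤ.+ (n ℤ.+ q ℤ.* y)
    lem = ℤSolver.solve-∀

  eval-· : ∀ q c P → eval q (c ·ₚ P) ≡ c ℤ.* eval q P
  eval-· q c []      = sym (ℤ.*-zeroʳ c)
  eval-· q c (m ∷ P) = trans (cong (λ x → c ℤ.* m ℤ.+ q ℤ.* x) (eval-· q c P)) (lem q c m (eval q P))
    where
    lem : ∀ q c m x → c ℤ.* m ℤ.+ q ℤ.* (c ℤ.* x) ≡ c ℤ.* (m ℤ.+ q ℤ.* x)
    lem = ℤSolver.solve-∀

  formAt : ℤ → Form → ℤ
  formAt q τ = size τ ℤ.- sgn τ ℤ.* q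

  eval-form : ∀ q τ P → eval q (τ *ₚ P) ≡ formAt q τ ℤ.* eval q P
  eval-form q τ P = trans (eval-+ q (size τ ·ₚ P) (+ 0 ∷ (ℤ.- sgn τ) ·ₚ P))
    (trans (cong₂ (λ x y → x ℤ.+ (+ 0 ℤ.+ q ℤ.* y)) (eval-· q (size τ) P) (eval-· q (ℤ.- sgn τ) P)) (lem q (sgn τ) (size τ) (eval q P)))
    where
    lem : ∀ q s d x → d ℤ.* x ℤ.+ (+ 0 ℤ.+ q ℤ.* ((ℤ.- s) ℤ.* x)) ≡ (d ℤ.- s ℤ.* q) ℤ.* x
    lem = ℤSolver.solve-∀

  others : ℤ → Form → ℤ
  others q r₁ = formAt q r₂ ℤ.* (formAt q l₁ ℤ.* formAt q l₂)
  others q r₂ = formAt q r₁ ℤ.* (formAt q l₁ ℤ.* formAt q l₂)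
  others q l₁ = formAt q r₁ ℤ.* (formAt q r₂ ℤ.* formAt q l₂)
  others q l₂ = formAt q r₁ ℤ.* (formAt q r₂ ℤ.* formAt q l₁)

  numAt : ℤ → Kind → ℤ
  numAt q (form c τ) = + c ℤ.* others q τ
  numAt q (flat e)   = + e ℤ.* (formAt q r₁ ℤ.* others q r₁)

  private
    assoc₃ : ∀ c f g h x → c ℤ.* (f ℤ.* (g ℤ.* (h ℤ.* x))) ≡ c ℤ.* (f ℤ.* (g ℤ.* h)) ℤ.* x
    assoc₃ = ℤSolver.solve-∀
    assoc₄ : ∀ c e f g h x → c ℤ.* (e ℤ.* (f ℤ.* (g ℤ.* (h ℤ.* x)))) ≡ c ℤ.* (e ℤ.* (f ℤ.* (g ℤ.* h))) ℤ.* x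
    assoc₄ = ℤSolver.solve-∀

    eval-form₃ : ∀ q ρ σ τ P → eval q (ρ *ₚ (σ *ₚ (τ *ₚ P))) ≡ formAt q ρ ℤ.* (formAt q σ ℤ.* (formAt q τ ℤ.* eval q P))
    eval-form₃ q ρ σ τ P = trans (eval-form q ρ (σ *ₚ (τ *ₚ P))) (cong (formAt q ρ ℤ.*_) (trans (eval-form q σ (τ *ₚ P)) (cong (formAt q σ ℤ.*_) (eval-form q τ P))))

  eval-num : ∀ q κ P → eval q (num κ P) ≡ numAt q κ ℤ.* eval q P
  eval-num q (form c r₁) P = trans (eval-· q (+ c) (other-forms r₁ P)) (trans (cong (+ c ℤ.*_) (eval-form₃ q r₂ l₁ l₂ P))
    (assoc₃ (+ c) (formAt q r₂) (formAt q l₁) (formAt q l₂) (eval q P)))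
  eval-num q (form c r₂) P = trans (eval-· q (+ c) (other-forms r₂ P)) (trans (cong (+ c ℤ.*_) (eval-form₃ q r₁ l₁ l₂ P))
    (assoc₃ (+ c) (formAt q r₁) (formAt q l₁) (formAt q l₂) (eval q P)))
  eval-num q (form c l₁) P = trans (eval-· q (+ c) (other-forms l₁ P)) (trans (cong (+ c ℤ.*_) (eval-form₃ q r₁ r₂ l₂ P))
    (assoc₃ (+ c) (formAt q r₁) (formAt q r₂) (formAt q l₂) (eval q P)))
  eval-num q (form c l₂) P = trans (eval-· q (+ c) (other-forms l₂ P)) (trans (cong (+ c ℤ.*_) (eval-form₃ q r₁ r₂ l₁ P))
    (assoc₃ (+ c) (formAt q r₁) (formAt q r₂) (formAt q l₁) (eval q P)))
  eval-num q (flat e)    P = trans (eval-· q (+ e) (all-forms P)) (trans (cong (+ e ℤ.*_) (trans (eval-form q r₁ (r₂ *ₚ (l₁ *ₚ (l₂ *ₚ P))))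
    (cong (formAt q r₁ ℤ.*_) (eval-form₃ q r₂ l₁ l₂ P))))
    (assoc₄ (+ e) (formAt q r₁) (formAt q r₂) (formAt q l₁) (formAt q l₂) (eval q P)))

  -- The norms of the forms are 2, 3, 2, 3: at most 18 for a product of three, and 36 for all four.
  kindNorm : Kind → ℕ
  kindNorm (form c τ) = c ℕ.* 18
  kindNorm (flat e)   = e ℕ.* 36

  private
    norm₃ : ∀ ρ σ τ P → norm (ρ *ₚ (σ *ₚ (τ *ₚ P))) ≤ formNorm ρ ℕ.* (formNorm σ ℕ.* (formNorm τ ℕ.* norm P))
    norm₃ ρ σ τ P = ℕ.≤-trans (norm-form ρ (σ *ₚ (τ *ₚ P))) (ℕ.*-monoʳ-≤ (formNorm ρ) (ℕ.≤-trans (norm-form σ (τ *ₚ P)) (ℕ.*-monoʳ-≤ (formNorm σ) (norm-form τ P))))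

    norm-others : ∀ τ P → norm (other-forms τ P) ≤ 18 ℕ.* norm P
    norm-others r₁ P = ℕ.≤-trans (norm₃ r₂ l₁ l₂ P) (ℕ.≤-reflexive (lem (norm P)))
      where lem : ∀ x → 3 ℕ.* (2 ℕ.* (3 ℕ.* x)) ≡ 18 ℕ.* x
            lem = ℕSolver.solve-∀
    norm-others r₂ P = ℕ.≤-trans (norm₃ r₁ l₁ l₂ P) (ℕ.≤-trans (ℕ.≤-reflexive (lem (norm P))) (ℕ.*-monoˡ-≤ (norm P) (ℕ.m≤m+n 12 6)))
      where lem : ∀ x → 2 ℕ.* (2 ℕ.* (3 ℕ.* x)) ≡ 12 ℕ.* x
            lem = ℕSolver.solve-∀
    norm-others l₁ P = ℕ.≤-trans (norm₃ r₁ r₂ l₂ P) (ℕ.≤-reflexive (lem (norm P)))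
      where lem : ∀ x → 2 ℕ.* (3 ℕ.* (3 ℕ.* x)) ≡ 18 ℕ.* x
            lem = ℕSolver.solve-∀
    norm-others l₂ P = ℕ.≤-trans (norm₃ r₁ r₂ l₁ P) (ℕ.≤-trans (ℕ.≤-reflexive (lem (norm P))) (ℕ.*-monoˡ-≤ (norm P) (ℕ.m≤m+n 12 6)))
      where lem : ∀ x → 2 ℕ.* (3 ℕ.* (2 ℕ.* x)) ≡ 12 ℕ.* x
            lem = ℕSolver.solve-∀

  norm-num : ∀ κ P → norm (num κ P) ≤ kindNorm κ ℕ.* norm P
  norm-num (form c τ) P = ℕ.≤-trans (ℕ.≤-reflexive (norm-· (+ c) (other-forms τ P))) (ℕ.≤-trans (ℕ.*-monoʳ-≤ c (norm-others τ P))
    (ℕ.≤-reflexive (sym (ℕ.*-assoc c 18 (norm P)))))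
  norm-num (flat e)   P = ℕ.≤-trans (ℕ.≤-reflexive (norm-· (+ e) (all-forms P))) (ℕ.≤-trans (ℕ.*-monoʳ-≤ e
    (ℕ.≤-trans (norm-form r₁ (other-forms r₁ P)) (ℕ.≤-trans (ℕ.*-monoʳ-≤ 2 (norm-others r₁ P)) (ℕ.≤-reflexive (sym (ℕ.*-assoc 2 18 (norm P)))))))
    (ℕ.≤-reflexive (sym (ℕ.*-assoc e 36 (norm P)))))

  length-+ : ∀ P R {b} → length P ≤ b → length R ≤ b → length (P +ₚ R) ≤ b
  length-+ []      R       p       r       = r
  length-+ (m ∷ P) []      p       r       = p
  length-+ (m ∷ P) (n ∷ R) (s≤s p) (s≤s r) = s≤s (length-+ P R p r)

  length-· : ∀ c P {b} → length P ≤ b → length (c ·ₚ P) ≤ b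
  length-· c P p = ℕ.≤-trans (ℕ.≤-reflexive (List.length-map (c ℤ.*_) P)) p

  length-form : ∀ τ P {b} → length P ≤ b → length (τ *ₚ P) ≤ suc b
  length-form τ P p = length-+ (size τ ·ₚ P) (+ 0 ∷ (ℤ.- sgn τ) ·ₚ P) (ℕ.m≤n⇒m≤1+n (length-· (size τ) P p)) (s≤s (length-· (ℤ.- sgn τ) P p))

  length-num : ∀ κ P {b} → length P ≤ b → length (num κ P) ≤ 4 ℕ.+ b
  length-num (form c τ) P {b} p = length-· (+ c) (other-forms τ P) (ℕ.m≤n⇒m≤1+n (three τ))
    where
    three : ∀ τ → length (other-forms τ P) ≤ 3 ℕ.+ b
    three r₁ = length-form r₂ (l₁ *ₚ (l₂ *ₚ P)) (length-form l₁ (l₂ *ₚ P) (length-form l₂ P p))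
    three r₂ = length-form r₁ (l₁ *ₚ (l₂ *ₚ P)) (length-form l₁ (l₂ *ₚ P) (length-form l₂ P p))
    three l₁ = length-form r₁ (r₂ *ₚ (l₂ *ₚ P)) (length-form r₂ (l₂ *ₚ P) (length-form l₂ P p))
    three l₂ = length-form r₁ (r₂ *ₚ (l₁ *ₚ P)) (length-form r₂ (l₁ *ₚ P) (length-form l₁ P p))
  length-num (flat e)   P p = length-· (+ e) (all-forms P) (length-form r₁ (r₂ *ₚ (l₁ *ₚ (l₂ *ₚ P))) (length-form r₂ (l₁ *ₚ (l₂ *ₚ P))
    (length-form l₁ (l₂ *ₚ P) (length-form l₂ P p))))

  twelves-≡ : ∀ k x → twelves k x ≡ + (12 ℕ.^ k) ℤ.* x
  twelves-≡ zero    x = sym (ℤ.*-identityˡ x)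
  twelves-≡ (suc k) x = trans (dozen-≡ _) (trans (cong (+ 12 ℤ.*_) (twelves-≡ k x)) (trans (sym (ℤ.*-assoc (+ 12) (+ (12 ℕ.^ k)) x))
    (cong (ℤ._* x) (sym (ℤ.pos-* 12 (12 ℕ.^ k))))))

  twelves-+ : ∀ k x y → twelves k (x ℤ.+ y) ≡ twelves k x ℤ.+ twelves k y
  twelves-+ k x y = trans (twelves-≡ k (x ℤ.+ y)) (trans (ℤ.*-distribˡ-+ (+ (12 ℕ.^ k)) x y) (sym (cong₂ ℤ._+_ (twelves-≡ k x) (twelves-≡ k y))))

  twelves-* : ∀ k c x → twelves k (c ℤ.* x) ≡ c ℤ.* twelves k x
  twelves-* k c x = trans (twelves-≡ k (c ℤ.* x)) (trans (lem (+ (12 ℕ.^ k)) c x) (cong (c ℤ.*_) (sym (twelves-≡ k x))))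
    where
    lem : ∀ t c x → t ℤ.* (c ℤ.* x) ≡ c ℤ.* (t ℤ.* x)
    lem = ℤSolver.solve-∀

  twelves-twelves : ∀ j k x → twelves j (twelves k x) ≡ twelves (j ℕ.+ k) x
  twelves-twelves zero    k x = refl
  twelves-twelves (suc j) k x = cong dozen (twelves-twelves j k x)

  residuals : List Label → Counts
  residuals []      = counts 0 0 0 0
  residuals (g ∷ T) = residual (kind g) (residuals T)

  factors : List Label → ℤ
  factors []      = + 1
  factors (g ∷ T) = factor (kind g) ℤ.* factors T

  W⁺-≡ : ∀ T → W⁺ T (counts 0 0 0 0) ≡ factors T ℤ.* W (residuals T)
  W⁺-≡ T = trans (go T (counts 0 0 0 0)) (cong (λ m → factors T ℤ.* W m) (res-≡ T))
    where
    res : List Label → Counts → Counts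
    res []      n = n
    res (g ∷ T) n = residual (kind g) (res T n)
    residual-comm : ∀ κ κ′ n → residual κ (residual κ′ n) ≡ residual κ′ (residual κ n)
    residual-comm (form c τ) (form c′ σ) n = inc-comm τ σ n
    residual-comm (form c τ) (flat e)    n = refl
    residual-comm (flat e)   _           n = refl
    res-comm : ∀ κ T n → res T (residual κ n) ≡ residual κ (res T n)
    res-comm κ []      n = refl
    res-comm κ (g ∷ T) n = trans (cong (residual (kind g)) (res-comm κ T n)) (residual-comm (kind g) κ (res T n))
    res-≡ : ∀ T → res T (counts 0 0 0 0) ≡ residuals T
    res-≡ []      = refl
    res-≡ (g ∷ T) = cong (residual (kind g)) (res-≡ T)
    go : ∀ T n → W⁺ T n ≡ factors T ℤ.* W (res T n)
    go []      n = sym (ℤ.*-identityˡ (W n))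
    go (g ∷ T) n = trans (cong (factor (kind g) ℤ.*_) (trans (go T (residual (kind g) n)) (cong (λ m → factors T ℤ.* W m) (res-comm (kind g) T n))))
      (sym (ℤ.*-assoc (factor (kind g)) (factors T) _))

  ⟪1⟫ : ∀ n → ⟪ + 1 ∷ [] ⟫ n ≡ W n
  ⟪1⟫ n = trans (cong₂ ℤ._+_ (ℤ.*-identityˡ (W n)) (z n)) (ℤ.+-identityʳ (W n))
    where
    z : ∀ n → functional-q n [] ⟪ [] ⟫ ≡ + 0
    z (counts a h b (suc k))          = refl
    z (counts a h (suc b) zero)       = refl
    z (counts (suc a) h zero zero)    = refl
    z (counts zero (suc h) zero zero) = refl
    z (counts zero zero zero zero)    = refl

  -- `T` holds the labels emitted before, and `n` is the number still to come. Each of these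
  -- contributes the quartic Π, hence length 4n + 1 and twelves to the power 3n. The base 144 covers
  -- the norm of a label and the number of branches.
  record Represents (q : ℤ) (c n : ℕ) (Φ : List Label → ℤ) (z : ℤ) : Set where
    field
      poly       : Poly
      evaluates  : eval q poly ≡ z
      small      : norm poly ≤ c ℕ.* 144 ℕ.^ n
      short      : length poly ≤ suc (n ℕ.* 4)
      represents : ∀ T → twelves (n ℕ.* 3) (Φ T) ≡ factors T ℤ.* ⟪ poly ⟫ (inc-alls n (residuals T))
  open Represents

  module Representation (q : ℤ) where
    private
      R : ℕ → ℕ → (List Label → ℤ) → ℤ → Set
      R = Represents q

    R-zero : ∀ {c} n → R c n (λ _ → + 0) (+ 0)
    R-zero n = record
      { poly = [] ; evaluates = refl ; small = z≤n ; short = z≤n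
      ; represents = λ T → trans (twelves-≡ (n ℕ.* 3) (+ 0)) (trans (ℤ.*-zeroʳ (+ (12 ℕ.^ (n ℕ.* 3)))) (sym (ℤ.*-zeroʳ (factors T))))
      }

    R-unit : ∀ {c} → R (suc c) 0 (λ T → W⁺ T (counts 0 0 0 0)) (+ 1)
    R-unit {c} = record
      { poly = + 1 ∷ [] ; evaluates = trans (cong (λ x → + 1 ℤ.+ x) (ℤ.*-zeroʳ q)) refl ; small = s≤s z≤n ; short = ℕ.≤-refl
      ; represents = λ T → trans (W⁺-≡ T) (cong (factors T ℤ.*_) (sym (⟪1⟫ (residuals T))))
      }

    R-+ : ∀ {c c′ n Φ Ψ y z} → R c n Φ y → R c′ n Ψ z → R (c ℕ.+ c′) n (λ T → Φ T ℤ.+ Ψ T) (y ℤ.+ z)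
    R-+ {c} {c′} {n} {Φ} {Ψ} r s = record
      { poly       = poly r +ₚ poly s
      ; evaluates  = trans (eval-+ q (poly r) (poly s)) (cong₂ ℤ._+_ (evaluates r) (evaluates s))
      ; small      = ℕ.≤-trans (norm-+ (poly r) (poly s)) (ℕ.≤-trans (ℕ.+-mono-≤ (small r) (small s)) (ℕ.≤-reflexive (sym (ℕ.*-distribʳ-+ (144 ℕ.^ n) c c′))))
      ; short      = length-+ (poly r) (poly s) (short r) (short s)
      ; represents = λ T → trans (twelves-+ (n ℕ.* 3) (Φ T) (Ψ T)) (trans (cong₂ ℤ._+_ (represents r T) (represents s T))
          (trans (sym (ℤ.*-distribˡ-+ (factors T) _ _)) (cong (factors T ℤ.*_) (sym (⟪⟫-+ (poly r) (poly s) (inc-alls n (residuals T)))))))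
      }

    R-neg : ∀ {c n Φ z} → R c n Φ z → R c n (λ T → ℤ.-1ℤ ℤ.* Φ T) (ℤ.-1ℤ ℤ.* z)
    R-neg {c} {n} {Φ} r = record
      { poly       = ℤ.-1ℤ ·ₚ poly r
      ; evaluates  = trans (eval-· q ℤ.-1ℤ (poly r)) (cong (ℤ.-1ℤ ℤ.*_) (evaluates r))
      ; small      = ℕ.≤-trans (ℕ.≤-reflexive (trans (norm-· ℤ.-1ℤ (poly r)) (ℕ.*-identityˡ _))) (small r)
      ; short      = length-· ℤ.-1ℤ (poly r) (short r)
      ; represents = λ T → trans (twelves-* (n ℕ.* 3) ℤ.-1ℤ (Φ T)) (trans (cong (ℤ.-1ℤ ℤ.*_) (represents r T))
          (trans (exchange ℤ.-1ℤ (factors T) (⟪ poly r ⟫ (inc-alls n (residuals T)))) (cong (factors T ℤ.*_) (sym (⟪⟫-· ℤ.-1ℤ (poly r) (inc-alls n (residuals T)))))))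
      }
      where
      exchange : ∀ a b c → a ℤ.* (b ℤ.* c) ≡ b ℤ.* (a ℤ.* c)
      exchange = ℤSolver.solve-∀

    R-emit : ∀ {c c′ n Φ z} g → kindNorm (kind g) ℕ.* c ≤ c′ ℕ.* 144 → R c n Φ z → R c′ (suc n) (λ T → Φ (g ∷ T)) (numAt q (kind g) ℤ.* z)
    R-emit {c} {c′} {n} {Φ} g bound r = record
      { poly       = num (kind g) (poly r)
      ; evaluates  = trans (eval-num q (kind g) (poly r)) (cong (numAt q (kind g) ℤ.*_) (evaluates r))
      ; small      = ℕ.≤-trans (norm-num (kind g) (poly r)) (ℕ.≤-trans (ℕ.*-monoʳ-≤ (kindNorm (kind g)) (small r))
          (ℕ.≤-trans (ℕ.≤-reflexive (sym (ℕ.*-assoc (kindNorm (kind g)) c (144 ℕ.^ n)))) (ℕ.≤-trans (ℕ.*-monoˡ-≤ (144 ℕ.^ n) bound)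
            (ℕ.≤-reflexive (ℕ.*-assoc c′ 144 (144 ℕ.^ n))))))
      ; short      = ℕ.≤-trans (length-num (kind g) (poly r) (short r)) (ℕ.≤-reflexive (ℕ.+-suc 4 (n ℕ.* 4)))
      ; represents = λ T → begin
          twelves (3 ℕ.+ n ℕ.* 3) (Φ (g ∷ T))
            ≡⟨ twelves-twelves 3 (n ℕ.* 3) (Φ (g ∷ T)) ⟨
          twelves 3 (twelves (n ℕ.* 3) (Φ (g ∷ T)))
            ≡⟨ cong (twelves 3) (represents r (g ∷ T)) ⟩
          twelves 3 (factor (kind g) ℤ.* factors T ℤ.* ⟪ poly r ⟫ (inc-alls n (residual (kind g) (residuals T))))
            ≡⟨ twelves-* 3 (factor (kind g) ℤ.* factors T) _ ⟩
          factor (kind g) ℤ.* factors T ℤ.* twelves 3 (⟪ poly r ⟫ (inc-alls n (residual (kind g) (residuals T))))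
            ≡⟨ cong (λ m → factor (kind g) ℤ.* factors T ℤ.* twelves 3 (⟪ poly r ⟫ m)) (inc-inc-alls (kind g) n (residuals T)) ⟨
          factor (kind g) ℤ.* factors T ℤ.* twelves 3 (⟪ poly r ⟫ (residual (kind g) (inc-alls n (residuals T))))
            ≡⟨ exchange (factor (kind g)) (factors T) _ ⟩
          factors T ℤ.* (factor (kind g) ℤ.* twelves 3 (⟪ poly r ⟫ (residual (kind g) (inc-alls n (residuals T)))))
            ≡⟨ cong (factors T ℤ.*_) (⟪⟫-num (kind g) (poly r) (inc-alls n (residuals T))) ⟨
          factors T ℤ.* ⟪ num (kind g) (poly r) ⟫ (inc-all (inc-alls n (residuals T))) ∎
      }
      where
      open ≡-Reasoning
      exchange : ∀ a b c → a ℤ.* b ℤ.* c ≡ b ℤ.* (a ℤ.* c)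
      exchange = ℤSolver.solve-∀

    R-one : ∀ {c n Φ z} a → R c n Φ z → R c (suc n) (λ T → Φ (one a ∷ T)) (numAt q (kind (one a)) ℤ.* z)
    R-one {c} a = R-emit (one a) (bound a)
      where
      bound : ∀ a → kindNorm (kind (one a)) ℕ.* c ≤ c ℕ.* 144
      bound up = ℕ.≤-trans (ℕ.*-monoˡ-≤ c (ℕ.m≤m+n 72 72)) (ℕ.≤-reflexive (ℕ.*-comm 144 c))
      bound dn = ℕ.≤-trans (ℕ.*-monoˡ-≤ c (ℕ.m≤m+n 72 72)) (ℕ.≤-reflexive (ℕ.*-comm 144 c))

    -- This step determines 144: a flat pair has norm 72, and two branches are added.
    R-two : ∀ {c n Φ z} a b → R (c ℕ.+ c) n Φ z → R c (suc n) (λ T → Φ (two a b ∷ T)) (numAt q (kind (two a b)) ℤ.* z)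
    R-two {c} a b = R-emit (two a b) (bound a b)
      where
      weak : 36 ℕ.* (c ℕ.+ c) ≤ c ℕ.* 144
      weak = ℕ.≤-trans (ℕ.≤-reflexive (lem c)) (ℕ.≤-trans (ℕ.*-monoˡ-≤ c (ℕ.m≤m+n 72 72)) (ℕ.≤-reflexive (ℕ.*-comm 144 c)))
        where lem : ∀ c → 36 ℕ.* (c ℕ.+ c) ≡ 72 ℕ.* c
              lem = ℕSolver.solve-∀
      strong : 72 ℕ.* (c ℕ.+ c) ≤ c ℕ.* 144
      strong = ℕ.≤-reflexive (lem c)
        where lem : ∀ c → 72 ℕ.* (c ℕ.+ c) ≡ c ℕ.* 144
              lem = ℕSolver.solve-∀
      bound : ∀ a b → kindNorm (kind (two a b)) ℕ.* (c ℕ.+ c) ≤ c ℕ.* 144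
      bound up up = weak
      bound up dn = strong
      bound dn up = strong
      bound dn dn = weak

    -- Norm at most 36 and four branches, again 144.
    R-four : ∀ {c n Φ z} a b d e → R (c ℕ.+ (c ℕ.+ (c ℕ.+ c))) n Φ z → R c (suc n) (λ T → Φ (four a b d e ∷ T)) (numAt q (kind (four a b d e)) ℤ.* z)
    R-four {c} a b d e = R-emit (four a b d e) (ℕ.≤-trans (ℕ.*-monoˡ-≤ (c ℕ.+ (c ℕ.+ (c ℕ.+ c))) (bound (ups a (ups b (ups d (ups e 0)))) refl)) (ℕ.≤-reflexive (lem c)))
      where
      lem : ∀ c → 36 ℕ.* (c ℕ.+ (c ℕ.+ (c ℕ.+ c))) ≡ c ℕ.* 144
      lem = ℕSolver.solve-∀
      bound : ∀ n → ups a (ups b (ups d (ups e 0))) ≡ n → kindNorm (kind (four a b d e)) ≤ 36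
      bound 0 eq rewrite eq = ℕ.m≤m+n 18 18
      bound 1 eq rewrite eq = ℕ.≤-refl
      bound 2 eq rewrite eq = ℕ.≤-refl
      bound 3 eq rewrite eq = ℕ.≤-refl
      bound (suc (suc (suc (suc n)))) eq rewrite eq = ℕ.m≤m+n 18 18

-- The integer recursion represents the volumes

module Encoding where

  open import Data.Nat.Base as ℕ using (ℕ; suc)
  import Data.Nat.Properties as ℕ
  import Data.Nat.Tactic.RingSolver as ℕSolver
  open import Data.Integer.Base as ℤ using (ℤ; +_)
  open import Data.List.Base using (List; []; _∷_; length; _++_)
  import Data.List.Properties as List
  open import Relation.Binary.PropositionalEquality
  open Labels
  open Recursion
  open Functionals
  open Polynomials
  open Tables using (module Integers)

  module _ (q : ℤ) (num : Label → ℤ) (num-≡ : ∀ g → num g ≡ numAt q (kind g)) where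
    open Representation q renaming (R-one to R-one′; R-two to R-two′; R-four to R-four′)
    private
      module F = Evaluate 𝔽
    open Integers num using (ℤAlgebra)
    private
      module Z = Evaluate ℤAlgebra
      Value = List Label → ℤ
      R : ℕ → ℕ → Value → ℤ → Set
      R = Represents q

      R-one : ∀ {c n Φ z} a → R c n Φ z → R c (suc n) (λ T → Φ (one a ∷ T)) (num (one a) ℤ.* z)
      R-one {c} {n} {Φ} {z} a r = subst (λ x → R c (suc n) (λ T → Φ (one a ∷ T)) (x ℤ.* z)) (sym (num-≡ (one a))) (R-one′ a r)

      R-two : ∀ {c n Φ z} a b → R (c ℕ.+ c) n Φ z → R c (suc n) (λ T → Φ (two a b ∷ T)) (num (two a b) ℤ.* z)
      R-two {c} {n} {Φ} {z} a b r = subst (λ x → R c (suc n) (λ T → Φ (two a b ∷ T)) (x ℤ.* z)) (sym (num-≡ (two a b))) (R-two′ a b r)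

      R-four : ∀ {c n Φ z} a b d e → R (c ℕ.+ (c ℕ.+ (c ℕ.+ c))) n Φ z → R c (suc n) (λ T → Φ (four a b d e ∷ T)) (num (four a b d e) ℤ.* z)
      R-four {c} {n} {Φ} {z} a b d e r = subst (λ x → R c (suc n) (λ T → Φ (four a b d e ∷ T)) (x ℤ.* z)) (sym (num-≡ (four a b d e))) (R-four′ a b d e r)

    resize : ∀ {c m n Φ z} → m ≡ n → R c m Φ z → R c n Φ z
    resize refl r = r

    -- Each step removes one entry and emits one label, so the remaining lengths count the labels to
    -- come.
    follow-race : ∀ {c} m {k l : List Tilt → Value} {k′ l′ : List Tilt → ℤ} →
                  (∀ A → R c (length A ℕ.+ m) (k A) (k′ A)) → (∀ B → R c (length B ℕ.+ m) (l B) (l′ B)) →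
                  ∀ A B → R c (length A ℕ.+ length B ℕ.+ m) (F.race A B k l) (Z.race A B k′ l′)
    follow-race m f g []      B       = g B
    follow-race m f g (a ∷ A) []      = resize (cong (ℕ._+ m) (sym (ℕ.+-identityʳ (suc (length A))))) (f (a ∷ A))
    follow-race m f g (a ∷ A) (b ∷ B) = R-two a b (R-+ (follow-race m f g A (b ∷ B))
      (resize (cong (ℕ._+ m) (sym (ℕ.+-suc (length A) (length B)))) (follow-race m f g (a ∷ A) B)))

    follow-leaf : ∀ {c} A → R (suc c) (length A) (F.leaf A) (Z.leaf A)
    follow-leaf []      = R-unit
    follow-leaf (a ∷ A) = R-one a (follow-leaf A)

    follow-beats : ∀ {c} P N → R (suc c) (length P ℕ.+ length N) (F.beats P N) (Z.beats P N)
    follow-beats P N = resize (ℕ.+-identityʳ _) (follow-race 0 (λ A → resize (sym (ℕ.+-identityʳ _)) (follow-leaf A)) (λ B → R-zero (length B ℕ.+ 0)) P N)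

    follow-beaten : ∀ {c} N P → R (suc c) (length N ℕ.+ length P) (F.beaten N P) (Z.beaten N P)
    follow-beaten N P = resize (ℕ.+-identityʳ _) (follow-race 0 (λ B → R-zero (length B ℕ.+ 0)) (λ A → resize (sym (ℕ.+-identityʳ _)) (follow-leaf A)) N P)

    follow-quad : ∀ {c} {kD kA kB kC : List Tilt → List Tilt → List Tilt → Value} {kD′ kA′ kB′ kC′ : List Tilt → List Tilt → List Tilt → ℤ} →
      (∀ A B C → R c (length A ℕ.+ (length B ℕ.+ length C)) (kD A B C) (kD′ A B C)) →
      (∀ D B C → R c (length D ℕ.+ (length B ℕ.+ length C)) (kA D B C) (kA′ D B C)) →
      (∀ D A C → R c (length D ℕ.+ (length A ℕ.+ length C)) (kB D A C) (kB′ D A C)) →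
      (∀ D A B → R c (length D ℕ.+ (length A ℕ.+ length B)) (kC D A B) (kC′ D A B)) →
      ∀ D A B C → R c (length D ℕ.+ (length A ℕ.+ (length B ℕ.+ length C))) (F.quad D A B C kD kA kB kC) (Z.quad D A B C kD′ kA′ kB′ kC′)
    follow-quad fD fA fB fC = go
      where
      size₁ : ∀ a b c d → suc d ℕ.+ (a ℕ.+ (suc b ℕ.+ suc c)) ≡ d ℕ.+ (suc a ℕ.+ (suc b ℕ.+ suc c))
      size₁ = ℕSolver.solve-∀
      size₂ : ∀ a b c d → suc d ℕ.+ (suc a ℕ.+ (b ℕ.+ suc c)) ≡ d ℕ.+ (suc a ℕ.+ (suc b ℕ.+ suc c))
      size₂ = ℕSolver.solve-∀
      size₃ : ∀ a b c d → suc d ℕ.+ (suc a ℕ.+ (suc b ℕ.+ c)) ≡ d ℕ.+ (suc a ℕ.+ (suc b ℕ.+ suc c))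
      size₃ = ℕSolver.solve-∀
      go : ∀ D A B C → R _ (length D ℕ.+ (length A ℕ.+ (length B ℕ.+ length C))) (F.quad D A B C _ _ _ _) (Z.quad D A B C _ _ _ _)
      go []      A       B       C       = fD A B C
      go (d ∷ D) []      B       C       = fA (d ∷ D) B C
      go (d ∷ D) (a ∷ A) []      C       = fB (d ∷ D) (a ∷ A) C
      go (d ∷ D) (a ∷ A) (b ∷ B) []      = resize (cong (λ x → suc (length D ℕ.+ (suc (length A) ℕ.+ x))) (sym (ℕ.+-identityʳ _))) (fC (d ∷ D) (a ∷ A) (b ∷ B))
      go (d ∷ D) (a ∷ A) (b ∷ B) (c ∷ C) = R-four d a b c (R-+ (go D (a ∷ A) (b ∷ B) (c ∷ C))
        (R-+ (resize (size₁ (length A) (length B) (length C) (length D)) (go (d ∷ D) A (b ∷ B) (c ∷ C)))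
        (R-+ (resize (size₂ (length A) (length B) (length C) (length D)) (go (d ∷ D) (a ∷ A) B (c ∷ C)))
             (resize (size₃ (length A) (length B) (length C) (length D)) (go (d ∷ D) (a ∷ A) (b ∷ B) C)))))

    private
      length₃ : ∀ (X Y Z : List Tilt) → length (X ++ (Y ++ Z)) ≡ length X ℕ.+ (length Y ℕ.+ length Z)
      length₃ X Y Z = trans (List.length-++ X) (cong (length X ℕ.+_) (List.length-++ Y))

      N : (D A B C : List Tilt) → ℕ
      N D A B C = length D ℕ.+ (length A ℕ.+ (length B ℕ.+ length C))

    -- Origin of the constant 5: three races and two copies of `leaf`.
    follow₊₊₊ : ∀ D A B C → R 5 (N D A B C) (F.case₊₊₊ D A B C) (Z.case₊₊₊ D A B C)
    follow₊₊₊ D A B C = R-+ {3} {2}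
      (R-+ {1} {2} (resize (trans (cong (length A ℕ.+_) (length₃ C B D)) (size₁ (length A) (length B) (length C) (length D))) (follow-beaten A (C ++ (B ++ D))))
      (R-+ {1} {1} (resize (trans (cong (length B ℕ.+_) (length₃ C A D)) (size₂ (length A) (length B) (length C) (length D))) (follow-beaten B (C ++ (A ++ D))))
                   (resize (trans (cong (length C ℕ.+_) (length₃ B A D)) (size₃ (length A) (length B) (length C) (length D))) (follow-beaten C (B ++ (A ++ D))))))
      (R-neg {2} (R-+ {1} {1} l l))
      where
      size₁ : ∀ a b c d → a ℕ.+ (c ℕ.+ (b ℕ.+ d)) ≡ d ℕ.+ (a ℕ.+ (b ℕ.+ c))
      size₁ = ℕSolver.solve-∀
      size₂ : ∀ a b c d → b ℕ.+ (c ℕ.+ (a ℕ.+ d)) ≡ d ℕ.+ (a ℕ.+ (b ℕ.+ c))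
      size₂ = ℕSolver.solve-∀
      size₃ : ∀ a b c d → c ℕ.+ (b ℕ.+ (a ℕ.+ d)) ≡ d ℕ.+ (a ℕ.+ (b ℕ.+ c))
      size₃ = ℕSolver.solve-∀
      l : R 1 (N D A B C) (F.leaf (C ++ (B ++ (A ++ D)))) (Z.leaf (C ++ (B ++ (A ++ D))))
      l = resize (trans (List.length-++ C) (trans (cong (length C ℕ.+_) (length₃ B A D)) (size₃ (length A) (length B) (length C) (length D)))) (follow-leaf (C ++ (B ++ (A ++ D))))

    follow₊₊₋ : ∀ D A B C → R 5 (N D A B C) (F.case₊₊₋ D A B C) (Z.case₊₊₋ D A B C)
    follow₊₊₋ D A B C = resize (size (length A) (length B) (length C) (length D)) (follow-race (length D ℕ.+ length C) each each A B)
      where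
      size : ∀ a b c d → a ℕ.+ b ℕ.+ (d ℕ.+ c) ≡ d ℕ.+ (a ℕ.+ (b ℕ.+ c))
      size = ℕSolver.solve-∀
      flip : ∀ a c d → d ℕ.+ (a ℕ.+ c) ≡ a ℕ.+ (d ℕ.+ c)
      flip = ℕSolver.solve-∀
      each : ∀ A → R 5 (length A ℕ.+ (length D ℕ.+ length C)) (F.beats D (A ++ C)) (Z.beats D (A ++ C))
      each A = resize (trans (cong (length D ℕ.+_) (List.length-++ A)) (flip (length A) (length C) (length D))) (follow-beats D (A ++ C))

    follow₊₋₋ : ∀ D A B C → R 5 (N D A B C) (F.case₊₋₋ D A B C) (Z.case₊₋₋ D A B C)
    follow₊₋₋ D A B C = resize (cong (length D ℕ.+_) (length₃ A B C)) (follow-beats D (A ++ (B ++ C)))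

    follow₋₋₋ : ∀ D A B C → R 5 (N D A B C) (F.case₋₋₋ D A B C) (Z.case₋₋₋ D A B C)
    follow₋₋₋ = follow-quad (λ A B C → R-zero (length A ℕ.+ (length B ℕ.+ length C))) each each each
      where
      each : ∀ D B C → R 5 (length D ℕ.+ (length B ℕ.+ length C)) (F.beats D (B ++ C)) (Z.beats D (B ++ C))
      each D B C = resize (cong (length D ℕ.+_) (List.length-++ B)) (follow-beats D (B ++ C))

    follow⁻ : ∀ D A B C → R 5 (N D A B C) (F.case⁻ D A B C) (Z.case⁻ D A B C)
    follow⁻ = follow-quad (follow₊₊₊ []) zero₃ zero₃ zero₃
      where
      zero₃ : ∀ A B C → R 5 (length A ℕ.+ (length B ℕ.+ length C)) (λ _ → + 0) (+ 0)
      zero₃ A B C = R-zero (length A ℕ.+ (length B ℕ.+ length C))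

    module _ (A⁺ A⁻ : List Tilt) where
      private
        a = length A⁺ ℕ.+ length A⁻

      follow-line : ∀ {f g : List Tilt → Value} {f′ g′ : List Tilt → ℤ} m →
        (∀ C → R 5 (length C ℕ.+ m) (f C) (f′ C)) → (∀ C → R 5 (length C ℕ.+ m) (g C) (g′ C)) →
        R 5 (a ℕ.+ m) (F.race A⁺ A⁻ f g) (Z.race A⁺ A⁻ f′ g′)
      follow-line m f g = follow-race m f g A⁺ A⁻

      private
        out₃ : ∀ d a b c → d ℕ.+ (a ℕ.+ (b ℕ.+ c)) ≡ c ℕ.+ (b ℕ.+ (a ℕ.+ d))
        out₃ = ℕSolver.solve-∀
        out₂ : ∀ d a b c → c ℕ.+ (b ℕ.+ (a ℕ.+ d)) ≡ b ℕ.+ (c ℕ.+ (a ℕ.+ d))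
        out₂ = ℕSolver.solve-∀
        out₁ : ∀ d a x → x ℕ.+ (x ℕ.+ (a ℕ.+ d)) ≡ a ℕ.+ (x ℕ.+ (x ℕ.+ d))
        out₁ = ℕSolver.solve-∀

        three : ∀ D {k₀ k₁ k₂ k₃ k₄ k₅ k₆ k₇ : List Tilt → List Tilt → List Tilt → Value}
                    {k₀′ k₁′ k₂′ k₃′ k₄′ k₅′ k₆′ k₇′ : List Tilt → List Tilt → List Tilt → ℤ} →
          (∀ A B C → R 5 (N D A B C) (k₀ A B C) (k₀′ A B C)) → (∀ A B C → R 5 (N D A B C) (k₁ A B C) (k₁′ A B C)) →
          (∀ A B C → R 5 (N D A B C) (k₂ A B C) (k₂′ A B C)) → (∀ A B C → R 5 (N D A B C) (k₃ A B C) (k₃′ A B C)) →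
          (∀ A B C → R 5 (N D A B C) (k₄ A B C) (k₄′ A B C)) → (∀ A B C → R 5 (N D A B C) (k₅ A B C) (k₅′ A B C)) →
          (∀ A B C → R 5 (N D A B C) (k₆ A B C) (k₆′ A B C)) → (∀ A B C → R 5 (N D A B C) (k₇ A B C) (k₇′ A B C)) →
          R 5 (a ℕ.+ (a ℕ.+ (a ℕ.+ length D)))
            (F.race A⁺ A⁻ (λ A → F.race A⁺ A⁻ (λ B → F.race A⁺ A⁻ (λ C → k₀ A B C) (λ C → k₁ A B C)) (λ B → F.race A⁺ A⁻ (λ C → k₂ A B C) (λ C → k₃ A B C)))
                          (λ A → F.race A⁺ A⁻ (λ B → F.race A⁺ A⁻ (λ C → k₄ A B C) (λ C → k₅ A B C)) (λ B → F.race A⁺ A⁻ (λ C → k₆ A B C) (λ C → k₇ A B C))))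
            (Z.race A⁺ A⁻ (λ A → Z.race A⁺ A⁻ (λ B → Z.race A⁺ A⁻ (λ C → k₀′ A B C) (λ C → k₁′ A B C)) (λ B → Z.race A⁺ A⁻ (λ C → k₂′ A B C) (λ C → k₃′ A B C)))
                          (λ A → Z.race A⁺ A⁻ (λ B → Z.race A⁺ A⁻ (λ C → k₄′ A B C) (λ C → k₅′ A B C)) (λ B → Z.race A⁺ A⁻ (λ C → k₆′ A B C) (λ C → k₇′ A B C))))
        three D f₀ f₁ f₂ f₃ f₄ f₅ f₆ f₇ = follow-line (a ℕ.+ (a ℕ.+ length D)) (λ A → last₂ A (f₀ A) (f₁ A) (f₂ A) (f₃ A)) (λ A → last₂ A (f₄ A) (f₅ A) (f₆ A) (f₇ A))
          where
          last : ∀ A B {f g : List Tilt → Value} {f′ g′ : List Tilt → ℤ} →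
                 (∀ C → R 5 (N D A B C) (f C) (f′ C)) → (∀ C → R 5 (N D A B C) (g C) (g′ C)) →
                 R 5 (length B ℕ.+ (a ℕ.+ (length A ℕ.+ length D))) (F.race A⁺ A⁻ f g) (Z.race A⁺ A⁻ f′ g′)
          last A B f g = resize (out₂ (length D) (length A) (length B) a) (follow-line (length B ℕ.+ (length A ℕ.+ length D))
            (λ C → resize (out₃ (length D) (length A) (length B) (length C)) (f C)) (λ C → resize (out₃ (length D) (length A) (length B) (length C)) (g C)))
          last₂ : ∀ A {f g h i : List Tilt → List Tilt → Value} {f′ g′ h′ i′ : List Tilt → List Tilt → ℤ} →
                 (∀ B C → R 5 (N D A B C) (f B C) (f′ B C)) → (∀ B C → R 5 (N D A B C) (g B C) (g′ B C)) →
                 (∀ B C → R 5 (N D A B C) (h B C) (h′ B C)) → (∀ B C → R 5 (N D A B C) (i B C) (i′ B C)) →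
                 R 5 (length A ℕ.+ (a ℕ.+ (a ℕ.+ length D))) (F.race A⁺ A⁻ (λ B → F.race A⁺ A⁻ (f B) (g B)) (λ B → F.race A⁺ A⁻ (h B) (i B)))
                                                           (Z.race A⁺ A⁻ (λ B → Z.race A⁺ A⁻ (f′ B) (g′ B)) (λ B → Z.race A⁺ A⁻ (h′ B) (i′ B)))
          last₂ A f g h i = resize (out₁ (length D) (length A) a) (follow-line (a ℕ.+ (length A ℕ.+ length D)) (λ B → last A B (f B) (g B)) (λ B → last A B (h B) (i B)))

        swapBC : ∀ d a b c → d ℕ.+ (a ℕ.+ (c ℕ.+ b)) ≡ d ℕ.+ (a ℕ.+ (b ℕ.+ c))
        swapBC = ℕSolver.solve-∀
        cycle : ∀ d a b c → d ℕ.+ (b ℕ.+ (c ℕ.+ a)) ≡ d ℕ.+ (a ℕ.+ (b ℕ.+ c))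
        cycle = ℕSolver.solve-∀
        swapAB : ∀ d a b c → d ℕ.+ (b ℕ.+ (a ℕ.+ c)) ≡ d ℕ.+ (a ℕ.+ (b ℕ.+ c))
        swapAB = ℕSolver.solve-∀
        cycle′ : ∀ d a b c → d ℕ.+ (c ℕ.+ (a ℕ.+ b)) ≡ d ℕ.+ (a ℕ.+ (b ℕ.+ c))
        cycle′ = ℕSolver.solve-∀

      follow-ahead⁺ : ∀ D → R 5 (a ℕ.+ (a ℕ.+ (a ℕ.+ length D))) (F.ahead⁺ A⁺ A⁻ D) (Z.ahead⁺ A⁺ A⁻ D)
      follow-ahead⁺ D = three D
        (follow₊₊₊ D)
        (follow₊₊₋ D)
        (λ A B C → resize (swapBC (length D) (length A) (length B) (length C)) (follow₊₊₋ D A C B))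
        (follow₊₋₋ D)
        (λ A B C → resize (cycle (length D) (length A) (length B) (length C)) (follow₊₊₋ D B C A))
        (λ A B C → resize (swapAB (length D) (length A) (length B) (length C)) (follow₊₋₋ D B A C))
        (λ A B C → resize (cycle′ (length D) (length A) (length B) (length C)) (follow₊₋₋ D C A B))
        (follow₋₋₋ D)

      follow-ahead⁻ : ∀ D → R 5 (a ℕ.+ (a ℕ.+ (a ℕ.+ length D))) (F.ahead⁻ A⁺ A⁻ D) (Z.ahead⁻ A⁺ A⁻ D)
      follow-ahead⁻ D = follow-line (a ℕ.+ (a ℕ.+ length D))
        (λ A → resize (out₁ (length D) (length A) a) (follow-line (a ℕ.+ (length A ℕ.+ length D))
          (λ B → resize (out₂ (length D) (length A) (length B) a) (follow-line (length B ℕ.+ (length A ℕ.+ length D))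
            (λ C → resize (out₃ (length D) (length A) (length B) (length C)) (follow⁻ D A B C))
            (λ C → R-zero (length C ℕ.+ (length B ℕ.+ (length A ℕ.+ length D))))))
          (λ B → R-zero (length B ℕ.+ (a ℕ.+ (length A ℕ.+ length D))))))
        (λ A → R-zero (length A ℕ.+ (a ℕ.+ (a ℕ.+ length D))))

      follow-total : ∀ D⁺ D⁻ → R 5 (length D⁺ ℕ.+ length D⁻ ℕ.+ (a ℕ.+ (a ℕ.+ a))) (F.total A⁺ A⁻ D⁺ D⁻) (Z.total A⁺ A⁻ D⁺ D⁻)
      follow-total D⁺ D⁻ = follow-race (a ℕ.+ (a ℕ.+ a)) (λ D → resize (front (length D) a) (follow-ahead⁺ D)) (λ D → resize (front (length D) a) (follow-ahead⁻ D)) D⁺ D⁻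
        where
        front : ∀ d a → a ℕ.+ (a ℕ.+ (a ℕ.+ d)) ≡ d ℕ.+ (a ℕ.+ (a ℕ.+ a))
        front = ℕSolver.solve-∀

-- Balanced digits and evaluation of the functional

module Decoding where

  open import Data.Nat.Base as ℕ using (ℕ; zero; suc; _≤_; _<_; s≤s)
  import Data.Nat.Properties as ℕ
  open import Data.Integer.Base as ℤ using (ℤ; +_; ∣_∣)
  import Data.Integer.Properties as ℤ
  import Data.Integer.Tactic.RingSolver as ℤSolver
  import Data.Integer.DivMod as ℤ
  open import Data.List.Base using (List; []; _∷_; length; _++_; replicate)
  open import Data.Product.Base using (_×_; _,_; proj₁; proj₂)
  open import Data.Sum.Base using (inj₁; inj₂)
  open import Relation.Binary.PropositionalEquality
  open Labels
  open Line
  open Functionals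
  open Polynomials
  open Tables using (tab; head₀; head₀-tab; module Table)

  module Digits (Q h : ℕ) .{{_ : ℕ.NonZero Q}} (Q-≡ : Q ≡ h ℕ.+ h) where

    -- Adding `h` before the division moves the digits to the range from -h to h - 1.
    decode : ℕ → ℤ → Poly
    decode zero    z = []
    decode (suc n) z = go (z ℤ.+ + h)
      where
      go : ℤ → Poly
      go y = (+ (y ℤ.%ℕ Q) ℤ.- + h) ∷ decode n (y ℤ./ℕ Q)

    private
      remainder : ∀ r → r < Q → ∣ + r ℤ.- + h ∣ ≤ h
      remainder r r<Q rewrite ℤ.m-n≡m⊖n r h with ℕ.≤-total r h
      ... | inj₁ r≤h = ℕ.≤-trans (ℕ.≤-reflexive (ℤ.∣⊖∣-≤ r≤h)) (ℕ.m∸n≤m h r)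
      ... | inj₂ h≤r = ℕ.≤-trans (ℕ.≤-reflexive (trans (ℤ.∣m⊖n∣≡∣n⊖m∣ r h) (ℤ.∣⊖∣-≤ h≤r)))
        (ℕ.m≤n+o⇒m∸n≤o r h (ℕ.≤-trans (ℕ.<⇒≤ r<Q) (ℕ.≤-reflexive Q-≡)))

      -- The computed digit differs from `m` by a multiple of `Q`, and by less than `Q`: it is at
      -- most `h` in absolute value and `m` is smaller than `h`.
      step : ∀ m e → ∣ m ∣ < h → let y = m ℤ.+ + Q ℤ.* e ℤ.+ + h in (+ (y ℤ.%ℕ Q) ℤ.- + h ≡ m) × (y ℤ./ℕ Q ≡ e)
      step m e m<h = trans (ℤ.i-j≡0⇒i≡j (+ r ℤ.- + h) m D≡0) refl , sym (ℤ.i-j≡0⇒i≡j e q e-q≡0)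
        where
        y = m ℤ.+ + Q ℤ.* e ℤ.+ + h
        r = y ℤ.%ℕ Q
        q = y ℤ./ℕ Q
        lem : ∀ m Q e h r q → m ℤ.+ Q ℤ.* e ℤ.+ h ≡ r ℤ.+ q ℤ.* Q → r ℤ.- h ℤ.- m ≡ Q ℤ.* (e ℤ.- q)
        lem m Q e h r q eq = trans (insert r h m q Q) (trans (cong (λ x → x ℤ.- q ℤ.* Q ℤ.- h ℤ.- m) (sym eq)) (other m Q e h q))
          where
          insert : ∀ r h m q Q → r ℤ.- h ℤ.- m ≡ (r ℤ.+ q ℤ.* Q) ℤ.- q ℤ.* Q ℤ.- h ℤ.- m
          insert = ℤSolver.solve-∀
          other : ∀ m Q e h q → (m ℤ.+ Q ℤ.* e ℤ.+ h) ℤ.- q ℤ.* Q ℤ.- h ℤ.- m ≡ Q ℤ.* (e ℤ.- q)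
          other = ℤSolver.solve-∀
        D≡ : + r ℤ.- + h ℤ.- m ≡ + Q ℤ.* (e ℤ.- q)
        D≡ = lem m (+ Q) e (+ h) (+ r) q (ℤ.a≡a%ℕn+[a/ℕn]*n y Q)
        D<Q : ∣ + r ℤ.- + h ℤ.- m ∣ < Q
        D<Q = ℕ.≤-<-trans (ℤ.∣i-j∣≤∣i∣+∣j∣ (+ r ℤ.- + h) m)
          (subst (∣ + r ℤ.- + h ∣ ℕ.+ ∣ m ∣ <_) (sym Q-≡) (ℕ.+-mono-≤-< (remainder r (ℤ.n%ℕd<d y Q)) m<h))
        small : ∀ n → Q ℕ.* n < Q → n ≡ 0
        small zero    p = refl
        small (suc n) p with () ← ℕ.<⇒≱ p (ℕ.m≤m*n Q (suc n))
        e-q≡0 : e ℤ.- q ≡ + 0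
        e-q≡0 = ℤ.∣i∣≡0⇒i≡0 (small (∣ e ℤ.- q ∣) (subst (_< Q) (trans (cong ∣_∣ D≡) (ℤ.abs-* (+ Q) (e ℤ.- q))) D<Q))
        D≡0 : + r ℤ.- + h ℤ.- m ≡ + 0
        D≡0 = trans D≡ (trans (cong (+ Q ℤ.*_) e-q≡0) (ℤ.*-zeroʳ (+ Q)))

    functional-cong : ∀ n P R {L L′} → (∀ n → L n ≡ L′ n) → functional-q n P L ≡ functional-q n R L′
    functional-cong (counts a h b (suc k))          P R e = cong₂ (times-q l₂) (e (counts a h b (suc k))) (e (counts a h b k))
    functional-cong (counts a h (suc b) zero)       P R e = cong₂ (times-q l₁) (e (counts a h (suc b) zero)) (e (counts a h b zero))
    functional-cong (counts (suc a) h zero zero)    P R e = cong₂ (times-q r₁) (e (counts (suc a) h zero zero)) (e (counts a h zero zero))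
    functional-cong (counts zero (suc h) zero zero) P R e = cong₂ (times-q r₂) (e (counts zero (suc h) zero zero)) (e (counts zero h zero zero))
    functional-cong (counts zero zero zero zero)    P R e = refl

    private
      digit : ∀ k m e {P} → ∣ m ∣ < h → (∀ n → ⟪ decode k e ⟫ n ≡ ⟪ P ⟫ n) → ∀ n → ⟪ decode (suc k) (m ℤ.+ + Q ℤ.* e) ⟫ n ≡ ⟪ m ∷ P ⟫ n
      digit k m e {P} m<h ih n = cong₂ (λ d x → d ℤ.* W n ℤ.+ x) (proj₁ (step m e m<h))
        (functional-cong n (decode k ((m ℤ.+ + Q ℤ.* e ℤ.+ + h) ℤ./ℕ Q)) P (λ n → trans (cong (λ e → ⟪ decode k e ⟫ n) (proj₂ (step m e m<h))) (ih n)))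

    decode-zero : 0 < h → ∀ k n → ⟪ decode k (+ 0) ⟫ n ≡ + 0
    decode-zero 0<h zero    n = refl
    decode-zero 0<h (suc k) n = trans (cong (λ z → ⟪ decode (suc k) z ⟫ n) (sym (trans (ℤ.+-identityˡ _) (ℤ.*-zeroʳ (+ Q)))))
      (trans (digit k (+ 0) (+ 0) {[]} 0<h (decode-zero 0<h k) n) (trans (cong (λ x → + 0 ℤ.* W n ℤ.+ x) (z n)) refl))
      where
      z : ∀ n → functional-q n [] ⟪ [] ⟫ ≡ + 0
      z (counts a h b (suc k))          = refl
      z (counts a h (suc b) zero)       = refl
      z (counts (suc a) h zero zero)    = refl
      z (counts zero (suc h) zero zero) = refl
      z (counts zero zero zero zero)    = refl

    -- Stated for functionals and not for coefficient lists, as decoding may append zeros to `P`.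
    decode-eval : ∀ k P → length P ≤ k → norm P < h → ∀ n → ⟪ decode k (eval (+ Q) P) ⟫ n ≡ ⟪ P ⟫ n
    decode-eval k       []      _       s n = decode-zero s k n
    decode-eval (suc k) (m ∷ P) (s≤s l) s n = digit k m (eval (+ Q) P) {P} (ℕ.≤-<-trans (ℕ.m≤m+n (∣ m ∣) (norm P)) s)
      (decode-eval k P l (ℕ.≤-<-trans (ℕ.m≤n+m (norm P) (∣ m ∣)) s)) n

  state : List Form → Counts
  state []       = counts 0 0 0 0
  state (τ ∷ τs) = inc τ (state τs)

  -- One step of Horner's rule at all suffixes at once: multiplication by q needs an entry and its
  -- neighbour only.
  next : ℤ → List Form → List ℤ → List ℤ → List ℤ
  next m (τ ∷ τs) (w ∷ ws) (x ∷ xs) = m ℤ.* w ℤ.+ times-q τ x (head₀ xs) ∷ next m τs ws xs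
  next m _        ws       _        = m ℤ.* head₀ ws ∷ []

  values : Poly → List Form → List ℤ → List ℤ
  values []      τs ws = tab (λ _ → + 0) τs
  values (m ∷ P) τs ws = next m τs ws (values P τs ws)

  values-≡ : ∀ P τs → values P τs (tab (λ σs → W (state σs)) τs) ≡ tab (λ σs → ⟪ P ⟫ (state σs)) τs
  values-≡ []      τs = refl
  values-≡ (m ∷ P) τs = trans (cong (next m τs (tab (λ σs → W (state σs)) τs)) (values-≡ P τs)) (next-≡ τs)
    where
    next-≡ : ∀ τs → next m τs (tab (λ σs → W (state σs)) τs) (tab (λ σs → ⟪ P ⟫ (state σs)) τs) ≡ tab (λ σs → ⟪ m ∷ P ⟫ (state σs)) τs
    next-≡ []       = cong (_∷ []) (sym (ℤ.+-identityʳ _))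
    next-≡ (τ ∷ τs) = cong₂ _∷_ (cong (λ x → m ℤ.* W (inc τ (state τs)) ℤ.+ x)
      (trans (cong (times-q τ (⟪ P ⟫ (inc τ (state τs)))) (head₀-tab (λ σs → ⟪ P ⟫ (state σs)) τs)) (sym (choice P (consistent P) τ (state τs))))) (next-≡ τs)

  init : List ℤ → List ℤ
  init []           = []
  init (x ∷ [])     = []
  init (x ∷ y ∷ ys) = x ∷ init (y ∷ ys)

  init-tab : ∀ {X : Set} (f : List X → ℤ) x L → init (tab f (x ∷ L)) ≡ f (x ∷ L) ∷ init (tab f L)
  init-tab f x []      = refl
  init-tab f x (y ∷ L) = refl

  rights lefts : ℕ → ℕ → List Form
  rights a h = replicate a r₁ ++ replicate h r₂
  lefts  b k = replicate k l₂ ++ replicate b l₁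

  state-r₂ : ∀ h → state (replicate h r₂) ≡ counts 0 h 0 0
  state-r₂ zero    = refl
  state-r₂ (suc h) = cong (inc r₂) (state-r₂ h)

  state-right : ∀ a h → state (rights a h) ≡ counts a h 0 0
  state-right zero    h = state-r₂ h
  state-right (suc a) h = cong (inc r₁) (state-right a h)

  state-l₁ : ∀ a h b → state (replicate b l₁ ++ rights a h) ≡ counts a h b 0
  state-l₁ a h zero    = state-right a h
  state-l₁ a h (suc b) = cong (inc l₁) (state-l₁ a h b)

  state-left : ∀ a h b k → state (lefts b k ++ rights a h) ≡ counts a h b k
  state-left a h b zero    = state-l₁ a h b
  state-left a h b (suc k) = cong (inc l₂) (state-left a h b k)

  module Weights₁ = Table {Size} {ℤ} ℤ._+_ (λ a b x → + share₂ a b ℤ.* x)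

  heads : List (List ℤ) → List ℤ
  heads []       = []
  heads (xs ∷ _) = xs

  -- One row of a race table covers the suffixes with left forms. Its last entry is also the first
  -- one of the right part, so `init` removes it.
  Ws : ℕ → ℕ → ℕ → ℕ → List ℤ
  Ws a h b k = init (heads (Weights₁.table (sizes a h) (sizesᵣ b k) (tab (λ A → + shares A) (sizes a h)) (tab (λ _ → + 0) (sizesᵣ b k)))) ++
               tab (λ R → w R []) (sizes a h)

  Ws-≡ : ∀ a h b k → Ws a h b k ≡ tab (λ σs → W (state σs)) (lefts b k ++ rights a h)
  Ws-≡ a h b k = trans (cong₂ (λ x y → init x ++ y) (trans (cong heads (Weights₁.table-≡ (λ A → + shares A) (λ _ → + 0) (sizes a h) (sizesᵣ b k)))
      (heads-tab (λ R L → w R L) (sizes a h) (sizesᵣ b k))) (rightPart a h)) (sym (leftPart k))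
    where
    f : List Form → ℤ
    f σs = W (state σs)
    heads-tab : ∀ (g : List Size → List Size → ℤ) L M → heads (tab (λ A → tab (g A) M) L) ≡ tab (g L) M
    heads-tab g []      M = refl
    heads-tab g (x ∷ L) M = refl
    right₂ : ∀ h → tab (λ R → w R []) (sizes 0 h) ≡ tab f (replicate h r₂)
    right₂ zero    = cong (_∷ []) (sym (W-≡ 0 0 0 0))
    right₂ (suc h) = cong₂ _∷_ (trans (sym (W-≡ 0 (suc h) 0 0)) (cong W (sym (state-r₂ (suc h))))) (right₂ h)
    rightPart : ∀ a h → tab (λ R → w R []) (sizes a h) ≡ tab f (rights a h)
    rightPart zero    h = right₂ h
    rightPart (suc a) h = cong₂ _∷_ (trans (sym (W-≡ (suc a) h 0 0)) (cong W (sym (state-right (suc a) h)))) (rightPart a h)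
    left₁ : ∀ b → tab f (replicate b l₁ ++ rights a h) ≡ init (tab (w (sizes a h)) (sizesᵣ b 0)) ++ tab f (rights a h)
    left₁ zero    = refl
    left₁ (suc b) = trans (cong₂ _∷_ (trans (cong W (state-l₁ a h (suc b))) (W-≡ a h (suc b) 0)) (left₁ b))
      (cong (_++ tab f (rights a h)) (sym (init-tab (w (sizes a h)) s₁ (sizesᵣ b 0))))
    leftPart : ∀ k → tab f (lefts b k ++ rights a h) ≡ init (tab (w (sizes a h)) (sizesᵣ b k)) ++ tab f (rights a h)
    leftPart zero    = left₁ b
    leftPart (suc k) = trans (cong₂ _∷_ (trans (cong W (state-left a h b (suc k))) (W-≡ a h b (suc k))) (leftPart k))
      (cong (_++ tab f (rights a h)) (sym (init-tab (w (sizes a h)) s₂ (sizesᵣ b k))))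

  ⟪⟫-fast : ∀ P a h b k → head₀ (values P (lefts b k ++ rights a h) (Ws a h b k)) ≡ ⟪ P ⟫ (state (lefts b k ++ rights a h))
  ⟪⟫-fast P a h b k = trans (cong (λ ws → head₀ (values P (lefts b k ++ rights a h) ws)) (Ws-≡ a h b k))
    (trans (cong head₀ (values-≡ P (lefts b k ++ rights a h))) (head₀-tab (λ σs → ⟪ P ⟫ (state σs)) (lefts b k ++ rights a h)))

-- The certified value of the volume

module Evaluation where

  open import Data.Bool.Base using (Bool; true; T)
  open import Data.Product.Base using (∃-syntax; _,_; proj₁; proj₂)
  open import Data.Unit.Base using (tt)
  open import Data.Nat.Base as ℕ using (ℕ; zero; suc; _<_; _≡ᵇ_)
  import Data.Nat.Properties as ℕ
  open import Data.Integer.Base as ℤ using (ℤ; +_; ∣_∣)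
  import Data.Integer.Properties as ℤ
  import Data.Integer.Tactic.RingSolver as ℤSolver
  open import Data.List.Base using (List; []; length; _++_)
  open import Relation.Binary.PropositionalEquality
  open Labels
  open Recursion
  open Line using (counts)
  open Functionals
  open Polynomials
  open Tables using (module Integers; head₀)
  open Decoding
  open Encoding using (follow-total)

  record Weights : Set where
    constructor mkWeights
    field 1u 1d 2u 2= 2d 4u 4u= 4= 4d= 4d : ℤ

  weightsAt : ℤ → Weights
  weightsAt q = mkWeights (at (form 4 r₁)) (at (form 4 l₁)) (at (form 2 r₁)) (at (flat 2)) (at (form 2 l₁))
                          (at (form 1 r₁)) (at (form 2 r₂)) (at (flat 1)) (at (form 2 l₂)) (at (form 1 l₁))
    where
    at : Kind → ℤ
    at = numAt q

  module _ (w : Weights) where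
    open Weights w
    weigh : Label → ℤ
    weigh (one up)             = 1u
    weigh (one dn)             = 1d
    weigh (two up up)          = 2u
    weigh (two up dn)          = 2=
    weigh (two dn up)          = 2=
    weigh (two dn dn)          = 2d
    weigh (four up up up up)   = 4u
    weigh (four up up up dn)   = 4u=
    weigh (four up up dn up)   = 4u=
    weigh (four up dn up up)   = 4u=
    weigh (four dn up up up)   = 4u=
    weigh (four up up dn dn)   = 4=
    weigh (four up dn up dn)   = 4=
    weigh (four dn up up dn)   = 4=
    weigh (four up dn dn up)   = 4=
    weigh (four dn up dn up)   = 4=
    weigh (four dn dn up up)   = 4=
    weigh (four up dn dn dn)   = 4d=
    weigh (four dn up dn dn)   = 4d=
    weigh (four dn dn up dn)   = 4d=
    weigh (four dn dn dn up)   = 4d=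
    weigh (four dn dn dn dn)   = 4d

  weigh-≡ : ∀ q g → weigh (weightsAt q) g ≡ numAt q (kind g)
  weigh-≡ q (one up)             = refl
  weigh-≡ q (one dn)             = refl
  weigh-≡ q (two up up)          = refl
  weigh-≡ q (two up dn)          = refl
  weigh-≡ q (two dn up)          = refl
  weigh-≡ q (two dn dn)          = refl
  weigh-≡ q (four up up up up)   = refl
  weigh-≡ q (four up up up dn)   = refl
  weigh-≡ q (four up up dn up)   = refl
  weigh-≡ q (four up dn up up)   = refl
  weigh-≡ q (four dn up up up)   = refl
  weigh-≡ q (four up up dn dn)   = refl
  weigh-≡ q (four up dn up dn)   = refl
  weigh-≡ q (four dn up up dn)   = refl
  weigh-≡ q (four up dn dn up)   = refl
  weigh-≡ q (four dn up dn up)   = refl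
  weigh-≡ q (four dn dn up up)   = refl
  weigh-≡ q (four up dn dn dn)   = refl
  weigh-≡ q (four dn up dn dn)   = refl
  weigh-≡ q (four dn dn up dn)   = refl
  weigh-≡ q (four dn dn dn up)   = refl
  weigh-≡ q (four dn dn dn dn)   = refl

  -- The weights are an argument, so that they are evaluated once.
  efficient : Weights → (A⁺ A⁻ D⁺ D⁻ : List Tilt) → ℤ
  efficient w = Integers.Lines.efficient (weigh w)

  module _ (Q h : ℕ) .{{_ : ℕ.NonZero Q}} (Q-≡ : Q ≡ h ℕ.+ h) where
    open Digits Q h Q-≡

    -- 12³ⁿ times the value at the empty list.
    answer : (n k : ℕ) (A⁺ A⁻ D⁺ D⁻ : List Tilt) → ℤ
    answer n k A⁺ A⁻ D⁺ D⁻ = head₀ (values (decode k (efficient (weightsAt (+ Q)) A⁺ A⁻ D⁺ D⁻)) (lefts n n ++ rights n n) (Ws n n n n))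

    -- At the empty list of labels the numerator is read over `n` copies of each form, because every
    -- one of the `n` labels has been cleared by Π.
    answer-≡ : ∀ n k A⁺ A⁻ D⁺ D⁻ → length D⁺ ℕ.+ length D⁻ ℕ.+ (length A⁺ ℕ.+ length A⁻ ℕ.+ (length A⁺ ℕ.+ length A⁻ ℕ.+ (length A⁺ ℕ.+ length A⁻))) ≡ n →
               suc (n ℕ.* 4) ≡ k → 5 ℕ.* 144 ℕ.^ n < h →
               answer n k A⁺ A⁻ D⁺ D⁻ ≡ + (12 ℕ.^ (n ℕ.* 3)) ℤ.* Evaluate.total 𝔽 A⁺ A⁻ D⁺ D⁻ []
    answer-≡ n k A⁺ A⁻ D⁺ D⁻ refl refl bound = begin
      answer n k A⁺ A⁻ D⁺ D⁻
        ≡⟨ ⟪⟫-fast (decode k (efficient (weightsAt (+ Q)) A⁺ A⁻ D⁺ D⁻)) n n n n ⟩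
      ⟪ decode k (efficient (weightsAt (+ Q)) A⁺ A⁻ D⁺ D⁻) ⟫ (state (lefts n n ++ rights n n))
        ≡⟨ cong (λ z → ⟪ decode k z ⟫ (state (lefts n n ++ rights n n))) (trans (Integers.Lines.efficient-≡ ν A⁺ A⁻ D⁺ D⁻) (sym (Represents.evaluates r))) ⟩
      ⟪ decode k (eval (+ Q) (Represents.poly r)) ⟫ (state (lefts n n ++ rights n n))
        ≡⟨ decode-eval k (Represents.poly r) (Represents.short r) (ℕ.≤-<-trans (Represents.small r) bound) (state (lefts n n ++ rights n n)) ⟩
      ⟪ Represents.poly r ⟫ (state (lefts n n ++ rights n n))
        ≡⟨ cong ⟪ Represents.poly r ⟫ (trans (state-≡ n) (sym (inc-alls-≡ n))) ⟩
      ⟪ Represents.poly r ⟫ (inc-alls n (counts 0 0 0 0))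
        ≡⟨ ℤ.*-identityˡ _ ⟨
      + 1 ℤ.* ⟪ Represents.poly r ⟫ (inc-alls n (counts 0 0 0 0))
        ≡⟨ Represents.represents r [] ⟨
      twelves (n ℕ.* 3) (Evaluate.total 𝔽 A⁺ A⁻ D⁺ D⁻ [])
        ≡⟨ twelves-≡ (n ℕ.* 3) _ ⟩
      + (12 ℕ.^ (n ℕ.* 3)) ℤ.* Evaluate.total 𝔽 A⁺ A⁻ D⁺ D⁻ [] ∎
      where
      open ≡-Reasoning
      ν : Label → ℤ
      ν = weigh (weightsAt (+ Q))
      r = follow-total (+ Q) ν (weigh-≡ (+ Q)) A⁺ A⁻ D⁺ D⁻
      inc-alls-≡ : ∀ n → inc-alls n (counts 0 0 0 0) ≡ counts n n n n
      inc-alls-≡ zero    = refl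
      inc-alls-≡ (suc n) = cong inc-all (inc-alls-≡ n)
      state-≡ : ∀ n → state (lefts n n ++ rights n n) ≡ counts n n n n
      state-≡ n = state-left n n n n

    -- `v` is a variable equal to the total, which keeps the closed recursion out of the type of the
    -- result.
    certified : ∀ n k A⁺ A⁻ D⁺ D⁻ → length D⁺ ℕ.+ length D⁻ ℕ.+ (length A⁺ ℕ.+ length A⁻ ℕ.+ (length A⁺ ℕ.+ length A⁻ ℕ.+ (length A⁺ ℕ.+ length A⁻))) ≡ n →
                suc (n ℕ.* 4) ≡ k → 5 ℕ.* 144 ℕ.^ n < h → ∀ v → v ≡ Evaluate.total 𝔽 A⁺ A⁻ D⁺ D⁻ [] → ∃[ x ] x ≡ + (12 ℕ.^ (n ℕ.* 3)) ℤ.* v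
    certified n k A⁺ A⁻ D⁺ D⁻ p q bound v v-≡ = answer n k A⁺ A⁻ D⁺ D⁻ ,
      trans (answer-≡ n k A⁺ A⁻ D⁺ D⁻ p q bound) (cong (+ (12 ℕ.^ (n ℕ.* 3)) ℤ.*_) (sym v-≡))

  private
    cancel-twelves : ∀ a b s t {x v} .{{_ : ℕ.NonZero t}} → x ≡ + t ℤ.* v → + 5 ℤ.* x ℤ.* + b ≡ + (a ℕ.* s ℕ.* t) → + 5 ℤ.* v ℤ.* + b ≡ + (a ℕ.* s)
    cancel-twelves a b s t {v = v} refl eq = ℤ.*-cancelˡ-≡ (+ t) (+ 5 ℤ.* v ℤ.* + b) (+ (a ℕ.* s)) (trans (lem (+ t) v (+ b)) (trans eq (trans (ℤ.pos-* (a ℕ.* s) t) (ℤ.*-comm (+ (a ℕ.* s)) (+ t)))))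
      where
      lem : ∀ t v b → t ℤ.* (+ 5 ℤ.* v ℤ.* b) ≡ + 5 ℤ.* (t ℤ.* v) ℤ.* b
      lem = ℤSolver.solve-∀

    same : ∀ x y → (∣ x ℤ.- y ∣ ≡ᵇ 0) ≡ true → x ≡ y
    same x y eq = ℤ.i-j≡0⇒i≡j x y (ℤ.∣i∣≡0⇒i≡0 (ℕ.≡ᵇ⇒≡ _ 0 (subst T (sym eq) tt)))

  a b : ℕ
  a = 760794547958864241496408591531018198021484884229346111658236615929935
  b = 1010827262551214358630401511004028249102084136257935356483840264634368

  private
    pointed : ∀ {X : Set} (x : X) → ∃[ y ] y ≡ x
    pointed x = x , refl

  -- A comparison of two terms which contain the total might evaluate it.
  abstract
    pointedVolume : ∃[ v ] v ≡ Evaluate.total 𝔽 A⁺ A⁻ D⁺ D⁻ []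
    pointedVolume = pointed (Evaluate.total 𝔽 A⁺ A⁻ D⁺ D⁻ [])

  volume : ℤ
  volume = proj₁ pointedVolume

  volume-total : volume ≡ Evaluate.total 𝔽 A⁺ A⁻ D⁺ D⁻ []
  volume-total = proj₂ pointedVolume

  private
    -- The claim a/b = 5 w / 48¹²⁰ with denominators cleared; 12³⁶⁰ stems from three twelves for
    -- each of the 120 labels.
    agreement : ℤ → Bool
    agreement x = ∣ + 5 ℤ.* x ℤ.* + b ℤ.- + (a ℕ.* 48 ℕ.^ 120 ℕ.* 12 ℕ.^ (120 ℕ.* 3)) ∣ ≡ᵇ 0

    agreement⇒≡ : ∀ x v → x ≡ + (12 ℕ.^ (120 ℕ.* 3)) ℤ.* v → agreement x ≡ true → + 5 ℤ.* v ℤ.* + b ≡ + (a ℕ.* 48 ℕ.^ 120)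
    agreement⇒≡ x v eq t = cancel-twelves a b (48 ℕ.^ 120) (12 ℕ.^ (120 ℕ.* 3)) eq (same (+ 5 ℤ.* x ℤ.* + b) (+ (a ℕ.* 48 ℕ.^ 120 ℕ.* 12 ℕ.^ (120 ℕ.* 3))) t)

    -- 2⁸⁶⁴ exceeds twice the coefficients of the polynomial of degree 480.
    numerator : ∃[ x ] x ≡ + (12 ℕ.^ (120 ℕ.* 3)) ℤ.* volume
    numerator = certified (2 ℕ.^ 864) (2 ℕ.^ 863) refl 120 481 A⁺ A⁻ D⁺ D⁻ refl refl (ℕ.<ᵇ⇒< (5 ℕ.* 144 ℕ.^ 120) (2 ℕ.^ 863) tt) volume volume-total

    agrees : agreement (proj₁ numerator) ≡ true
    -- The whole numerical computation takes place in this comparison.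
    agrees = refl

  volume-value : + 5 ℤ.* volume ℤ.* + b ≡ + (a ℕ.* 48 ℕ.^ 120)
  volume-value = agreement⇒≡ (proj₁ numerator) volume (proj₂ numerator) agrees

-- The limit

module Limits where

  open import Data.Nat.Base as ℕ using (ℕ; zero; suc; _+_; _*_; _≤_; _<_)
  import Data.Nat.Properties as ℕ
  import Data.Nat.Tactic.RingSolver as ℕSolver
  open import Data.Integer.Base as ℤ using (ℤ; +_; ∣_∣)
  import Data.Integer.Properties as ℤ
  open import Data.Product.Base using (∃-syntax; proj₁; proj₂; _,_)
  open import Data.Sum.Base using (inj₁; inj₂)
  open import Relation.Binary.PropositionalEquality
  open import Data.Rational.Unnormalised.Base as ℚᵘ using (ℚᵘ; mkℚᵘ; 0ℚᵘ)
  open Binomials using (B; 1≤B)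
  open Line using (B-step-k; B-mono; Σ≤; B-Σ)

  private
    mul-≤ : ∀ x {y z} → y ≤ z → x * y ≤ x * z
    mul-≤ x = ℕ.*-monoʳ-≤ x

  module _ (m : ℕ) where

    -- Consecutive values have the ratio 1 + m/(k + 1).
    growth₁ : ∀ D k → D * m ≤ suc k → D * B m (suc k) ≤ suc D * B m k
    growth₁ D k Dm≤ = ℕ.*-cancelˡ-≤ (suc k) (begin
      suc k * (D * B m (suc k))       ≡⟨ lem₁ (suc k) D (B m (suc k)) ⟩
      D * (suc k * B m (suc k))       ≡⟨ cong (D *_) (B-step-k m k) ⟩
      D * ((suc k + m) * B m k)       ≡⟨ lem₂ D (suc k) m (B m k) ⟩
      (D * suc k + D * m) * B m k     ≤⟨ ℕ.*-monoˡ-≤ (B m k) (ℕ.+-monoʳ-≤ (D * suc k) Dm≤) ⟩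
      (D * suc k + suc k) * B m k     ≡⟨ lem₃ D (suc k) (B m k) ⟩
      suc k * (suc D * B m k)         ∎)
      where
      open ℕ.≤-Reasoning
      lem₁ : ∀ a b c → a * (b * c) ≡ b * (a * c)
      lem₁ = ℕSolver.solve-∀
      lem₂ : ∀ D k m b → D * ((k + m) * b) ≡ (D * k + D * m) * b
      lem₂ = ℕSolver.solve-∀
      lem₃ : ∀ D k b → (D * k + k) * b ≡ k * (suc D * b)
      lem₃ = ℕSolver.solve-∀

    -- (1 + 1/(2D+1))² ≤ 1 + 1/D
    growth : ∀ h D → ∃[ K ] (∀ k → K ≤ k → D * B m (h + k) ≤ suc D * B m k)
    growth zero    D = 0 , λ k _ → ℕ.*-monoˡ-≤ (B m k) (ℕ.n≤1+n D)
    growth (suc h) D = K ℕ.+ D′ * m , λ k K≤k → compose (B m (suc h + k)) (B m (h + k)) (B m k)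
        (growth₁ D′ (h + k) (ℕ.≤-trans (ℕ.m≤n+m (D′ * m) K) (ℕ.≤-trans K≤k (ℕ.≤-trans (ℕ.m≤n+m k h) (ℕ.n≤1+n (h + k))))))
        (proj₂ (growth h D′) k (ℕ.≤-trans (ℕ.m≤m+n K (D′ * m)) K≤k))
      where
      D′ = suc (2 * D)
      K = proj₁ (growth h D′)
      compose : ∀ x y z → D′ * x ≤ suc D′ * y → D′ * y ≤ suc D′ * z → D * x ≤ suc D * z
      compose x y z p q = ℕ.*-cancelˡ-≤ (4 * suc D) (begin
        4 * suc D * (D * x)         ≤⟨ ℕ.m≤m+n _ x ⟩
        4 * suc D * (D * x) + x     ≡⟨ lem₁ D x ⟩
        D′ * (D′ * x)               ≤⟨ mul-≤ D′ p ⟩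
        D′ * (suc D′ * y)           ≡⟨ lem₂ D′ (suc D′) y ⟩
        suc D′ * (D′ * y)           ≤⟨ mul-≤ (suc D′) q ⟩
        suc D′ * (suc D′ * z)       ≡⟨ lem₃ D z ⟩
        4 * suc D * (suc D * z)     ∎)
        where
        open ℕ.≤-Reasoning
        lem₁ : ∀ D x → 4 * suc D * (D * x) + x ≡ suc (2 * D) * (suc (2 * D) * x)
        lem₁ = ℕSolver.solve-∀
        lem₂ : ∀ a b c → a * (b * c) ≡ b * (a * c)
        lem₂ = ℕSolver.solve-∀
        lem₃ : ∀ D z → suc (suc (2 * D)) * (suc (suc (2 * D)) * z) ≡ 4 * suc D * (suc D * z)
        lem₃ = ℕSolver.solve-∀

    module _ (Y : ℕ → ℕ) (Y-mono : ∀ k → Y k ≤ Y (suc k)) where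

      Y-mono* : ∀ h k → Y k ≤ Y (h + k)
      Y-mono* zero    k = ℕ.≤-refl
      Y-mono* (suc h) k = ℕ.≤-trans (Y-mono* h k) (Y-mono (h + k))

      block-≥ : ∀ h k → h * Y k + Σ≤ Y k ≤ Σ≤ Y (h + k)
      block-≥ zero    k = ℕ.≤-refl
      block-≥ (suc h) k = ℕ.≤-trans (ℕ.≤-reflexive (lem (h * Y k) (Y k) (Σ≤ Y k))) (ℕ.+-mono-≤ (block-≥ h k) (Y-mono* (suc h) k))
        where
        lem : ∀ a b c → b + a + c ≡ a + c + b
        lem = ℕSolver.solve-∀

      block-≤ : ∀ h k → Σ≤ Y (h + k) ≤ h * Y (h + k) + Σ≤ Y k
      block-≤ zero    k = ℕ.≤-refl
      block-≤ (suc h) k = ℕ.≤-trans (ℕ.+-monoˡ-≤ (Y (suc h + k)) (ℕ.≤-trans (block-≤ h k) (ℕ.+-monoˡ-≤ (Σ≤ Y k) (mul-≤ h (Y-mono (h + k))))))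
        (ℕ.≤-reflexive (lem (h * Y (suc h + k)) (Y (suc h + k)) (Σ≤ Y k)))
        where
        lem : ∀ a b c → a + c + b ≡ b + a + c
        lem = ℕSolver.solve-∀

  -- A monotone sequence whose partial sums are asymptotic, up to an error of lower order, to multiples
  -- of binomial coefficients is itself asymptotic to them.
  module _ (m : ℕ) (Y : ℕ → ℕ) (Y-mono : ∀ k → Y k ≤ Y (suc k)) (s v A : ℕ)
           (above : ∀ k → s * Σ≤ Y k ≤ v * B (suc m) k + A * B m k)
           (below : ∀ k → v * B (suc m) k ≤ s * Σ≤ Y k + A * B m k) where
    private
      N : ℕ → ℕ
      N = B m
      N-mono : ∀ k → N k ≤ N (suc k)
      N-mono k = B-mono m (ℕ.n≤1+n k)
      c : ℕ
      c = suc (A + A)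

    -- By monotonicity `h` copies of `Y k` are at most the partial sum over the block after `k`. The
    -- error of the partial sums is a fixed multiple of `N k`, whatever the length `h`, so dividing
    -- by a large `h` makes it negligible.
    upper : ∀ h → ∃[ K ] (∀ k → K ≤ k → h * (s * Y k) ≤ h * (v * N k) + c * N k)
    upper h = proj₁ g , λ k K≤k → ℕ.+-cancelʳ-≤ (s * Σ≤ Y k + A * N k) _ _ (begin
      h * (s * Y k) + (s * Σ≤ Y k + A * N k)
        ≡⟨ lem₁ h s (Y k) (Σ≤ Y k) (A * N k) ⟩
      s * (h * Y k + Σ≤ Y k) + A * N k
        ≤⟨ ℕ.+-mono-≤ (mul-≤ s (block-≥ m Y Y-mono h k)) (mul-≤ A (B-mono m (ℕ.m≤n+m k h))) ⟩
      s * Σ≤ Y (h + k) + A * N (h + k)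
        ≤⟨ ℕ.+-monoˡ-≤ (A * N (h + k)) (above (h + k)) ⟩
      v * B (suc m) (h + k) + A * N (h + k) + A * N (h + k)
        ≡⟨ cong (λ x → v * x + A * N (h + k) + A * N (h + k)) (B-Σ m (h + k)) ⟩
      v * Σ≤ N (h + k) + A * N (h + k) + A * N (h + k)
        ≤⟨ ℕ.+-monoˡ-≤ _ (ℕ.+-monoˡ-≤ _ (mul-≤ v (block-≤ m N N-mono h k))) ⟩
      v * (h * N (h + k) + Σ≤ N k) + A * N (h + k) + A * N (h + k)
        ≡⟨ lem₂ v h (N (h + k)) (Σ≤ N k) A ⟩
      D * N (h + k) + v * Σ≤ N k
        ≤⟨ ℕ.+-mono-≤ (proj₂ g k K≤k) (ℕ.≤-trans (ℕ.≤-reflexive (cong (v *_) (sym (B-Σ m k)))) (below k)) ⟩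
      suc D * N k + (s * Σ≤ Y k + A * N k)
        ≡⟨ cong (_+ (s * Σ≤ Y k + A * N k)) (lem₃ v h (N k) A) ⟩
      h * (v * N k) + c * N k + (s * Σ≤ Y k + A * N k) ∎)
      where
      open ℕ.≤-Reasoning
      D = v * h + (A + A)
      g = growth m h D
      lem₁ : ∀ h s y Y a → h * (s * y) + (s * Y + a) ≡ s * (h * y + Y) + a
      lem₁ = ℕSolver.solve-∀
      lem₂ : ∀ v h n T A → v * (h * n + T) + A * n + A * n ≡ (v * h + (A + A)) * n + v * T
      lem₂ = ℕSolver.solve-∀
      lem₃ : ∀ v h n A → suc (v * h + (A + A)) * n ≡ h * (v * n) + suc (A + A) * n
      lem₃ = ℕSolver.solve-∀

    -- The block now ends at the index in question, which therefore has to be at least `h`.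
    lower : ∀ h → ∃[ K ] (∀ k → K ≤ k → h * (v * N k) ≤ h * (s * Y k) + c * N k)
    lower h = h + proj₁ g , λ k K≤k → subst (λ k → h * (v * N k) ≤ h * (s * Y k) + c * N k) (trans (ℕ.+-comm h (k ℕ.∸ h)) (ℕ.m∸n+n≡m (ℕ.≤-trans (ℕ.m≤m+n h _) K≤k)))
        (shifted (k ℕ.∸ h) (ℕ.m+n≤o⇒m≤o∸n (proj₁ g) (ℕ.≤-trans (ℕ.≤-reflexive (ℕ.+-comm (proj₁ g) h)) K≤k)))
      where
      open ℕ.≤-Reasoning
      D = v * h
      g = growth m h D
      lem₁ : ∀ h v n → h * (v * n) ≡ v * h * n
      lem₁ = ℕSolver.solve-∀
      lem₂ : ∀ v h n T → v * h * n + n + v * T ≡ n + v * (h * n + T)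
      lem₂ = ℕSolver.solve-∀
      shifted : ∀ k → proj₁ g ≤ k → h * (v * N (h + k)) ≤ h * (s * Y (h + k)) + c * N (h + k)
      shifted k K≤k = ℕ.+-cancelʳ-≤ (v * Σ≤ N k) _ _ (begin
        h * (v * N (h + k)) + v * Σ≤ N k
          ≡⟨ cong (_+ v * Σ≤ N k) (lem₁ h v (N (h + k))) ⟩
        D * N (h + k) + v * Σ≤ N k
          ≤⟨ ℕ.+-monoˡ-≤ (v * Σ≤ N k) (proj₂ g k K≤k) ⟩
        N k + D * N k + v * Σ≤ N k
          ≡⟨ cong (_+ v * Σ≤ N k) (ℕ.+-comm (N k) (D * N k)) ⟩
        D * N k + N k + v * Σ≤ N k
          ≡⟨ lem₂ v h (N k) (Σ≤ N k) ⟩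
        N k + v * (h * N k + Σ≤ N k)
          ≤⟨ ℕ.+-mono-≤ (B-mono m (ℕ.m≤n+m k h)) (mul-≤ v (block-≥ m N N-mono h k)) ⟩
        N (h + k) + v * Σ≤ N (h + k)
          ≤⟨ ℕ.+-monoʳ-≤ (N (h + k)) (ℕ.≤-trans (ℕ.≤-reflexive (cong (v *_) (sym (B-Σ m (h + k))))) (below (h + k))) ⟩
        N (h + k) + (s * Σ≤ Y (h + k) + A * N (h + k))
          ≤⟨ ℕ.+-monoʳ-≤ (N (h + k)) (ℕ.+-monoˡ-≤ (A * N (h + k)) (mul-≤ s (block-≤ m Y Y-mono h k))) ⟩
        N (h + k) + (s * (h * Y (h + k) + Σ≤ Y k) + A * N (h + k))
          ≡⟨ lem₅ (N (h + k)) s h (Y (h + k)) (Σ≤ Y k) A ⟩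
        h * (s * Y (h + k)) + (N (h + k) + A * N (h + k)) + s * Σ≤ Y k
          ≤⟨ ℕ.+-monoʳ-≤ (h * (s * Y (h + k)) + (N (h + k) + A * N (h + k))) (ℕ.≤-trans (above k)
               (ℕ.+-mono-≤ (ℕ.≤-reflexive (cong (v *_) (B-Σ m k))) (mul-≤ A (B-mono m (ℕ.m≤n+m k h))))) ⟩
        h * (s * Y (h + k)) + (N (h + k) + A * N (h + k)) + (v * Σ≤ N k + A * N (h + k))
          ≡⟨ lem₆ (h * (s * Y (h + k))) (N (h + k)) A (v * Σ≤ N k) ⟩
        h * (s * Y (h + k)) + c * N (h + k) + v * Σ≤ N k ∎)
        where
        lem₅ : ∀ n s h y Y A → n + (s * (h * y + Y) + A * n) ≡ h * (s * y) + (n + A * n) + s * Y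
        lem₅ = ℕSolver.solve-∀
        lem₆ : ∀ a n A t → a + (n + A * n) + (t + A * n) ≡ a + suc (A + A) * n + t
        lem₆ = ℕSolver.solve-∀

    module _ (a b : ℕ) .{{_ : ℕ.NonZero s}} (1≤b : 1 ≤ b) (value : 5 * v * b ≡ a * s) where
      private
        -- Larger than 5c, so that the error c N, multiplied by 5b, stays strictly below g s (b N),
        -- the tolerance that becomes 1/E.
        g : ℕ
        g = suc (5 * c)
        slack : ∀ k {x y} → x ≤ y + 5 * b * (c * N k) → x < y + g * s * (b * N k)
        slack k {x} {y} p = ℕ.≤-<-trans p (ℕ.+-monoʳ-< y (begin-strict
          5 * b * (c * N k)      ≡⟨ lem b c (N k) ⟩
          5 * c * (b * N k)      <⟨ ℕ.m<n+m (5 * c * (b * N k)) (ℕ.*-mono-≤ 1≤b (1≤B m k)) ⟩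
          g * (b * N k)          ≤⟨ ℕ.*-monoˡ-≤ (b * N k) (ℕ.m≤m*n g s) ⟩
          g * s * (b * N k)      ∎))
          where
          open ℕ.≤-Reasoning
          lem : ∀ b c n → 5 * b * (c * n) ≡ 5 * c * (b * n)
          lem = ℕSolver.solve-∀

        above-ratio : ∀ E k → g * E * (s * Y k) ≤ g * E * (v * N k) + c * N k → E * (5 * Y k * b) < E * (a * N k) + b * N k
        above-ratio E k p = ℕ.*-cancelˡ-< (g * s) _ _ (begin-strict
          g * s * (E * (5 * Y k * b))                         ≡⟨ lem₁ g s E (Y k) b ⟩
          5 * b * (g * E * (s * Y k))                         <⟨ slack k (ℕ.≤-trans (mul-≤ (5 * b) p) (ℕ.≤-reflexive (ℕ.*-distribˡ-+ (5 * b) (g * E * (v * N k)) (c * N k)))) ⟩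
          5 * b * (g * E * (v * N k)) + g * s * (b * N k)     ≡⟨ cong (_+ g * s * (b * N k)) (lem₂ b g E v (N k)) ⟩
          5 * v * b * (g * E * N k) + g * s * (b * N k)       ≡⟨ cong (λ x → x * (g * E * N k) + g * s * (b * N k)) value ⟩
          a * s * (g * E * N k) + g * s * (b * N k)           ≡⟨ lem₃ a s g E (N k) b ⟩
          g * s * (E * (a * N k) + b * N k)                   ∎)
          where
          open ℕ.≤-Reasoning
          lem₁ : ∀ g s E y b → g * s * (E * (5 * y * b)) ≡ 5 * b * (g * E * (s * y))
          lem₁ = ℕSolver.solve-∀
          lem₂ : ∀ b g E v n → 5 * b * (g * E * (v * n)) ≡ 5 * v * b * (g * E * n)
          lem₂ = ℕSolver.solve-∀
          lem₃ : ∀ a s g E n b → a * s * (g * E * n) + g * s * (b * n) ≡ g * s * (E * (a * n) + b * n)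
          lem₃ = ℕSolver.solve-∀

        below-ratio : ∀ E k → g * E * (v * N k) ≤ g * E * (s * Y k) + c * N k → E * (a * N k) < E * (5 * Y k * b) + b * N k
        below-ratio E k p = ℕ.*-cancelˡ-< (g * s) _ _ (begin-strict
          g * s * (E * (a * N k))                             ≡⟨ lem₁ g s E a (N k) ⟩
          a * s * (g * E * N k)                               ≡⟨ cong (_* (g * E * N k)) value ⟨
          5 * v * b * (g * E * N k)                           ≡⟨ lem₂ b g E v (N k) ⟩
          5 * b * (g * E * (v * N k))                         <⟨ slack k (ℕ.≤-trans (mul-≤ (5 * b) p) (ℕ.≤-reflexive (ℕ.*-distribˡ-+ (5 * b) (g * E * (s * Y k)) (c * N k)))) ⟩
          5 * b * (g * E * (s * Y k)) + g * s * (b * N k)     ≡⟨ lem₃ b g E s (Y k) (N k) ⟩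
          g * s * (E * (5 * Y k * b) + b * N k)               ∎)
          where
          open ℕ.≤-Reasoning
          lem₁ : ∀ g s E a n → g * s * (E * (a * n)) ≡ a * s * (g * E * n)
          lem₁ = ℕSolver.solve-∀
          lem₂ : ∀ b g E v n → 5 * v * b * (g * E * n) ≡ 5 * b * (g * E * (v * n))
          lem₂ = ℕSolver.solve-∀
          lem₃ : ∀ b g E s y n → 5 * b * (g * E * (s * y)) + g * s * (b * n) ≡ g * s * (E * (5 * y * b) + b * n)
          lem₃ = ℕSolver.solve-∀

        distance : ∀ E x y t → E * x < E * y + t → E * y < E * x + t → ∣ x ℤ.⊖ y ∣ * E < t
        distance E x y t p q with ℕ.≤-total x y
        ... | inj₁ x≤y rewrite ℤ.∣⊖∣-≤ x≤y = half x y x≤y q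
          where
          half : ∀ x y → x ≤ y → E * y < E * x + t → (y ℕ.∸ x) * E < t
          half x y x≤y q = ℕ.+-cancelˡ-< (E * x) _ _ (subst (_< E * x + t) (trans (cong (E *_) (sym (ℕ.m+[n∸m]≡n x≤y)))
            (trans (ℕ.*-distribˡ-+ E x (y ℕ.∸ x)) (cong (λ u → E * x + u) (ℕ.*-comm E (y ℕ.∸ x))))) q)
        ... | inj₂ y≤x rewrite ℤ.∣m⊖n∣≡∣n⊖m∣ x y | ℤ.∣⊖∣-≤ y≤x = ℕ.+-cancelˡ-< (E * y) _ _ (subst (_< E * y + t) (trans (cong (E *_) (sym (ℕ.m+[n∸m]≡n y≤x)))
            (trans (ℕ.*-distribˡ-+ E y (x ℕ.∸ y)) (cong (λ u → E * y + u) (ℕ.*-comm E (x ℕ.∸ y))))) p)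

        -- A positive tolerance is at least the inverse of its denominator `suc d`, which serves as
        -- `E`.
        near : ∀ X P .{{_ : ℕ.NonZero P}} .{{_ : ℕ.NonZero b}} p d → 0ℚᵘ ℚᵘ.< mkℚᵘ p d →
               suc d * (X * b) < suc d * (a * P) + b * P → suc d * (a * P) < suc d * (X * b) + b * P →
               ℚᵘ.∣ (+ X) ℚᵘ./ P ℚᵘ.- (+ a) ℚᵘ./ b ∣ ℚᵘ.< mkℚᵘ p d
        near X (suc P) p@(+ suc p′) d _ lt gt = go b 1≤b lt gt
          where
          go : ∀ b .{{_ : ℕ.NonZero b}} → 1 ≤ b → suc d * (X * b) < suc d * (a * suc P) + b * suc P → suc d * (a * suc P) < suc d * (X * b) + b * suc P →
               ℚᵘ.∣ (+ X) ℚᵘ./ suc P ℚᵘ.- (+ a) ℚᵘ./ b ∣ ℚᵘ.< mkℚᵘ p d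
          go (suc b) _ lt gt = ℚᵘ.*<* (subst₂ ℤ._<_ (ℤ.pos-* (∣ + X ℤ.* + suc b ℤ.+ ℤ.- (+ a) ℤ.* + suc P ∣) (suc d)) (ℤ.pos-* (suc p′) (suc P * suc b)) (ℤ.+<+
            (ℕ.<-≤-trans (subst (λ z → z * suc d < suc b * suc P) (cong ∣_∣ z-≡) (distance (suc d) (X * suc b) (a * suc P) (suc b * suc P) lt gt))
              (ℕ.≤-trans (ℕ.≤-reflexive (ℕ.*-comm (suc b) (suc P))) (ℕ.m≤n*m (suc P * suc b) (suc p′))))))
            where
            z-≡ : X * suc b ℤ.⊖ a * suc P ≡ + X ℤ.* + suc b ℤ.+ ℤ.- (+ a) ℤ.* + suc P
            z-≡ = trans (sym (ℤ.m-n≡m⊖n (X * suc b) (a * suc P))) (cong₂ ℤ._+_ (ℤ.pos-* X (suc b))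
              (trans (cong ℤ.-_ (ℤ.pos-* a (suc P))) (ℤ.neg-distribˡ-* (+ a) (+ suc P))))
        near X P (+ 0)     d (ℚᵘ.*<* (ℤ.+<+ ())) lt gt
        near X P ℤ.-[1+ n ] d (ℚᵘ.*<* ()) lt gt

      ratio-limit : ∀ (X P : ℕ → ℕ) (nz : ∀ k → ℕ.NonZero (P k)) .{{_ : ℕ.NonZero b}} → (∀ k → X k ≡ 5 * Y k) → (∀ k → P k ≡ N k) →
                    (λ k → ℚᵘ._/_ (+ X k) (P k) {{nz k}}) ⟶ ((+ a) ℚᵘ./ b)
      ratio-limit X P nz X≡ P≡ (mkℚᵘ p d) 0<ε = proj₁ u + proj₁ l , λ k K≤k →
        near (X k) (P k) {{nz k}} p d 0<ε
          (subst₂ (λ x n → suc d * (x * b) < suc d * (a * n) + b * n) (sym (X≡ k)) (sym (P≡ k)) (above-ratio (suc d) k (proj₂ u k (ℕ.≤-trans (ℕ.m≤m+n _ _) K≤k))))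
          (subst₂ (λ x n → suc d * (a * n) < suc d * (x * b) + b * n) (sym (X≡ k)) (sym (P≡ k)) (below-ratio (suc d) k (proj₂ l k (ℕ.≤-trans (ℕ.m≤n+m _ _) K≤k))))
        where
        u = upper (g * suc d)
        l = lower (g * suc d)

-- Profiles

module Profiles where

  open import Data.Bool.Base using (Bool; true; false; if_then_else_)
  open import Data.Fin.Base as Fin using (Fin; zero; suc)
  import Data.Fin.Properties as Fin
  open import Data.Nat.Base as ℕ using (ℕ; zero; suc; _+_; _*_; _≤_; _<_; s≤s)
  import Data.Nat.Properties as ℕ
  import Data.Nat.Tactic.RingSolver as ℕSolver
  open import Data.Integer.Base as ℤ using (ℤ; +_)
  import Data.Integer.Properties as ℤ
  import Data.Integer.Tactic.RingSolver as ℤSolver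
  open import Data.List.Base as List using (List; []; _∷_; _++_; length; map; filter; upTo; applyUpTo; cartesianProductWith)
  import Data.List.Properties as List
  open import Data.List.Relation.Unary.All using (All; []; _∷_)
  open import Data.Product.Base using (∃-syntax; _,_)
  open import Data.Sum.Base using (inj₁; inj₂)
  open import Data.Vec.Base using (Vec; []; _∷_; fromList; zipWith; sum)
  open import Data.List.Relation.Binary.Permutation.Propositional using (_↭_)
  open import Relation.Binary.PropositionalEquality hiding ([_])
  open import Relation.Nullary using (¬_; does; yes; no; contradiction)
  open import Relation.Unary using (Decidable)
  open import Function.Base using (_∘_; id)
  open Binomials using (B)
  open Space

  ∑ : ∀ {X : Set} → (X → ℕ) → List X → ℕ
  ∑ f []       = 0
  ∑ f (x ∷ xs) = f x + ∑ f xs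

  module _ {X : Set} where

    ∑-cong : ∀ {f g : X → ℕ} → (∀ x → f x ≡ g x) → ∀ xs → ∑ f xs ≡ ∑ g xs
    ∑-cong h []       = refl
    ∑-cong h (x ∷ xs) = cong₂ _+_ (h x) (∑-cong h xs)

    ∑-0 : ∀ (xs : List X) → ∑ (λ _ → 0) xs ≡ 0
    ∑-0 []       = refl
    ∑-0 (x ∷ xs) = ∑-0 xs

    ∑-++ : ∀ (f : X → ℕ) xs ys → ∑ f (xs ++ ys) ≡ ∑ f xs + ∑ f ys
    ∑-++ f []       ys = refl
    ∑-++ f (x ∷ xs) ys = trans (cong (λ s → f x + s) (∑-++ f xs ys)) (sym (ℕ.+-assoc (f x) (∑ f xs) (∑ f ys)))

    ∑-map : ∀ {Y : Set} (f : X → ℕ) (h : Y → X) ys → ∑ f (map h ys) ≡ ∑ (f ∘ h) ys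
    ∑-map f h []       = refl
    ∑-map f h (y ∷ ys) = cong (λ s → f (h y) + s) (∑-map f h ys)

    ∑-product : ∀ {Y Z : Set} (f : X → ℕ) (h : Y → Z → X) ys zs →
                ∑ f (cartesianProductWith h ys zs) ≡ ∑ (λ y → ∑ (λ z → f (h y z)) zs) ys
    ∑-product f h []       zs = refl
    ∑-product f h (y ∷ ys) zs = trans (∑-++ f (map (h y) zs) (cartesianProductWith h ys zs))
      (cong₂ _+_ (∑-map f (h y) zs) (∑-product f h ys zs))

    length-filter : ∀ {P : X → Set} (P? : Decidable P) xs → length (filter P? xs) ≡ ∑ (λ x → if does (P? x) then 1 else 0) xs
    length-filter P? []       = refl
    length-filter P? (x ∷ xs) with does (P? x)
    ... | true  = cong suc (length-filter P? xs)
    ... | false = length-filter P? xs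

    ∑-filter : ∀ {P : X → Set} (P? : Decidable P) (f : X → ℕ) xs → ∑ f (filter P? xs) ≡ ∑ (λ x → if does (P? x) then f x else 0) xs
    ∑-filter P? f []       = refl
    ∑-filter P? f (x ∷ xs) with does (P? x)
    ... | true  = cong (λ s → f x + s) (∑-filter P? f xs)
    ... | false = ∑-filter P? f xs

  ∑-applyUpTo : ∀ {X : Set} (f : X → ℕ) (h : ℕ → X) n → ∑ f (applyUpTo h n) ≡ ∑ (f ∘ h) (upTo n)
  ∑-applyUpTo f h n = go f h id n
    where
    go : ∀ {X : Set} (f : X → ℕ) (h : ℕ → X) (e : ℕ → ℕ) n → ∑ f (applyUpTo (h ∘ e) n) ≡ ∑ (f ∘ h) (applyUpTo e n)
    go f h e zero    = refl
    go f h e (suc n) = cong (λ s → f (h (e 0)) + s) (go f h (e ∘ suc) n)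

  ∑-upTo : ∀ (f : ℕ → ℕ) n → ∑ f (upTo (suc n)) ≡ f 0 + ∑ (f ∘ suc) (upTo n)
  ∑-upTo f n = cong (λ s → f 0 + s) (∑-applyUpTo f suc n)

  -- The sequence which is φ at 0, so that count (δ φ) counts exactly.
  δ : (Point → ℕ) → Seq
  δ φ zero    o = φ o
  δ φ (suc k) o = 0

  move : ℕ → Point → Point → Point
  move zero    u o = o
  move (suc j) u o = move j u (o ⊹ u)

  -- `j` is the multiplicity of the first vector. Terms with j > k vanish, and lowering `j` and `k`
  -- together is the recursion of a ray.
  ∑-ray : ∀ u (ψ : Seq) (t : ℕ → ℕ → Point → ℕ) → (∀ k o → t 0 k o ≡ ψ k o) → (∀ j o → t (suc j) 0 o ≡ 0) →
          (∀ j k o → t (suc j) (suc k) o ≡ t j k (o ⊹ u)) → ∀ J k o → k < J → ∑ (λ j → t j k o) (upTo J) ≡ ray (gen 0 u) ψ k o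
  ∑-ray u ψ t t₀ t₁ t₂ (suc J) zero    o _         = trans (∑-upTo (λ j → t j 0 o) J)
    (trans (cong₂ _+_ (t₀ 0 o) (trans (∑-cong (λ j → t₁ j o) (upTo J)) (∑-0 (upTo J)))) (sym (ray-unfold (gen 0 u) ψ 0 o)))
  ∑-ray u ψ t t₀ t₁ t₂ (suc J) (suc k) o (s≤s k<J) = trans (∑-upTo (λ j → t j (suc k) o) J)
    (trans (cong₂ _+_ (t₀ (suc k) o) (trans (∑-cong (λ j → t₂ j k o) (upTo J)) (∑-ray u ψ t t₀ t₁ t₂ J k (o ⊹ u) k<J)))
      (sym (ray-unfold (gen 0 u) ψ (suc k) o)))

  module _ {R : Set} (dir : R → Point) where

    walk : (L : List R) → Vec ℕ (length L) → Point → Point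
    walk []      []      o = o
    walk (r ∷ L) (j ∷ x) o = walk L x (move j (dir r) o)

    gens : List R → List Gen
    gens = map (λ r → gen 0 (dir r))

    module _ (φ : Point → ℕ) where

      -- `K` is separated from `k` because the entries keep their range while the number of voters
      -- left decreases.
      tally : ∀ K L k o → k ≤ K →
              ∑ (λ x → if does (sum x ℕ.≟ k) then φ (walk L x o) else 0) (vectorsOver (upTo (suc K)) (length L)) ≡ count (δ φ) (gens L) k o
      tally K []      zero    o _   = ℕ.+-identityʳ (φ o)
      tally K []      (suc k) o _   = refl
      tally K (r ∷ L) k       o k≤K = trans
        (∑-product (λ x → if does (sum x ℕ.≟ k) then φ (walk (r ∷ L) x o) else 0) _∷_ (upTo (suc K)) vs)
        (go k o k≤K)
        where
        vs = vectorsOver (upTo (suc K)) (length L)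
        t : ℕ → ℕ → Point → ℕ
        t j k o = ∑ (λ x → if does (j + sum x ℕ.≟ k) then φ (walk L x (move j (dir r) o)) else 0) vs
        -- Above `K` the enumeration is truncated and need not be the count. The ray only reads
        -- degrees up to `k`, so the two may be glued.
        ψ : Seq
        ψ k o with k ℕ.≤? K
        ... | yes _ = count (δ φ) (gens L) k o
        ... | no  _ = t 0 k o
        ψ-≡ : ∀ k o → t 0 k o ≡ ψ k o
        ψ-≡ k o with k ℕ.≤? K
        ... | yes k≤K = tally K L k o k≤K
        ... | no  _   = refl
        ψ-count : ∀ k o → k ≤ K → ψ k o ≡ count (δ φ) (gens L) k o
        ψ-count k o k≤K with k ℕ.≤? K
        ... | yes _   = refl
        ... | no  k≰K = contradiction k≤K k≰K
        ray-ψ : ∀ k o → k ≤ K → ray (gen 0 (dir r)) ψ k o ≡ ray (gen 0 (dir r)) (count (δ φ) (gens L)) k o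
        ray-ψ zero    o k≤K = trans (ray-unfold (gen 0 (dir r)) ψ 0 o) (trans (cong (_+ 0) (ψ-count 0 o k≤K)) (sym (ray-unfold (gen 0 (dir r)) (count (δ φ) (gens L)) 0 o)))
        ray-ψ (suc k) o k≤K = trans (ray-unfold (gen 0 (dir r)) ψ (suc k) o) (trans (cong₂ _+_ (ψ-count (suc k) o k≤K) (ray-ψ k (o ⊹ dir r) (ℕ.≤-trans (ℕ.n≤1+n k) k≤K)))
          (sym (ray-unfold (gen 0 (dir r)) (count (δ φ) (gens L)) (suc k) o)))
        go : ∀ k o → k ≤ K → ∑ (λ j → t j k o) (upTo (suc K)) ≡ ray (gen 0 (dir r)) (count (δ φ) (gens L)) k o
        go k o k≤K = trans (∑-ray (dir r) ψ t ψ-≡ (λ j o → ∑-0 vs) (λ j k o → refl) (suc K) k o (s≤s k≤K)) (ray-ψ k o k≤K)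

  ∑ᶠ : ∀ {n} → (Fin n → ℕ) → ℕ
  ∑ᶠ {zero}  f = 0
  ∑ᶠ {suc n} f = f zero + ∑ᶠ (f ∘ suc)

  ∑ᶠ-0 : ∀ {n} (f : Fin n → ℕ) → (∀ A → f A ≡ 0) → ∑ᶠ f ≡ 0
  ∑ᶠ-0 {zero}  f h = refl
  ∑ᶠ-0 {suc n} f h = cong₂ _+_ (h zero) (∑ᶠ-0 (f ∘ suc) (h ∘ suc))

  ∑ᶠ-1 : ∀ {n} (f : Fin n → ℕ) A → f A ≡ 1 → (∀ B → B ≢ A → f B ≡ 0) → ∑ᶠ f ≡ 1
  ∑ᶠ-1 f zero    e h = cong₂ _+_ e (∑ᶠ-0 (f ∘ suc) (λ B → h (suc B) (λ ())))
  ∑ᶠ-1 f (suc A) e h = cong₂ _+_ (h zero (λ ())) (∑ᶠ-1 (f ∘ suc) A e (λ B B≢A → h (suc B) (B≢A ∘ Fin.suc-injective)))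

  ∑-+ : ∀ {X : Set} (f g : X → ℕ) xs → ∑ (λ x → f x + g x) xs ≡ ∑ f xs + ∑ g xs
  ∑-+ f g []       = refl
  ∑-+ f g (x ∷ xs) = trans (cong (λ s → f x + g x + s) (∑-+ f g xs)) (lem (f x) (g x) (∑ f xs) (∑ g xs))
    where
    lem : ∀ a b c d → a + b + (c + d) ≡ (a + c) + (b + d)
    lem = ℕSolver.solve-∀

  ∑-∑ᶠ : ∀ {X : Set} {n} (q : X → Bool) (f : Fin n → X → ℕ) xs →
         ∑ (λ x → if q x then ∑ᶠ (λ A → f A x) else 0) xs ≡ ∑ᶠ (λ A → ∑ (λ x → if q x then f A x else 0) xs)
  ∑-∑ᶠ {n = zero}  q f xs = trans (∑-cong (λ x → same (q x)) xs) (∑-0 xs)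
    where
    same : ∀ b → (if b then 0 else 0) ≡ 0
    same true  = refl
    same false = refl
  ∑-∑ᶠ {n = suc n} q f xs = trans (∑-cong (λ x → split (q x) (f zero x) (∑ᶠ (λ A → f (suc A) x))) xs)
    (trans (∑-+ (λ x → if q x then f zero x else 0) (λ x → if q x then ∑ᶠ (λ A → f (suc A) x) else 0) xs)
      (cong (λ s → ∑ (λ x → if q x then f zero x else 0) xs + s) (∑-∑ᶠ q (f ∘ suc) xs)))
    where
    split : ∀ b x y → (if b then x + y else 0) ≡ (if b then x else 0) + (if b then y else 0)
    split true  x y = refl
    split false x y = refl

  bit : Bool → ℕ
  bit b = if b then 1 else 0

  beats⇒loses : ∀ n (x : Profile n) A B → BeatsInMajority {n} x A B → ¬ BeatsInMajority {n} x B A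
  beats⇒loses n x A B = ℕ.<-asym

  module _ (n : ℕ) (x : Profile n) (f : Fin n → ℕ) (f-1 : ∀ A → IsCondorcetWinner {n} x A → f A ≡ 1) (f-0 : ∀ A → ¬ IsCondorcetWinner {n} x A → f A ≡ 0) where

    -- Two winners would beat each other, so the indicator that a winner exists is the sum of the
    -- indicators of the candidates.
    ∑ᶠ-winner : bit (does (hasCondorcetWinner? n x)) ≡ ∑ᶠ f
    ∑ᶠ-winner with hasCondorcetWinner? n x
    ... | yes (A , p) = sym (∑ᶠ-1 f A (f-1 A p) λ B B≢A → f-0 B λ q → beats⇒loses n x A B (p B B≢A) (q A (B≢A ∘ sym)))
    ... | no  none    = sym (∑ᶠ-0 f λ A → f-0 A λ p → none (A , p))

  origin : Point
  origin = point (+ 0) (+ 0) (+ 0) (+ 0)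

  wins : Point → ℕ
  wins = event (c₁ ∷ c₂ ∷ c₃ ∷ c₄ ∷ [])

  module _ {n : ℕ} where

    sign : Vec (Fin n) n → Fin n → Fin n → ℤ
    sign r A B = + bit (does (above? r A B)) ℤ.- + bit (does (above? r B A))

    direction : (Fin 4 → Fin n) → Fin n → Vec (Fin n) n → Point
    direction rival A r = point (sign r A (rival zero)) (sign r A (rival (suc zero))) (sign r A (rival (suc (suc zero)))) (sign r A (rival (suc (suc (suc zero)))))

  module Candidate (n : ℕ) (A : Fin n) (rival : Fin 4 → Fin n) (rival≢ : ∀ i → rival i ≢ A) (cover : ∀ B → B ≢ A → ∃[ i ] rival i ≡ B) where

    coordinate : Fin 4 → Functional
    coordinate zero                   = c₁
    coordinate (suc zero)             = c₂
    coordinate (suc (suc zero))       = c₃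
    coordinate (suc (suc (suc zero))) = c₄

    direction-≡ : ∀ i r → fun (coordinate i) (direction rival A r) ≡ sign r A (rival i)
    direction-≡ zero                   r = refl
    direction-≡ (suc zero)             r = refl
    direction-≡ (suc (suc zero))       r = refl
    direction-≡ (suc (suc (suc zero))) r = refl

    private
      tallyOf : (L : List (Vec (Fin n) n)) → Vec ℕ (length L) → Fin n → Fin n → ℕ
      tallyOf L x A B = sum (zipWith (λ r xᵣ → if does (above? r A B) then xᵣ else 0) (fromList L) x)

      move-≡ : ∀ λ′ j u o → fun λ′ (move j u o) ≡ fun λ′ o ℤ.+ + j ℤ.* fun λ′ u
      move-≡ λ′ zero    u o = sym (trans (cong (λ z → fun λ′ o ℤ.+ z) (ℤ.*-zeroˡ (fun λ′ u))) (ℤ.+-identityʳ (fun λ′ o)))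
      move-≡ λ′ (suc j) u o = trans (move-≡ λ′ j u (o ⊹ u)) (trans (cong (λ z → z ℤ.+ + j ℤ.* fun λ′ u) (add λ′ o u)) (lem (fun λ′ o) (fun λ′ u) (+ j)))
        where
        lem : ∀ o u j → o ℤ.+ u ℤ.+ j ℤ.* u ≡ o ℤ.+ (+ 1 ℤ.+ j) ℤ.* u
        lem = ℤSolver.solve-∀

      bit-* : ∀ j b → + j ℤ.* + bit b ≡ + (if b then j else 0)
      bit-* j true  = ℤ.*-identityʳ (+ j)
      bit-* j false = ℤ.*-zeroʳ (+ j)

      -- Each voter moves coordinate `i` by the sign of the comparison with rival `i`, so the
      -- endpoint records the majority margins.
      walk-≡ : ∀ i L x o → fun (coordinate i) (walk (direction rival A) L x o) ≡ fun (coordinate i) o ℤ.+ (+ tallyOf L x A (rival i) ℤ.- + tallyOf L x (rival i) A)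
      walk-≡ i []      []      o = sym (ℤ.+-identityʳ _)
      walk-≡ i (r ∷ L) (j ∷ x) o = begin
        fun (coordinate i) (walk (direction rival A) L x (move j (direction rival A r) o))
          ≡⟨ walk-≡ i L x (move j (direction rival A r) o) ⟩
        fun (coordinate i) (move j (direction rival A r) o) ℤ.+ (+ T₁ ℤ.- + T₂)
          ≡⟨ cong (λ z → z ℤ.+ (+ T₁ ℤ.- + T₂)) (trans (move-≡ (coordinate i) j (direction rival A r) o) (cong (λ z → fun (coordinate i) o ℤ.+ + j ℤ.* z) (direction-≡ i r))) ⟩
        fun (coordinate i) o ℤ.+ + j ℤ.* (+ bit b₁ ℤ.- + bit b₂) ℤ.+ (+ T₁ ℤ.- + T₂)
          ≡⟨ lem₁ (fun (coordinate i) o) (+ j) (+ bit b₁) (+ bit b₂) (+ T₁) (+ T₂) ⟩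
        fun (coordinate i) o ℤ.+ ((+ j ℤ.* + bit b₁ ℤ.+ + T₁) ℤ.- (+ j ℤ.* + bit b₂ ℤ.+ + T₂))
          ≡⟨ cong₂ (λ y z → fun (coordinate i) o ℤ.+ ((y ℤ.+ + T₁) ℤ.- (z ℤ.+ + T₂))) (bit-* j b₁) (bit-* j b₂) ⟩
        fun (coordinate i) o ℤ.+ ((+ (if b₁ then j else 0) ℤ.+ + T₁) ℤ.- (+ (if b₂ then j else 0) ℤ.+ + T₂))
          ≡⟨ cong₂ (λ y z → fun (coordinate i) o ℤ.+ (y ℤ.- z)) (sym (ℤ.pos-+ (if b₁ then j else 0) T₁)) (sym (ℤ.pos-+ (if b₂ then j else 0) T₂)) ⟩
        fun (coordinate i) o ℤ.+ (+ tallyOf (r ∷ L) (j ∷ x) A (rival i) ℤ.- + tallyOf (r ∷ L) (j ∷ x) (rival i) A) ∎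
        where
        open ≡-Reasoning
        b₁ = does (above? r A (rival i))
        b₂ = does (above? r (rival i) A)
        T₁ = tallyOf L x A (rival i)
        T₂ = tallyOf L x (rival i) A
        lem₁ : ∀ o j a b s t → o ℤ.+ j ℤ.* (a ℤ.- b) ℤ.+ (s ℤ.- t) ≡ o ℤ.+ ((j ℤ.* a ℤ.+ s) ℤ.- (j ℤ.* b ℤ.+ t))
        lem₁ = ℤSolver.solve-∀

    module _ (x : Profile n) where
      private
        z : Fin 4 → ℤ
        z i = fun (coordinate i) (walk (direction rival A) (rankings n) x origin)
        z-≡ : ∀ i → z i ≡ + preferring {n} x A (rival i) ℤ.- + preferring {n} x (rival i) A
        z-≡ i = trans (walk-≡ i (rankings n) x origin) (trans (cong (λ o → o ℤ.+ (+ preferring {n} x A (rival i) ℤ.- + preferring {n} x (rival i) A)) (start i)) (ℤ.+-identityˡ _))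
          where
          start : ∀ i → fun (coordinate i) origin ≡ + 0
          start zero                   = refl
          start (suc zero)             = refl
          start (suc (suc zero))       = refl
          start (suc (suc (suc zero))) = refl
        0<z⇒beats : ∀ i → + 0 ℤ.< z i → BeatsInMajority {n} x A (rival i)
        0<z⇒beats i h = ℤ.drop‿+<+ (subst (λ t → + preferring {n} x (rival i) A ℤ.< t) (cancel (+ preferring {n} x A (rival i)) (+ preferring {n} x (rival i) A))
          (subst (λ t → t ℤ.< (+ preferring {n} x A (rival i) ℤ.- + preferring {n} x (rival i) A) ℤ.+ + preferring {n} x (rival i) A) (ℤ.+-identityˡ (+ preferring {n} x (rival i) A))
            (ℤ.+-monoˡ-< (+ preferring {n} x (rival i) A) (subst (λ t → + 0 ℤ.< t) (z-≡ i) h))))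
          where
          cancel : ∀ p q → (p ℤ.- q) ℤ.+ q ≡ p
          cancel = ℤSolver.solve-∀
        beats⇒0<z : ∀ i → BeatsInMajority {n} x A (rival i) → + 0 ℤ.< z i
        beats⇒0<z i h = subst₂ ℤ._<_ (ℤ.+-inverseʳ (+ preferring {n} x (rival i) A)) (sym (z-≡ i)) (ℤ.+-monoˡ-< (ℤ.- + preferring {n} x (rival i) A) (ℤ.+<+ h))
        pos-1 : ∀ i → + 0 ℤ.< z i → pos (z i) ≡ 1
        pos-1 i h with pos-cases (z i)
        ... | inj₁ (e , _) = e
        ... | inj₂ (_ , g) = contradiction h (ℤ.≤⇒≯ g)
        p : Fin 4 → ℕ
        p i = pos (z i)

      wins-1 : IsCondorcetWinner {n} x A → wins (walk (direction rival A) (rankings n) x origin) ≡ 1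
      wins-1 p = cong₂ _*_ (one zero) (cong₂ _*_ (one (suc zero)) (cong₂ _*_ (one (suc (suc zero))) (cong (_* 1) (one (suc (suc (suc zero)))))))
        where
        one : ∀ i → pos (z i) ≡ 1
        one i = pos-1 i (beats⇒0<z i (p (rival i) (rival≢ i)))

      wins-0 : ¬ IsCondorcetWinner {n} x A → wins (walk (direction rival A) (rankings n) x origin) ≡ 0
      wins-0 ¬p with pos-cases (z zero) | pos-cases (z (suc zero)) | pos-cases (z (suc (suc zero))) | pos-cases (z (suc (suc (suc zero))))
      ... | inj₂ (e , _) | _            | _            | _            = cong (λ t → t * (p (suc zero) * (p (suc (suc zero)) * (p (suc (suc (suc zero))) * 1)))) e
      ... | inj₁ _       | inj₂ (e , _) | _            | _            = trans (cong (λ t → p zero * (t * (p (suc (suc zero)) * (p (suc (suc (suc zero))) * 1)))) e) (ℕ.*-zeroʳ (p zero))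
      ... | inj₁ _       | inj₁ _       | inj₂ (e , _) | _            = trans (cong (λ t → p zero * (p (suc zero) * (t * (p (suc (suc (suc zero))) * 1)))) e)
                                                                          (trans (cong (p zero *_) (ℕ.*-zeroʳ (p (suc zero)))) (ℕ.*-zeroʳ (p zero)))
      ... | inj₁ _       | inj₁ _       | inj₁ _       | inj₂ (e , _) = trans (cong (λ t → p zero * (p (suc zero) * (p (suc (suc zero)) * (t * 1)))) e)
                                                                          (trans (cong (λ t → p zero * (p (suc zero) * t)) (ℕ.*-zeroʳ (p (suc (suc zero)))))
                                                                          (trans (cong (p zero *_) (ℕ.*-zeroʳ (p (suc zero)))) (ℕ.*-zeroʳ (p zero))))
      ... | inj₁ (_ , g₀) | inj₁ (_ , g₁) | inj₁ (_ , g₂) | inj₁ (_ , g₃) = contradiction (λ B B≢A → beats B (cover B B≢A)) ¬p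
        where
        all : ∀ i → + 0 ℤ.< z i
        all zero                   = g₀
        all (suc zero)             = g₁
        all (suc (suc zero))       = g₂
        all (suc (suc (suc zero))) = g₃
        beats : ∀ B → ∃[ i ] rival i ≡ B → BeatsInMajority {n} x A B
        beats B (i , refl) = 0<z⇒beats i (all i)

  module _ (n k : ℕ) (dir : Fin n → Vec (Fin n) n → Point) where

    winners-≡ : ∀ φ o → (∀ A x → IsCondorcetWinner {n} x A → φ (walk (dir A) (rankings n) x o) ≡ 1) →
                (∀ A x → ¬ IsCondorcetWinner {n} x A → φ (walk (dir A) (rankings n) x o) ≡ 0) →
                #profilesWithCondorcetWinner n k ≡ ∑ᶠ (λ A → count (δ φ) (gens (dir A) (rankings n)) k o)
    winners-≡ φ o one none = begin
      length (filter (hasCondorcetWinner? n) (profiles n k))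
        ≡⟨ length-filter (hasCondorcetWinner? n) (profiles n k) ⟩
      ∑ (λ x → bit (does (hasCondorcetWinner? n x))) (profiles n k)
        ≡⟨ ∑-cong (λ x → ∑ᶠ-winner n x (λ A → φ (walk (dir A) (rankings n) x o)) (λ A → one A x) (λ A → none A x)) (profiles n k) ⟩
      ∑ (λ x → ∑ᶠ (λ A → φ (walk (dir A) (rankings n) x o))) (profiles n k)
        ≡⟨ ∑-filter (hasSum? k) (λ x → ∑ᶠ (λ A → φ (walk (dir A) (rankings n) x o))) vs ⟩
      ∑ (λ x → if does (sum x ℕ.≟ k) then ∑ᶠ (λ A → φ (walk (dir A) (rankings n) x o)) else 0) vs
        ≡⟨ ∑-∑ᶠ (λ x → does (sum x ℕ.≟ k)) (λ A x → φ (walk (dir A) (rankings n) x o)) vs ⟩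
      ∑ᶠ (λ A → ∑ (λ x → if does (sum x ℕ.≟ k) then φ (walk (dir A) (rankings n) x o) else 0) vs)
        ≡⟨ ∑ᶠ-cong (λ A → tally (dir A) φ k (rankings n) k o ℕ.≤-refl) ⟩
      ∑ᶠ (λ A → count (δ φ) (gens (dir A) (rankings n)) k o) ∎
      where
      open ≡-Reasoning
      vs = vectorsOver (upTo (suc k)) (length (rankings n))
      ∑ᶠ-cong : ∀ {n} {f g : Fin n → ℕ} → (∀ A → f A ≡ g A) → ∑ᶠ f ≡ ∑ᶠ g
      ∑ᶠ-cong {zero}  h = refl
      ∑ᶠ-cong {suc n} h = cong₂ _+_ (h zero) (∑ᶠ-cong (h ∘ suc))

  -- Stars and bars, read as Pascal's rule.
  count-1 : ∀ M k o → All (λ g → Gen.d g ≡ 0) M → cnt (λ _ → 1) M k o ≡ B (length M) k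
  count-1 []      k o []         = refl
  count-1 (gen _ u ∷ M) k o (refl ∷ ds) = sym (ray-unique (gen 0 u) (cnt (λ _ → 1) M) {λ k o → B (suc (length M)) k} step k o)
    where
    step : ∀ k o → B (suc (length M)) k ≡ cnt (λ _ → 1) M k o + shift (gen 0 u) (λ k o → B (suc (length M)) k) k o
    step zero    o = sym (trans (ℕ.+-identityʳ _) (count-1 M 0 o ds))
    step (suc k) o = trans (ℕ.+-comm (B (suc (length M)) k) (B (length M) (suc k))) (cong (_+ B (suc (length M)) k) (sym (count-1 M (suc k) o ds)))

  -- One ray over `δ` absorbs the unspent degree: exactly `k` voters on m + 1 rankings amount to at
  -- most `k` on `m` rankings.
  count-δ1 : ∀ M {m} k o → length M ≡ suc m → All (λ g → Gen.d g ≡ 0) M → count (δ (λ _ → 1)) M k o ≡ B m k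
  count-δ1 (gen _ u ∷ M) k o refl (refl ∷ ds) = trans (sym (count-ray (gen 0 u) (δ (λ _ → 1)) M k o))
    (trans (count-cong M (λ k o → sym (ray-unique (gen 0 u) (δ (λ _ → 1)) {constant (λ _ → 1)} step k o)) k o) (count-1 M k o ds))
    where
    step : ∀ k o → 1 ≡ δ (λ _ → 1) k o + shift (gen 0 u) (constant (λ _ → 1)) k o
    step zero    o = refl
    step (suc k) o = refl

  profiles-count : ∀ n k {m} → length (rankings n) ≡ suc m → #profiles n k ≡ B m k
  profiles-count n k len = trans (length-filter (hasSum? k) (vectorsOver (upTo (suc k)) (length (rankings n))))
    (trans (tally still (λ _ → 1) k (rankings n) k origin ℕ.≤-refl)
      (count-δ1 (gens still (rankings n)) k origin (trans (List.length-map (λ _ → gen 0 origin) (rankings n)) len) (simple (rankings n))))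
    where
    still : Vec (Fin n) n → Point
    still _ = origin
    simple : ∀ L → All (λ g → Gen.d g ≡ 0) (gens still L)
    simple []      = []
    simple (r ∷ L) = refl ∷ simple L

  module Election (n : ℕ) (rival : Fin n → Fin 4 → Fin n) (rival≢ : ∀ A i → rival A i ≢ A) (cover : ∀ A B → B ≢ A → ∃[ i ] rival A i ≡ B) where

    -- All candidates see the same vectors up to order, so each wins equally often.
    winners-common : ∀ M → (∀ A → gens (direction (rival A) A) (rankings n) ↭ M) → ∀ k → #profilesWithCondorcetWinner n k ≡ n * count (δ wins) M k origin
    winners-common M p k = trans
      (winners-≡ n k (λ A → direction (rival A) A) wins origin (λ A x → Candidate.wins-1 n A (rival A) (rival≢ A) (cover A) x)
        (λ A x → Candidate.wins-0 n A (rival A) (rival≢ A) (cover A) x))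
      (common (λ A → count-↭ (δ wins) (p A) k origin))
      where
      common : ∀ {n y} {f : Fin n → ℕ} → (∀ A → f A ≡ y) → ∑ᶠ f ≡ n * y
      common {zero}  h = refl
      common {suc n} h = cong₂ _+_ (h zero) (common (h ∘ suc))

-- Five candidates

open import Data.Fin.Base as Fin using (Fin; zero; suc; punchIn; punchOut)
import Data.Fin.Properties as Fin
open import Data.Nat.Base as ℕ using (ℕ; zero; suc; _+_; _*_; _≤_; z≤n; s≤s)
import Data.Nat.Properties as ℕ
open import Data.Integer.Base as ℤ using (ℤ; +_; -[1+_]; ∣_∣)
import Data.Integer.Properties as ℤ
open import Data.List.Base as List using (List; []; _∷_; _++_; length; map; replicate)
import Data.List.Properties as List
open import Data.List.Sort.InsertionSort.Base ℕ.≤-decTotalOrder using (sort)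
open import Data.List.Sort.InsertionSort.Properties ℕ.≤-decTotalOrder using (sort-↭)
open import Data.List.Relation.Binary.Permutation.Propositional using (_↭_; ↭-sym; ↭-trans; ↭-reflexive)
import Data.List.Relation.Binary.Permutation.Propositional.Properties as ↭
open import Data.List.Relation.Unary.All as All using (All; []; _∷_)
open import Data.Product.Base using (∃-syntax; _×_; proj₁; proj₂; _,_)
open import Data.Rational.Unnormalised.Base using (_/_)
open import Data.Sum.Base using (inj₁; inj₂)
open import Data.Unit.Base using (⊤; tt)
open import Relation.Binary.PropositionalEquality hiding ([_])
open import Relation.Nullary.Decidable using (Dec; True; map′; _×-dec_; toWitness)
open import Function.Base using (_∘_)
open Binomials using (B; Approx)
open Labels
open Functionals using (tilt; 𝔽)
open Recursion using (D⁺; D⁻; A⁺; A⁻; module Evaluate)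
open Space
open Profiles
open Limits using (ratio-limit)
open Evaluation using (volume; volume-total; volume-value)

count-translate : ∀ ψ M u k o → count ψ M k (o ⊹ u) ≡ count (λ k o → ψ k (o ⊹ u)) M k o
count-translate ψ []      u k o = refl
count-translate ψ (g ∷ M) u k o = trans
  (ray-unique g (λ k o → count ψ M k (o ⊹ u)) {λ k o → ray g (count ψ M) k (o ⊹ u)} (λ k o → trans (ray-unfold g (count ψ M) k (o ⊹ u))
    (cong (λ s → count ψ M k (o ⊹ u) + s) (Binomials.delay-ext (deg g) k λ j → cong (ray g (count ψ M) j) (exchange o u (v g))))) k o)
  (ray-cong g (count-translate ψ M u) k o)

-- Degree at most `k` is degree exactly `k` with one more generator that does not move and takes up
-- the unspent degree.
count-Σ : ∀ φ M k o → (∀ o → o ⊹ point (+ 0) (+ 0) (+ 0) (+ 0) ≡ o) → cnt φ M k o ≡ Σ≤ (λ j → count (δ φ) M j o) k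
count-Σ φ M k o id = trans (count-cong M (λ k o → constant-ray k o) k o) (trans (count-ray z (δ φ) M k o) (partial k o))
  where
  z : Gen
  z = gen 0 (point (+ 0) (+ 0) (+ 0) (+ 0))
  constant-ray : ∀ k o → φ o ≡ ray z (δ φ) k o
  constant-ray k o = ray-unique z (δ φ) {constant φ} step k o
    where
    step : ∀ k o → φ o ≡ δ φ k o + shift z (constant φ) k o
    step zero    o = sym (ℕ.+-identityʳ (φ o))
    step (suc k) o = cong φ (sym (id o))
  partial : ∀ k o → ray z (count (δ φ) M) k o ≡ Σ≤ (λ j → count (δ φ) M j o) k
  partial zero    o = trans (ray-unfold z (count (δ φ) M) 0 o) (ℕ.+-identityʳ _)
  partial (suc k) o = trans (ray-unfold z (count (δ φ) M) (suc k) o) (trans (ℕ.+-comm (count (δ φ) M (suc k) o) _)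
    (cong (_+ count (δ φ) M (suc k) o) (trans (cong (ray z (count (δ φ) M) k) (id o)) (partial k o))))

⊹-identity : ∀ o → o ⊹ point (+ 0) (+ 0) (+ 0) (+ 0) ≡ o
⊹-identity (point a b c d) rewrite ℤ.+-identityʳ a | ℤ.+-identityʳ b | ℤ.+-identityʳ c | ℤ.+-identityʳ d = refl

private
  1⁺ 1⁻ : ℤ
  1⁺ = + 1
  1⁻ = ℤ.- + 1

  ahead-by behind-by : ℤ → ℤ → ℤ → ℕ → ℕ → List Gen
  ahead-by  i j k p q = replicate p (gen 0 (point i j k 1⁺)) ++ replicate q (gen 0 (point i j k 1⁻))
  behind-by i j k p q = replicate p (gen 0 (point i j k 1⁻)) ++ replicate q (gen 0 (point i j k 1⁺))

-- p and q are the multiplicities of the two tilts in the directions ± (1 , 1 , 1), r and s those in the other directions.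
arrangement : (p q r s : ℕ) → List Gen
arrangement p q r s =
  ahead-by 1⁺ 1⁺ 1⁺ p q ++ (behind-by 1⁻ 1⁻ 1⁻ p q ++ (ahead-by 1⁻ 1⁺ 1⁺ r s ++ (behind-by 1⁺ 1⁻ 1⁻ r s ++
  (ahead-by 1⁺ 1⁻ 1⁺ r s ++ (behind-by 1⁻ 1⁺ 1⁻ r s ++ (ahead-by 1⁺ 1⁺ 1⁻ r s ++ behind-by 1⁻ 1⁻ 1⁺ r s))))))

canonical : List Gen
canonical = arrangement 24 6 6 4

private
  tilted : ∀ {i j k u} t p → Values c₁ c₂ c₃ i j k u → Point.x₄ u ≡ tilt t → Tilted (Values c₁ c₂ c₃ i j k) (replicate p (gen 0 u)) (replicate p t)
  tilted t zero    h e = []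
  tilted t (suc p) h e = (h , e) ∷ tilted t p h e

  tilted-ahead : ∀ i j k p q → Tilted (Values c₁ c₂ c₃ i j k) (ahead-by i j k p q) (replicate p up ++ replicate q dn)
  tilted-ahead i j k p q = tilted up p (refl , refl , refl) refl ++ᵗ tilted dn q (refl , refl , refl) refl

  tilted-behind : ∀ i j k p q → Tilted (Values c₁ c₂ c₃ i j k) (behind-by i j k p q) (replicate p dn ++ replicate q up)
  tilted-behind i j k p q = tilted dn p (refl , refl , refl) refl ++ᵗ tilted up q (refl , refl , refl) refl

-- The equations avoid a comparison of closed totals, which might evaluate them.
vol-arrangement : ∀ p q r s {A⁺ A⁻ D⁺ D⁻ w} →
  replicate (suc p) up ++ replicate q dn ≡ D⁺ → replicate (suc p) dn ++ replicate q up ≡ D⁻ →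
  replicate (suc r) up ++ replicate s dn ≡ A⁺ → replicate (suc r) dn ++ replicate s up ≡ A⁻ →
  w ≡ Evaluate.total 𝔽 A⁺ A⁻ D⁺ D⁻ [] → HasVol wins (arrangement (suc p) q (suc r) s) w
vol-arrangement p q r s refl refl refl refl refl = Total.vol-total c₁ c₂ c₃
  (tilted-ahead 1⁺ 1⁺ 1⁺ (suc p) q) (tilted-behind 1⁻ 1⁻ 1⁻ (suc p) q) (tilted-ahead 1⁻ 1⁺ 1⁺ (suc r) s) (tilted-behind 1⁺ 1⁻ 1⁻ (suc r) s)
  (tilted-ahead 1⁺ 1⁻ 1⁺ (suc r) s) (tilted-behind 1⁻ 1⁺ 1⁻ (suc r) s) (tilted-ahead 1⁺ 1⁺ 1⁻ (suc r) s) (tilted-behind 1⁻ 1⁻ 1⁺ (suc r) s)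

vol-canonical : HasVol wins canonical volume
vol-canonical = vol-arrangement 23 6 5 4 {A⁺} {A⁻} {D⁺} {D⁻} {volume} refl refl refl refl volume-total

-- Lists of generators with coordinates ±1 are compared through binary codes.
private
  digit : ℤ → ℕ
  digit (+ _)    = 1
  digit -[1+ _ ] = 0

  code : Point → ℕ
  code (point a b c d) = digit a + 2 * (digit b + 2 * (digit c + 2 * digit d))

  signs : ℕ → Point
  signs n = point (coord n) (coord (n ℕ./ 2)) (coord (n ℕ./ 4)) (coord (n ℕ./ 8))
    where
    fromDigit : ℕ → ℤ
    fromDigit zero    = -[1+ 0 ]
    fromDigit (suc _) = + 1
    coord : ℕ → ℤ
    coord n = fromDigit (n ℕ.% 2)

  _≟ₚ_ : (p q : Point) → Dec (p ≡ q)
  point a b c d ≟ₚ point a′ b′ c′ d′ = map′ (λ { (refl , refl , refl , refl) → refl }) (λ { refl → refl , refl , refl , refl })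
    (a ℤ.≟ a′ ×-dec b ℤ.≟ b′ ×-dec c ℤ.≟ c′ ×-dec d ℤ.≟ d′)

  -- `code` forgets all but signs; the first two equations certify that `signs` restores the vectors
  -- of both lists. Equality of sorted numerals is then decided by computation.
  signed-↭ : ∀ (L M : List Point) → map (signs ∘ code) L ≡ L → map (signs ∘ code) M ≡ M → sort (map code L) ≡ sort (map code M) → L ↭ M
  signed-↭ L M p q r = ↭-trans (↭-reflexive (sym p)) (↭-trans (↭-reflexive (List.map-∘ L)) (↭-trans (↭.map⁺ signs
    (↭-trans (↭-sym (sort-↭ (map code L))) (↭-trans (↭-reflexive r) (sort-↭ (map code M)))))
    (↭-trans (↭-reflexive (sym (List.map-∘ M))) (↭-reflexive q))))

  points : List Point
  points = map Gen.v canonical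

  Signed : List Point → Set
  Signed L = map (signs ∘ code) L ≡ L

  signed? : ∀ L → Dec (Signed L)
  signed? L = List.≡-dec _≟ₚ_ (map (signs ∘ code) L) L

  sameCodes? : ∀ L M → Dec (sort (map code L) ≡ sort (map code M))
  sameCodes? L M = List.≡-dec ℕ._≟_ (sort (map code L)) (sort (map code M))

  gens-↭′ : ∀ {R : Set} (dir : R → Point) L {M N} → map dir L ↭ M → map (gen 0) M ≡ N → gens dir L ↭ N
  gens-↭′ dir L p q = ↭-trans (↭-reflexive (List.map-∘ {g = gen 0} {f = dir} L)) (↭-trans (↭.map⁺ (gen 0) p) (↭-reflexive q))

  gens-↭ : ∀ {R : Set} (dir : R → Point) (L : List R) → True (signed? (map dir L)) → True (sameCodes? (map dir L) points) → gens dir L ↭ canonical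
  gens-↭ dir L p q = gens-↭′ dir L {points} {canonical} (signed-↭ (map dir L) points (toWitness p) (toWitness {a? = signed? points} tt) (toWitness q)) refl

  -- Abstract, so that the lists of rankings are not compared again.
  abstract
    rankings-↭ : ∀ A → gens (direction (punchIn A) A) (rankings 5) ↭ canonical
    rankings-↭ zero = gens-↭ (direction (punchIn zero) zero) (rankings 5) tt tt
    rankings-↭ (suc zero) = gens-↭ (direction (punchIn (suc zero)) (suc zero)) (rankings 5) tt tt
    rankings-↭ (suc (suc zero)) = gens-↭ (direction (punchIn (suc (suc zero))) (suc (suc zero))) (rankings 5) tt tt
    rankings-↭ (suc (suc (suc zero))) = gens-↭ (direction (punchIn (suc (suc (suc zero)))) (suc (suc (suc zero)))) (rankings 5) tt tt
    rankings-↭ (suc (suc (suc (suc zero)))) = gens-↭ (direction (punchIn (suc (suc (suc (suc zero))))) (suc (suc (suc (suc zero))))) (rankings 5) tt tt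

-- The number of profiles of which a given candidate is the Condorcet winner.
Y : ℕ → ℕ
Y k = count (δ wins) canonical k origin

X-≡ : ∀ k → #profilesWithCondorcetWinner 5 k ≡ 5 * Y k
X-≡ = Election.winners-common 5 punchIn Fin.punchInᵢ≢i (λ A B B≢A → punchOut (B≢A ∘ sym) , Fin.punchIn-punchOut (B≢A ∘ sym)) canonical rankings-↭

P-≡ : ∀ k → #profiles 5 k ≡ B 119 k
P-≡ k = profiles-count 5 k #rankings-5

pos-suc : ∀ z → pos z ≤ pos (z ℤ.+ + 1)
pos-suc (+ zero)  = z≤n
pos-suc (+ suc n) = s≤s z≤n
pos-suc -[1+ n ]  = z≤n

wins-mono : ∀ o → wins o ≤ wins (o ⊹ point 1⁺ 1⁺ 1⁺ 1⁺)
wins-mono (point a b c d) = ℕ.*-mono-≤ (pos-suc a) (ℕ.*-mono-≤ (pos-suc b) (ℕ.*-mono-≤ (pos-suc c) (ℕ.*-monoˡ-≤ 1 (pos-suc d))))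

-- A voter who ranks the candidate first can be added to any winning profile: moving the offset by
-- `u` is one unfolding of the ray of `u`.
count-suc : ∀ {φ} u M {N} → N ≡ gen 0 u ∷ M → (∀ o → φ o ≤ φ (o ⊹ u)) → ∀ k o → count (δ φ) N k o ≤ count (δ φ) N (suc k) o
count-suc {φ} u M refl mono k o = ℕ.≤-trans (count-mono (λ _ → ⊤) (gen 0 u ∷ M) (All.universal {P = λ _ → ∀ {y : Point} → ⊤ → ⊤} (λ _ _ → tt) (gen 0 u ∷ M)) (λ k o _ → δ-mono k o) k o tt)
  (ℕ.≤-trans (ℕ.≤-reflexive (sym (count-translate (δ φ) (gen 0 u ∷ M) u k o)))
  (ℕ.≤-trans (ℕ.m≤n+m _ (count (δ φ) M (suc k) o)) (ℕ.≤-reflexive (sym (ray-unfold (gen 0 u) (count (δ φ) M) (suc k) o)))))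
  where
  δ-mono : ∀ k o → δ φ k o ≤ δ φ k (o ⊹ u)
  δ-mono zero    o = mono o
  δ-mono (suc k) o = z≤n

Y-mono : ∀ k → Y k ≤ Y (suc k)
Y-mono k = count-suc (point 1⁺ 1⁺ 1⁺ 1⁺) (List.drop 1 canonical) {canonical} refl wins-mono k origin

private
  -- The limit is estimated in natural numbers; a negative volume would make the left side negative.
  natural : ∀ w {c} b .{{_ : ℕ.NonZero b}} → + 5 ℤ.* w ℤ.* + b ≡ + c → ∃[ v ] w ≡ + v × 5 * v * b ≡ c
  natural (+ v)    b       eq = v , refl , ℤ.+-injective (trans (trans (ℤ.pos-* (5 * v) b) (cong (ℤ._* + b) (ℤ.pos-* 5 v))) eq)
  natural -[1+ n ] (suc b) ()

  distance : ∀ x y e → ∣ + x ℤ.- + y ∣ ≤ e → x ≤ y + e × y ≤ x + e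
  distance x y e h with ℕ.≤-total x y
  ... | inj₁ x≤y = ℕ.≤-trans x≤y (ℕ.m≤m+n y e) , ℕ.≤-trans (ℕ.m≤n+m∸n y x) (ℕ.+-monoʳ-≤ x (subst (_≤ e) (trans (cong ∣_∣ (ℤ.m-n≡m⊖n x y)) (ℤ.∣⊖∣-≤ x≤y)) h))
  ... | inj₂ y≤x = ℕ.≤-trans (ℕ.m≤n+m∸n x y) (ℕ.+-monoʳ-≤ y (subst (_≤ e) (trans (cong ∣_∣ (ℤ.m-n≡m⊖n x y)) (trans (ℤ.∣m⊖n∣≡∣n⊖m∣ x y) (ℤ.∣⊖∣-≤ y≤x))) h)) ,
                   ℕ.≤-trans y≤x (ℕ.m≤m+n x e)

  scale-^ : ∀ n → scale n ≡ 48 ℕ.^ n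
  scale-^ zero    = scale-0
  scale-^ (suc n) = trans (scale-suc n) (cong (48 *_) (scale-^ n))

  asymptotic : ∀ {w v} M {m} → length M ≡ suc m → w ≡ + v → HasVol wins M w →
               ∃[ A ] (∀ k → let s = 48 ℕ.^ suc m * Σ≤ (λ j → count (δ wins) M j origin) k; t = v * B (suc m) k in s ≤ t + A * B m k × t ≤ s + A * B m k)
  asymptotic {w} {v} M {m} len refl h = go (length M) len (HasVol.at h origin)
    where
    go : ∀ n → n ≡ suc m → Approx (λ k → + (scale n * cnt wins M k origin)) w n →
         ∃[ A ] (∀ k → let s = 48 ℕ.^ suc m * Σ≤ (λ j → count (δ wins) M j origin) k; t = v * B (suc m) k in s ≤ t + A * B m k × t ≤ s + A * B m k)
    go n refl (A Binomials., bounded) = A , λ k → distance _ _ (A * B m k) (subst (λ z → ∣ z ∣ ≤ A * B m k)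
      (cong₂ (λ x y → + x ℤ.- y) (cong₂ _*_ (scale-^ n) (count-Σ wins M k origin ⊹-identity)) (sym (ℤ.pos-* v (B (suc m) k)))) (bounded k))

-- Stated for variables, because closed terms of these types would be evaluated when they are compared.
limit-of-volume : ∀ a b m .{{_ : ℕ.NonZero b}} M w → 1 ≤ b → length M ≡ suc m → HasVol wins M w → + 5 ℤ.* w ℤ.* + b ≡ + (a * 48 ℕ.^ suc m) →
  (∀ k → count (δ wins) M k origin ≤ count (δ wins) M (suc k) origin) →
  ∀ n → (∀ k → #profilesWithCondorcetWinner n k ≡ 5 * count (δ wins) M k origin) → (∀ k → #profiles n k ≡ B m k) →
  condorcetProbability n ⟶ ((+ a) / b)
limit-of-volume a b m M w 1≤b len h value mono n X≡ P≡ =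
  let v , w≡v , value′ = natural w b value
      A , bounds = asymptotic M len w≡v h
  in ratio-limit m (λ k → count (δ wins) M k origin) mono (48 ℕ.^ suc m) v A (λ k → proj₁ (bounds k)) (λ k → proj₂ (bounds k))
       a b {{ℕ.m^n≢0 48 (suc m)}} 1≤b value′ (#profilesWithCondorcetWinner n) (#profiles n) (#profiles-nonZero n) X≡ P≡

mainTheorem2 :
  condorcetProbability 5 ⟶
    ((+ 760794547958864241496408591531018198021484884229346111658236615929935)
      / 1010827262551214358630401511004028249102084136257935356483840264634368)
mainTheorem2 = limit-of-volume
  760794547958864241496408591531018198021484884229346111658236615929935
  1010827262551214358630401511004028249102084136257935356483840264634368
  119 canonical volume (s≤s z≤n) refl vol-canonical volume-value Y-mono 5 X-≡ P-≡
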